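{- Let $\mathcal{A}$ be an Exploration algorithm that explores every finite graph in $\mathrm{SC}$, i.e., on every graph $G\in\mathrm{SC}$ (with any port numbering) and from every starting vertex it visits all vertices and halts. Then for every computable function $f:\mathbb{N}\to\mathbb{N}$ there exists a graph $G\in\mathrm{SC}$ (with a port numbering and a starting vertex) such that, when executed on $G$, $\mathcal{A}$ executes strictly more than $f(|V(G)|)$ steps.
   Context: All graphs are simple, connected, undirected. A port numbering assigns to each vertex $v$ an injective map $\delta_v$ from the neighbours of $v$ to $\mathbb{N}$. Binoculars labelling: each vertex $v$ carries the label $\nu(v)$, the subgraph induced by the closed neighbourhood of $v$ with the port numbers of its edges (up to isomorphism preserving ports and the central vertex). A mobile agent is a deterministic Turing machine with unbounded memory moving in the graph from an unmarked starting vertex; at each step, at vertex $v$, it has access only to $\nu(v)$ and to the port number through which it entered $v$, updates its memory, and either halts or moves along the edge at $v$ with a chosen port number (a step). An algorithm is an Exploration algorithm if for every finite graph with binoculars labelling, every port numbering and every starting vertex, either the agent visits every vertex at least once and halts, or it never halts. The clique complex $\mathcal{X}(G)$ has the cliques of $G$ as simplices. Elementary homotopies of paths in a complex: insert/delete a subpath $(u,v,u)$; replace a subpath $q$ by $q'$ with same endpoints where $q^{ -1}q'$ is a triangle ($q$ or $q'$ may be empty). A complex is simply connected if every cycle can be reduced to a single vertex by a finite sequence of elementary homotopies. $\mathrm{SC}$ is the class of finite graphs $G$ whose clique complex $\mathcal{X}(G)$ is simply connected. -}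

module Defs where

open import Data.Nat using (ℕ; zero; suc; _+_; _*_; _^_; _≤_; _<_; _⊔_; _≡ᵇ_)
open import Data.Fin using (Fin)
open import Data.Bool using (Bool; true; false; if_then_else_; _∧_)
open import Data.List using (List; []; _∷_; _++_; map; foldr; upTo; allFin)
open import Data.Vec using (Vec; []; _∷_)
open import Data.Maybe using (Maybe; just; nothing)
open import Data.Product using (Σ; _×_; _,_)
open import Relation.Binary.PropositionalEquality using (_≡_)
open import Relation.Binary.Construct.Closure.ReflexiveTransitive using (Star)
open import Relation.Binary.Construct.Closure.Symmetric using (SymClosure)

data PR : ℕ → Set where
  zer  : ∀ {n} → PR n
  succ : PR 1
  proj : ∀ {n} → Fin n → PR n
  comp : ∀ {m n} → PR m → Vec (PR n) m → PR n
  prec : ∀ {n} → PR n → PR (suc (suc n)) → PR (suc n)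
  mu   : ∀ {n} → PR (suc n) → PR n

mutual
  data Eval : ∀ {n} → PR n → Vec ℕ n → ℕ → Set where
    e-zer  : ∀ {n} {xs : Vec ℕ n} → Eval zer xs 0
    e-succ : ∀ {x} → Eval succ (x ∷ []) (suc x)
    e-proj : ∀ {n} {i : Fin n} {xs} → Eval (proj i) xs (Data.Vec.lookup xs i)
    e-comp : ∀ {m n} {g : PR m} {hs : Vec (PR n) m} {xs ys y} →
             EvalAll hs xs ys → Eval g ys y → Eval (comp g hs) xs y
    e-prec0 : ∀ {n} {g : PR n} {h} {xs y} →
              Eval g xs y → Eval (prec g h) (0 ∷ xs) y
    e-precS : ∀ {n} {g : PR n} {h} {m xs r y} →
              Eval (prec g h) (m ∷ xs) r → Eval h (m ∷ r ∷ xs) y →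
              Eval (prec g h) (suc m ∷ xs) y
    e-mu   : ∀ {n} {f : PR (suc n)} {xs y} →
             Eval f (y ∷ xs) 0 →
             (∀ z → z < y → Σ ℕ λ k → Eval f (z ∷ xs) (suc k)) →
             Eval (mu f) xs y

  data EvalAll {n} : ∀ {m} → Vec (PR n) m → Vec ℕ n → Vec ℕ m → Set where
    ea-nil  : ∀ {xs} → EvalAll [] xs []
    ea-cons : ∀ {m} {h : PR n} {hs : Vec (PR n) m} {xs y ys} →
              Eval h xs y → EvalAll hs xs ys → EvalAll (h ∷ hs) xs (y ∷ ys)

Computable : (ℕ → ℕ) → Set
Computable f = Σ (PR 1) λ c → ∀ x → Eval c (x ∷ []) (f x)

pair : ℕ → ℕ → ℕ
pair x y = 2 ^ x * suc (2 * y)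

encList : List ℕ → ℕ
encList []       = 0
encList (x ∷ xs) = suc (pair x (encList xs))

record Graph (n : ℕ) : Set where
  field
    adj    : Fin n → Fin n → Bool
    sym    : ∀ u v → adj u v ≡ adj v u
    irrefl : ∀ v → adj v v ≡ false
    conn   : ∀ u v → Star (λ a b → adj a b ≡ true) u v

module _ {n : ℕ} (G : Graph n) where
  open Graph G

  Adj : Fin n → Fin n → Set
  Adj u v = adj u v ≡ true

  data IsWalk : List (Fin n) → Set where
    w-one  : ∀ v → IsWalk (v ∷ [])
    w-cons : ∀ {u v xs} → Adj u v → IsWalk (v ∷ xs) → IsWalk (u ∷ v ∷ xs)

  lastOf : Fin n → List (Fin n) → Fin n
  lastOf v []       = v
  lastOf v (x ∷ xs) = lastOf x xs

  -- 2-simplices of the clique complex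
  Tri : Fin n → Fin n → Fin n → Set
  Tri a b c = Adj a b × Adj b c × Adj a c

  data HStep : List (Fin n) → List (Fin n) → Set where
    back : ∀ xs ys u v → Adj u v →
           HStep (xs ++ u ∷ v ∷ u ∷ ys) (xs ++ u ∷ ys)
    tri1 : ∀ xs ys a b c → Tri a b c →
           HStep (xs ++ a ∷ b ∷ ys) (xs ++ a ∷ c ∷ b ∷ ys)
    tri0 : ∀ xs ys a b c → Tri a b c →
           HStep (xs ++ a ∷ ys) (xs ++ a ∷ b ∷ c ∷ a ∷ ys)

  Homotopic : List (Fin n) → List (Fin n) → Set
  Homotopic = Star (SymClosure HStep)

  -- the clique complex X(G) is simply connected
  SimplyConnected : Set
  SimplyConnected = ∀ v xs → IsWalk (v ∷ xs) → lastOf v xs ≡ v →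
                    Σ (Fin n) λ w → Homotopic (v ∷ xs) (w ∷ [])

  record Ports : Set where
    field
      δ   : Fin n → Fin n → ℕ
      inj : ∀ v u w → Adj v u → Adj v w → δ v u ≡ δ v w → u ≡ w

InSC : ∀ {n} → Graph n → Set
InSC G = SimplyConnected G

module Label {n : ℕ} (G : Graph n) (P : Ports G) where
  open Graph G
  open Ports P

  findFirst : (Fin n → Bool) → List (Fin n) → Maybe (Fin n)
  findFirst p []       = nothing
  findFirst p (x ∷ xs) = if p x then just x else findFirst p xs

  -- the neighbour of v reached through port q (unique by injectivity)
  nbr : Fin n → ℕ → Maybe (Fin n)
  nbr v q = findFirst (λ u → adj v u ∧ (δ v u ≡ᵇ q)) (allFin n)

  portBound : Fin n → ℕ
  portBound v = foldr (λ u m → (if adj v u then suc (δ v u) else 0) ⊔ m) 0 (allFin n)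

  -- for a neighbour u of v: the port at u of the edge uw, for the neighbour w
  -- of v at port q (0 = no such edge, suc p = port p)
  inner : Fin n → Fin n → ℕ → ℕ
  inner v u q with nbr v q
  ... | nothing = 0
  ... | just w  = if adj u w then suc (δ u w) else 0

  entry : Fin n → ℕ → ℕ
  entry v p with nbr v p
  ... | nothing = 0
  ... | just u  = suc (pair (δ u v) (encList (map (inner v u) (upTo (portBound v)))))

  label : Fin n → ℕ
  label v = encList (map (entry v) (upTo (portBound v)))

-- An agent is a partial recursive function from the (encoded) history of
-- observations to a decision: 0 = halt, suc p = move through port p.
Agent : Set
Agent = PR 1

module Run (A : Agent) {n : ℕ} (G : Graph n) (P : Ports G) (s : Fin n) where
  open Ports P
  open Label G P

  -- observation: binoculars label and entry port (0 = none, suc p = port p)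
  obs : Fin n → ℕ → ℕ
  obs v e = pair (label v) e

  data Reach : ℕ → Fin n → List ℕ → Set where
    start : Reach 0 s (obs s 0 ∷ [])
    move  : ∀ {k v h u p} → Reach k v h →
            Eval A (encList h ∷ []) (suc p) →
            Adj G v u → δ v u ≡ p →
            Reach (suc k) u (obs u (suc (δ u v)) ∷ h)

  HaltsAt : ℕ → Set
  HaltsAt k = Σ (Fin n) λ v → Σ (List ℕ) λ h → Reach k v h × Eval A (encList h ∷ []) 0

  VisitedBy : ℕ → Fin n → Set
  VisitedBy k w = Σ ℕ λ j → j ≤ k × Σ (List ℕ) λ h → Reach j w h

  MoreThan : ℕ → Set
  MoreThan m = Σ (Fin n) λ v → Σ (List ℕ) λ h → Reach (suc m) v h

IsExploration : Agent → Set
IsExploration A = ∀ n (G : Graph n) (P : Ports G) (s : Fin n) k →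
  Run.HaltsAt A G P s k → ∀ w → Run.VisitedBy A G P s k w

ExploresSC : Agent → Set
ExploresSC A = ∀ n (G : Graph n) → InSC G → ∀ (P : Ports G) (s : Fin n) →
  Σ ℕ λ k → Run.HaltsAt A G P s k × (∀ w → Run.VisitedBy A G P s k w)

module Submission where

-- Given 𝒜 and f, we build a graph G on which 𝒜 needs more than f(|V(G)|) steps. A computation is encoded in a finite
-- presentation of a group, as in the proof of the Adian–Rabin theorem: the group is trivial if the computation accepts,
-- and contains an element of infinite order otherwise. G consists of blocks 0, …, ℓ, each a bouquet of loops with
-- discs glued along the relators, so that its clique complex has this group as fundamental group. The encoded
-- computation runs 𝒜 on G itself for f(|V(G)|) + 1 steps and accepts if 𝒜 does not halt before. It knows G from the
-- number ℓ: the last block receives 2^ℓ as the input of the computation, and ℓ is chosen to code the labels of all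
-- vertices, which depend on ℓ only through the position of the block.
--
-- If the computation accepts, G is in SC, so 𝒜 halts on G, and it does so after more than f(|V(G)|) steps. To see that
-- it accepts, consider the first j steps of 𝒜 on G and fold the stars of the visited vertices into a finite simply
-- connected graph T, immersed in G and with the same labels along the walk. 𝒜 halts on T. If it makes more than j
-- steps there, it makes another step in G. Otherwise it has explored T, so T is a finite simply connected cover
-- of G and all elements of the fundamental group of G have finite order, which is impossible unless the computation
-- accepts.
--
-- As halting is not decidable, the element of infinite order is obtained from an action by permutations in the logic
-- where falsity is replaced by the desired conclusion.

-- Finitely many relators must govern infinitely many configurations. The configuration numbered n
-- is represented by an involution, the conjugate of `𝐭` by the n-th power of a shift `𝐱`. An
-- instruction is affine on a residue class, and conjugation by a letter `𝐫 i` realises it on the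
-- whole class, because the shift along a class is itself a word. The letter `𝐤` of order three
-- commutes with the involution of the accepting configuration, hence with those of all
-- configurations leading to it. A relator of the last block kills the cube of `𝐤` times the
-- involution of the input; if the two commute, that involution is trivial. The collapse reaches the
-- other generators through pairs of coprime orders, which the alternating group of degree five
-- allows to coexist as long as `𝐭` survives. The input 2^ℓ would make a relator grow with ℓ.
-- Instead a letter `𝐞` stands for the involution of 2^b in block b and is doubled on passing to the
-- next block, so that all blocks have the same bounded shape.

-- Homotopy of walks, fundamental groups, monodromy

module Walks where

  open import Level using (0ℓ)
  open import Defs
  open import Algebra.Bundles using (Group)
  open import Data.Nat using (ℕ)
  open import Data.List using (List; []; _∷_; _++_; map)
  open import Data.List.Properties using (++-assoc; ++-identityʳ; map-++)
  open import Data.Product using (Σ; _,_; proj₁; proj₂)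
  open import Relation.Binary.PropositionalEquality using (_≡_; refl; cong; subst; subst₂; sym; trans)
  open import Relation.Binary.Construct.Closure.Equivalence using (EqClosure; gmap; setoid)
  import Relation.Binary.Construct.Closure.Equivalence as EqC
  open import Relation.Binary.Construct.Closure.ReflexiveTransitive using (ε; _◅_)
  open import Relation.Binary.Construct.Closure.Symmetric using (fwd; bwd)
  import Relation.Binary.Reasoning.Setoid as SetoidReasoning

  module Homotopy {V : Set} (_~_ : V → V → Set) where

    -- These two moves generate homotopy: a whole triangle is inserted by undoing a backtrack and
    -- then applying `tri`.
    data Step : List V → List V → Set where
      back : ∀ xs ys u v → u ~ v → Step (xs ++ u ∷ v ∷ u ∷ ys) (xs ++ u ∷ ys)
      tri  : ∀ xs ys a b c → a ~ b → b ~ c → a ~ c → Step (xs ++ a ∷ b ∷ ys) (xs ++ a ∷ c ∷ b ∷ ys)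

    infix 4 _≃_
    _≃_ : List V → List V → Set
    _≃_ = EqClosure Step

    ≃-refl : ∀ {xs} → xs ≃ xs
    ≃-refl = ε

    ≃-reflexive : ∀ {xs ys} → xs ≡ ys → xs ≃ ys
    ≃-reflexive refl = ε

    ≃-sym : ∀ {xs ys} → xs ≃ ys → ys ≃ xs
    ≃-sym = EqC.symmetric Step

    ≃-trans : ∀ {xs ys zs} → xs ≃ ys → ys ≃ zs → xs ≃ zs
    ≃-trans = EqC.transitive Step

    module ≃-Reasoning = SetoidReasoning (setoid Step)

    prefix : ∀ zs {xs ys} → xs ≃ ys → zs ++ xs ≃ zs ++ ys
    prefix zs = gmap (zs ++_) step
      where
      step : ∀ {xs ys} → Step xs ys → Step (zs ++ xs) (zs ++ ys)
      step (back xs ys u v e) = subst₂ Step (++-assoc zs xs _) (++-assoc zs xs _) (back (zs ++ xs) ys u v e)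
      step (tri xs ys a b c p q r) = subst₂ Step (++-assoc zs xs _) (++-assoc zs xs _) (tri (zs ++ xs) ys a b c p q r)

    suffix : ∀ zs {xs ys} → xs ≃ ys → xs ++ zs ≃ ys ++ zs
    suffix zs = gmap (_++ zs) step
      where
      step : ∀ {xs ys} → Step xs ys → Step (xs ++ zs) (ys ++ zs)
      step (back xs ys u v e) = subst₂ Step (sym (++-assoc xs _ zs)) (sym (++-assoc xs _ zs)) (back xs (ys ++ zs) u v e)
      step (tri xs ys a b c p q r) = subst₂ Step (sym (++-assoc xs _ zs)) (sym (++-assoc xs _ zs)) (tri xs (ys ++ zs) a b c p q r)

    backtrack : ∀ {u v} ys → u ~ v → u ∷ v ∷ u ∷ ys ≃ u ∷ ys
    backtrack ys e = EqC.return (back [] ys _ _ e)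

    shortcut : ∀ {a b c} ys → a ~ b → b ~ c → a ~ c → a ∷ c ∷ b ∷ ys ≃ a ∷ b ∷ ys
    shortcut ys p q r = ≃-sym (EqC.return (tri [] ys _ _ _ p q r))

    -- Walks are written as a start vertex and the list of the vertices after it,
    -- so that concatenation of walks is concatenation of lists.
    data Path : V → List V → V → Set where
      []  : ∀ {u} → Path u [] u
      _∷_ : ∀ {u x p v} → u ~ x → Path x p v → Path u (x ∷ p) v

    infixr 5 _⁀_
    _⁀_ : ∀ {u p v q w} → Path u p v → Path v q w → Path u (p ++ q) w
    [] ⁀ Q = Q
    (e ∷ P) ⁀ Q = e ∷ (P ⁀ Q)

    -- The last vertex of the walk is the `v` that heads both lists, so peeling off its edges leaves
    -- the given homotopy.
    after : ∀ {u p v q r} → Path u p v → v ∷ q ≃ v ∷ r → u ∷ p ++ q ≃ u ∷ p ++ r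
    after [] h = h
    after (_∷_ {u = u} e P) h = prefix (u ∷ []) (after P h)

    rev : V → List V → List V
    rev u [] = []
    rev u (x ∷ p) = rev x p ++ u ∷ []


    module Symmetric (~-sym : ∀ {u v} → u ~ v → v ~ u) where

      rev-path : ∀ {u p v} → Path u p v → Path v (rev u p) u
      rev-path [] = []
      rev-path (e ∷ P) = rev-path P ⁀ (~-sym e ∷ [])

      rev-inverseʳ : ∀ {u p v} → Path u p v → u ∷ p ++ rev u p ≃ u ∷ []
      rev-inverseʳ [] = ≃-refl
      rev-inverseʳ (_∷_ {u} {x} {p} e P) = begin
        u ∷ x ∷ p ++ (rev x p ++ u ∷ [])  ≡⟨ cong (λ l → u ∷ x ∷ l) (sym (++-assoc p (rev x p) _)) ⟩
        u ∷ x ∷ (p ++ rev x p) ++ u ∷ []  ≈⟨ prefix (u ∷ []) (suffix (u ∷ []) (rev-inverseʳ P)) ⟩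
        u ∷ x ∷ u ∷ []                    ≈⟨ backtrack [] e ⟩
        u ∷ []                            ∎
        where open ≃-Reasoning

      rev-inverseˡ : ∀ {u p v} → Path u p v → v ∷ rev u p ++ p ≃ v ∷ []
      rev-inverseˡ [] = ≃-refl
      rev-inverseˡ {v = v} (_∷_ {u} {x} {p} e P) = begin
        v ∷ (rev x p ++ u ∷ []) ++ x ∷ p  ≡⟨ cong (v ∷_) (++-assoc (rev x p) _ _) ⟩
        v ∷ rev x p ++ u ∷ x ∷ p          ≈⟨ after (rev-path P) (backtrack p (~-sym e)) ⟩
        v ∷ rev x p ++ p                  ≈⟨ rev-inverseˡ P ⟩
        v ∷ []                            ∎
        where open ≃-Reasoning

      rev-cong : ∀ {u p q v} → Path u p v → Path u q v → u ∷ p ≃ u ∷ q → v ∷ rev u p ≃ v ∷ rev u q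
      rev-cong {u} {p} {q} {v} P Q h = begin
        v ∷ rev u p                     ≡⟨ cong (v ∷_) (sym (++-identityʳ (rev u p))) ⟩
        v ∷ rev u p ++ []               ≈⟨ after (rev-path P) (≃-sym (rev-inverseʳ Q)) ⟩
        v ∷ rev u p ++ q ++ rev u q     ≈⟨ after (rev-path P) (suffix (rev u q) (≃-sym h)) ⟩
        v ∷ rev u p ++ p ++ rev u q     ≡⟨ cong (v ∷_) (sym (++-assoc (rev u p) p _)) ⟩
        v ∷ (rev u p ++ p) ++ rev u q   ≈⟨ suffix (rev u q) (rev-inverseˡ P) ⟩
        v ∷ rev u q                     ∎
        where open ≃-Reasoning

      π₁ : V → Group 0ℓ 0ℓ
      π₁ o = record
        { Carrier = Σ (List V) λ p → Path o p o
        ; _≈_ = λ a b → o ∷ proj₁ a ≃ o ∷ proj₁ b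
        ; _∙_ = λ a b → proj₁ a ++ proj₁ b , proj₂ a ⁀ proj₂ b
        ; ε = [] , []
        ; _⁻¹ = λ a → rev o (proj₁ a) , rev-path (proj₂ a)
        ; isGroup = record
          { isMonoid = record
            { isSemigroup = record
              { isMagma = record
                { isEquivalence = record { refl = ≃-refl ; sym = ≃-sym ; trans = ≃-trans }
                ; ∙-cong = λ {a} {b} {c} {d} h k → ≃-trans (after (proj₂ a) k) (suffix (proj₁ d) h) }
              ; assoc = λ a b c → ≃-reflexive (cong (o ∷_) (++-assoc (proj₁ a) _ _)) }
            ; identity = (λ a → ≃-refl) , (λ a → ≃-reflexive (cong (o ∷_) (++-identityʳ (proj₁ a)))) }
          ; inverse = (λ a → rev-inverseˡ (proj₂ a)) , (λ a → rev-inverseʳ (proj₂ a))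
          ; ⁻¹-cong = λ {a} {b} h → rev-cong (proj₂ a) (proj₂ b) h } }

      rev-++ : ∀ {u p v} → Path u p v → ∀ q → rev u (p ++ q) ≡ rev v q ++ rev u p
      rev-++ [] q = sym (++-identityʳ _)
      rev-++ {v = v} (_∷_ {u} {x} {p} e P) q = trans (cong (_++ u ∷ []) (rev-++ P q)) (++-assoc (rev v q) (rev x p) _)

      module Conjugation {o U v} (P : Path o U v) where

        conj : List V → List V
        conj p = U ++ p ++ rev o U

        conj-path : ∀ {p} → Path v p v → Path o (conj p) o
        conj-path Q = P ⁀ (Q ⁀ rev-path P)

        conj-cong : ∀ {p q} → v ∷ p ≃ v ∷ q → o ∷ conj p ≃ o ∷ conj q
        conj-cong h = after P (suffix (rev o U) h)

        conj-++ : ∀ {p} q → Path v p v → o ∷ conj (p ++ q) ≃ o ∷ conj p ++ conj q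
        conj-++ {p} q Q = begin
          o ∷ U ++ (p ++ q) ++ rev o U                 ≡⟨ cong (λ l → o ∷ U ++ l) (++-assoc p q _) ⟩
          o ∷ U ++ p ++ q ++ rev o U                   ≈⟨ after P (after Q (suffix (q ++ rev o U) (≃-sym (rev-inverseˡ P)))) ⟩
          o ∷ U ++ p ++ (rev o U ++ U) ++ q ++ rev o U ≡⟨ cong (λ l → o ∷ U ++ p ++ l) (++-assoc (rev o U) U _) ⟩
          o ∷ U ++ p ++ rev o U ++ conj q              ≡⟨ cong (λ l → o ∷ U ++ l) (sym (++-assoc p _ _)) ⟩
          o ∷ U ++ (p ++ rev o U) ++ conj q            ≡⟨ cong (o ∷_) (sym (++-assoc U _ _)) ⟩
          o ∷ conj p ++ conj q                         ∎
          where open ≃-Reasoning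

        conj-trivial : ∀ {p} → Path v p v → o ∷ conj p ≃ o ∷ [] → v ∷ p ≃ v ∷ []
        conj-trivial {p} Q h = begin
          v ∷ p                                   ≡⟨ cong (v ∷_) (sym (++-identityʳ p)) ⟩
          v ∷ p ++ []                             ≈⟨ after Q (≃-sym (rev-inverseˡ P)) ⟩
          v ∷ p ++ rev o U ++ U                   ≈⟨ suffix (p ++ rev o U ++ U) (≃-sym (rev-inverseˡ P)) ⟩
          v ∷ (rev o U ++ U) ++ p ++ rev o U ++ U ≡⟨ cong (v ∷_) (++-assoc (rev o U) U _) ⟩
          v ∷ rev o U ++ U ++ p ++ rev o U ++ U   ≡⟨ cong (λ l → v ∷ rev o U ++ l) (trans (cong (U ++_) (sym (++-assoc p _ _))) (sym (++-assoc U _ _))) ⟩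
          v ∷ rev o U ++ conj p ++ U              ≈⟨ after (rev-path P) (suffix U h) ⟩
          v ∷ rev o U ++ U                        ≈⟨ rev-inverseˡ P ⟩
          v ∷ []                                  ∎
          where open ≃-Reasoning

      -- A choice of a walk ω v to every vertex that is compatible with all edges up to
      -- homotopy trivialises every closed walk.
      module Trivialisation (o : V) (ω : V → List V) (ω-path : ∀ v → Path o (ω v) v)
        (ω-edge : ∀ {u v} → u ~ v → o ∷ ω u ++ v ∷ [] ≃ o ∷ ω v) where

        ω-walk : ∀ {u p v} → Path u p v → o ∷ ω u ++ p ≃ o ∷ ω v
        ω-walk {u} [] = ≃-reflexive (cong (o ∷_) (++-identityʳ (ω u)))
        ω-walk {u} {x ∷ p} {v} (e ∷ P) = begin
          o ∷ ω u ++ x ∷ p           ≡⟨ cong (o ∷_) (sym (++-assoc (ω u) (x ∷ []) p)) ⟩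
          o ∷ (ω u ++ x ∷ []) ++ p   ≈⟨ suffix p (ω-edge e) ⟩
          o ∷ ω x ++ p               ≈⟨ ω-walk P ⟩
          o ∷ ω v                    ∎
          where open ≃-Reasoning

        -- Prefixed with `ω u`, both walks become `ω v`; cancelling `ω u` again makes them homotopic
        -- to each other.
        parallel : ∀ {u p q v} → Path u p v → Path u q v → u ∷ p ≃ u ∷ q
        parallel {u} {p} {q} {v} P Q = begin
          u ∷ p                            ≈⟨ ≃-sym (suffix p (rev-inverseˡ (ω-path u))) ⟩
          u ∷ (rev o (ω u) ++ ω u) ++ p    ≡⟨ cong (u ∷_) (++-assoc (rev o (ω u)) _ _) ⟩
          u ∷ rev o (ω u) ++ ω u ++ p      ≈⟨ after (rev-path (ω-path u)) (≃-trans (ω-walk P) (≃-sym (ω-walk Q))) ⟩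
          u ∷ rev o (ω u) ++ ω u ++ q      ≡⟨ cong (u ∷_) (sym (++-assoc (rev o (ω u)) _ _)) ⟩
          u ∷ (rev o (ω u) ++ ω u) ++ q    ≈⟨ suffix q (rev-inverseˡ (ω-path u)) ⟩
          u ∷ q                            ∎
          where open ≃-Reasoning

    -- Turns a homotopy into an equation in a group: the product of edge labels is invariant once
    -- the labelling is flat on triangles. This is how homotopies in the constructed graph are shown
    -- not to exist.
    module Monodromy {c ℓ} (H : Group c ℓ) (lab : V → V → Group.Carrier H)
      (lab-inv : ∀ {u v} → u ~ v → Group._≈_ H (Group._∙_ H (lab u v) (lab v u)) (Group.ε H))
      (lab-tri : ∀ {a b c} → a ~ b → b ~ c → a ~ c → Group._≈_ H (Group._∙_ H (lab a c) (lab c b)) (lab a b)) where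
      private module H = Group H
      open H using (_∙_; _≈_; Carrier)

      ev : V → List V → Carrier
      ev u [] = H.ε
      ev u (x ∷ p) = lab u x ∙ ev x p

      total : List V → Carrier
      total [] = H.ε
      total (u ∷ p) = ev u p

      private
        under : ∀ x xs {u ys zs} → ev u ys ≈ ev u zs → ev x (xs ++ u ∷ ys) ≈ ev x (xs ++ u ∷ zs)
        under x [] h = H.∙-congˡ h
        under x (y ∷ xs) h = H.∙-congˡ (under y xs h)

        under-total : ∀ xs {u ys zs} → ev u ys ≈ ev u zs → total (xs ++ u ∷ ys) ≈ total (xs ++ u ∷ zs)
        under-total [] h = h
        under-total (x ∷ xs) h = under x xs h

        step : ∀ {xs ys} → Step xs ys → total xs ≈ total ys
        step (back xs ys u v e) = under-total xs
          (H.trans (H.sym (H.assoc _ _ _)) (H.trans (H.∙-congʳ (lab-inv e)) (H.identityˡ _)))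
        step (tri xs ys a b c p q r) = under-total xs
          (H.trans (H.∙-congʳ (H.sym (lab-tri p q r))) (H.assoc _ _ _))

      total-resp : ∀ {xs ys} → xs ≃ ys → total xs ≈ total ys
      total-resp ε = H.refl
      total-resp (fwd s ◅ h) = H.trans (step s) (total-resp h)
      total-resp (bwd s ◅ h) = H.trans (H.sym (step s)) (total-resp h)

  module _ {V W : Set} {_~_ : V → V → Set} {_≁_ : W → W → Set} (f : V → W)
    (f-resp : ∀ {u v} → u ~ v → f u ≁ f v) where
    private
      module A = Homotopy _~_
      module B = Homotopy _≁_

      step : ∀ {xs ys} → A.Step xs ys → B.Step (map f xs) (map f ys)
      step (A.back xs ys u v e) = subst₂ B.Step (sym (map-++ f xs _)) (sym (map-++ f xs _))
        (B.back (map f xs) (map f ys) (f u) (f v) (f-resp e))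
      step (A.tri xs ys a b c p q r) = subst₂ B.Step (sym (map-++ f xs _)) (sym (map-++ f xs _))
        (B.tri (map f xs) (map f ys) (f a) (f b) (f c) (f-resp p) (f-resp q) (f-resp r))

    map-≃ : ∀ {xs ys} → A._≃_ xs ys → B._≃_ (map f xs) (map f ys)
    map-≃ = gmap (map f) step

    map-path : ∀ {u p v} → A.Path u p v → B.Path (f u) (map f p) (f v)
    map-path A.[] = B.[]
    map-path (e A.∷ P) = f-resp e B.∷ map-path P

  module GraphHomotopy {n : ℕ} (G : Graph n) where
    open Homotopy (Adj G) public

    Adj-sym : ∀ {u v} → Adj G u v → Adj G v u
    Adj-sym {u} {v} e = trans (Graph.sym G v u) e

    open Symmetric Adj-sym public

    toHomotopic : ∀ {xs ys} → xs ≃ ys → Homotopic G xs ys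
    toHomotopic = gmap (λ xs → xs) step
      where
      step : ∀ {xs ys} → Step xs ys → HStep G xs ys
      step (back xs ys u v e) = back xs ys u v e
      step (tri xs ys a b c p q r) = tri1 xs ys a b c (p , trans (Graph.sym G b c) (Adj-sym q) , r)

    walk⇒path : ∀ {v xs} → IsWalk G (v ∷ xs) → Path v xs (lastOf G v xs)
    walk⇒path (w-one v) = []
    walk⇒path (w-cons e w) = e ∷ walk⇒path w

    closed⇒SC : (∀ {u p} → Path u p u → u ∷ p ≃ u ∷ []) → InSC G
    closed⇒SC h v xs w c = v , toHomotopic (h (subst (Path v xs) c (walk⇒path w)))

-- Binoculars labels depend only on the star of a vertex

module Labels where

  open import Defs
  open import Data.Bool using (Bool; true; false; if_then_else_; _∧_)
  open import Data.Bool.Properties using (T-∧; T-≡)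
  open import Data.Fin using (Fin; suc)
  open import Data.List using ([]; _∷_; map; foldr; upTo; allFin)
  open import Data.List.Properties using (map-cong)
  open import Data.List.Membership.Propositional using (_∈_)
  open import Data.List.Membership.Propositional.Properties using (∈-allFin)
  open import Data.List.Relation.Unary.Any using (here; there)
  open import Data.Maybe using (just; nothing)
  open import Data.Nat using (ℕ; suc; _≤_; _⊔_; z≤n; _≡ᵇ_)
  open import Data.Nat.Properties using (≤-antisym; ≤-trans; m≤m⊔n; m≤n⊔m; ⊔-lub; ≡ᵇ⇒≡; ≡⇒≡ᵇ; ≤-reflexive)
  open import Data.Product using (Σ; _×_; _,_; proj₁; proj₂)
  open import Data.Sum using (_⊎_; inj₁; inj₂)
  open import Function.Bundles using (Equivalence)
  open import Relation.Binary.PropositionalEquality using (_≡_; refl; cong; cong₂; sym; trans)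

  module Neighbours {n : ℕ} (G : Graph n) (P : Ports G) where
    open Graph G using (adj)
    open Ports P
    open Label G P

    private
      test : Fin n → ℕ → Fin n → Bool
      test v q u = adj v u ∧ (δ v u ≡ᵇ q)

      test-sound : ∀ v q u → test v q u ≡ true → Adj G v u × δ v u ≡ q
      test-sound v q u e with Equivalence.to T-∧ (Equivalence.from T-≡ e)
      ... | a , b = Equivalence.to T-≡ a , ≡ᵇ⇒≡ _ _ b

      test-complete : ∀ v q u → Adj G v u → δ v u ≡ q → test v q u ≡ true
      test-complete v q u a b = Equivalence.to T-≡ (Equivalence.from T-∧ (Equivalence.from T-≡ a , ≡⇒≡ᵇ _ _ b))

      first-sound : ∀ p xs {x} → findFirst p xs ≡ just x → p x ≡ true
      first-sound p (y ∷ xs) e with p y in eq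
      first-sound p (y ∷ xs) refl | true = eq
      first-sound p (y ∷ xs) e    | false = first-sound p xs e

      first-complete : ∀ p {xs x} → x ∈ xs → p x ≡ true → Σ (Fin n) λ y → findFirst p xs ≡ just y
      first-complete p {y ∷ xs} m e with p y in eq
      first-complete p {y ∷ xs} m e | true = y , refl
      first-complete p {y ∷ xs} (here refl) e | false with trans (sym e) eq
      ... | ()
      first-complete p {y ∷ xs} (there m) e | false = first-complete p m e

    nbr-sound : ∀ {v q u} → nbr v q ≡ just u → Adj G v u × δ v u ≡ q
    nbr-sound {v} {q} {u} e = test-sound v q u (first-sound (test v q) (allFin n) e)

    nbr-complete : ∀ {v q u} → Adj G v u → δ v u ≡ q → nbr v q ≡ just u
    nbr-complete {v} {q} {u} a e with first-complete (test v q) (∈-allFin u) (test-complete v q u a e)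
    ... | w , eq with nbr-sound eq
    ... | a' , e' = trans eq (cong just (inj v w u a' a (trans e' (sym e))))

    bound-upper : ∀ v {m} → (∀ u → Adj G v u → suc (δ v u) ≤ m) → portBound v ≤ m
    bound-upper v {m} h = go (allFin n)
      where
      one : ∀ u → (if adj v u then suc (δ v u) else 0) ≤ m
      one u with adj v u in eq
      ... | true = h u eq
      ... | false = z≤n
      go : ∀ xs → foldr (λ u k → (if adj v u then suc (δ v u) else 0) ⊔ k) 0 xs ≤ m
      go [] = z≤n
      go (x ∷ xs) = ⊔-lub (one x) (go xs)

    bound-lower : ∀ v u → Adj G v u → suc (δ v u) ≤ portBound v
    bound-lower v u a = go (∈-allFin u)
      where
      go : ∀ {xs} → u ∈ xs → suc (δ v u) ≤ foldr (λ u k → (if adj v u then suc (δ v u) else 0) ⊔ k) 0 xs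
      go {_ ∷ xs} (here refl) rewrite a =
        m≤m⊔n (suc (δ v u)) (foldr (λ u k → (if adj v u then suc (δ v u) else 0) ⊔ k) 0 xs)
      go {x ∷ _} (there m) = ≤-trans (go m) (m≤n⊔m (if adj v x then suc (δ v x) else 0) _)

    inner-just : ∀ v u q {w} → nbr v q ≡ just w → inner v u q ≡ (if adj u w then suc (δ u w) else 0)
    inner-just v u q e rewrite e = refl

    inner-nothing : ∀ v u q → nbr v q ≡ nothing → inner v u q ≡ 0
    inner-nothing v u q e rewrite e = refl

    entry-just : ∀ v p {u} → nbr v p ≡ just u →
      entry v p ≡ suc (pair (δ u v) (encList (map (inner v u) (upTo (portBound v)))))
    entry-just v p e rewrite e = refl

    entry-nothing : ∀ v p → nbr v p ≡ nothing → entry v p ≡ 0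
    entry-nothing v p e rewrite e = refl

  -- Collects what `label` reads: both ports of the edges at the centre, and adjacency and ports
  -- among the neighbours. A relation is used because the correspondence is defined only on
  -- neighbours of the centre.
  record StarIso {n n'} (G : Graph n) (P : Ports G) (v : Fin n) (G' : Graph n') (P' : Ports G') (v' : Fin n') : Set₁ where
    private
      module P = Ports P
      module P' = Ports P'
    field
      _↔_ : Fin n → Fin n' → Set
      image : ∀ {u} → Adj G v u → Σ (Fin n') λ u' → u ↔ u'
      preimage : ∀ {u'} → Adj G' v' u' → Σ (Fin n) λ u → u ↔ u'
      adjacent : ∀ {u u'} → u ↔ u' → Adj G v u × Adj G' v' u'
      port-out : ∀ {u u'} → u ↔ u' → P.δ v u ≡ P'.δ v' u'
      port-in : ∀ {u u'} → u ↔ u' → P.δ u v ≡ P'.δ u' v'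
      adj-eq : ∀ {u u' w w'} → u ↔ u' → w ↔ w' → Graph.adj G u w ≡ Graph.adj G' u' w'
      port-eq : ∀ {u u' w w'} → u ↔ u' → w ↔ w' → Adj G u w → P.δ u w ≡ P'.δ u' w'

  module _ {n n'} {G : Graph n} {P : Ports G} {v : Fin n} {G' : Graph n'} {P' : Ports G'} {v' : Fin n'}
    (I : StarIso G P v G' P' v') where
    open StarIso I
    private
      module P = Ports P
      module P' = Ports P'
      module L = Label G P
      module L' = Label G' P'
      module N = Neighbours G P
      module N' = Neighbours G' P'

      portBound-eq : L.portBound v ≡ L'.portBound v'
      portBound-eq = ≤-antisym
        (N.bound-upper v λ u a → let u' , r = image a in
          ≤-trans (≤-reflexive (cong suc (port-out r))) (N'.bound-lower v' u' (proj₂ (adjacent r))))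
        (N'.bound-upper v' λ u' a → let u , r = preimage a in
          ≤-trans (≤-reflexive (cong suc (sym (port-out r)))) (N.bound-lower v u (proj₁ (adjacent r))))

      nbr-rel : ∀ q → (L.nbr v q ≡ nothing × L'.nbr v' q ≡ nothing) ⊎
        (Σ (Fin n) λ u → Σ (Fin n') λ u' → L.nbr v q ≡ just u × L'.nbr v' q ≡ just u' × u ↔ u')
      nbr-rel q with L.nbr v q in e | L'.nbr v' q in e'
      ... | nothing | nothing = inj₁ (refl , refl)
      ... | just u | _ with N.nbr-sound e
      ...   | a , d with image a
      ...     | u' , r = inj₂ (u , u' , refl ,
                  trans (sym e') (N'.nbr-complete (proj₂ (adjacent r)) (trans (sym (port-out r)) d)) , r)
      nbr-rel q | nothing | just u' with N'.nbr-sound e'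
      ...   | a , d with preimage a
      ...     | u , r with trans (sym e) (N.nbr-complete (proj₁ (adjacent r)) (trans (port-out r) d))
      ...       | ()

      inner-eq : ∀ {u u'} → u ↔ u' → ∀ q → L.inner v u q ≡ L'.inner v' u' q
      inner-eq {u} {u'} r q with nbr-rel q
      ... | inj₁ (e , e') = trans (N.inner-nothing v u q e) (sym (N'.inner-nothing v' u' q e'))
      ... | inj₂ (w , w' , e , e' , s) = trans (N.inner-just v u q e) (trans same (sym (N'.inner-just v' u' q e')))
        where
        same : (if Graph.adj G u w then suc (P.δ u w) else 0) ≡ (if Graph.adj G' u' w' then suc (P'.δ u' w') else 0)
        same with Graph.adj G u w in a | Graph.adj G' u' w' | adj-eq r s
        ... | true | .true | refl = cong suc (port-eq r s a)
        ... | false | .false | refl = refl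

      entry-eq : ∀ p → L.entry v p ≡ L'.entry v' p
      entry-eq p with nbr-rel p
      ... | inj₁ (e , e') = trans (N.entry-nothing v p e) (sym (N'.entry-nothing v' p e'))
      ... | inj₂ (u , u' , e , e' , r) = trans (N.entry-just v p e) (trans
              (cong₂ (λ x y → suc (pair x (encList y))) (port-in r)
                (trans (map-cong (inner-eq r) _) (cong (λ k → map (L'.inner v' u') (upTo k)) portBound-eq)))
              (sym (N'.entry-just v' p e')))

    label-eq : L.label v ≡ L'.label v'
    label-eq = cong encList (trans (map-cong entry-eq _) (cong (λ k → map (L'.entry v') (upTo k)) portBound-eq))

-- Determinism of evaluation and of the agent's run

module Determinism where

  open import Defs
  open import Data.Fin using (Fin)
  open import Data.List using (List)
  open import Data.Nat using (ℕ; _≤_; s≤s)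
  open import Data.Nat.Properties using (<-cmp; m≤n⇒m<n∨m≡n)
  open import Data.Sum using (inj₁; inj₂)
  open import Data.Product using (Σ; _×_; _,_)
  open import Data.Vec using (Vec)
  open import Relation.Binary.Definitions using (tri<; tri≈; tri>)
  open import Relation.Binary.PropositionalEquality using (_≡_; refl; sym; trans)

  mutual
    Eval-det : ∀ {n} {c : PR n} {xs y z} → Eval c xs y → Eval c xs z → y ≡ z
    Eval-det e-zer e-zer = refl
    Eval-det e-succ e-succ = refl
    Eval-det e-proj e-proj = refl
    Eval-det (e-comp as a) (e-comp bs b) with EvalAll-det as bs
    ... | refl = Eval-det a b
    Eval-det (e-prec0 a) (e-prec0 b) = Eval-det a b
    Eval-det (e-precS a a') (e-precS b b') with Eval-det a b
    ... | refl = Eval-det a' b'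
    Eval-det (e-mu {y = y} a f) (e-mu {y = z} b g) with <-cmp y z
    ... | tri≈ _ eq _ = eq
    ... | tri< y<z _ _ with g y y<z
    ...   | k , b' with Eval-det a b'
    ...     | ()
    Eval-det (e-mu {y = y} a f) (e-mu {y = z} b g) | tri> _ _ z<y with f z z<y
    ...   | k , a' with Eval-det a' b
    ...     | ()

    EvalAll-det : ∀ {n m} {cs : Vec (PR n) m} {xs ys zs} → EvalAll cs xs ys → EvalAll cs xs zs → ys ≡ zs
    EvalAll-det ea-nil ea-nil = refl
    EvalAll-det (ea-cons a as) (ea-cons b bs) with Eval-det a b | EvalAll-det as bs
    ... | refl | refl = refl

  module _ (A : Agent) {n : ℕ} (G : Graph n) (P : Ports G) (s : Fin n) where
    open Run A G P s

    Reach-det : ∀ {k v w h h'} → Reach k v h → Reach k w h' → v ≡ w × h ≡ h'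
    Reach-det start start = refl , refl
    Reach-det (move a d e f) (move a' d' e' f') with Reach-det a a'
    ... | refl , refl with Eval-det d d'
    ... | refl with Ports.inj P _ _ _ e e' (trans f (sym f'))
    ... | refl = refl , refl

    Reach-prefix : ∀ {k v h} → Reach k v h → ∀ {j} → j ≤ k → Σ (Fin n) λ w → Σ (List ℕ) λ h' → Reach j w h'
    Reach-prefix {k} R j≤k with m≤n⇒m<n∨m≡n j≤k
    ... | inj₂ refl = _ , _ , R
    Reach-prefix (move R _ _ _) j≤k | inj₁ (s≤s j≤k') = Reach-prefix R j≤k'

-- Folding the stars along a walk into a simply connected graph

module Developments where

  open import Defs
  open Walks
  open Labels
  open Determinism
  open import Data.Bool using (Bool; true; false)
  open import Data.Empty using (⊥; ⊥-elim)
  open import Data.Fin using (Fin; zero; suc; toℕ; fromℕ<; punchOut; combine; remQuot)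
  open import Data.Fin.Properties using (_≟_; any?; pigeonhole; punchOut-injective; punchOut-punchIn; punchInᵢ≢i; remQuot-combine; toℕ-fromℕ<; toℕ<n)
  open import Data.List using (List; []; _∷_; _++_; map)
  open import Data.List.Properties using (++-assoc; ++-identityʳ)
  open import Data.Nat using (ℕ; zero; suc; _<_; _≤_; s≤s; z≤n; _*_)
  open import Data.Nat.Properties using (≤-refl; ≤-trans; m⊓n≤n; m≤n⇒m⊓n≡m; ≤-<-connex; <⇒≤; n<1+n; ≤-pred)
  import Data.Nat.Properties as ℕₚ
  open import Data.Product using (Σ; _×_; _,_; proj₁; proj₂)
  open import Data.Vec using () renaming ([] to []ᵥ; _∷_ to _∷ᵥ_)
  open import Data.Sum using (_⊎_; inj₁; inj₂; [_,_]′)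
  open import Relation.Binary.Construct.Closure.ReflexiveTransitive using (Star; ε; _◅_; _◅◅_)
  open import Relation.Binary.PropositionalEquality using (_≡_; _≢_; refl; cong; cong₂; subst; subst₂; sym; trans)
  open import Relation.Nullary using (Dec; yes; no; does)
  open import Relation.Nullary.Decidable using (_×-dec_; _⊎-dec_; ¬?; dec-true)
  import Data.Bool.Properties as Boolₚ

  witness : ∀ {X : Set} (d : Dec X) → does d ≡ true → X
  witness (yes x) _ = x

  -- Computes the least equivalence closed under conditional identifications. `sound` keeps a
  -- derivation for every identification made, so that facts about classes can be proved by
  -- induction over `≈`.
  module Quotient {M : ℕ} (Rule : Fin M → Fin M → Fin M → Fin M → Set)
    (rule? : ∀ p q r s → Dec (Rule p q r s)) where

    data _≈_ : Fin M → Fin M → Set where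
      ≈-refl  : ∀ {p} → p ≈ p
      ≈-sym   : ∀ {p q} → p ≈ q → q ≈ p
      ≈-trans : ∀ {p q r} → p ≈ q → q ≈ r → p ≈ r
      ≈-rule  : ∀ {p q r s} → Rule p q r s → p ≈ q → r ≈ s

    record Classes (c : ℕ) : Set where
      field
        cl    : Fin M → Fin c
        sec   : Fin c → Fin M
        cl-sec : ∀ x → cl (sec x) ≡ x
        sound : ∀ {p q} → cl p ≡ cl q → p ≈ q

    Closed : ∀ {c} → Classes c → Set
    Closed C = ∀ {p q r s} → Rule p q r s → cl p ≡ cl q → cl r ≡ cl s
      where open Classes C

    private
      Violation : ∀ {c} → Classes c → Set
      Violation C = Σ _ λ p → Σ _ λ q → Σ _ λ r → Σ _ λ s → Rule p q r s × cl p ≡ cl q × cl r ≢ cl s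
        where open Classes C

      violation? : ∀ {c} (C : Classes c) → Dec (Violation C)
      violation? C = any? λ p → any? λ q → any? λ r → any? λ s →
        rule? p q r s ×-dec (cl p ≟ cl q) ×-dec ¬? (cl r ≟ cl s)
        where open Classes C

      -- The class of `s` is removed and redirected to that of `r`. The number of classes drops,
      -- which makes the repair of violations terminate.
      merge : ∀ {c} (C : Classes (suc c)) → Violation C → Classes c
      merge {c} C (p , q , r , s , R , e , ne) = record
        { cl = λ a → f (cl a)
        ; sec = λ x → sec (g x)
        ; cl-sec = λ x → trans (cong f (cl-sec (g x))) (f-g x)
        ; sound = λ {a} {b} h → joined (cl a) (cl b) refl refl h }
        where
        open Classes C
        s≢r : cl s ≢ cl r
        s≢r h = ne (sym h)
        f : Fin (suc c) → Fin c
        f x with cl s ≟ x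
        ... | yes _ = punchOut {i = cl s} {j = cl r} s≢r
        ... | no h = punchOut {i = cl s} {j = x} h
        g : Fin c → Fin (suc c)
        g = Data.Fin.punchIn (cl s)
        f-g : ∀ x → f (g x) ≡ x
        f-g x with cl s ≟ g x
        ... | yes h = ⊥-elim (punchInᵢ≢i (cl s) x (sym h))
        ... | no h = punchOut-punchIn (cl s)
        r≈s : r ≈ s
        r≈s = ≈-rule R (sound e)
        joined : ∀ {a b} x y → cl a ≡ x → cl b ≡ y → f x ≡ f y → a ≈ b
        joined x y refl refl h with cl s ≟ x | cl s ≟ y
        ... | yes i | yes j = sound (trans (sym i) j)
        ... | yes i | no j = ≈-trans (≈-sym (sound i)) (≈-trans (≈-sym r≈s) (sound (punchOut-injective {i = cl s} s≢r j h)))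
        ... | no i | yes j = ≈-trans (sound (punchOut-injective {i = cl s} i s≢r h)) (≈-trans r≈s (sound j))
        ... | no i | no j = sound (punchOut-injective {i = cl s} i j h)

      close : ∀ c → Classes c → Σ ℕ λ d → Σ (Classes d) Closed
      close zero C = zero , C , λ {p} → ⊥-elim (noFin (Classes.cl C p))
        where noFin : Fin zero → ⊥
              noFin ()
      close (suc c) C with violation? C
      ... | yes V = close c (merge C V)
      ... | no N = suc c , C , closed
        where
        closed : Closed C
        closed {p} {q} {r} {s} R e with Classes.cl C r ≟ Classes.cl C s
        ... | yes h = h
        ... | no h = ⊥-elim (N (p , q , r , s , R , e , h))

    abstract
     quotient : Σ ℕ λ c → Σ (Classes c) Closed
     quotient = close M (record { cl = λ p → p ; sec = λ p → p ; cl-sec = λ _ → refl ; sound = λ { refl → ≈-refl } })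

  -- The stars of the vertices of a walk v₀ … v_j, glued along the walk and folded until
  -- the projection to G is locally injective.
  module Development {n : ℕ} (G : Graph n) (P : Ports G) (j : ℕ) (v : ℕ → Fin n)
    (v-adj : ∀ i → i < j → Adj G (v i) (v (suc i))) where
    open Graph G using (adj)
    private module GH = GraphHomotopy G

    Near : ℕ → Fin n → Set
    Near i u = u ≡ v i ⊎ Adj G (v i) u

    near? : ∀ i u → Dec (Near i u)
    near? i u = (u ≟ v i) ⊎-dec (adj (v i) u Boolₚ.≟ true)

    M : ℕ
    M = suc j * n

    abstract
      st : Fin M → ℕ
      st p = toℕ (proj₁ (remQuot {suc j} n p))

      st≤ : ∀ p → st p ≤ j
      st≤ p = ≤-pred (toℕ<n (proj₁ (remQuot {suc j} n p)))

      -- All pairs of a step and a vertex are kept, to have a set of the form `Fin M`; a pair whose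
      -- vertex lies outside the star is read as another name of the centre.
      pt : Fin M → Fin n
      pt p with near? (st p) (proj₂ (remQuot {suc j} n p))
      ... | yes _ = proj₂ (remQuot {suc j} n p)
      ... | no _ = v (st p)

      pt-near : ∀ p → Near (st p) (pt p)
      pt-near p with near? (st p) (proj₂ (remQuot {suc j} n p))
      ... | yes h = h
      ... | no _ = inj₁ refl

      mk : ℕ → Fin n → Fin M
      mk i u = combine {suc j} (fromℕ< (s≤s (m⊓n≤n i j))) u

      st-mk : ∀ {i} u → i ≤ j → st (mk i u) ≡ i
      st-mk {i} u h = trans (cong (λ x → toℕ (proj₁ x)) (remQuot-combine {suc j} {n} (fromℕ< (s≤s (m⊓n≤n i j))) u))
        (trans (toℕ-fromℕ< (s≤s (m⊓n≤n i j))) (m≤n⇒m⊓n≡m h))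

      pt-mk : ∀ {i u} → i ≤ j → Near i u → pt (mk i u) ≡ u
      pt-mk {i} {u} h N with near? (st (mk i u)) (proj₂ (remQuot {suc j} n (mk i u)))
      ... | yes _ = cong proj₂ (remQuot-combine {suc j} {n} (fromℕ< (s≤s (m⊓n≤n i j))) u)
      ... | no ¬N = ⊥-elim (¬N (subst₂ Near (sym (st-mk u h))
          (sym (cong proj₂ (remQuot-combine {suc j} {n} (fromℕ< (s≤s (m⊓n≤n i j))) u))) N))

    -- In this order: two names of one point of a star; the gluing of the next centre to the point
    -- of the present star that it continues; the fold of two edges with identified starts and equal
    -- images. The first two hold unconditionally and are applied with equal `p` and `q`.
    Rule : Fin M → Fin M → Fin M → Fin M → Set
    Rule p q r s = (st r ≡ st s × pt r ≡ pt s)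
      ⊎ (st s ≡ suc (st r) × pt r ≡ v (st s) × pt s ≡ v (st s))
      ⊎ (st p ≡ st r × st q ≡ st s × pt p ≡ pt q × pt r ≡ pt s × Adj G (pt p) (pt r))

    rule? : ∀ p q r s → Dec (Rule p q r s)
    rule? p q r s = ((st r ℕₚ.≟ st s) ×-dec (pt r ≟ pt s))
      ⊎-dec ((st s ℕₚ.≟ suc (st r)) ×-dec (pt r ≟ v (st s)) ×-dec (pt s ≟ v (st s)))
      ⊎-dec ((st p ℕₚ.≟ st r) ×-dec (st q ℕₚ.≟ st s) ×-dec (pt p ≟ pt q) ×-dec (pt r ≟ pt s)
        ×-dec (adj (pt p) (pt r) Boolₚ.≟ true))

    open Quotient Rule rule?

    c : ℕ
    c = proj₁ quotient

    open Classes (proj₁ (proj₂ quotient))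

    closed : Closed (proj₁ (proj₂ quotient))
    closed = proj₂ (proj₂ quotient)

    ≈⇒pt : ∀ {p q} → p ≈ q → pt p ≡ pt q
    ≈⇒pt ≈-refl = refl
    ≈⇒pt (≈-sym h) = sym (≈⇒pt h)
    ≈⇒pt (≈-trans h k) = trans (≈⇒pt h) (≈⇒pt k)
    ≈⇒pt (≈-rule (inj₁ (_ , e)) h) = e
    ≈⇒pt (≈-rule (inj₂ (inj₁ (_ , e , e'))) h) = trans e (sym e')
    ≈⇒pt (≈-rule (inj₂ (inj₂ (_ , _ , _ , e , _))) h) = e

    ≈⇒cl : ∀ {p q} → p ≈ q → cl p ≡ cl q
    ≈⇒cl ≈-refl = refl
    ≈⇒cl (≈-sym h) = sym (≈⇒cl h)
    ≈⇒cl (≈-trans h k) = trans (≈⇒cl h) (≈⇒cl k)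
    ≈⇒cl (≈-rule R h) = closed R (≈⇒cl h)

    cl-same : ∀ {r s} → st r ≡ st s → pt r ≡ pt s → cl r ≡ cl s
    cl-same {r} e f = closed {r} {r} (inj₁ (e , f)) refl

    φ : Fin c → Fin n
    φ x = pt (sec x)

    φ-cl : ∀ p → φ (cl p) ≡ pt p
    φ-cl p = ≈⇒pt (sound (cl-sec (cl p)))

    Edge : Fin c → Fin c → Set
    Edge x y = Σ (Fin M) λ p → Σ (Fin M) λ q → cl p ≡ x × cl q ≡ y × st p ≡ st q × Adj G (pt p) (pt q)

    abstract
      edge? : ∀ x y → Dec (Edge x y)
      edge? x y = any? λ p → any? λ q → (cl p ≟ x) ×-dec (cl q ≟ y) ×-dec (st p ℕₚ.≟ st q)
        ×-dec (adj (pt p) (pt q) Boolₚ.≟ true)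

      adjT : Fin c → Fin c → Bool
      adjT x y = does (edge? x y)

      edge⇒ : ∀ {x y} → Edge x y → adjT x y ≡ true
      edge⇒ {x} {y} E = dec-true (edge? x y) E

      ⇒edge : ∀ {x y} → adjT x y ≡ true → Edge x y
      ⇒edge {x} {y} e = witness (edge? x y) e

    _~_ : Fin c → Fin c → Set
    x ~ y = adjT x y ≡ true

    edge-sym : ∀ {x y} → Edge x y → Edge y x
    edge-sym (p , q , e , f , g , a) = q , p , f , e , sym g , GH.Adj-sym a

    ~-sym : ∀ {x y} → x ~ y → y ~ x
    ~-sym e = edge⇒ (edge-sym (⇒edge e))

    star-edge : ∀ {p q} → st p ≡ st q → Adj G (pt p) (pt q) → cl p ~ cl q
    star-edge {p} {q} e a = edge⇒ (p , q , refl , refl , e , a)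

    φ-hom : ∀ {x y} → x ~ y → Adj G (φ x) (φ y)
    φ-hom e with ⇒edge e
    ... | p , q , refl , refl , _ , a = subst₂ (Adj G) (sym (φ-cl p)) (sym (φ-cl q)) a

    private
      fold : ∀ {p q p' q'} → cl p ≡ cl p' → st p ≡ st q → st p' ≡ st q' → pt q ≡ pt q' →
        Adj G (pt p) (pt q) → cl q ≡ cl q'
      fold e s s' f a = closed (inj₂ (inj₂ (s , s' , ≈⇒pt (sound e) , f , a))) e

    -- Edges at a common vertex come from edges of stars with identified starts, and those with
    -- equal images have been folded: the projection is an immersion.
    φ-injective : ∀ {x y z} → x ~ y → x ~ z → φ y ≡ φ z → y ≡ z
    φ-injective e e' h with ⇒edge e | ⇒edge e'
    ... | p , q , refl , refl , s , a | p' , q' , f , refl , s' , a' =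
      fold (sym f) s s' (trans (sym (φ-cl q)) (trans h (φ-cl q'))) a

    centre : ℕ → Fin c
    centre i = cl (mk i (v i))

    φ-centre : ∀ {i} → i ≤ j → φ (centre i) ≡ v i
    φ-centre h = trans (φ-cl _) (pt-mk h (inj₁ refl))

    -- An edge at a centre may stem from some other star, but the star of that centre contains an
    -- edge with the same image, and the fold identifies the two. Hence the neighbourhood of a
    -- centre is no larger than its star.
    centre-neighbour : ∀ {i y} → i ≤ j → centre i ~ y → Σ (Fin M) λ q → st q ≡ i × cl q ≡ y
    centre-neighbour {i} h e with ⇒edge e
    ... | p , q , f , refl , s , a = mk i (pt q) , st-mk _ h ,
      sym (fold f s (trans (st-mk _ h) (sym (st-mk _ h))) (sym (pt-mk h near)) a)
      where
      near : Near i (pt q)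
      near = inj₂ (subst (λ x → Adj G x (pt q)) (trans (≈⇒pt (sound f)) (pt-mk h (inj₁ refl))) a)

    centre-edge : ∀ {i u} → i ≤ j → Adj G (v i) u → centre i ~ cl (mk i u)
    centre-edge {i} {u} h a = star-edge (trans (st-mk _ h) (sym (st-mk _ h)))
      (subst₂ (Adj G) (sym (pt-mk h (inj₁ refl))) (sym (pt-mk h (inj₂ a))) a)

    advance : ∀ {i} → i < j → cl (mk i (v (suc i))) ≡ centre (suc i)
    advance {i} h = closed {mk i (v i)} {mk i (v i)} (inj₂ (inj₁
      ( trans (st-mk _ h) (cong suc (sym (st-mk _ (<⇒≤ h))))
      , trans (pt-mk (<⇒≤ h) (inj₂ (v-adj i h))) (sym (cong v (st-mk _ h)))
      , trans (pt-mk h (inj₁ refl)) (sym (cong v (st-mk _ h)))))) refl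

    centre-step : ∀ {i} → i < j → centre i ~ centre (suc i)
    centre-step {i} h = subst (centre i ~_) (advance h) (centre-edge (<⇒≤ h) (v-adj i h))

    open Homotopy _~_ public
    open Symmetric ~-sym public

    o : Fin c
    o = centre 0

    W : ℕ → List (Fin c)
    W zero = []
    W (suc i) = W i ++ centre (suc i) ∷ []

    W-path : ∀ {i} → i ≤ j → Path o (W i) (centre i)
    W-path {zero} h = []
    W-path {suc i} h = W-path (<⇒≤ h) ⁀ (centre-step h ∷ [])

    leg : Fin M → List (Fin c)
    leg p with pt p ≟ v (st p)
    ... | yes _ = []
    ... | no _ = cl p ∷ []

    route : Fin M → List (Fin c)
    route p = W (st p) ++ leg p

    private
      centre-cl : ∀ {p} → pt p ≡ v (st p) → centre (st p) ≡ cl p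
      centre-cl {p} e = cl-same (st-mk _ (st≤ p)) (trans (pt-mk (st≤ p) (inj₁ refl)) (sym e))

      centre-off : ∀ {p} → pt p ≢ v (st p) → centre (st p) ~ cl p
      centre-off {p} ne with pt-near p
      ... | inj₁ e = ⊥-elim (ne e)
      ... | inj₂ a = subst (centre (st p) ~_) (cl-same (st-mk _ (st≤ p)) (pt-mk (st≤ p) (inj₂ a))) (centre-edge (st≤ p) a)

      leg-path : ∀ p → Path (centre (st p)) (leg p) (cl p)
      leg-path p with pt p ≟ v (st p)
      ... | yes e = subst (Path (centre (st p)) []) (centre-cl e) []
      ... | no ne = centre-off ne ∷ []

      leg-edge : ∀ p q → st p ≡ st q → Adj G (pt p) (pt q) →
        centre (st p) ∷ leg p ++ cl q ∷ [] ≃ centre (st p) ∷ leg q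
      leg-edge p q s a with pt p ≟ v (st p) | pt q ≟ v (st q)
      ... | yes e | yes f = ⊥-elim (Boolₚ.not-¬ {x = true} refl
          (trans (sym a) (trans (cong₂ adj e (trans f (cong v (sym s)))) (Graph.irrefl G _))))
      ... | yes e | no f = ≃-refl
      ... | no e | yes f = subst (λ x → centre (st p) ∷ cl p ∷ x ∷ [] ≃ centre (st p) ∷ [])
          (trans (cong centre s) (centre-cl f)) (backtrack [] (centre-off e))
      ... | no e | no f = shortcut [] (subst (λ i → centre i ~ cl q) (sym s) (centre-off f))
          (~-sym (star-edge s a)) (centre-off e)

    route-path : ∀ p → Path o (route p) (cl p)
    route-path p = W-path (st≤ p) ⁀ leg-path p

    route-edge : ∀ p q → st p ≡ st q → Adj G (pt p) (pt q) → o ∷ route p ++ cl q ∷ [] ≃ o ∷ route q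
    route-edge p q s a = begin
      o ∷ (W (st p) ++ leg p) ++ cl q ∷ []  ≡⟨ cong (o ∷_) (++-assoc (W (st p)) _ _) ⟩
      o ∷ W (st p) ++ leg p ++ cl q ∷ []    ≈⟨ after (W-path (st≤ p)) (leg-edge p q s a) ⟩
      o ∷ W (st p) ++ leg q                 ≡⟨ cong (λ i → o ∷ W i ++ leg q) s ⟩
      o ∷ route q                           ∎
      where open ≃-Reasoning

    -- This is why the development is simply connected: the route to a point depends, up to
    -- homotopy, only on its class. In a derivation by a fold, both routes extend homotopic routes
    -- by one and the same vertex of the quotient.
    route-cong : ∀ {p q} → p ≈ q → o ∷ route p ≃ o ∷ route q
    route-cong ≈-refl = ≃-refl
    route-cong (≈-sym h) = ≃-sym (route-cong h)
    route-cong (≈-trans h k) = ≃-trans (route-cong h) (route-cong k)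
    route-cong {r} {s} (≈-rule (inj₁ (e , f)) _) = ≃-reflexive (cong (o ∷_) (cong₂ _++_ (cong W e) legs))
      where
      legs : leg r ≡ leg s
      legs with pt r ≟ v (st r) | pt s ≟ v (st s)
      ... | yes _ | yes _ = refl
      ... | yes a | no b = ⊥-elim (b (trans (sym f) (trans a (cong v e))))
      ... | no a | yes b = ⊥-elim (a (trans f (trans b (cong v (sym e)))))
      ... | no _ | no _ = cong (_∷ []) (cl-same e f)
    route-cong {r} {s} (≈-rule {p} (inj₂ (inj₁ (e , f , g))) _) = ≃-reflexive (cong (o ∷_) eq)
      where
      ne : pt r ≢ v (st r)
      ne h = Boolₚ.not-¬ {x = true} refl (trans (sym (v-adj (st r) (subst (_≤ j) e (st≤ s))))
        (trans (cong₂ adj refl (trans (cong v (sym e)) (trans (sym f) h))) (Graph.irrefl G _)))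
      cl-eq : cl r ≡ centre (suc (st r))
      cl-eq = trans (closed {p} {p} (inj₂ (inj₁ (e , f , g))) refl) (trans (sym (centre-cl g)) (cong centre e))
      -- As `v (suc i)` is adjacent to `v i` and so differs from it, the leg to the glued point is
      -- one edge, namely the last edge of the walk to the next centre.
      eq : route r ≡ route s
      eq with pt r ≟ v (st r) | pt s ≟ v (st s)
      ... | yes h | _ = ⊥-elim (ne h)
      ... | no _ | no h = ⊥-elim (h g)
      ... | no _ | yes _ = trans (cong (λ x → W (st r) ++ x ∷ []) cl-eq) (trans (cong W (sym e)) (sym (++-identityʳ _)))
    route-cong {r} {s} (≈-rule {p} {q} R@(inj₂ (inj₂ (e , f , g , h , a))) k) = begin
      o ∷ route r                 ≈⟨ ≃-sym (route-edge p r e a) ⟩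
      o ∷ route p ++ cl r ∷ []    ≈⟨ suffix _ (route-cong k) ⟩
      o ∷ route q ++ cl r ∷ []    ≡⟨ cong (λ x → o ∷ route q ++ x ∷ []) (closed R (≈⇒cl k)) ⟩
      o ∷ route q ++ cl s ∷ []    ≈⟨ route-edge q s f (subst₂ (Adj G) g h a) ⟩
      o ∷ route s                 ∎
      where open ≃-Reasoning

    ω-path : ∀ x → Path o (route (sec x)) x
    ω-path x = subst (Path o (route (sec x))) (cl-sec x) (route-path (sec x))

    ω-edge : ∀ {x y} → x ~ y → o ∷ route (sec x) ++ y ∷ [] ≃ o ∷ route (sec y)
    ω-edge e with ⇒edge e
    ... | p , q , refl , refl , s , a = ≃-trans (suffix _ (route-cong (sound (cl-sec (cl p)))))
      (≃-trans (route-edge p q s a) (route-cong (≈-sym (sound (cl-sec (cl q))))))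

    open Trivialisation o (λ x → route (sec x)) ω-path ω-edge public

    private
      path⇒star : ∀ {x p y} → Path x p y → Star _~_ x y
      path⇒star [] = ε
      path⇒star (e ∷ Q) = e ◅ path⇒star Q

    T : Graph c
    T = record
      { adj = adjT
      ; sym = λ x y → iff (~-sym {x} {y}) (~-sym {y} {x})
      ; irrefl = irreflexive
      ; conn = λ x y → path⇒star (rev-path (ω-path x)) ◅◅ path⇒star (ω-path y) }
      where
      iff : ∀ {a b} → (a ≡ true → b ≡ true) → (b ≡ true → a ≡ true) → a ≡ b
      iff {true} {b} f g = sym (f refl)
      iff {false} {true} f g = g refl
      iff {false} {false} f g = refl
      irreflexive : ∀ x → adjT x x ≡ false
      irreflexive x with adjT x x in e
      ... | false = refl
      ... | true with trans (sym (φ-hom e)) (Graph.irrefl G _)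
      ...   | ()

    T-SC : InSC T
    T-SC = GraphHomotopy.closed⇒SC T (λ Q → parallel Q [])

    PT : Ports T
    PT = record
      { δ = λ x y → Ports.δ P (φ x) (φ y)
      ; inj = λ x y z e f h → φ-injective e f (Ports.inj P _ _ _ (φ-hom e) (φ-hom f) h) }

    -- The point at issue is adjacency of two neighbours with adjacent images: both lie in star `i`
    -- by `centre-neighbour`, and a star carries all edges of `G` between its points.
    star-iso : ∀ {i} → i ≤ j → StarIso T PT (centre i) G P (v i)
    star-iso {i} h = record
      { _↔_ = λ x u → (centre i ~ x) × φ x ≡ u
      ; image = λ {x} e → φ x , e , refl
      ; preimage = λ {u} a → cl (mk i u) , centre-edge h a , trans (φ-cl _) (pt-mk h (inj₂ a))
      ; adjacent = λ { (e , refl) → e , subst (λ z → Adj G z _) (φ-centre h) (φ-hom e) }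
      ; port-out = λ { (e , refl) → cong (λ z → Ports.δ P z _) (φ-centre h) }
      ; port-in = λ { (e , refl) → cong (Ports.δ P _) (φ-centre h) }
      ; adj-eq = λ { {x} {_} {y} (e , refl) (f , refl) → adj-eq e f }
      ; port-eq = λ { (e , refl) (f , refl) _ → refl } }
      where
      adj-eq : ∀ {x y} → centre i ~ x → centre i ~ y → adjT x y ≡ adj (φ x) (φ y)
      adj-eq {x} {y} e f with adjT x y in t
      ... | true = sym (φ-hom t)
      ... | false with adj (φ x) (φ y) in a
      ...   | false = refl
      ...   | true with centre-neighbour h e | centre-neighbour h f
      ...     | p , s , refl | q , s' , refl = trans (sym t)
        (star-edge (trans s (sym s')) (subst₂ (Adj G) (φ-cl p) (φ-cl q) a))

    label-centre : ∀ {i} → i ≤ j → Label.label T PT (centre i) ≡ Label.label G P (v i)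
    label-centre h = label-eq (star-iso h)

    -- If every vertex of the development is a centre, then the immersion is surjective on every
    -- star, so walks of `G` lift edge by edge as for a covering.
    lift : (∀ x → Σ ℕ λ i → i ≤ j × x ≡ centre i) → ∀ {u p w} → GH.Path u p w → ∀ {x} → φ x ≡ u →
      Σ (List (Fin c)) λ p' → Σ (Fin c) λ y → Path x p' y × map φ p' ≡ p × φ y ≡ w
    lift complete GH.[] {x} e = [] , x , [] , refl , e
    lift complete (GH._∷_ {x = b} a Q) {x} refl with complete x
    ... | i , h , refl with lift complete Q {cl (mk i b)} (trans (φ-cl _) (pt-mk h (inj₂ (subst (λ z → Adj G z b) (φ-centre h) a))))
    ...   | p' , y , Q' , refl , f =
      cl (mk i b) ∷ p' , y , centre-edge h a' ∷ Q' , cong (_∷ map φ p') (trans (φ-cl _) (pt-mk h (inj₂ a'))) , f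
      where a' = subst (λ z → Adj G z b) (φ-centre h) a

  power : ∀ {A : Set} → ℕ → List A → List A
  power zero γ = []
  power (suc i) γ = γ ++ power i γ

  -- If A stops within k steps on the development of its own walk in G, that development is a finite
  -- simply connected cover of G.
  module Continue (A : Agent) (E : ExploresSC A) {n : ℕ} (G : Graph n) (P : Ports G) (s : Fin n) where
    open Run A G P s
    private module GH = GraphHomotopy G

    FiniteOrder : Set
    FiniteOrder = ∀ γ → GH.Path s γ s → Σ ℕ λ i → Σ ℕ λ i' → i < i' × s ∷ power i γ GH.≃ s ∷ power i' γ

    private
      step-adj : ∀ {k x h} → Reach (suc k) x h → Σ (Fin n) λ u → Σ (List ℕ) λ h' → Reach k u h' × Adj G u x
      step-adj (move S _ a _) = _ , _ , S , a

    module _ {j : ℕ} {w : Fin n} {h : List ℕ} (R : Reach j w h) where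
      private
        v : ℕ → Fin n
        v i = proj₁ (Reach-prefix A G P s R (m⊓n≤n i j))

        v-reach : ∀ i → i ≤ j → Σ (List ℕ) (Reach i (v i))
        v-reach i i≤j with Reach-prefix A G P s R (m⊓n≤n i j)
        ... | x , g , S = g , subst (λ k → Reach k x g) (m≤n⇒m⊓n≡m i≤j) S

        agree : ∀ {i u h'} → Reach i u h' → i ≤ j → u ≡ v i
        agree {i} S i≤j = proj₁ (Reach-det A G P s S (proj₂ (v-reach i i≤j)))

        v-adj : ∀ i → i < j → Adj G (v i) (v (suc i))
        v-adj i i<j with step-adj (proj₂ (v-reach (suc i) i<j))
        ... | u , h' , S , a = subst (λ z → Adj G z (v (suc i))) (agree S (<⇒≤ i<j)) a

        module D = Development G P j v v-adj
        module RT = Run A D.T D.PT D.o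

        -- Equal labels and ports along the centres give equal observations, so the agent makes the
        -- same decisions with the same history.
        transfer : ∀ {i u g} → Reach i u g → i ≤ j → RT.Reach i (D.centre i) g
        transfer start i≤j = subst (λ l → RT.Reach 0 D.o (pair l 0 ∷ []))
          (trans (D.label-centre i≤j) (cong (Label.label G P) (sym (agree start i≤j)))) RT.start
        transfer {suc i} {u} (move {v = x} {h = g} S d a refl) i<j =
          subst₂ (λ l p → RT.Reach (suc i) (D.centre (suc i)) (pair l (suc p) ∷ g))
            (trans (D.label-centre i<j) (cong (Label.label G P) (sym u≡)))
            (cong₂ (Ports.δ P) (trans (D.φ-centre i<j) (sym u≡)) (trans (D.φ-centre (<⇒≤ i<j)) (sym x≡)))
            (RT.move (transfer S (<⇒≤ i<j)) d (D.centre-step i<j)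
              (cong₂ (Ports.δ P) (trans (D.φ-centre (<⇒≤ i<j)) (sym x≡)) (trans (D.φ-centre i<j) (sym u≡))))
          where
          u≡ : u ≡ v (suc i)
          u≡ = agree (move S d a refl) i<j
          x≡ : x ≡ v i
          x≡ = agree S (<⇒≤ i<j)

        φo : D.φ D.o ≡ s
        φo = trans (D.φ-centre z≤n) (sym (agree start z≤n))

        Lift : List (Fin n) → Set
        Lift p = Σ (List (Fin D.c)) λ p' → Σ (Fin D.c) λ y → D.Path D.o p' y × map D.φ p' ≡ p × D.φ y ≡ s

        meet : ∀ {p q} (L : Lift p) (L' : Lift q) → proj₁ (proj₂ L) ≡ proj₁ (proj₂ L') → s ∷ p GH.≃ s ∷ q
        meet (pa , y , Pa , ea , _) (pb , _ , Pb , eb , _) refl =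
          subst₂ GH._≃_ (cong₂ _∷_ φo ea) (cong₂ _∷_ φo eb) (map-≃ D.φ D.φ-hom (D.parallel Pa Pb))

        coincide : ∀ {m} (f : ℕ → Fin m) → Σ ℕ λ i → Σ ℕ λ i' → i < i' × f i ≡ f i'
        coincide {m} f with pigeonhole (n<1+n m) (λ i → f (toℕ i))
        ... | a , b , a<b , e = toℕ a , toℕ b , a<b , e

        -- All powers of the closed walk lift from the same vertex, and two of the lifts end at the
        -- same vertex of the finite development. There they are homotopic by simple connectivity,
        -- and the homotopy projects to `G`.
        finite-order : (∀ x → Σ ℕ λ i → i ≤ j × x ≡ D.centre i) → FiniteOrder
        finite-order complete γ Q = let i , i' , i<i' , e = coincide (λ i → proj₁ (proj₂ (lifted i))) in
            i , i' , i<i' , meet (lifted i) (lifted i') e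
          where
          powerP : ∀ i → GH.Path s (power i γ) s
          powerP zero = GH.[]
          powerP (suc i) = Q GH.⁀ powerP i
          lifted : ∀ i → Lift (power i γ)
          lifted i = D.lift complete (powerP i) φo

        Next : Set
        Next = Σ (Fin n) λ u → Σ (List ℕ) λ h' → Reach (suc j) u h'

        project : ∀ {y g x p} → y ≡ D.centre j × g ≡ h → Eval A (encList g ∷ᵥ []ᵥ) (suc p) →
          y D.~ x → Ports.δ P (D.φ y) (D.φ x) ≡ p → Next
        project {x = x} (refl , refl) d a f = D.φ x , _ ,
          move R d (subst (λ z → Adj G z (D.φ x)) eq (D.φ-hom a)) (trans (cong (λ z → Ports.δ P z (D.φ x)) (sym eq)) f)
          where
          eq : D.φ (D.centre j) ≡ w
          eq = trans (D.φ-centre ≤-refl) (sym (agree R ≤-refl))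

        proceed : ∀ {x g} → RT.Reach (suc j) x g → Next
        proceed (RT.move S d a f) = project (Reach-det A D.T D.PT D.o S (transfer R ≤-refl)) d a f

        -- A halt within `j` steps means that all vertices of the development were visited while the
        -- agent was on the centres, hence that all of them are centres. A longer run leaves the
        -- last centre along an edge that projects to `G`.
        conclude : (Σ ℕ λ k → RT.HaltsAt k × (∀ y → RT.VisitedBy k y)) → Next ⊎ FiniteOrder
        conclude (k , (_ , _ , S , _) , visited) = [ short , long ]′ (≤-<-connex k j)
          where
          place : k ≤ j → ∀ y → RT.VisitedBy k y → Σ ℕ λ i → i ≤ j × y ≡ D.centre i
          place k≤j y (i , i≤k , g' , S') = i , ≤-trans i≤k k≤j ,
            proj₁ (Reach-det A D.T D.PT D.o S' (transfer (proj₂ (v-reach i (≤-trans i≤k k≤j))) (≤-trans i≤k k≤j)))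
          short : k ≤ j → Next ⊎ FiniteOrder
          short k≤j = inj₂ (finite-order (λ y → place k≤j y (visited y)))
          long : j < k → Next ⊎ FiniteOrder
          long j<k = inj₁ (proceed (proj₂ (proj₂ (Reach-prefix A D.T D.PT D.o S j<k))))

      continue : (Σ (Fin n) λ u → Σ (List ℕ) λ h' → Reach (suc j) u h') ⊎ FiniteOrder
      continue = conclude (E D.c D.T D.T-SC D.PT D.o)

-- Programs for arithmetic, pairing, lists and division by three

module RecursiveFunctions where

  open import Defs
  open import Data.Bool using (if_then_else_)
  open import Data.Fin using (Fin; zero; suc)
  open import Data.List using ([]; _∷_)
  open import Data.Nat using (ℕ; zero; suc; _+_; _*_; _^_; _∸_; pred; _≤_; z≤n; s≤s; _≡ᵇ_)
  open import Data.Nat.Properties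
  open import Data.Product using (Σ; _×_; _,_; proj₁; proj₂)
  open import Data.Vec using (Vec; []; _∷_; lookup)
  open import Relation.Binary.PropositionalEquality using (_≡_; refl; cong; cong₂; subst; sym; trans)

  Rep : (n : ℕ) → (Vec ℕ n → ℕ) → Set
  Rep n F = Σ (PR n) λ c → ∀ xs → Eval c xs (F xs)

  Rep₁ : (ℕ → ℕ) → Set
  Rep₁ = Computable

  Rep₂ : (ℕ → ℕ → ℕ) → Set
  Rep₂ f = Σ (PR 2) λ c → ∀ x y → Eval c (x ∷ y ∷ []) (f x y)

  Rep₃ : (ℕ → ℕ → ℕ → ℕ) → Set
  Rep₃ f = Σ (PR 3) λ c → ∀ x y z → Eval c (x ∷ y ∷ z ∷ []) (f x y z)

  Rep₄ : (ℕ → ℕ → ℕ → ℕ → ℕ) → Set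
  Rep₄ f = Σ (PR 4) λ c → ∀ x y z w → Eval c (x ∷ y ∷ z ∷ w ∷ []) (f x y z w)

  module _ {n : ℕ} where

    ap₁ : ∀ {f F} → Rep₁ f → Rep n F → Rep n (λ xs → f (F xs))
    ap₁ (c , p) (d , q) = comp c (d ∷ []) , λ xs → e-comp (ea-cons (q xs) ea-nil) (p _)

    ap₂ : ∀ {f F G} → Rep₂ f → Rep n F → Rep n G → Rep n (λ xs → f (F xs) (G xs))
    ap₂ (c , p) (d , q) (e , r) = comp c (d ∷ e ∷ []) , λ xs → e-comp (ea-cons (q xs) (ea-cons (r xs) ea-nil)) (p _ _)

    ap₃ : ∀ {f F G H} → Rep₃ f → Rep n F → Rep n G → Rep n H → Rep n (λ xs → f (F xs) (G xs) (H xs))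
    ap₃ (c , p) (d , q) (e , r) (g , s) =
      comp c (d ∷ e ∷ g ∷ []) , λ xs → e-comp (ea-cons (q xs) (ea-cons (r xs) (ea-cons (s xs) ea-nil))) (p _ _ _)

    ap₄ : ∀ {f F G H K} → Rep₄ f → Rep n F → Rep n G → Rep n H → Rep n K → Rep n (λ xs → f (F xs) (G xs) (H xs) (K xs))
    ap₄ (c , p) (d , q) (e , r) (g , s) (h , t) = comp c (d ∷ e ∷ g ∷ h ∷ []) ,
      λ xs → e-comp (ea-cons (q xs) (ea-cons (r xs) (ea-cons (s xs) (ea-cons (t xs) ea-nil)))) (p _ _ _ _)

    arg : (i : Fin n) → Rep n (λ xs → lookup xs i)
    arg i = proj i , λ xs → e-proj

    con : (k : ℕ) → Rep n (λ _ → k)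
    con zero = zer , λ xs → e-zer
    con (suc k) = comp succ (proj₁ (con k) ∷ []) , λ xs → e-comp (ea-cons (proj₂ (con k) xs) ea-nil) e-succ

  pattern #0 = zero
  pattern #1 = suc zero
  pattern #2 = suc (suc zero)
  pattern #3 = suc (suc (suc zero))

  fn₁ : ∀ {f} → Rep 1 (λ xs → f (lookup xs #0)) → Rep₁ f
  fn₁ (c , p) = c , λ x → p (x ∷ [])

  fn₂ : ∀ {f} → Rep 2 (λ xs → f (lookup xs #0) (lookup xs #1)) → Rep₂ f
  fn₂ (c , p) = c , λ x y → p (x ∷ y ∷ [])

  fn₃ : ∀ {f} → Rep 3 (λ xs → f (lookup xs #0) (lookup xs #1) (lookup xs #2)) → Rep₃ f
  fn₃ (c , p) = c , λ x y z → p (x ∷ y ∷ z ∷ [])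

  fn₄ : ∀ {f} → Rep 4 (λ xs → f (lookup xs #0) (lookup xs #1) (lookup xs #2) (lookup xs #3)) → Rep₄ f
  fn₄ (c , p) = c , λ x y z w → p (x ∷ y ∷ z ∷ w ∷ [])

  rec₁ : ∀ {f h} b → Rep₂ h → f 0 ≡ b → (∀ m → f (suc m) ≡ h m (f m)) → Rep₁ f
  rec₁ {f} {h} b (c , p) e₀ eₛ = prec (proj₁ (con b)) c , go
    where
    go : ∀ m → Eval (prec (proj₁ (con b)) c) (m ∷ []) (f m)
    go zero = subst (Eval _ _) (sym e₀) (e-prec0 (proj₂ (con b) []))
    go (suc m) = subst (Eval _ _) (sym (eₛ m)) (e-precS (go m) (p m (f m)))

  rec₂ : ∀ {f g h} → Rep₁ g → Rep₃ h → (∀ x → f 0 x ≡ g x) → (∀ m x → f (suc m) x ≡ h m (f m x) x) → Rep₂ f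
  rec₂ {f} {g} {h} (d , q) (c , p) e₀ eₛ = prec d c , go
    where
    go : ∀ m x → Eval (prec d c) (m ∷ x ∷ []) (f m x)
    go zero x = subst (Eval _ _) (sym (e₀ x)) (e-prec0 (q x))
    go (suc m) x = subst (Eval _ _) (sym (eₛ m x)) (e-precS (go m x) (p m (f m x) x))

  rec₃ : ∀ {f g h} → Rep₂ g → Rep₄ h → (∀ x y → f 0 x y ≡ g x y) → (∀ m x y → f (suc m) x y ≡ h m (f m x y) x y) → Rep₃ f
  rec₃ {f} {g} {h} (d , q) (c , p) e₀ eₛ = prec d c , go
    where
    go : ∀ m x y → Eval (prec d c) (m ∷ x ∷ y ∷ []) (f m x y)
    go zero x y = subst (Eval _ _) (sym (e₀ x y)) (e-prec0 (q x y))
    go (suc m) x y = subst (Eval _ _) (sym (eₛ m x y)) (e-precS (go m x y) (p m (f m x y) x y))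

  sucʳ : Rep₁ suc
  sucʳ = succ , λ x → e-succ

  addʳ : Rep₂ _+_
  addʳ = rec₂ {h = λ m r x → suc r} (fn₁ (arg #0)) (fn₃ (ap₁ sucʳ (arg #1))) (λ _ → refl) (λ _ _ → refl)

  mulʳ : Rep₂ _*_
  mulʳ = rec₂ {h = λ m r x → x + r} (fn₁ (con 0)) (fn₃ (ap₂ addʳ (arg #2) (arg #1))) (λ _ → refl) (λ _ _ → refl)

  predʳ : Rep₁ pred
  predʳ = rec₁ {h = λ m r → m} 0 (fn₂ (arg #0)) refl (λ _ → refl)

  monusʳ : Rep₂ _∸_
  monusʳ = fn₂ {f = _∸_} (ap₂ {f = λ y x → x ∸ y}
    (rec₂ {h = λ m r x → pred r} (fn₁ (arg #0)) (fn₃ (ap₁ predʳ (arg #1))) (λ _ → refl) (λ m x → sym (pred[m∸n]≡m∸[1+n] x m)))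
    (arg #1) (arg #0))

  pow2ʳ : Rep₁ (2 ^_)
  pow2ʳ = rec₁ {h = λ m r → 2 * r} 1 (fn₂ (ap₂ mulʳ (con 2) (arg #1))) refl (λ _ → refl)

  ifz : ℕ → ℕ → ℕ → ℕ
  ifz zero a b = a
  ifz (suc _) a b = b

  ifzʳ : Rep₃ ifz
  ifzʳ = rec₃ {h = λ m r x y → y} (fn₂ (arg #0)) (fn₄ (arg #3)) (λ _ _ → refl) (λ _ _ _ → refl)

  ifEq : ℕ → ℕ → ℕ → ℕ → ℕ
  ifEq x y a b = if x ≡ᵇ y then a else b

  ifEq-ifz : ∀ x y a b → ifz ((x ∸ y) + (y ∸ x)) a b ≡ ifEq x y a b
  ifEq-ifz zero zero a b = refl
  ifEq-ifz zero (suc y) a b = refl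
  ifEq-ifz (suc x) zero a b = refl
  ifEq-ifz (suc x) (suc y) a b = ifEq-ifz x y a b

  ifEqʳ : Rep₄ ifEq
  ifEqʳ = proj₁ code , λ x y a b → subst (Eval _ _) (ifEq-ifz x y a b) (proj₂ code x y a b)
    where
    code : Rep₄ (λ x y a b → ifz ((x ∸ y) + (y ∸ x)) a b)
    code = fn₄ (ap₃ ifzʳ (ap₂ addʳ (ap₂ monusʳ (arg #0) (arg #1)) (ap₂ monusʳ (arg #1) (arg #0))) (arg #2) (arg #3))

  pairʳ : Rep₂ pair
  pairʳ = fn₂ (ap₂ mulʳ (ap₁ pow2ʳ (arg #0)) (ap₁ sucʳ (ap₂ mulʳ (con 2) (arg #1))))

  par half : ℕ → ℕ
  par zero = 0
  par (suc n) = 1 ∸ par n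
  half zero = 0
  half (suc n) = half n + par n

  strip : ℕ → ℕ
  strip m = ifz (par m) (half m) m

  strips valuation : ℕ → ℕ → ℕ
  strips zero n = n
  strips (suc i) n = strip (strips i n)
  valuation zero n = 0
  valuation (suc i) n = valuation i n + (1 ∸ par (strips i n))

  -- A code 2^x (2y+1) is decoded by its 2-adic valuation and its odd part. As x is at most the
  -- code, that many rounds of halving suffice, and surplus rounds leave an odd number alone.
  fst snd : ℕ → ℕ
  fst n = valuation n n
  snd n = half (strips n n)

  parʳ : Rep₁ par
  parʳ = rec₁ {h = λ m r → 1 ∸ r} 0 (fn₂ (ap₂ monusʳ (con 1) (arg #1))) refl (λ _ → refl)

  halfʳ : Rep₁ half
  halfʳ = rec₁ {h = λ m r → r + par m} 0 (fn₂ (ap₂ addʳ (arg #1) (ap₁ parʳ (arg #0)))) refl (λ _ → refl)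

  stripsʳ : Rep₂ strips
  stripsʳ = rec₂ {h = λ m r x → strip r} (fn₁ (arg #0))
    (fn₃ {f = λ m r x → strip r} (ap₃ ifzʳ (ap₁ parʳ (arg #1)) (ap₁ halfʳ (arg #1)) (arg #1))) (λ _ → refl) (λ _ _ → refl)

  valuationʳ : Rep₂ valuation
  valuationʳ = rec₂ {h = λ m r x → r + (1 ∸ par (strips m x))} (fn₁ (con 0))
    (fn₃ (ap₂ addʳ (arg #1) (ap₂ monusʳ (con 1) (ap₁ parʳ (ap₂ stripsʳ (arg #0) (arg #2)))))) (λ _ → refl) (λ _ _ → refl)

  fstʳ : Rep₁ fst
  fstʳ = fn₁ (ap₂ valuationʳ (arg #0) (arg #0))

  sndʳ : Rep₁ snd
  sndʳ = fn₁ (ap₁ halfʳ (ap₂ stripsʳ (arg #0) (arg #0)))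

  private
    par-half : ∀ y → par (y + y) ≡ 0 × half (y + y) ≡ y
    par-half zero = refl , refl
    par-half (suc y) rewrite +-suc y y with par-half y
    ... | p , h rewrite p | h = refl , trans (+-assoc y 0 1) (+-comm y 1)

    double : ∀ m → 2 * m ≡ m + m
    double m = cong (m +_) (+-identityʳ m)

    par-even : ∀ m → par (2 * m) ≡ 0
    par-even m = trans (cong par (double m)) (proj₁ (par-half m))

    half-even : ∀ m → half (2 * m) ≡ m
    half-even m = trans (cong half (double m)) (proj₂ (par-half m))

    par-odd : ∀ m → par (suc (2 * m)) ≡ 1
    par-odd m = cong (1 ∸_) (par-even m)

    half-odd : ∀ m → half (suc (2 * m)) ≡ m
    half-odd m = trans (cong₂ _+_ (half-even m) (par-even m)) (+-identityʳ m)

    strip-even : ∀ m → strip (2 * m) ≡ m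
    strip-even m rewrite par-even m = half-even m

    strip-odd : ∀ m → strip (suc (2 * m)) ≡ suc (2 * m)
    strip-odd m rewrite par-odd m = refl

    strips-shift : ∀ i n → strips (suc i) n ≡ strips i (strip n)
    strips-shift zero n = refl
    strips-shift (suc i) n = cong strip (strips-shift i n)

    valuation-shift : ∀ i n → valuation (suc i) n ≡ (1 ∸ par n) + valuation i (strip n)
    valuation-shift zero n = +-comm 0 (1 ∸ par n)
    valuation-shift (suc i) n = trans (cong₂ (λ a b → a + (1 ∸ par b)) (valuation-shift i n) (strips-shift i n))
      (+-assoc (1 ∸ par n) (valuation i (strip n)) _)

    pair-suc : ∀ x y → pair (suc x) y ≡ 2 * pair x y
    pair-suc x y = *-assoc 2 (2 ^ x) (suc (2 * y))

    pair-zero : ∀ y → pair 0 y ≡ suc (2 * y)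
    pair-zero y = *-identityˡ (suc (2 * y))

    strips-pair : ∀ x k y → strips (x + k) (pair x y) ≡ suc (2 * y)
    strips-pair zero zero y = pair-zero y
    strips-pair zero (suc k) y = trans (cong strip (strips-pair zero k y)) (strip-odd y)
    strips-pair (suc x) k y = trans (strips-shift (x + k) (pair (suc x) y))
      (trans (cong (λ z → strips (x + k) (strip z)) (pair-suc x y))
      (trans (cong (strips (x + k)) (strip-even (pair x y))) (strips-pair x k y)))

    valuation-pair : ∀ x k y → valuation (x + k) (pair x y) ≡ x
    valuation-pair zero zero y = refl
    valuation-pair zero (suc k) y =
      cong₂ (λ a b → a + (1 ∸ b)) (valuation-pair zero k y) (trans (cong par (strips-pair zero k y)) (par-odd y))
    valuation-pair (suc x) k y = trans (valuation-shift (x + k) (pair (suc x) y))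
      (trans (cong (λ z → (1 ∸ par z) + valuation (x + k) (strip z)) (pair-suc x y))
      (cong₂ (λ a b → (1 ∸ a) + b) (par-even (pair x y))
        (trans (cong (valuation (x + k)) (strip-even (pair x y))) (valuation-pair x k y))))

    x≤pair : ∀ x y → x ≤ pair x y
    x≤pair zero y = z≤n
    x≤pair (suc x) y = subst (suc x ≤_) (sym (trans (pair-suc x y) (double (pair x y))))
      (+-mono-≤ (pos x) (x≤pair x y))
      where
      pos : ∀ x → 1 ≤ pair x y
      pos zero = subst (1 ≤_) (sym (pair-zero y)) (s≤s z≤n)
      pos (suc x) = subst (1 ≤_) (sym (trans (pair-suc x y) (double (pair x y)))) (≤-trans (pos x) (m≤m+n _ _))

  abstract
    fst-pair : ∀ x y → fst (pair x y) ≡ x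
    fst-pair x y = trans (cong (λ i → valuation i (pair x y)) (sym (m+[n∸m]≡n (x≤pair x y)))) (valuation-pair x _ y)

    snd-pair : ∀ x y → snd (pair x y) ≡ y
    snd-pair x y = trans (cong (λ i → half (strips i (pair x y))) (sym (m+[n∸m]≡n (x≤pair x y))))
      (trans (cong half (strips-pair x (pair x y ∸ x) y)) (half-odd y))

  drops : ℕ → ℕ → ℕ
  drops zero n = n
  drops (suc i) n = snd (pred (drops i n))

  nth : ℕ → ℕ → ℕ
  nth n i = fst (pred (drops i n))

  nthʳ : Rep₂ nth
  nthʳ = fn₂ (ap₁ fstʳ (ap₁ predʳ (ap₂ dropsʳ (arg #1) (arg #0))))
    where
    dropsʳ : Rep₂ drops
    dropsʳ = rec₂ {h = λ m r x → snd (pred r)} (fn₁ (arg #0)) (fn₃ (ap₁ sndʳ (ap₁ predʳ (arg #1)))) (λ _ → refl) (λ _ _ → refl)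

  private
    drops-shift : ∀ i n → drops (suc i) n ≡ drops i (snd (pred n))
    drops-shift zero n = refl
    drops-shift (suc i) n = cong (λ z → snd (pred z)) (drops-shift i n)

  nth-zero : ∀ x xs → nth (encList (x ∷ xs)) 0 ≡ x
  nth-zero x xs = fst-pair x (encList xs)

  nth-suc : ∀ x xs i → nth (encList (x ∷ xs)) (suc i) ≡ nth (encList xs) i
  nth-suc x xs i = cong (λ z → fst (pred z)) (trans (drops-shift i (encList (x ∷ xs))) (cong (drops i) (snd-pair x (encList xs))))

  -- Ports of the constructed graph have the form 3c + s, with a type c of vertices and a
  -- displacement s of blocks.
  rem3 quot3 : ℕ → ℕ
  rem3 zero = 0
  rem3 (suc n) = ifEq (rem3 n) 2 0 (suc (rem3 n))
  quot3 zero = 0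
  quot3 (suc n) = ifEq (rem3 n) 2 (suc (quot3 n)) (quot3 n)

  rem3ʳ : Rep₁ rem3
  rem3ʳ = rec₁ {h = λ m r → ifEq r 2 0 (suc r)} 0 (fn₂ (ap₄ ifEqʳ (arg #1) (con 2) (con 0) (ap₁ sucʳ (arg #1)))) refl (λ _ → refl)

  quot3ʳ : Rep₁ quot3
  quot3ʳ = rec₁ {h = λ m r → ifEq (rem3 m) 2 (suc r) r} 0
    (fn₂ (ap₄ ifEqʳ (ap₁ rem3ʳ (arg #0)) (con 2) (ap₁ sucʳ (arg #1)) (arg #1))) refl (λ _ → refl)

  divmod3 : ∀ c {s} → s ≤ 2 → rem3 (3 * c + s) ≡ s × quot3 (3 * c + s) ≡ c
  divmod3 c {s} s≤2 = subst (λ z → rem3 (z + s) ≡ s × quot3 (z + s) ≡ c) (*-comm c 3) (go c s≤2)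
    where
    base : ∀ z {c} → rem3 z ≡ 0 → quot3 z ≡ c → ∀ {s} → s ≤ 2 → rem3 (s + z) ≡ s × quot3 (s + z) ≡ c
    base z r q z≤n = r , q
    base z r q (s≤s z≤n) rewrite r | q = refl , refl
    base z r q (s≤s (s≤s z≤n)) rewrite r | q = refl , refl
    three : ∀ z {c} → rem3 z ≡ 0 → quot3 z ≡ c → rem3 (3 + z) ≡ 0 × quot3 (3 + z) ≡ suc c
    three z r q rewrite r | q = refl , refl
    mult : ∀ c → rem3 (c * 3) ≡ 0 × quot3 (c * 3) ≡ c
    mult zero = refl , refl
    mult (suc c) = three (c * 3) (proj₁ (mult c)) (proj₂ (mult c))
    go : ∀ c {s} → s ≤ 2 → rem3 (c * 3 + s) ≡ s × quot3 (c * 3 + s) ≡ c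
    go c {s} s≤2 rewrite +-comm (c * 3) s = base (c * 3) (proj₁ (mult c)) (proj₂ (mult c)) s≤2

-- A program that simulates the agent on the graph coded by ℓ

module AgentSimulation where

  open import Defs
  open RecursiveFunctions
  open import Data.Fin using (zero; suc)
  open import Data.Nat using (ℕ; zero; suc; _+_; _*_; _∸_; pred; _<_; _≤_)
  open import Data.Nat.Properties using (≤-refl)
  open import Data.Product using (Σ; _×_; _,_; proj₁; proj₂)
  open import Data.Vec using (Vec; []; _∷_)
  open import Relation.Binary.PropositionalEquality using (_≡_; cong; subst; sym; trans)

  -- Blocks 0 and 1, the last two blocks, and all the others are told apart by their labels.
  kap : ℕ → ℕ → ℕ
  kap ℓ b = ifEq b 0 0 (ifEq b 1 1 (ifEq ℓ b 4 (ifEq ℓ (suc b) 3 2)))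

  -- The coded list starts with the number of types of vertices; it continues with the labels, one
  -- row of types for each of the five kinds of blocks. The 4 removed here is added to the code so
  -- that there are at least five blocks.
  tab : ℕ → ℕ → ℕ
  tab ℓ i = nth (ℓ ∸ 4) i

  lab : ℕ → ℕ → ℕ → ℕ
  lab ℓ c b = tab ℓ (suc (kap ℓ b * tab ℓ 0 + c))

  state : ℕ → ℕ → ℕ → ℕ → ℕ
  state c b h g = pair c (pair b (pair h g))

  typ blk hist flag : ℕ → ℕ
  typ s = fst s
  blk s = fst (snd s)
  hist s = fst (snd (snd s))
  flag s = snd (snd (snd s))

  -- The agent starts at the vertex whose type has number 0, in block 0, with entry port 0, that is,
  -- none.
  init : ℕ → ℕ
  init ℓ = state 0 0 (suc (pair (pair (lab ℓ 0 0) 0) 0)) 0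

  arrive : ℕ → ℕ → ℕ → ℕ → ℕ → ℕ
  arrive ℓ c b e h = state c b (suc (pair (pair (lab ℓ c b) e) h)) 0

  -- Along a port 3c + s the agent arrives at type c in block b + s - 1, and the same edge has
  -- displacement 2 - s when seen from there. A halt raises the flag and keeps the history, so that
  -- the agent, consulted again, halts again.
  step : ℕ → ℕ → ℕ → ℕ
  step ℓ s a = ifz a (state (typ s) (blk s) (hist s) 1)
    (arrive ℓ (quot3 (pred a)) ((blk s + rem3 (pred a)) ∸ 1) (suc (3 * typ s + (2 ∸ rem3 (pred a)))) (hist s))

  private
    kapʳ : Rep₂ kap
    kapʳ = fn₂ (ap₄ ifEqʳ (arg #1) (con 0) (con 0) (ap₄ ifEqʳ (arg #1) (con 1) (con 1)
      (ap₄ ifEqʳ (arg #0) (arg #1) (con 4) (ap₄ ifEqʳ (arg #0) (ap₁ sucʳ (arg #1)) (con 3) (con 2)))))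

    tabʳ : Rep₂ tab
    tabʳ = fn₂ (ap₂ nthʳ (ap₂ monusʳ (arg #0) (con 4)) (arg #1))

    labʳ : Rep₃ lab
    labʳ = fn₃ (ap₂ tabʳ (arg #0) (ap₁ sucʳ (ap₂ addʳ
      (ap₂ mulʳ (ap₂ kapʳ (arg #0) (arg #2)) (ap₂ tabʳ (arg #0) (con 0))) (arg #1))))

    stateʳ : Rep₄ state
    stateʳ = fn₄ (ap₂ pairʳ (arg #0) (ap₂ pairʳ (arg #1) (ap₂ pairʳ (arg #2) (arg #3))))

    typʳ : Rep₁ typ
    typʳ = fn₁ (ap₁ fstʳ (arg #0))
    blkʳ : Rep₁ blk
    blkʳ = fn₁ (ap₁ fstʳ (ap₁ sndʳ (arg #0)))
    histʳ : Rep₁ hist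
    histʳ = fn₁ (ap₁ fstʳ (ap₁ sndʳ (ap₁ sndʳ (arg #0))))
    flagʳ : Rep₁ flag
    flagʳ = fn₁ (ap₁ sndʳ (ap₁ sndʳ (ap₁ sndʳ (arg #0))))

    obsʳ : ∀ {n} {L C B E H : Vec ℕ n → ℕ} → Rep n L → Rep n C → Rep n B → Rep n E → Rep n H →
      Rep n (λ xs → arrive (L xs) (C xs) (B xs) (E xs) (H xs))
    obsʳ L C B E H = ap₄ stateʳ C B (ap₁ sucʳ (ap₂ pairʳ (ap₂ pairʳ (ap₃ labʳ L C B) E) H)) (con 0)

    initʳ : Rep₁ init
    initʳ = fn₁ (obsʳ (arg #0) (con 0) (con 0) (con 0) (con 0))

    stepʳ : Rep₃ step
    stepʳ = fn₃ (ap₃ ifzʳ (arg #2)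
      (ap₄ stateʳ (ap₁ typʳ (arg #1)) (ap₁ blkʳ (arg #1)) (ap₁ histʳ (arg #1)) (con 1))
      (obsʳ (arg #0) (ap₁ quot3ʳ (ap₁ predʳ (arg #2)))
        (ap₂ monusʳ (ap₂ addʳ (ap₁ blkʳ (arg #1)) (ap₁ rem3ʳ (ap₁ predʳ (arg #2)))) (con 1))
        (ap₁ sucʳ (ap₂ addʳ (ap₂ mulʳ (con 3) (ap₁ typʳ (arg #1))) (ap₂ monusʳ (con 2) (ap₁ rem3ʳ (ap₁ predʳ (arg #2))))))
        (ap₁ histʳ (arg #1))))

  abstract
    stepᶜ : Rep₃ step
    stepᶜ = stepʳ
    initᶜ : Rep₁ init
    initᶜ = initʳ
    histᶜ : Rep₁ hist
    histᶜ = histʳ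
    flagᶜ : Rep₁ flag
    flagᶜ = flagʳ
    tabᶜ : Rep₂ tab
    tabᶜ = tabʳ

    typ-state : ∀ c b h g → typ (state c b h g) ≡ c
    typ-state c b h g = fst-pair c (pair b (pair h g))
    blk-state : ∀ c b h g → blk (state c b h g) ≡ b
    blk-state c b h g = trans (cong fst (snd-pair c (pair b (pair h g)))) (fst-pair b (pair h g))
    tail-state : ∀ c b h g → snd (snd (state c b h g)) ≡ pair h g
    tail-state c b h g = trans (cong snd (snd-pair c (pair b (pair h g)))) (snd-pair b (pair h g))
    hist-state : ∀ c b h g → hist (state c b h g) ≡ h
    hist-state c b h g = trans (cong fst (tail-state c b h g)) (fst-pair h g)
    flag-state : ∀ c b h g → flag (state c b h g) ≡ g
    flag-state c b h g = trans (cong snd (tail-state c b h g)) (snd-pair h g)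

  module Simulator (A : Agent) (f : ℕ → ℕ) (f-computable : Computable f) where

    -- The product is the number of vertices, types times blocks. One round more than `f` of it is
    -- made, so that a halt after exactly that many steps still raises the flag.
    rounds : ℕ → ℕ
    rounds ℓ = suc (f (tab ℓ 0 * suc ℓ))

    private
      roundsʳ : Rep₁ rounds
      roundsʳ = fn₁ (ap₁ sucʳ (ap₁ f-computable (ap₂ mulʳ (ap₂ tabᶜ (arg #0) (con 0)) (ap₁ sucʳ (arg #0)))))

      body : PR 3
      body = comp (proj₁ stepᶜ) (proj #2 ∷ proj #1 ∷ comp A (comp (proj₁ histᶜ) (proj #1 ∷ []) ∷ []) ∷ [])

      loop : PR 2
      loop = prec (proj₁ initᶜ) body

    program : PR 1
    program = comp (proj₁ flagᶜ) (comp loop (proj₁ roundsʳ ∷ proj #0 ∷ []) ∷ [])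

    -- The agent is a partial function, so the states are supplied together with a decision of the
    -- agent at each of them.
    program-eval : ∀ ℓ (s : ℕ → ℕ) → s 0 ≡ init ℓ →
      (∀ i → i < rounds ℓ → Σ ℕ λ a → Eval A (hist (s i) ∷ []) a × s (suc i) ≡ step ℓ (s i) a) →
      Eval program (ℓ ∷ []) (flag (s (rounds ℓ)))
    program-eval ℓ s s₀ sₛ = e-comp (ea-cons (e-comp
        (ea-cons (proj₂ roundsʳ ℓ) (ea-cons e-proj ea-nil)) (go (rounds ℓ) ≤-refl)) ea-nil) (proj₂ flagᶜ _)
      where
      go : ∀ i → i ≤ rounds ℓ → Eval loop (i ∷ ℓ ∷ []) (s i)
      go zero _ = subst (Eval loop _) (sym s₀) (e-prec0 (proj₂ initᶜ ℓ))
      go (suc i) i<N with sₛ i i<N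
      ... | a , d , eq = subst (Eval loop _) (sym eq) (e-precS (go i (Data.Nat.Properties.<⇒≤ i<N))
        (e-comp (ea-cons e-proj (ea-cons e-proj (ea-cons
          (e-comp (ea-cons (e-comp (ea-cons e-proj ea-nil) (proj₂ histᶜ (s i))) ea-nil) d) ea-nil)))
          (proj₂ stepᶜ ℓ (s i) a)))

-- Compiling recursive functions to machines acting on a single number

module CounterMachines where

  open import Defs
  open import Data.Empty using (⊥-elim)
  open import Data.Fin using (Fin; zero; suc)
  open import Data.List using (List; []; _∷_; _++_; length)
  open import Data.List.Properties using (length-++; ++-assoc)
  open import Data.Maybe using (Maybe; just; nothing)
  open import Data.Nat using (ℕ; zero; suc; _+_; _*_; _^_; _≤_; _<_; z≤n; s≤s)
  open import Data.Nat.Properties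
  open import Data.Nat.Divisibility using (_∣_; ∣-trans; m∣m*n; n∣m*n; ∣1⇒≡1; ∣m+n∣m⇒∣n)
  open import Data.Nat.Coprimality using (Coprime; coprime-divisor) renaming (sym to coprime-sym)
  open import Data.Product using (Σ; _×_; _,_)
  open import Data.Sum using (_⊎_; inj₁; inj₂)
  open import Data.Unit using (⊤)
  open import Data.Vec using (Vec; []; _∷_; lookup)
  open import Data.Vec.Functional using () renaming (_∷_ to _∷ᶠ_)
  open import Function using (_∘_)
  open import Relation.Binary.Construct.Closure.ReflexiveTransitive using (Star; ε; _◅_; _◅◅_)
  open import Relation.Binary.Definitions using (tri<; tri≈; tri>)
  open import Relation.Binary.PropositionalEquality using (_≡_; _≢_; _≗_; refl; cong; cong₂; subst; subst₂; sym; trans)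
  open import Relation.Nullary using (¬_; yes; no)

  Regs : ℕ → Set
  Regs m = Fin m → ℕ

  bump : ∀ {m} → Fin m → ℕ → Regs m → Regs m
  bump zero a σ zero = a + σ zero
  bump zero a σ (suc j) = σ (suc j)
  bump (suc i) a σ zero = σ zero
  bump (suc i) a σ (suc j) = bump i a (σ ∘ suc) j

  reset : ∀ {m} → Fin m → Regs m → Regs m
  reset zero σ zero = 0
  reset zero σ (suc j) = σ (suc j)
  reset (suc i) σ zero = σ zero
  reset (suc i) σ (suc j) = reset i (σ ∘ suc) j

  data Prog : ℕ → Set where
    skip : ∀ {m} → Prog m
    inc : ∀ {m} → Fin m → Prog m
    loop : ∀ {m} → Fin m → Prog m → Prog m
    _⨟_ : ∀ {m} → Prog m → Prog m → Prog m
    local : ∀ {m} → Prog (suc m) → Prog m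

  infixr 5 _⨟_
  infix 4 _⊢_⇓_

  -- `loop i` decrements register `i` and runs its body until the register is empty. `conv` stands
  -- in for extensionality, registers being functions. A local register has to be returned empty:
  -- with exponent 0 it does not affect the number that codes the registers.
  data _⊢_⇓_ : ∀ {m} → Prog m → Regs m → Regs m → Set where
    skip : ∀ {m} {σ : Regs m} → skip ⊢ σ ⇓ σ
    inc : ∀ {m i} {σ : Regs m} → inc i ⊢ σ ⇓ bump i 1 σ
    exit : ∀ {m i P} {σ : Regs m} → σ i ≡ 0 → loop i P ⊢ σ ⇓ σ
    again : ∀ {m i P} {σ σ' σ'' : Regs m} → P ⊢ σ ⇓ σ' → loop i P ⊢ σ' ⇓ σ'' → loop i P ⊢ bump i 1 σ ⇓ σ''
    _⨟_ : ∀ {m P P'} {σ σ' σ'' : Regs m} → P ⊢ σ ⇓ σ' → P' ⊢ σ' ⇓ σ'' → (P ⨟ P') ⊢ σ ⇓ σ''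
    local : ∀ {m P} {σ σ' : Regs m} → P ⊢ 0 ∷ᶠ σ ⇓ 0 ∷ᶠ σ' → local P ⊢ σ ⇓ σ'
    conv : ∀ {m P} {σ₀ σ σ' σ₁ : Regs m} → σ₀ ≗ σ → P ⊢ σ ⇓ σ' → σ' ≗ σ₁ → P ⊢ σ₀ ⇓ σ₁

  ∷-cong : ∀ {m a b} {σ τ : Regs m} → a ≡ b → σ ≗ τ → (a ∷ᶠ σ) ≗ (b ∷ᶠ τ)
  ∷-cong e f zero = e
  ∷-cong e f (suc i) = f i

  private
    rfl : ∀ {m} {σ : Regs m} → σ ≗ σ
    rfl _ = refl

    bump-+ : ∀ {m} (i : Fin m) a b σ → bump i (a + b) σ ≗ bump i a (bump i b σ)
    bump-+ zero a b σ zero = +-assoc a b _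
    bump-+ zero a b σ (suc j) = refl
    bump-+ (suc i) a b σ zero = refl
    bump-+ (suc i) a b σ (suc j) = bump-+ i a b (σ ∘ suc) j

    bump-0 : ∀ {m} (i : Fin m) σ → bump i 0 σ ≗ σ
    bump-0 zero σ zero = refl
    bump-0 zero σ (suc j) = refl
    bump-0 (suc i) σ zero = refl
    bump-0 (suc i) σ (suc j) = bump-0 i (σ ∘ suc) j

    bump-reset : ∀ {m} (i : Fin m) σ → σ ≗ bump i (σ i) (reset i σ)
    bump-reset zero σ zero = sym (+-identityʳ _)
    bump-reset zero σ (suc j) = refl
    bump-reset (suc i) σ zero = refl
    bump-reset (suc i) σ (suc j) = bump-reset i (σ ∘ suc) j

    reset-0 : ∀ {m} (i : Fin m) σ → reset i σ i ≡ 0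
    reset-0 zero σ = refl
    reset-0 (suc i) σ = reset-0 i (σ ∘ suc)

    bump-∷ : ∀ {m} {k a} {σ : Regs m} → (a + k ∷ᶠ σ) ≗ bump zero a (k ∷ᶠ σ)
    bump-∷ zero = refl
    bump-∷ (suc j) = refl

    bump-there : ∀ {m} {i : Fin m} {k a} {σ : Regs m} → bump (suc i) a (k ∷ᶠ σ) ≗ (k ∷ᶠ bump i a σ)
    bump-there zero = refl
    bump-there (suc j) = refl

    again₀ : ∀ {m P k} {σ : Regs m} {σ' σ''} → P ⊢ k ∷ᶠ σ ⇓ σ' → loop zero P ⊢ σ' ⇓ σ'' → loop zero P ⊢ suc k ∷ᶠ σ ⇓ σ''
    again₀ {k = k} d e = conv (bump-∷ {k = k} {a = 1}) (again d e) rfl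

    again-i : ∀ {m P k} (i : Fin m) {σ : Regs m} {σ' σ''} → P ⊢ bump i k σ ⇓ σ' → loop i P ⊢ σ' ⇓ σ'' →
      loop i P ⊢ bump i (suc k) σ ⇓ σ''
    again-i {k = k} i {σ} d e = conv (bump-+ i 1 k σ) (again d e) rfl

  inc₀ : ∀ {m k} {σ : Regs m} → inc zero ⊢ k ∷ᶠ σ ⇓ suc k ∷ᶠ σ
  inc₀ = conv rfl inc (λ j → sym (bump-∷ j))

  inc₁ : ∀ {m a k} {σ : Regs m} → inc (suc zero) ⊢ a ∷ᶠ k ∷ᶠ σ ⇓ a ∷ᶠ suc k ∷ᶠ σ
  inc₁ = conv rfl inc (λ { zero → refl ; (suc zero) → refl ; (suc (suc j)) → refl })

  clear : ∀ {m} → Fin m → Prog m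
  clear i = loop i skip

  private
    clear-bump : ∀ {m} (i : Fin m) k {σ} → σ i ≡ 0 → clear i ⊢ bump i k σ ⇓ σ
    clear-bump i zero {σ} e = conv (bump-0 i σ) (exit e) rfl
    clear-bump i (suc k) {σ} e = again-i i skip (clear-bump i k e)

  clear-run : ∀ {m} (i : Fin m) {σ} → clear i ⊢ σ ⇓ reset i σ
  clear-run i {σ} = conv (bump-reset i σ) (clear-bump i (σ i) (reset-0 i σ)) rfl

  clear₀ : ∀ {m a} {σ : Regs m} → clear zero ⊢ a ∷ᶠ σ ⇓ 0 ∷ᶠ σ
  clear₀ = conv rfl (clear-run zero) (λ { zero → refl ; (suc j) → refl })

  move : ∀ {m} → Fin m → Prog (suc m)
  move i = loop zero (inc (suc i))

  move-run : ∀ {m} (i : Fin m) a {σ} → move i ⊢ a ∷ᶠ σ ⇓ 0 ∷ᶠ bump i a σ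
  move-run i zero {σ} = conv rfl (exit refl) (∷-cong refl (λ j → sym (bump-0 i σ j)))
  move-run i (suc a) {σ} = again₀ (conv rfl inc bump-there)
    (conv rfl (move-run i a) (∷-cong refl (λ j → trans (sym (bump-+ i a 1 σ j)) (cong (λ z → bump i z σ j) (+-comm a 1)))))

  -- Reading a register empties it, so a local register takes a second copy, from which the first is
  -- restored.
  copy : ∀ {m} → Fin m → Prog (suc m)
  copy i = local (loop (suc (suc i)) (inc (suc zero) ⨟ inc zero) ⨟ move (suc i))

  copy-run : ∀ {m} (i : Fin m) a {σ} → copy i ⊢ a ∷ᶠ σ ⇓ (σ i + a) ∷ᶠ σ
  copy-run {m} i a {σ} = local (conv (∷-cong refl (∷-cong refl (bump-reset i σ))) (first (σ i) 0 a) rfl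
    ⨟ conv rfl (move-run (suc i) (σ i + 0)) (∷-cong refl fixup))
    where
    σ₀ = reset i σ
    first : ∀ k t a → loop (suc (suc i)) (inc (suc zero) ⨟ inc zero) ⊢ t ∷ᶠ a ∷ᶠ bump i k σ₀ ⇓ (k + t) ∷ᶠ (k + a) ∷ᶠ σ₀
    first zero t a = conv (∷-cong refl (∷-cong refl (bump-0 i σ₀))) (exit (reset-0 i σ)) rfl
    first (suc k) t a = conv split (again-i (suc (suc i)) {σ = t ∷ᶠ a ∷ᶠ σ₀} (conv unsplit (inc₁ ⨟ inc₀) rfl) (first k (suc t) (suc a)))
        (∷-cong (+-suc k t) (∷-cong (+-suc k a) rfl))
      where
      split : (t ∷ᶠ a ∷ᶠ bump i (suc k) σ₀) ≗ bump (suc (suc i)) (suc k) (t ∷ᶠ a ∷ᶠ σ₀)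
      split zero = refl
      split (suc zero) = refl
      split (suc (suc j)) = refl
      unsplit : bump (suc (suc i)) k (t ∷ᶠ a ∷ᶠ σ₀) ≗ (t ∷ᶠ a ∷ᶠ bump i k σ₀)
      unsplit zero = refl
      unsplit (suc zero) = refl
      unsplit (suc (suc j)) = refl
    fixup : bump (suc i) (σ i + 0) ((σ i + a) ∷ᶠ σ₀) ≗ ((σ i + a) ∷ᶠ σ)
    fixup zero = refl
    fixup (suc j) = trans (cong (λ z → bump i z σ₀ j) (+-identityʳ (σ i))) (sym (bump-reset i σ j))

  plus : ℕ → ℕ → ℕ
  plus zero m = m
  plus (suc k) m = plus k (suc m)

  wk : ∀ k {m} → Fin m → Fin (plus k m)
  wk zero i = i
  wk (suc k) i = wk k (suc i)

  res : ∀ {k m} → Fin k → Fin (plus k m)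
  res {suc k} zero = wk k zero
  res {suc k} (suc j) = res {k} j

  push : ∀ {k m} → Vec ℕ k → Regs m → Regs (plus k m)
  push [] σ = σ
  push (y ∷ ys) σ = push ys (y ∷ᶠ σ)

  private
    push-cong : ∀ {k m} (ys : Vec ℕ k) {σ τ : Regs m} → σ ≗ τ → push ys σ ≗ push ys τ
    push-cong [] f = f
    push-cong (y ∷ ys) f = push-cong ys (∷-cong refl f)

    push-wk : ∀ {k m} (ys : Vec ℕ k) {σ : Regs m} i → push ys σ (wk k i) ≡ σ i
    push-wk [] i = refl
    push-wk (y ∷ ys) i = push-wk ys (suc i)

    push-res : ∀ {k m} (ys : Vec ℕ k) {σ : Regs m} j → push ys σ (res {k} j) ≡ lookup ys j
    push-res (y ∷ ys) zero = push-wk ys zero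
    push-res (y ∷ ys) (suc j) = push-res ys j

    bump-wk : ∀ {k m} (ys : Vec ℕ k) (i : Fin m) a σ → bump (wk k i) a (push ys σ) ≗ push ys (bump i a σ)
    bump-wk [] i a σ j = refl
    bump-wk (y ∷ ys) i a σ j = trans (bump-wk ys (suc i) a (y ∷ᶠ σ) j) (push-cong ys bump-there j)

  mutual
    compile : ∀ {n m} → PR n → (Fin n → Fin m) → Prog (suc m)
    compile zer ins = skip
    compile succ ins = copy (ins zero) ⨟ inc zero
    compile (proj i) ins = copy (ins i)
    compile (comp {k} g hs) ins = compiles hs (suc ∘ ins) (local (compile g (res {k}) ⨟ move (wk k zero)))
    compile (prec g h) ins = compile g (ins ∘ suc)
      ⨟ local (local (copy (suc (suc (ins zero))) ⨟ recurse h ins) ⨟ clear zero)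
    -- The raised flag keeps the search going: a nonzero value raises it anew and advances the
    -- candidate, a zero value leaves it down.
    compile (mu f) ins = local (inc zero ⨟ search f ins)

    -- registers: remaining rounds, index, accumulator
    recurse : ∀ {n m} → PR (suc (suc n)) → (Fin (suc n) → Fin m) → Prog (suc (suc (suc m)))
    recurse h ins = loop zero (local (compile h (suc zero ∷ᶠ suc (suc zero) ∷ᶠ λ j → suc (suc (suc (ins (suc j)))))
      ⨟ clear (suc (suc (suc zero))) ⨟ move (suc (suc zero))) ⨟ inc (suc zero))

    -- registers: flag, candidate
    search : ∀ {n m} → PR (suc n) → (Fin n → Fin m) → Prog (suc (suc m))
    search f ins = loop zero (local (compile f (suc zero ∷ᶠ λ j → suc (suc (ins j)))
      ⨟ loop zero (clear zero ⨟ inc (suc (suc zero)) ⨟ inc (suc zero))))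

    compiles : ∀ {k n m} → Vec (PR n) k → (Fin n → Fin m) → Prog (plus k m) → Prog m
    compiles [] ins P = P
    compiles (h ∷ hs) ins P = local (compile h ins ⨟ compiles hs (suc ∘ ins) P ⨟ clear zero)

  mutual
    compile-run : ∀ {n m} {F : PR n} {xs y} → Eval F xs y → (ins : Fin n → Fin m) {σ : Regs m} →
      (∀ i → σ (ins i) ≡ lookup xs i) → compile F ins ⊢ 0 ∷ᶠ σ ⇓ y ∷ᶠ σ
    compile-run e-zer ins r = skip
    compile-run (e-succ {x}) ins {σ} r = copy-run (ins zero) 0
      ⨟ conv rfl inc₀ (∷-cong (cong suc (trans (+-identityʳ _) (r zero))) rfl)
    compile-run (e-proj {i = i}) ins {σ} r = conv rfl (copy-run (ins i) 0) (∷-cong (trans (+-identityʳ _) (r i)) rfl)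
    compile-run {m = m} (e-comp {k} {g = g} {ys = ys} {y = y} ds d) ins {σ} r = compiles-run ds (suc ∘ ins) r
      (local (compile-run d (res {k}) (push-res ys) ⨟ conv rfl (move-run (wk k zero) y)
        (∷-cong refl (λ j → trans (bump-wk ys zero y (0 ∷ᶠ σ) j)
          (push-cong ys (λ { zero → +-identityʳ y ; (suc i) → refl }) j)))))
    compile-run (e-prec0 {g = g} {h} {xs} {y} d) ins {σ} r = compile-run d (ins ∘ suc) (r ∘ suc)
      ⨟ local (local (conv rfl (copy-run (suc (suc (ins zero))) 0) (∷-cong (trans (+-identityʳ _) (r zero)) rfl) ⨟ exit refl) ⨟ clear₀)
    compile-run (e-precS {m = m} {y = y} d e) ins {σ} r with recurse-run (e-precS d e) ins {σ} (r ∘ suc) {k = 0} (exit refl)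
    ... | r₀ , d₀ , run = compile-run d₀ (ins ∘ suc) (r ∘ suc)
      ⨟ local (local (conv rfl (copy-run (suc (suc (ins zero))) 0) (∷-cong (trans (+-identityʳ _) (r zero)) rfl)
        ⨟ conv (∷-cong (sym (+-identityʳ (suc m))) rfl) run rfl) ⨟ clear₀)
    compile-run (e-mu {f = f} {xs} {y} d e) ins {σ} r = local (inc₀ ⨟ search-run y 0 (+-identityʳ y))
      where
      reads : ∀ {k z} i → (k ∷ᶠ z ∷ᶠ σ) ((suc zero ∷ᶠ λ j → suc (suc (ins j))) i) ≡ lookup (z ∷ xs) i
      reads zero = refl
      reads (suc i) = r i
      search-run : ∀ k z → k + z ≡ y → search f ins ⊢ 1 ∷ᶠ z ∷ᶠ σ ⇓ 0 ∷ᶠ y ∷ᶠ σ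
      search-run zero z refl = again₀ (local (compile-run d _ reads ⨟ exit refl)) (exit refl)
      search-run (suc k) z eq with e z (subst (z <_) eq (s≤s (m≤n+m z k)))
      ... | v , d' = again₀ (local (compile-run d' _ reads ⨟ again₀ (clear₀
          ⨟ conv rfl inc (λ { zero → refl ; (suc zero) → refl ; (suc (suc zero)) → refl ; (suc (suc (suc j))) → refl })
          ⨟ inc₁) (exit refl))) (search-run k (suc z) (trans (+-suc k z) eq))

    -- A derivation for `prec` has its base innermost, whereas the loop starts from the base. The
    -- rest of the run is therefore passed down as a continuation and extended by one round at every
    -- level.
    recurse-run : ∀ {n m} {g : PR n} {h xs i y} → Eval (prec g h) (i ∷ xs) y → (ins : Fin (suc n) → Fin m) {σ : Regs m} →
      (∀ j → σ (ins (suc j)) ≡ lookup xs j) → ∀ {k ρ} → recurse h ins ⊢ k ∷ᶠ i ∷ᶠ y ∷ᶠ σ ⇓ ρ →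
      Σ ℕ λ r₀ → Eval g xs r₀ × (recurse h ins ⊢ (i + k) ∷ᶠ 0 ∷ᶠ r₀ ∷ᶠ σ ⇓ ρ)
    recurse-run (e-prec0 d) ins r rest = _ , d , rest
    recurse-run {h = h} {xs} (e-precS {m = i} {r = q} {y} d e) ins {σ} r {k} rest with recurse-run d ins {σ} r {k = suc k}
      (again₀ (local (compile-run e _ reads
        ⨟ conv rfl (clear-run (suc (suc (suc zero)))) (λ { zero → refl ; (suc zero) → refl ; (suc (suc zero)) → refl
            ; (suc (suc (suc zero))) → refl ; (suc (suc (suc (suc j)))) → refl })
        ⨟ conv rfl (move-run (suc (suc zero)) y {σ = k ∷ᶠ i ∷ᶠ 0 ∷ᶠ σ}) (∷-cong refl (λ { zero → refl ; (suc zero) → refl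
            ; (suc (suc zero)) → +-identityʳ y ; (suc (suc (suc j))) → refl })))
        ⨟ inc₁) rest)
      where
      reads : ∀ j → (k ∷ᶠ i ∷ᶠ q ∷ᶠ σ) ((suc zero ∷ᶠ suc (suc zero) ∷ᶠ λ j → suc (suc (suc (ins (suc j))))) j) ≡ lookup (i ∷ q ∷ xs) j
      reads zero = refl
      reads (suc zero) = refl
      reads (suc (suc j)) = r j
    ... | r₀ , d₀ , run = r₀ , d₀ , conv (∷-cong (sym (+-suc i k)) rfl) run rfl

    compiles-run : ∀ {k n m} {hs : Vec (PR n) k} {xs ys} → EvalAll hs xs ys → (ins : Fin n → Fin m) {σ σ' : Regs m} {P : Prog (plus k m)} →
      (∀ i → σ (ins i) ≡ lookup xs i) → P ⊢ push ys σ ⇓ push ys σ' → compiles hs ins P ⊢ σ ⇓ σ'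
    compiles-run ea-nil ins r d = d
    compiles-run (ea-cons d ds) ins r e = local (compile-run d ins r ⨟ compiles-run ds (suc ∘ ins) r e ⨟ clear₀)

  -- Sylvester's sequence 2, 3, 7, 43, …, whose members are pairwise coprime: the registers are the exponents of its members in one number.
  sylv sylvΠ : ℕ → ℕ
  sylv k = suc (sylvΠ k)
  sylvΠ zero = 1
  sylvΠ (suc k) = sylv k * sylvΠ k

  private
    sylv∣Π : ∀ {k m} → k < m → sylv k ∣ sylvΠ m
    sylv∣Π {k} {suc m} (s≤s k≤m) with m≤n⇒m<n∨m≡n k≤m
    ... | inj₁ k<m = ∣-trans (sylv∣Π k<m) (n∣m*n (sylv m))
    ... | inj₂ refl = m∣m*n (sylvΠ k)

    sylv-coprime< : ∀ {k m} → k < m → Coprime (sylv k) (sylv m)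
    sylv-coprime< {k} {m} k<m {d} (d∣k , d∣m) =
      ∣1⇒≡1 (∣m+n∣m⇒∣n (subst (d ∣_) (+-comm 1 (sylvΠ m)) d∣m) (∣-trans d∣k (sylv∣Π k<m)))

    sylv-coprime : ∀ {k m} → k ≢ m → Coprime (sylv k) (sylv m)
    sylv-coprime {k} {m} k≢m with <-cmp k m
    ... | tri< h _ _ = sylv-coprime< h
    ... | tri≈ _ e _ = ⊥-elim (k≢m e)
    ... | tri> _ _ h = coprime-sym (sylv-coprime< h)

  sylvΠ-pos : ∀ k → 1 ≤ sylvΠ k
  sylvΠ-pos zero = s≤s z≤n
  sylvΠ-pos (suc k) = ≤-trans (sylvΠ-pos k) (m≤n*m (sylvΠ k) (sylv k))

  -- Counted from the far end, so that a register keeps its base when local registers are put in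
  -- front of it.
  level : ∀ {m} → Fin m → ℕ
  level {suc m} zero = m
  level (suc i) = level i

  private
    level< : ∀ {m} (i : Fin m) → level i < m
    level< zero = ≤-refl
    level< (suc i) = m≤n⇒m≤1+n (level< i)

    level-injective : ∀ {m} {i j : Fin m} → level i ≡ level j → i ≡ j
    level-injective {i = zero} {zero} e = refl
    level-injective {i = zero} {suc j} e = ⊥-elim (<-irrefl (sym e) (level< j))
    level-injective {i = suc i} {zero} e = ⊥-elim (<-irrefl e (level< i))
    level-injective {i = suc i} {suc j} e = cong suc (level-injective e)

  enc : ∀ m → Regs m → ℕ
  enc zero σ = 1
  enc (suc m) σ = sylv m ^ σ zero * enc m (σ ∘ suc)

  enc-cong : ∀ {m} {σ τ : Regs m} → σ ≗ τ → enc m σ ≡ enc m τ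
  enc-cong {zero} f = refl
  enc-cong {suc m} f = cong₂ (λ a b → sylv m ^ a * b) (f zero) (enc-cong (f ∘ suc))

  enc-bump : ∀ {m} (i : Fin m) σ → enc m (bump i 1 σ) ≡ sylv (level i) * enc m σ
  enc-bump {suc m} zero σ = *-assoc (sylv m) (sylv m ^ σ zero) (enc m (σ ∘ suc))
  enc-bump {suc m} (suc i) σ = trans (cong (sylv m ^ σ zero *_) (enc-bump i (σ ∘ suc)))
    (trans (sym (*-assoc (sylv m ^ σ zero) (sylv (level i)) _))
    (trans (cong (_* enc m (σ ∘ suc)) (*-comm (sylv m ^ σ zero) (sylv (level i)))) (*-assoc (sylv (level i)) (sylv m ^ σ zero) (enc m (σ ∘ suc)))))

  private
    divides-enc : ∀ {m} p (σ : Regs m) → (∀ i → σ i ≡ 0 ⊎ Coprime p (sylv (level i))) → p ∣ enc m σ → p ∣ 1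
    divides-enc {zero} p σ h d = d
    divides-enc {suc m} p σ h d = divides-enc p (σ ∘ suc) (h ∘ suc) (strip (h zero) d)
      where
      remove : Coprime p (sylv m) → ∀ a {N} → p ∣ sylv m ^ a * N → p ∣ N
      remove c zero {N} d = subst (p ∣_) (*-identityˡ N) d
      remove c (suc a) {N} d = remove c a (coprime-divisor c (subst (p ∣_) (*-assoc (sylv m) (sylv m ^ a) N) d))
      strip : σ zero ≡ 0 ⊎ Coprime p (sylv m) → p ∣ sylv m ^ σ zero * enc m (σ ∘ suc) → p ∣ enc m (σ ∘ suc)
      strip (inj₁ e) d rewrite e = subst (p ∣_) (*-identityˡ _) d
      strip (inj₂ c) d = remove c (σ zero) d

  -- The bases of the other registers are coprime to that of `i`, so a divisor could only come from
  -- the exponent of `i` itself: testing a register for zero is testing divisibility.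
  enc-zero : ∀ {m} (i : Fin m) {σ} → σ i ≡ 0 → ¬ sylv (level i) ∣ enc m σ
  enc-zero i {σ} e d = <-irrefl (sym (∣1⇒≡1 (divides-enc _ σ others d))) (s≤s (sylvΠ-pos (level i)))
    where
    others : ∀ j → σ j ≡ 0 ⊎ Coprime (sylv (level i)) (sylv (level j))
    others j with j Data.Fin.≟ i
    ... | yes refl = inj₁ e
    ... | no ne = inj₂ (sylv-coprime (λ h → ne (sym (level-injective h))))

  -- Minsky's machines with the counters as exponents: incrementing is multiplication, and
  -- decrementing with a test for zero is division, with the second target taken if it fails.
  data Instr : Set where
    mul : ℕ → ℕ → Instr
    div : ℕ → ℕ → ℕ → Instr

  at : List Instr → ℕ → Maybe Instr
  at [] q = nothing
  at (x ∷ xs) zero = just x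
  at (x ∷ xs) (suc q) = at xs q

  data Move : Instr → ℕ → ℕ → ℕ → Set where
    mul : ∀ {p q N} → Move (mul p q) N q (p * N)
    div : ∀ {p q q' N} → Move (div p q q') (p * N) q N
    nodiv : ∀ {p q q' N} → ¬ p ∣ N → Move (div p q q') N q' N

  Config : Set
  Config = ℕ × ℕ

  infix 4 _⊢_⟶_ _⊢_⟶*_
  data _⊢_⟶_ (C : List Instr) : Config → Config → Set where
    step : ∀ {q N I q' N'} → at C q ≡ just I → Move I N q' N' → C ⊢ (q , N) ⟶ (q' , N')

  _⊢_⟶*_ : List Instr → Config → Config → Set
  C ⊢ x ⟶* y = Star (C ⊢_⟶_) x y

  size : ∀ {m} → Prog m → ℕ
  size skip = 0
  size (inc i) = 1
  size (loop i P) = suc (size P + 1)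
  size (P ⨟ P') = size P + size P'
  size (local P) = size P

  code : ∀ {m} → Prog m → ℕ → List Instr
  code skip a = []
  code (inc i) a = mul (sylv (level i)) (suc a) ∷ []
  -- The division tests and decrements the register, and multiplication by 1 is the jump back to it.
  -- The exit is the first address after that jump.
  code (loop i P) a = div (sylv (level i)) (suc a) (suc (suc (size P + a))) ∷ code P (suc a) ++ mul 1 a ∷ []
  code (P ⨟ P') a = code P a ++ code P' (size P + a)
  code (local P) a = code P a

  length-code : ∀ {m} (P : Prog m) a → length (code P a) ≡ size P
  length-code skip a = refl
  length-code (inc i) a = refl
  length-code (loop i P) a = cong suc (trans (length-++ (code P (suc a))) (cong (_+ 1) (length-code P (suc a))))
  length-code (P ⨟ P') a = trans (length-++ (code P a)) (cong₂ _+_ (length-code P a) (length-code P' (size P + a)))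
  length-code (local P) a = length-code P a

  Loaded : List Instr → ℕ → List Instr → Set
  Loaded C a [] = ⊤
  Loaded C a (x ∷ xs) = at C a ≡ just x × Loaded C (suc a) xs

  Loaded-++ : ∀ {C} a xs {ys} → Loaded C a (xs ++ ys) → Loaded C a xs × Loaded C (length xs + a) ys
  Loaded-++ a [] h = _ , h
  Loaded-++ {C} a (x ∷ xs) {ys} (e , h) with Loaded-++ (suc a) xs h
  ... | h₁ , h₂ = (e , h₁) , subst (λ z → Loaded C z ys) (+-suc (length xs) a) h₂

  Loaded-self : ∀ xs → Loaded xs 0 xs
  Loaded-self xs = go [] xs
    where
    here : ∀ (ys : List Instr) x zs → at (ys ++ x ∷ zs) (length ys) ≡ just x
    here [] x zs = refl
    here (y ∷ ys) x zs = here ys x zs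
    go : ∀ ys zs → Loaded (ys ++ zs) (length ys) zs
    go ys [] = _
    go ys (z ∷ zs) = here ys z zs , subst₂ (λ C a → Loaded C a zs) (++-assoc ys (z ∷ []) zs)
      (trans (length-++ ys) (+-comm (length ys) 1)) (go (ys ++ z ∷ []) zs)

  execute : ∀ {C m} {P : Prog m} {σ σ'} → P ⊢ σ ⇓ σ' → ∀ a → Loaded C a (code P a) →
    C ⊢ (a , enc m σ) ⟶* (size P + a , enc m σ')
  execute skip a l = ε
  execute (inc {i = i} {σ}) a (e , _) = subst (λ N → _ ⊢ _ ⟶ (suc a , N)) (sym (enc-bump i σ)) (step e mul) ◅ ε
  execute {C} {m} (exit {i = i} {P} {σ} z) a (e , _) = subst (λ q → C ⊢ (a , enc m σ) ⟶* (q , enc m σ)) (cong suc (label P))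
    (step e (nodiv (enc-zero i z)) ◅ ε)
    where
    label : ∀ P → suc (size P + a) ≡ size P + 1 + a
    label P = trans (sym (+-suc (size P) a)) (sym (+-assoc (size P) 1 a))
  execute {C} {m} (again {i = i} {P} {σ} {σ'} {σ''} d d') a l@(e , l') with Loaded-++ (suc a) (code P (suc a)) l'
  ... | l₁ , (e₂ , _) = subst (λ N → C ⊢ (a , N) ⟶ (suc a , enc m σ)) (sym (enc-bump i σ)) (step e div)
      ◅ execute d (suc a) l₁
      ◅◅ subst₂ (λ q N → C ⊢ (q , enc m σ') ⟶ (a , N)) (cong (_+ suc a) (length-code P (suc a))) (*-identityˡ (enc m σ')) (step e₂ mul)
      ◅ execute d' a l
  execute {C} {m} (_⨟_ {P = P} {P'} {σ} {σ'} {σ''} d d') a l with Loaded-++ a (code P a) l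
  ... | l₁ , l₂ = execute d a l₁ ◅◅ subst (λ q → C ⊢ (size P + a , enc m σ') ⟶* (q , enc m σ'')) label
      (execute d' (size P + a) (subst (λ z → Loaded C (z + a) (code P' (size P + a))) (length-code P a) l₂))
    where
    label : size P' + (size P + a) ≡ size P + size P' + a
    label = trans (sym (+-assoc (size P') (size P) a)) (cong (_+ a) (+-comm (size P') (size P)))
  execute {C} {m} (local {P = P} {σ} {σ'} d) a l = subst₂ (λ N N' → C ⊢ (a , N) ⟶* (size P + a , N'))
    (*-identityˡ (enc m σ)) (*-identityˡ (enc m σ')) (execute d a l)
  execute {C} (conv {P = P} f d g) a l = subst₂ (λ N N' → C ⊢ (a , N) ⟶* (size P + a , N'))
    (sym (enc-cong f)) (enc-cong g) (execute d a l)

  -- No instruction stays in its state, so the residue classes that it exchanges modulo the number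
  -- of states are disjoint. Positive factors make these classes proper arithmetic progressions.
  Ok : ℕ → ℕ → Instr → Set
  Ok hi a (mul p q) = (1 ≤ p) × q ≢ a × q ≤ hi
  Ok hi a (div p q q') = (1 ≤ p) × (q ≢ a × q ≤ hi) × (q' ≢ a × q' ≤ hi)

  Oks : ℕ → ℕ → List Instr → Set
  Oks hi a [] = ⊤
  Oks hi a (x ∷ xs) = Ok hi a x × Oks hi (suc a) xs

  Oks-++ : ∀ {hi} a xs {ys} → Oks hi a xs → Oks hi (length xs + a) ys → Oks hi a (xs ++ ys)
  Oks-++ a [] h k = k
  Oks-++ {hi} a (x ∷ xs) {ys} (o , h) k = o , Oks-++ (suc a) xs h (subst (λ z → Oks hi z ys) (sym (+-suc (length xs) a)) k)

  Oks-at : ∀ {hi} a xs → Oks hi a xs → ∀ {i I} → at xs i ≡ just I → Ok hi (i + a) I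
  Oks-at a (x ∷ xs) (o , h) {zero} refl = o
  Oks-at {hi} a (x ∷ xs) (o , h) {suc i} {I} e = subst (λ z → Ok hi z I) (+-suc i a) (Oks-at (suc a) xs h e)

  Oks-code : ∀ {m} hi (P : Prog m) a → size P + a ≤ hi → Oks hi a (code P a)
  Oks-code hi skip a h = _
  Oks-code hi (inc i) a h = ((s≤s z≤n) , 1+n≢n , h) , _
  Oks-code hi (loop i P) a h =
    ((s≤s z≤n) , (1+n≢n , ≤-trans (s≤s (m≤n+m a (size P))) (≤-trans (n≤1+n _) h')) ,
      ((λ e → <-irrefl (sym e) (s≤s (≤-trans (m≤n+m a (size P)) (n≤1+n _)))) , h')) ,
    Oks-++ (suc a) (code P (suc a)) (Oks-code hi P (suc a) (≤-trans (≤-reflexive (+-suc (size P) a)) (≤-trans (n≤1+n _) h')))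
      ((s≤s z≤n , (λ e → <-irrefl e (m≤n+m (suc a) (length (code P (suc a))))) ,
        ≤-trans (≤-trans (m≤n+m a (size P)) (≤-trans (n≤1+n _) (n≤1+n _))) h') , _)
    where
    h' : suc (suc (size P + a)) ≤ hi
    h' = subst (_≤ hi) (cong suc (trans (+-assoc (size P) 1 a) (+-suc (size P) a))) h
  Oks-code hi (P ⨟ P') a h = Oks-++ a (code P a) (Oks-code hi P a (≤-trans (m≤n+m _ (size P')) h'))
    (subst (λ z → Oks hi (z + a) (code P' (size P + a))) (sym (length-code P a)) (Oks-code hi P' (size P + a) h'))
    where
    h' : size P' + (size P + a) ≤ hi
    h' = subst (_≤ hi) (trans (cong (_+ a) (+-comm (size P) (size P'))) (+-assoc (size P') (size P) a)) h
  Oks-code hi (local P) a h = Oks-code hi P a h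

-- Machines as finitely many affine maps between residue classes

module MachineRules where

  open import Defs
  open CounterMachines
  open import Data.Empty using (⊥; ⊥-elim)
  open import Data.Fin using (Fin; zero; suc)
  open import Data.List using (List; []; _∷_; _++_; length; lookup)
  open import Data.List.Membership.Propositional using (_∈_)
  open import Data.List.Membership.Propositional.Properties using (∈-++⁺ˡ; ∈-++⁺ʳ)
  open import Data.List.Relation.Unary.Any using (here; there; index)
  open import Data.List.Relation.Unary.Any.Properties using (lookup-index)
  open import Data.List.Properties using (length-++)
  open import Data.Maybe using (just; nothing)
  open import Data.Maybe.Properties using (just-injective)
  open import Data.Nat using (ℕ; zero; suc; _+_; _*_; _^_; _≤_; _<_; z≤n; s≤s; >-nonZero)
  open import Data.Nat.DivMod using (_%_; _/_; m≡m%n+[m/n]*n; m%n<n)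
  open import Data.Nat.Divisibility using (_∣_; ∣m+n∣m⇒∣n; m∣m*n; ∣⇒≤; m%n≡0⇒n∣m)
  open import Data.Nat.Properties
  open import Data.Product using (Σ; _×_; _,_; proj₁; proj₂)
  open import Data.Sum using (inj₁; inj₂)
  open import Data.Vec using () renaming ([] to []ᵥ; _∷_ to _∷ᵥ_)
  open import Data.Vec.Functional using () renaming (_∷_ to _∷ᶠ_)
  open import Relation.Binary.Construct.Closure.ReflexiveTransitive using (ε; _◅_; _◅◅_)
  open import Relation.Binary.PropositionalEquality using (_≡_; _≢_; refl; cong; cong₂; subst; subst₂; sym; trans)
  open import Relation.Nullary using (¬_)

  -- (q, a + m j) ↦ (q', a' + m' j) for all j, on configurations numbered by q + N Q.
  record Rule (Q : ℕ) : Set where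
    field
      q a m q' a' m' : ℕ
      q<Q : q < Q
      q'<Q : q' < Q
      q≢q' : q ≢ q'
      a<m : a < m
      a'<m' : a' < m'

    α M α' M' : ℕ
    α = q + a * Q
    M = m * Q
    α' = q' + a' * Q
    M' = m' * Q

  -- The machine code of a program run on input ℓ, followed by a test of its output.
  module Machine (F : PR 1) where

    body : Prog 2
    body = compile F (λ _ → zero) ⨟ clear (suc zero)

    E : ℕ
    E = size body

    -- The input is the exponent of 2 and the output that of 3, which is `sylv 1`. With the input
    -- cleared, output 0 fails the last division and output 1 passes it; in both cases the number
    -- left is 1, so there is one accepting configuration.
    C : List Instr
    C = code body 0 ++ div (sylv 1) (suc E) (suc (suc E)) ∷ []

    -- label of the accepting state; suc E is rejecting, 3 + E is reserved for doubling the input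
    qₕ : ℕ
    qₕ = suc (suc E)

    Q : ℕ
    Q = suc (suc (suc (suc E)))

    pos : ℕ → ℕ → ℕ
    pos q N = q + N * Q

    private
      lenC : length C ≡ suc E
      lenC = trans (length-++ (code body 0)) (trans (cong (_+ 1) (length-code body 0)) (+-comm E 1))

      okC : Oks qₕ 0 C
      okC = Oks-++ 0 (code body 0) (Oks-code qₕ body 0 (≤-trans (≤-reflexive (+-identityʳ E)) (≤-trans (n≤1+n E) (n≤1+n _))))
        (subst (λ z → Oks qₕ z (div (sylv 1) (suc E) (suc (suc E)) ∷ [])) (sym (trans (+-identityʳ _) (length-code body 0)))
          ((s≤s z≤n , (1+n≢n , n≤1+n _) , ((λ e → <-irrefl (sym e) (n≤1+n _)) , ≤-refl)) , _))

      ok-at : ∀ {q I} → at C q ≡ just I → Ok qₕ q I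
      ok-at {q} {I} e = subst (λ z → Ok qₕ z I) (+-identityʳ q) (Oks-at 0 C okC e)

      at-< : ∀ xs {q I} → at xs q ≡ just I → q < length xs
      at-< (x ∷ xs) {zero} e = s≤s z≤n
      at-< (x ∷ xs) {suc q} e = s≤s (at-< xs e)

      at≤E : ∀ {q I} → at C q ≡ just I → q ≤ E
      at≤E e = ≤-pred (subst (_ <_) lenC (at-< C e))

      q<Q : ∀ {q} → q ≤ qₕ → q < Q
      q<Q h = s≤s (m≤n⇒m≤1+n h)

      at<Q : ∀ {q I} → at C q ≡ just I → q < Q
      at<Q e = q<Q (≤-trans (at≤E e) (≤-trans (n≤1+n E) (n≤1+n _)))

    start⟶* : ∀ {ℓ y} → Eval F (ℓ ∷ᵥ []ᵥ) y → C ⊢ (0 , 2 ^ ℓ) ⟶* (E , sylv 1 ^ y)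
    start⟶* {ℓ} {y} d = subst₂ (λ N x → C ⊢ (0 , N) ⟶* x) input output (execute run 0 (proj₁ loaded))
      where
      σ : Regs 1
      σ = ℓ ∷ᶠ λ ()
      run : body ⊢ 0 ∷ᶠ σ ⇓ (y ∷ᶠ 0 ∷ᶠ λ ())
      run = compile-run d (λ _ → zero) (λ { zero → refl })
        ⨟ conv (λ _ → refl) (clear-run (suc zero)) (λ { zero → refl ; (suc zero) → refl })
      loaded : Loaded C 0 (code body 0) × Loaded C (length (code body 0) + 0) _
      loaded = Loaded-++ 0 (code body 0) (Loaded-self C)
      input : enc 2 (0 ∷ᶠ σ) ≡ 2 ^ ℓ
      input = trans (+-identityʳ _) (*-identityʳ (2 ^ ℓ))
      output : (size body + 0 , enc 2 (y ∷ᶠ 0 ∷ᶠ λ ())) ≡ (E , sylv 1 ^ y)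
      output = cong₂ _,_ (+-identityʳ E) (*-identityʳ (sylv 1 ^ y))

    private
      test : at C E ≡ just (div (sylv 1) (suc E) (suc (suc E)))
      test = subst (λ z → at C z ≡ just (div (sylv 1) (suc E) (suc (suc E)))) (trans (+-identityʳ _) (length-code body 0))
        (proj₁ (proj₂ (Loaded-++ 0 (code body 0) {div (sylv 1) (suc E) (suc (suc E)) ∷ []} (Loaded-self C))))

    Accepts : ℕ → Set
    Accepts ℓ = C ⊢ (0 , 2 ^ ℓ) ⟶* (qₕ , 1)

    accepts : ∀ {ℓ} → Eval F (ℓ ∷ᵥ []ᵥ) 0 → Accepts ℓ
    accepts d = start⟶* d ◅◅ step test (nodiv (λ h → <⇒≱ (s≤s (s≤s z≤n)) (∣⇒≤ h))) ◅ ε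

    rejects : ∀ {ℓ} → Eval F (ℓ ∷ᵥ []ᵥ) 1 → C ⊢ (0 , 2 ^ ℓ) ⟶* (suc E , 1)
    rejects d = start⟶* d ◅◅ step test div ◅ ε

    private
      Move-det : ∀ {I a N q₁ N₁ q₂ N₂} → Ok qₕ a I → Move I N q₁ N₁ → Move I N q₂ N₂ → q₁ ≡ q₂ × N₁ ≡ N₂
      Move-det ok mul mul = refl , refl
      Move-det {div p _ _} (p>0 , _) m₁ m₂ = go m₁ m₂ refl
        where
        go : ∀ {N N' q q' q₁ q₂ N₁ N₂} → Move (div p q q') N q₁ N₁ → Move (div p q q') N' q₂ N₂ → N ≡ N' → q₁ ≡ q₂ × N₁ ≡ N₂
        go (div {N = A}) (div {N = B}) e = refl , *-cancelˡ-≡ A B p {{>-nonZero p>0}} e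
        go (div {N = A}) (nodiv h) e = ⊥-elim (h (subst (p ∣_) e (m∣m*n A)))
        go (nodiv h) (div {N = B}) e = ⊥-elim (h (subst (p ∣_) (sym e) (m∣m*n B)))
        go (nodiv h) (nodiv _) e = refl , e

      ⟶-det : ∀ {x y z} → C ⊢ x ⟶ y → C ⊢ x ⟶ z → y ≡ z
      ⟶-det (step e m) (step e' m') with just-injective (trans (sym e) e')
      ... | refl with Move-det (ok-at e) m m'
      ... | refl , refl = refl

      terminal : ∀ {q N x} → E < q → ¬ C ⊢ (q , N) ⟶ x
      terminal h (step e _) = <⇒≱ h (at≤E e)

    -- By determinism a run to a terminal state goes through every successor. Together with the
    -- trivial converse, reaching the accepting configuration is invariant along a step in both
    -- directions, as conjugation by an involution requires.
    ⟶*-step : ∀ {x y q N} → E < q → C ⊢ x ⟶* (q , N) → C ⊢ x ⟶ y → C ⊢ y ⟶* (q , N)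
    ⟶*-step h ε s = ⊥-elim (terminal h s)
    ⟶*-step h (s' ◅ ss) s with ⟶-det s s'
    ... | refl = ss

    private
      terminal* : ∀ {q N y} → E < q → C ⊢ (q , N) ⟶* y → y ≡ (q , N)
      terminal* h ε = refl
      terminal* h (s ◅ _) = ⊥-elim (terminal h s)

      confluent : ∀ {x y} → C ⊢ x ⟶* (qₕ , 1) → C ⊢ x ⟶* y → y ≡ (suc E , 1) → qₕ ≡ suc E
      confluent a ε refl = cong proj₁ (terminal* ≤-refl a)
      confluent a (s ◅ ss) e = confluent (⟶*-step (n≤1+n _) a s) ss e

    not-both : ∀ {ℓ} → Accepts ℓ → C ⊢ (0 , 2 ^ ℓ) ⟶* (suc E , 1) → ⊥
    not-both a r = 1+n≢n (confluent a r refl)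

    record MRule : Set where
      field
        rule : Rule Q
      open Rule rule public
      field
        sound : ∀ j → C ⊢ (q , a + m * j) ⟶ (q' , a' + m' * j)

    private
      mulRule : ∀ {q p q'} → at C q ≡ just (mul p q') → MRule
      mulRule {q} {p} {q'} e = record
        { rule = record { q = q ; a = 0 ; m = 1 ; q' = q' ; a' = 0 ; m' = p ; q<Q = at<Q e ; q'<Q = q<Q (proj₂ (proj₂ (ok-at e)))
                        ; q≢q' = λ h → proj₁ (proj₂ (ok-at e)) (sym h) ; a<m = s≤s z≤n ; a'<m' = proj₁ (ok-at e) }
        ; sound = λ j → subst (λ z → C ⊢ (q , z) ⟶ (q' , p * j)) (sym (+-identityʳ j)) (step e mul) }

      divRule : ∀ {q p q' q''} → at C q ≡ just (div p q' q'') → MRule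
      divRule {q} {p} {q'} e = record
        { rule = record { q = q ; a = 0 ; m = p ; q' = q' ; a' = 0 ; m' = 1 ; q<Q = at<Q e ; q'<Q = q<Q (proj₂ (proj₁ (proj₂ (ok-at e))))
                        ; q≢q' = λ h → proj₁ (proj₁ (proj₂ (ok-at e))) (sym h) ; a<m = proj₁ (ok-at e) ; a'<m' = s≤s z≤n }
        ; sound = λ j → subst (λ z → C ⊢ (q , p * j) ⟶ (q' , z)) (sym (+-identityʳ j)) (step e div) }

      -- A failing division is not one affine rule but one for each nonzero residue; on such a class
      -- the number stays unchanged.
      nodivRule : ∀ {q p q' q''} → at C q ≡ just (div p q' q'') → ∀ k → suc k < p → MRule
      nodivRule {q} {p} {_} {q''} e k k<p = record
        { rule = record { q = q ; a = suc k ; m = p ; q' = q'' ; a' = suc k ; m' = p ; q<Q = at<Q e ; q'<Q = q<Q (proj₂ (proj₂ (proj₂ (ok-at e))))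
                        ; q≢q' = λ h → proj₁ (proj₂ (proj₂ (ok-at e))) (sym h) ; a<m = k<p ; a'<m' = k<p }
        ; sound = λ j → step e (nodiv λ d → <⇒≱ k<p (∣⇒≤ (∣m+n∣m⇒∣n (subst (p ∣_) (+-comm (suc k) (p * j)) d) (m∣m*n j)))) }

      nodivRules : ∀ {q p q' q''} → at C q ≡ just (div p q' q'') → ∀ k → k < p → List MRule
      nodivRules e zero h = []
      nodivRules e (suc k) h = nodivRule e k h ∷ nodivRules e k (<⇒≤ h)

      instrRules : ∀ {q} I → at C q ≡ just I → List MRule
      instrRules (mul p q') e = mulRule e ∷ []
      instrRules {q} (div zero q' q'') e = []
      instrRules (div (suc p) q' q'') e = divRule e ∷ nodivRules e p ≤-refl

      stateRules : ∀ q r → at C q ≡ r → List MRule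
      stateRules q nothing e = []
      stateRules q (just I) e = instrRules I e

      rulesUpTo : ℕ → List MRule
      rulesUpTo zero = []
      rulesUpTo (suc k) = stateRules k (at C k) refl ++ rulesUpTo k

    rules : List MRule
    rules = rulesUpTo Q

    Fires : MRule → Config → Config → Set
    Fires r (q , N) (q' , N') = Σ ℕ λ j → q ≡ MRule.q r × N ≡ MRule.a r + MRule.m r * j × q' ≡ MRule.q' r × N' ≡ MRule.a' r + MRule.m' r * j

    private
      nodiv-fires : ∀ {q p q' q''} (e : at C q ≡ just (div p q' q'')) k (h : k < p) a j → 1 ≤ a → a ≤ k →
        Σ MRule λ r → r ∈ nodivRules e k h × Fires r (q , a + p * j) (q'' , a + p * j)
      nodiv-fires e zero h a j 1≤a a≤k = ⊥-elim (<⇒≱ 1≤a a≤k)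
      nodiv-fires {p = p} e (suc k) h a j 1≤a a≤k with m≤n⇒m<n∨m≡n a≤k
      ... | inj₂ refl = nodivRule e k h , here refl , j , refl , refl , refl , refl
      nodiv-fires e (suc k) h a j 1≤a a≤k | inj₁ (s≤s a≤k') with nodiv-fires e k (<⇒≤ h) a j 1≤a a≤k'
      ... | r , m , f = r , there m , f

      instr-fires : ∀ {q I N q' N'} (e : at C q ≡ just I) → Move I N q' N' →
        Σ MRule λ r → r ∈ instrRules I e × Fires r (q , N) (q' , N')
      instr-fires {q} e (mul {p} {q'} {N}) = mulRule e , here refl , N , refl , sym (+-identityʳ N) , refl , refl
      instr-fires {q} {div zero _ _} e m with ok-at e
      ... | () , _
      instr-fires {q} {div (suc p) q₁ q₂} e (div {N = N}) = divRule e , here refl , N , refl , refl , refl , sym (+-identityʳ N)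
      instr-fires {q} {div (suc p) q₁ q₂} e (nodiv {N = N} nd) with nodiv-fires e p ≤-refl (N % suc p) (N / suc p) pos% (≤-pred (m%n<n N (suc p)))
        where
        pos% : 1 ≤ N % suc p
        pos% with N % suc p in eq
        ... | zero = ⊥-elim (nd (m%n≡0⇒n∣m N (suc p) eq))
        ... | suc _ = s≤s z≤n
      ... | r , m , f = r , there m , subst (λ z → Fires r (q , z) (q₂ , z)) (sym eqN) f
        where
        eqN : N ≡ N % suc p + suc p * (N / suc p)
        eqN = trans (m≡m%n+[m/n]*n N (suc p)) (cong (N % suc p +_) (*-comm (N / suc p) (suc p)))

      state-fires : ∀ {q I N q' N'} r (e : at C q ≡ r) → r ≡ just I → Move I N q' N' →
        Σ MRule λ x → x ∈ stateRules q r e × Fires x (q , N) (q' , N')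
      state-fires (just I) e refl m = instr-fires e m

      upTo-fires : ∀ k {q I N q' N'} → q < k → at C q ≡ just I → Move I N q' N' →
        Σ MRule λ r → r ∈ rulesUpTo k × Fires r (q , N) (q' , N')
      upTo-fires (suc k) {q} q<k e m with m≤n⇒m<n∨m≡n (≤-pred q<k)
      ... | inj₁ q<k' = let r , i , f = upTo-fires k q<k' e m in r , ∈-++⁺ʳ (stateRules k (at C k) refl) i , f
      ... | inj₂ refl = let r , i , f = state-fires (at C q) refl e m in r , ∈-++⁺ˡ i , f

    ruleAt : Fin (length rules) → MRule
    ruleAt = lookup rules

    fires : ∀ {x y} → C ⊢ x ⟶ y → Σ (Fin (length rules)) λ i → Fires (ruleAt i) x y
    fires {x} {y} (step e m) with upTo-fires Q (at<Q e) e m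
    ... | r , i , f = index i , subst (λ z → Fires z x y) (lookup-index i) f

    -- Doubling the number in state 0 would be a rule from a state to itself. It is split by the
    -- reserved state `suc qₕ`, in which the doubled number waits.
    double undouble : Rule Q
    double = record { q = 0 ; a = 0 ; m = 1 ; q' = suc qₕ ; a' = 0 ; m' = 2 ; q<Q = s≤s z≤n ; q'<Q = ≤-refl
                    ; q≢q' = λ () ; a<m = s≤s z≤n ; a'<m' = s≤s z≤n }
    undouble = record { q = suc qₕ ; a = 0 ; m = 1 ; q' = 0 ; a' = 0 ; m' = 1 ; q<Q = ≤-refl ; q'<Q = s≤s z≤n
                    ; q≢q' = λ () ; a<m = s≤s z≤n ; a'<m' = s≤s z≤n }

-- The presentation and its collapse when the computation accepts

module Presentations where

  open import Algebra.Bundles using (Group)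
  open import Data.Bool using (Bool; true; false; not)
  open import Data.Empty using (⊥-elim)
  open import Data.Fin using (Fin; zero; suc; #_)
  open import Data.List using (List; []; _∷_; _++_)
  open import Data.Nat using (ℕ; zero; suc; _+_; _*_)
  import Data.Nat.Properties as ℕₚ
  open import Data.Product using (_×_; _,_)
  open import Data.Sum using (_⊎_; inj₁; inj₂)
  open import Data.Vec using (Vec; []; _∷_; lookup)
  open import Relation.Binary.PropositionalEquality as ≡ using (_≡_; _≢_; refl)
  import Algebra.Properties.Group as GroupProperties
  import Relation.Binary.Reasoning.Setoid as SetoidReasoning
  open MachineRules using (Rule)

  module GroupKit {c ℓ} (G : Group c ℓ) where
    open Group G public hiding (refl)
    open Group G using () renaming (refl to ≈-refl) public
    open GroupProperties G public
    module ≈-Reasoning = SetoidReasoning setoid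

    infixr 7.5 _◁_
    _◁_ : Carrier → Carrier → Carrier
    g ◁ x = g ∙ x ∙ g ⁻¹

    ◁-cong : ∀ {g h x y} → g ≈ h → x ≈ y → g ◁ x ≈ h ◁ y
    ◁-cong p q = ∙-cong (∙-cong p q) (⁻¹-cong p)

    ◁-congʳ : ∀ {g x y} → x ≈ y → g ◁ x ≈ g ◁ y
    ◁-congʳ = ◁-cong ≈-refl

    ◁-∙ : ∀ g h x → (g ∙ h) ◁ x ≈ g ◁ h ◁ x
    ◁-∙ g h x = begin
      g ∙ h ∙ x ∙ (g ∙ h) ⁻¹       ≈⟨ ∙-congˡ (⁻¹-anti-homo-∙ g h) ⟩
      g ∙ h ∙ x ∙ (h ⁻¹ ∙ g ⁻¹)    ≈⟨ assoc _ _ _ ⟨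
      g ∙ h ∙ x ∙ h ⁻¹ ∙ g ⁻¹      ≈⟨ ∙-congʳ (trans (∙-congʳ (assoc _ _ _)) (assoc _ _ _)) ⟩
      g ∙ (h ∙ x ∙ h ⁻¹) ∙ g ⁻¹    ∎
      where open ≈-Reasoning

    ε◁ : ∀ x → ε ◁ x ≈ x
    ε◁ x = trans (∙-cong (identityˡ x) ε⁻¹≈ε) (identityʳ x)

    ◁ε : ∀ g → g ◁ ε ≈ ε
    ◁ε g = trans (∙-congʳ (identityʳ g)) (inverseʳ g)

    ⁻¹◁◁ : ∀ g x → g ⁻¹ ◁ g ◁ x ≈ x
    ⁻¹◁◁ g x = trans (sym (◁-∙ (g ⁻¹) g x)) (trans (◁-cong (inverseˡ g) ≈-refl) (ε◁ x))

    ◁-homo : ∀ g x y → g ◁ (x ∙ y) ≈ g ◁ x ∙ g ◁ y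
    ◁-homo g x y = sym (begin
      g ∙ x ∙ g ⁻¹ ∙ (g ∙ y ∙ g ⁻¹)      ≈⟨ ∙-congˡ (assoc _ _ _) ⟩
      g ∙ x ∙ g ⁻¹ ∙ (g ∙ (y ∙ g ⁻¹))    ≈⟨ assoc _ _ _ ⟨
      g ∙ x ∙ g ⁻¹ ∙ g ∙ (y ∙ g ⁻¹)      ≈⟨ ∙-congʳ (trans (assoc _ _ _) (trans (∙-congˡ (inverseˡ g)) (identityʳ _))) ⟩
      g ∙ x ∙ (y ∙ g ⁻¹)                 ≈⟨ assoc _ _ _ ⟨
      g ∙ x ∙ y ∙ g ⁻¹                   ≈⟨ ∙-congʳ (assoc _ _ _) ⟩
      g ∙ (x ∙ y) ∙ g ⁻¹                 ∎)
      where open ≈-Reasoning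

    fixed⇒comm : ∀ {g h} → g ◁ h ≈ h → g ∙ h ≈ h ∙ g
    fixed⇒comm {g} {h} p = begin
      g ∙ h                 ≈⟨ identityʳ _ ⟨
      g ∙ h ∙ ε             ≈⟨ ∙-congˡ (inverseˡ g) ⟨
      g ∙ h ∙ (g ⁻¹ ∙ g)    ≈⟨ assoc _ _ _ ⟨
      g ◁ h ∙ g             ≈⟨ ∙-congʳ p ⟩
      h ∙ g                 ∎
      where open ≈-Reasoning

    comm⇒fixed : ∀ {g h} → g ∙ h ≈ h ∙ g → g ◁ h ≈ h
    comm⇒fixed {g} {h} p = trans (∙-congʳ p) (trans (assoc _ _ _) (trans (∙-congˡ (inverseʳ g)) (identityʳ h)))

    swap : ∀ {g h} x → g ∙ h ≈ h ∙ g → g ◁ h ◁ x ≈ h ◁ g ◁ x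
    swap {g} {h} x p = trans (sym (◁-∙ g h x)) (trans (◁-cong p ≈-refl) (◁-∙ h g x))

    comm-⁻¹ : ∀ {g h} → g ∙ h ≈ h ∙ g → g ∙ h ⁻¹ ≈ h ⁻¹ ∙ g
    comm-⁻¹ {g} {h} p = fixed⇒comm (begin
      g ◁ h ⁻¹                       ≈⟨ identityˡ _ ⟨
      ε ∙ g ◁ h ⁻¹                   ≈⟨ ∙-congʳ (inverseˡ h) ⟨
      h ⁻¹ ∙ h ∙ g ◁ h ⁻¹            ≈⟨ assoc _ _ _ ⟩
      h ⁻¹ ∙ (h ∙ g ◁ h ⁻¹)          ≈⟨ ∙-congˡ (∙-congʳ (comm⇒fixed p)) ⟨
      h ⁻¹ ∙ (g ◁ h ∙ g ◁ h ⁻¹)      ≈⟨ ∙-congˡ (◁-homo g h (h ⁻¹)) ⟨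
      h ⁻¹ ∙ g ◁ (h ∙ h ⁻¹)          ≈⟨ ∙-congˡ (trans (◁-congʳ (inverseʳ h)) (◁ε g)) ⟩
      h ⁻¹ ∙ ε                       ≈⟨ identityʳ _ ⟩
      h ⁻¹                           ∎)
      where open ≈-Reasoning

    pow : ℕ → Carrier → Carrier
    pow zero g = ε
    pow (suc n) g = g ∙ pow n g

    pow-cong : ∀ n {g h} → g ≈ h → pow n g ≈ pow n h
    pow-cong zero p = ≈-refl
    pow-cong (suc n) p = ∙-cong p (pow-cong n p)

    pow-+ : ∀ m n g → pow (m + n) g ≈ pow m g ∙ pow n g
    pow-+ zero n g = sym (identityˡ _)
    pow-+ (suc m) n g = trans (∙-congˡ (pow-+ m n g)) (sym (assoc _ _ _))

    pow-∙ : ∀ m n g → pow (m * n) g ≈ pow m (pow n g)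
    pow-∙ zero n g = ≈-refl
    pow-∙ (suc m) n g = trans (pow-+ n (m * n) g) (∙-congˡ (pow-∙ m n g))

    ◁-pow : ∀ n g x → g ◁ pow n x ≈ pow n (g ◁ x)
    ◁-pow zero g x = ◁ε g
    ◁-pow (suc n) g x = trans (◁-homo g x (pow n x)) (∙-congˡ (◁-pow n g x))

    comm-pow : ∀ n {g h} → g ∙ h ≈ h ∙ g → g ∙ pow n h ≈ pow n h ∙ g
    comm-pow n p = fixed⇒comm (trans (◁-pow n _ _) (pow-cong n (comm⇒fixed p)))

    pow-comm-∙ : ∀ n {g h} → g ∙ h ≈ h ∙ g → pow n (g ∙ h) ≈ pow n g ∙ pow n h
    pow-comm-∙ zero p = sym (identityˡ ε)
    pow-comm-∙ (suc n) {g} {h} p = begin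
      g ∙ h ∙ pow n (g ∙ h)              ≈⟨ ∙-congˡ (pow-comm-∙ n p) ⟩
      g ∙ h ∙ (pow n g ∙ pow n h)        ≈⟨ assoc _ _ _ ⟩
      g ∙ (h ∙ (pow n g ∙ pow n h))      ≈⟨ ∙-congˡ (trans (sym (assoc _ _ _)) (trans (∙-congʳ (comm-pow n (sym p))) (assoc _ _ _))) ⟩
      g ∙ (pow n g ∙ (h ∙ pow n h))      ≈⟨ assoc _ _ _ ⟨
      g ∙ pow n g ∙ (h ∙ pow n h)        ∎
      where open ≈-Reasoning

    conj-pow : ∀ n g h x → g ◁ pow n h ◁ x ≈ pow n (g ◁ h) ◁ g ◁ x
    conj-pow n g h x = begin
      g ◁ pow n h ◁ x                   ≈⟨ ◁-∙ g (pow n h) x ⟨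
      (g ∙ pow n h) ◁ x                 ≈⟨ ◁-cong lem ≈-refl ⟩
      (pow n (g ◁ h) ∙ g) ◁ x           ≈⟨ ◁-∙ _ g x ⟩
      pow n (g ◁ h) ◁ g ◁ x             ∎
      where
      open ≈-Reasoning
      lem : g ∙ pow n h ≈ pow n (g ◁ h) ∙ g
      lem = trans (sym (trans (assoc _ _ _) (trans (∙-congˡ (inverseˡ g)) (identityʳ _)))) (∙-congʳ (◁-pow n g h))

    order-2-5 : ∀ {g} → pow 2 g ≈ ε → pow 5 g ≈ ε → g ≈ ε
    order-2-5 {g} p q = begin
      g                     ≈⟨ identityʳ g ⟨
      g ∙ ε                 ≈⟨ ∙-congˡ (trans (pow-∙ 2 2 g) (trans (pow-cong 2 p) (trans (identityˡ _) (identityˡ _)))) ⟨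
      g ∙ pow 4 g           ≈⟨ q ⟩
      ε                     ∎
      where open ≈-Reasoning

    order-2-3 : ∀ {g} → pow 2 g ≈ ε → pow 3 g ≈ ε → g ≈ ε
    order-2-3 {g} p q = trans (sym (identityʳ g)) (trans (∙-congˡ (sym p)) q)

    order-3-5 : ∀ {g} → pow 3 g ≈ ε → pow 5 g ≈ ε → g ≈ ε
    order-3-5 {g} p q = begin
      g                     ≈⟨ identityʳ g ⟨
      g ∙ ε                 ≈⟨ ∙-congˡ q ⟨
      pow 6 g               ≈⟨ pow-∙ 2 3 g ⟩
      pow 2 (pow 3 g)       ≈⟨ trans (pow-cong 2 p) (trans (identityˡ _) (identityˡ _)) ⟩
      ε                     ∎
      where open ≈-Reasoning

  module Words (L : Set) where

    Word : Set
    Word = List (Bool × L)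

    gen : L → Word
    gen g = (true , g) ∷ []

    inv : Word → Word
    inv [] = []
    inv ((s , g) ∷ w) = inv w ++ (not s , g) ∷ []

    powW : ℕ → Word → Word
    powW zero w = []
    powW (suc n) w = w ++ powW n w

    conjW commW eqW : Word → Word → Word
    conjW u v = u ++ v ++ inv u
    eqW u v = u ++ inv v
    commW u v = eqW (conjW u v) v

    module Eval {c ℓ} (G : Group c ℓ) (val : L → Group.Carrier G) where
      open GroupKit G

      sgn : Bool → Carrier → Carrier
      sgn true g = g
      sgn false g = g ⁻¹

      ev : Word → Carrier
      ev [] = ε
      ev ((s , g) ∷ w) = sgn s (val g) ∙ ev w

      ev-++ : ∀ u v → ev (u ++ v) ≈ ev u ∙ ev v
      ev-++ [] v = sym (identityˡ _)
      ev-++ (x ∷ u) v = trans (∙-congˡ (ev-++ u v)) (sym (assoc _ _ _))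

      ev-gen : ∀ g → ev (gen g) ≈ val g
      ev-gen g = identityʳ _

      ev-inv : ∀ w → ev (inv w) ≈ ev w ⁻¹
      ev-inv [] = sym ε⁻¹≈ε
      ev-inv ((s , g) ∷ w) = trans (ev-++ (inv w) _) (trans (∙-cong (ev-inv w) (trans (identityʳ _) (flip s)))
          (sym (⁻¹-anti-homo-∙ _ _)))
        where
        flip : ∀ s → sgn (not s) (val g) ≈ sgn s (val g) ⁻¹
        flip true = ≈-refl
        flip false = sym (⁻¹-involutive (val g))

      ev-pow : ∀ n w → ev (powW n w) ≈ pow n (ev w)
      ev-pow zero w = ≈-refl
      ev-pow (suc n) w = trans (ev-++ w (powW n w)) (∙-congˡ (ev-pow n w))

      ev-conj : ∀ u v → ev (conjW u v) ≈ ev u ◁ ev v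
      ev-conj u v = trans (ev-++ u _) (trans (∙-congˡ (trans (ev-++ v _) (∙-congˡ (ev-inv u)))) (sym (assoc _ _ _)))

      ev-eq : ∀ u v → ev (eqW u v) ≈ ε → ev u ≈ ev v
      ev-eq u v p = trans (inverseˡ-unique _ _ (trans (∙-congˡ (sym (ev-inv v))) (trans (sym (ev-++ u (inv v))) p)))
        (⁻¹-involutive (ev v))

      eq-ev : ∀ u v → ev u ≈ ev v → ev (eqW u v) ≈ ε
      eq-ev u v p = trans (ev-++ u (inv v)) (trans (∙-cong p (ev-inv v)) (inverseʳ (ev v)))

      ev-comm : ∀ u v → ev (commW u v) ≈ ε → ev u ◁ ev v ≈ ev v
      ev-comm u v p = trans (sym (ev-conj u v)) (ev-eq (conjW u v) v p)

      comm-ev : ∀ u v a b → ev u ≈ a → ev v ≈ b → a ∙ b ≈ b ∙ a → ev (commW u v) ≈ ε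
      comm-ev u v a b p q r = eq-ev (conjW u v) v (trans (ev-conj u v) (trans (◁-cong p q) (trans (comm⇒fixed r) (sym q))))

    module _ {c ℓ c' ℓ'} (G : Group c ℓ) (H : Group c' ℓ') (f : Group.Carrier G → Group.Carrier H)
      (f-cong : ∀ {x y} → Group._≈_ G x y → Group._≈_ H (f x) (f y))
      (f-∙ : ∀ x y → Group._≈_ H (f (Group._∙_ G x y)) (Group._∙_ H (f x) (f y))) (val : L → Group.Carrier G) where
      private
        module G = GroupKit G
        module EG = Eval G val
        open GroupKit H
        module EH = Eval H (λ g → f (val g))

        f-ε : f G.ε ≈ ε
        f-ε = identityʳ-unique (f G.ε) (f G.ε) (trans (sym (f-∙ G.ε G.ε)) (f-cong (G.identityˡ G.ε)))

        f-⁻¹ : ∀ x → f (x G.⁻¹) ≈ f x ⁻¹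
        f-⁻¹ x = inverseˡ-unique _ _ (trans (sym (f-∙ (x G.⁻¹) x)) (trans (f-cong (G.inverseˡ x)) f-ε))

      ev-hom : ∀ w → EH.ev w ≈ f (EG.ev w)
      ev-hom [] = sym f-ε
      ev-hom ((true , g) ∷ w) = trans (∙-congˡ (ev-hom w)) (sym (f-∙ _ _))
      ev-hom ((false , g) ∷ w) = trans (∙-cong (sym (f-⁻¹ (val g))) (ev-hom w)) (sym (f-∙ _ _))

  module Presentation (Q ρ : ℕ) (rule : Fin ρ → Rule Q) (machine : Fin ρ → Bool) (dbl undbl : Fin ρ) (h β : ℕ) where

    -- `𝐚` and `𝐛` are reflections generating the shift, `𝐭` marks position 0, `𝐮` serves to spread
    -- `𝐭` to `𝛉`, `𝐤` detects acceptance, `𝛉` and `𝛈` generate the alternating group of degree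
    -- five, and `𝐞` holds the input. Each rule has its exchange `𝐫` and two reflections of its
    -- source class.
    Letter : Set
    Letter = Fin 8 ⊎ (Fin ρ × Fin 3)

    pattern 𝐚 = inj₁ zero
    pattern 𝐛 = inj₁ (suc zero)
    pattern 𝐭 = inj₁ (suc (suc zero))
    pattern 𝐮 = inj₁ (suc (suc (suc zero)))
    pattern 𝐤 = inj₁ (suc (suc (suc (suc zero))))
    pattern 𝛉 = inj₁ (suc (suc (suc (suc (suc zero)))))
    pattern 𝛈 = inj₁ (suc (suc (suc (suc (suc (suc zero))))))
    pattern 𝐞 = inj₁ (suc (suc (suc (suc (suc (suc (suc zero)))))))
    pattern 𝐫 i = inj₂ (i , zero)
    pattern 𝐲₁ i = inj₂ (i , suc zero)
    pattern 𝐲₂ i = inj₂ (i , suc (suc zero))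

    open Words Letter public

    -- A shift written as a product of two involutions, an element of order five, and the doubling
    -- in state 0. All generators are given finite orders, so that each of them can be killed by a
    -- coprime order.
    𝐱 𝛒 𝐝 : Word
    𝐱 = gen 𝐚 ++ gen 𝐛
    𝛒 = gen 𝛉 ++ gen 𝛈
    𝐝 = gen (𝐫 undbl) ++ gen (𝐫 dbl)

    𝐓 : ℕ → Word
    𝐓 n = conjW (powW n 𝐱) (gen 𝐭)

    -- The power of `𝐱` translating by the modulus is factored into the shift `𝐲` of the source
    -- class and the complementary `𝐳`, which is to fix that class. `𝐲'` is `𝐲` carried to the
    -- target class, with its complement `𝐳'`.
    𝐲 𝐲' 𝐳 𝐳' : Fin ρ → Word
    𝐲 i = gen (𝐲₁ i) ++ gen (𝐲₂ i)
    𝐲' i = conjW (gen (𝐫 i)) (𝐲 i)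
    𝐳 i = eqW (powW (Rule.M (rule i)) 𝐱) (𝐲 i)
    𝐳' i = eqW (powW (Rule.M' (rule i)) 𝐱) (𝐲' i)

    -- The trap of the Adian-Rabin construction: multiplying `g` by `𝛒` gives an element of order
    -- dividing five. This restrains `g` only once `𝛒` is trivial; then `g` has order dividing five
    -- besides its own order 2 or 3.
    order five : ℕ → Letter → Word
    order n g = powW n (gen g)
    five n g = powW n (gen g ++ 𝛒)

    when : Bool → Word → Word
    when true w = w
    when false w = []

    -- The arguments tell whether the block is the first and whether it is the last one.
    baseRel : Bool → Bool → Vec Word 15
    baseRel first last =
        order 3 𝛈
      ∷ powW 5 𝛒
      ∷ eqW (gen 𝛉) (gen 𝐭 ++ conjW (gen 𝐮) (gen 𝐭))
      ∷ order 2 𝐭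
      ∷ order 3 𝐤
      ∷ five 5 𝐤
      ∷ commW (gen 𝐤) (𝐓 h)
      ∷ order 2 𝐚 ∷ order 2 𝐛 ∷ order 2 𝐮
      ∷ five 5 𝐚 ∷ five 5 𝐛 ∷ five 5 𝐮
      ∷ when first (eqW (gen 𝐞) (𝐓 β))
      ∷ when last (powW 3 (gen 𝐤 ++ gen 𝐞))
      ∷ []

    ruleRel : Fin ρ → Vec Word 12
    ruleRel i =
        commW (𝐳 i) (𝐲 i)
      ∷ commW (𝐳 i) (𝐓 (Rule.α (rule i)))
      ∷ commW (𝐳' i) (𝐲' i)
      ∷ commW (𝐳' i) (𝐓 (Rule.α' (rule i)))
      ∷ eqW (conjW (gen (𝐫 i)) (𝐓 (Rule.α (rule i)))) (𝐓 (Rule.α' (rule i)))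
      -- Only genuine instructions preserve acceptance; the two doubling rules do not, so their
      -- letters must be free not to commute with `𝐤`.
      ∷ when (machine i) (commW (gen (𝐫 i)) (gen 𝐤))
      ∷ order 2 (𝐫 i) ∷ order 2 (𝐲₁ i) ∷ order 2 (𝐲₂ i)
      ∷ five 5 (𝐫 i) ∷ five 5 (𝐲₁ i) ∷ five 5 (𝐲₂ i)
      ∷ []

    Relator : Set
    Relator = Fin 15 ⊎ (Fin ρ × Fin 12)

    relator : Bool → Bool → Relator → Word
    relator first last (inj₁ i) = lookup (baseRel first last) i
    relator first last (inj₂ (i , j)) = lookup (ruleRel i) j

    -- the letter g of the next block, as a word in the letters of the present one
    cross : Letter → Word
    cross 𝐞 = conjW 𝐝 (gen 𝐞)
    cross g = gen g

    module Consequences {c ℓ} (G : Group c ℓ) (val : Letter → Group.Carrier G)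
      (rel : ∀ i → Group._≈_ G (Eval.ev G val (relator false false i)) (Group.ε G)) where
      open GroupKit G
      open Eval G val

      x t k : Carrier
      x = ev 𝐱
      t = val 𝐭
      k = val 𝐤

      T : ℕ → Carrier
      T n = pow n x ◁ t

      ev-T : ∀ n → ev (𝐓 n) ≈ T n
      ev-T n = trans (ev-conj (powW n 𝐱) (gen 𝐭)) (◁-cong (ev-pow n 𝐱) (ev-gen 𝐭))

      private
        -- if pow M x = z ∙ y, where z commutes with y and with T α, then y acts on the T (α + M j) as pow M x
        glide : ∀ {M α y z} → pow M x ≈ z ∙ y → z ◁ y ≈ y → z ◁ T α ≈ T α → ∀ j → T (α + M * j) ≈ pow j y ◁ T α
        glide {M} {α} {y} {z} xM zy zT j = begin
          T (α + M * j)                   ≡⟨ ≡.cong T (≡.trans (ℕₚ.+-comm α (M * j)) (≡.cong (_+ α) (ℕₚ.*-comm M j))) ⟩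
          T (j * M + α)                   ≈⟨ ◁-cong (pow-+ (j * M) α x) ≈-refl ⟩
          (pow (j * M) x ∙ pow α x) ◁ t   ≈⟨ ◁-∙ _ _ t ⟩
          pow (j * M) x ◁ T α             ≈⟨ ◁-cong (pow-∙ j M x) ≈-refl ⟩
          pow j (pow M x) ◁ T α           ≈⟨ go j ⟩
          pow j y ◁ T α                   ∎
          where
          open ≈-Reasoning
          go : ∀ j → pow j (pow M x) ◁ T α ≈ pow j y ◁ T α
          go zero = ≈-refl
          go (suc j) = begin
            (pow M x ∙ pow j (pow M x)) ◁ T α    ≈⟨ ◁-∙ _ _ _ ⟩
            pow M x ◁ pow j (pow M x) ◁ T α      ≈⟨ ◁-cong xM (go j) ⟩
            (z ∙ y) ◁ pow j y ◁ T α              ≈⟨ ◁-∙ z y _ ⟩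
            z ◁ y ◁ pow j y ◁ T α                ≈⟨ ◁-congʳ (sym (◁-∙ y (pow j y) _)) ⟩
            z ◁ pow (suc j) y ◁ T α              ≈⟨ swap _ (comm-pow (suc j) (fixed⇒comm zy)) ⟩
            pow (suc j) y ◁ z ◁ T α              ≈⟨ ◁-congʳ zT ⟩
            pow (suc j) y ◁ T α                  ∎

      -- On the source class `𝐲` does what the power of `𝐱` does, and `𝐲'` likewise on the target
      -- class. Conjugation by `𝐫 i` takes `𝐲` to `𝐲'`, so the relator for the first member of the
      -- class spreads to all of them.
      rule-conj : ∀ i j → val (𝐫 i) ◁ T (Rule.α (rule i) + Rule.M (rule i) * j) ≈ T (Rule.α' (rule i) + Rule.M' (rule i) * j)
      rule-conj i j = begin
        r ◁ T (α + M * j)          ≈⟨ ◁-congʳ (glide {M = M} {α = α} {y = y} {z = z} (split M (𝐲 i)) (ev-comm (𝐳 i) (𝐲 i) (rel (inj₂ (i , # 0)))) zT j) ⟩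
        r ◁ pow j y ◁ T α          ≈⟨ conj-pow j r y _ ⟩
        pow j (r ◁ y) ◁ r ◁ T α    ≈⟨ ◁-cong (pow-cong j (sym y'≈)) rT ⟩
        pow j y' ◁ T α'            ≈⟨ glide {M = M'} {α = α'} {y = y'} {z = z'} (split M' (𝐲' i)) (ev-comm (𝐳' i) (𝐲' i) (rel (inj₂ (i , # 2)))) z'T j ⟨
        T (α' + M' * j)            ∎
        where
        open ≈-Reasoning
        open Rule (rule i)
        r = val (𝐫 i)
        y = ev (𝐲 i)
        y' = ev (𝐲' i)
        z = ev (𝐳 i)
        z' = ev (𝐳' i)
        y'≈ : y' ≈ r ◁ y
        y'≈ = trans (ev-conj (gen (𝐫 i)) (𝐲 i)) (◁-cong (ev-gen (𝐫 i)) ≈-refl)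
        split : ∀ n w → pow n x ≈ ev (eqW (powW n 𝐱) w) ∙ ev w
        split n w = sym (begin
          ev (eqW (powW n 𝐱) w) ∙ ev w        ≈⟨ ∙-congʳ (trans (ev-++ (powW n 𝐱) (inv w)) (∙-cong (ev-pow n 𝐱) (ev-inv w))) ⟩
          pow n x ∙ ev w ⁻¹ ∙ ev w            ≈⟨ trans (assoc _ _ _) (trans (∙-congˡ (inverseˡ _)) (identityʳ _)) ⟩
          pow n x                             ∎)
        zT : z ◁ T α ≈ T α
        zT = trans (◁-congʳ (sym (ev-T α))) (trans (ev-comm (𝐳 i) (𝐓 α) (rel (inj₂ (i , # 1)))) (ev-T α))
        z'T : z' ◁ T α' ≈ T α'
        z'T = trans (◁-congʳ (sym (ev-T α'))) (trans (ev-comm (𝐳' i) (𝐓 α') (rel (inj₂ (i , # 3)))) (ev-T α'))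
        rT : r ◁ T α ≈ T α'
        rT = trans (◁-cong (sym (ev-gen (𝐫 i))) (sym (ev-T α))) (trans (sym (ev-conj (gen (𝐫 i)) (𝐓 α)))
          (trans (ev-eq (conjW (gen (𝐫 i)) (𝐓 α)) (𝐓 α') (rel (inj₂ (i , # 4)))) (ev-T α')))

      Centralised : ℕ → Set ℓ
      Centralised n = k ∙ T n ≈ T n ∙ k

      centralised-h : Centralised h
      centralised-h = fixed⇒comm (trans (◁-cong (sym (ev-gen 𝐤)) (sym (ev-T h)))
        (trans (ev-comm (gen 𝐤) (𝐓 h) (rel (inj₁ (# 6)))) (ev-T h)))

      -- As `𝐫 i` commutes with `𝐤` and carries one involution to the other, commutation with `𝐤` is
      -- transported backwards along an instruction.
      centralised-rule : ∀ i j → machine i ≡ true → Centralised (Rule.α' (rule i) + Rule.M' (rule i) * j) →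
        Centralised (Rule.α (rule i) + Rule.M (rule i) * j)
      centralised-rule i j m p = fixed⇒comm (begin
        k ◁ T n             ≈⟨ ◁-congʳ back ⟩
        k ◁ r ⁻¹ ◁ T n'     ≈⟨ swap _ (comm-⁻¹ kr) ⟩
        r ⁻¹ ◁ k ◁ T n'     ≈⟨ ◁-congʳ (comm⇒fixed p) ⟩
        r ⁻¹ ◁ T n'         ≈⟨ back ⟨
        T n                 ∎)
        where
        open ≈-Reasoning
        r = val (𝐫 i)
        n = Rule.α (rule i) + Rule.M (rule i) * j
        n' = Rule.α' (rule i) + Rule.M' (rule i) * j
        back : T n ≈ r ⁻¹ ◁ T n'
        back = trans (sym (⁻¹◁◁ r (T n))) (◁-congʳ (rule-conj i j))
        guarded : ∀ {b w} → b ≡ true → ev (when b w) ≈ ε → ev w ≈ ε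
        guarded refl q = q
        kr : k ∙ r ≈ r ∙ k
        kr = sym (fixed⇒comm (trans (◁-cong (sym (ev-gen (𝐫 i))) (sym (ev-gen 𝐤)))
          (trans (ev-comm (gen (𝐫 i)) (gen 𝐤) (guarded m (rel (inj₂ (i , # 5)))))
            (ev-gen 𝐤))))

      -- Commutation splits the cube, so `T n` has order dividing 3 and 2, and its conjugate `t` is
      -- trivial. Then `𝛉`, a product of conjugates of `t`, disappears, `𝛒` equals `𝛈` and has
      -- orders 5 and 3, and every other letter is left with two coprime orders.
      module Collapse {n : ℕ} (central : Centralised n) (cube : pow 3 (k ∙ T n) ≈ ε) where
        private
          base : ∀ i → ev (lookup (baseRel false false) i) ≈ ε
          base i = rel (inj₁ i)

          ord : ∀ {w} m → ev (powW m w) ≈ ε → pow m (ev w) ≈ ε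
          ord {w} m p = trans (sym (ev-pow m w)) p

          ordg : ∀ {g} m → ev (order m g) ≈ ε → pow m (val g) ≈ ε
          ordg {g} m p = trans (pow-cong m (sym (ev-gen g))) (ord m p)

          T²≈ε : pow 2 (T n) ≈ ε
          T²≈ε = trans (sym (◁-pow 2 (pow n x) t)) (trans (◁-congʳ (ordg 2 (base (# 3)))) (◁ε _))

          k³≈ε : pow 3 k ≈ ε
          k³≈ε = ordg 3 (base (# 4))

          T≈ε : T n ≈ ε
          T≈ε = order-2-3 T²≈ε (trans (sym (identityˡ _)) (trans (∙-congʳ (sym k³≈ε)) (trans (sym (pow-comm-∙ 3 central)) cube)))

        t≈ε : t ≈ ε
        t≈ε = trans (sym (⁻¹◁◁ (pow n x) t)) (trans (◁-congʳ T≈ε) (◁ε _))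

        private
          θ≈ε : val 𝛉 ≈ ε
          θ≈ε = begin
            val 𝛉                              ≈⟨ ev-gen 𝛉 ⟨
            ev (gen 𝛉)                         ≈⟨ ev-eq (gen 𝛉) (gen 𝐭 ++ conjW (gen 𝐮) (gen 𝐭)) (base (# 2)) ⟩
            t ∙ ev (conjW (gen 𝐮) (gen 𝐭))     ≈⟨ ∙-cong t≈ε (trans (ev-conj (gen 𝐮) (gen 𝐭)) (trans (◁-congʳ (trans (ev-gen 𝐭) t≈ε)) (◁ε _))) ⟩
            ε ∙ ε                              ≈⟨ identityˡ ε ⟩
            ε                                  ∎
            where open ≈-Reasoning

          ρ≈η : ev 𝛒 ≈ val 𝛈
          ρ≈η = trans (∙-cong θ≈ε (ev-gen 𝛈)) (identityˡ _)

          η≈ε : val 𝛈 ≈ ε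
          η≈ε = order-3-5 (ordg 3 (base zero)) (trans (pow-cong 5 (sym ρ≈η)) (ord {𝛒} 5 (base (# 1))))

          killed : ∀ g → ev (five 5 g) ≈ ε → pow 5 (val g) ≈ ε
          killed g p = trans (pow-cong 5 (sym (trans (∙-congˡ (trans ρ≈η η≈ε)) (identityʳ _)))) (ord {gen g ++ 𝛒} 5 p)

          involution : ∀ g → ev (order 2 g) ≈ ε → ev (five 5 g) ≈ ε → val g ≈ ε
          involution g p q = order-2-5 (ordg 2 p) (killed g q)

        trivial : ∀ g → g ≢ 𝐞 → val g ≈ ε
        trivial 𝐚 _ = involution 𝐚 (base (# 7)) (base (# 10))
        trivial 𝐛 _ = involution 𝐛 (base (# 8)) (base (# 11))
        trivial 𝐭 _ = t≈ε
        trivial 𝐮 _ = involution 𝐮 (base (# 9)) (base (# 12))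
        trivial 𝐤 _ = order-3-5 k³≈ε (killed 𝐤 (base (# 5)))
        trivial 𝛉 _ = θ≈ε
        trivial 𝛈 _ = η≈ε
        trivial (𝐫 i) _ = involution (𝐫 i) (rel (inj₂ (i , # 6))) (rel (inj₂ (i , # 9)))
        trivial (𝐲₁ i) _ = involution (𝐲₁ i) (rel (inj₂ (i , # 7))) (rel (inj₂ (i , # 10)))
        trivial (𝐲₂ i) _ = involution (𝐲₂ i) (rel (inj₂ (i , # 8))) (rel (inj₂ (i , # 11)))
        trivial 𝐞 p = ⊥-elim (p refl)

-- Permutations when falsity is replaced by a proposition R

module RelationalPermutations where

  open import Level using (0ℓ) renaming (suc to lsuc)
  open import Algebra.Bundles using (Group)
  open import Data.Product using (Σ; _×_; _,_)
  open import Relation.Binary.PropositionalEquality using (_≡_; refl; cong; sym; trans)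

  -- Permutations in the logic where ⊥ is read as R: relations that are total and functional
  -- in both directions up to the continuation monad (X → R) → R.
  module Permutations (R : Set) (S : Set) where

    𝕄 : Set → Set
    𝕄 X = (X → R) → R

    ret : ∀ {X} → X → 𝕄 X
    ret x k = k x

    infixl 1 _>>=_
    _>>=_ : ∀ {X Y} → 𝕄 X → (X → 𝕄 Y) → 𝕄 Y
    (m >>= f) k = m (λ x → f x k)

    record RPerm : Set₁ where
      field
        rel : S → S → Set
        total : ∀ s → 𝕄 (Σ S (rel s))
        cototal : ∀ s → 𝕄 (Σ S (λ s' → rel s' s))
        functional : ∀ {s a b} → rel s a → rel s b → 𝕄 (a ≡ b)
        cofunctional : ∀ {s a b} → rel a s → rel b s → 𝕄 (a ≡ b)
    open RPerm public

    group : Group (lsuc 0ℓ) 0ℓ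
    group = record
      { Carrier = RPerm
      ; _≈_ = _≈_
      ; _∙_ = _∙_
      ; ε = one
      ; _⁻¹ = flip
      ; isGroup = record
        { isMonoid = record
          { isSemigroup = record
            { isMagma = record
              { isEquivalence = record
                { refl = λ {f} s → total f s >>= λ (s' , r) → ret (s' , r , r)
                ; sym = λ p s → p s >>= λ (s' , r , q) → ret (s' , q , r)
                ; trans = λ {f} {g} {h} p q s → p s >>= λ (a , fa , ga) → q s >>= λ (b , gb , hb) →
                    functional g ga gb >>= λ { refl → ret (a , fa , hb) } }
              ; ∙-cong = λ p q s → q s >>= λ (a , fa , ga) → p a >>= λ (b , fb , gb) → ret (b , (a , fa , fb) , (a , ga , gb)) }
            ; assoc = λ f g h s → total h s >>= λ (a , ha) → total g a >>= λ (b , gb) → total f b >>= λ (c , fc) →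
                ret (c , (a , ha , (b , gb , fc)) , (b , (a , ha , gb) , fc)) }
          ; identity = (λ f s → total f s >>= λ (a , fa) → ret (a , (a , fa , refl) , fa))
                     , (λ f s → total f s >>= λ (a , fa) → ret (a , (s , refl , fa) , fa)) }
        ; inverse = (λ f s → total f s >>= λ (a , fa) → ret (s , (a , fa , fa) , refl))
                  , (λ f s → cototal f s >>= λ (a , fa) → ret (s , (a , fa , fa) , refl))
        ; ⁻¹-cong = λ {f} {g} p s → cototal f s >>= λ (a , fa) → p a >>= λ (b , fb , gb) →
            functional f fa fb >>= λ { refl → ret (a , fa , gb) } } }
      where
      _≈_ : RPerm → RPerm → Set
      f ≈ g = ∀ s → 𝕄 (Σ S λ s' → rel f s s' × rel g s s')
      _∙_ : RPerm → RPerm → RPerm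
      f ∙ g = record
        { rel = λ s s'' → Σ S λ s' → rel g s s' × rel f s' s''
        ; total = λ s → total g s >>= λ (a , ga) → total f a >>= λ (b , fb) → ret (b , a , ga , fb)
        ; cototal = λ s → cototal f s >>= λ (b , fb) → cototal g b >>= λ (a , ga) → ret (a , b , ga , fb)
        ; functional = λ { (a , ga , fa) (b , gb , fb) → functional g ga gb >>= λ { refl → functional f fa fb } }
        ; cofunctional = λ { (a , ga , fa) (b , gb , fb) → cofunctional f fa fb >>= λ { refl → cofunctional g ga gb } } }
      one : RPerm
      one = record
        { rel = _≡_
        ; total = λ s → ret (s , refl)
        ; cototal = λ s → ret (s , refl)
        ; functional = λ { refl refl → ret refl }
        ; cofunctional = λ { refl refl → ret refl } }
      flip : RPerm → RPerm
      flip f = record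
        { rel = λ s s' → rel f s' s
        ; total = cototal f
        ; cototal = total f
        ; functional = cofunctional f
        ; cofunctional = functional f }

    perm : (f g : S → S) → (∀ s → f (g s) ≡ s) → (∀ s → g (f s) ≡ s) → RPerm
    perm f g fg gf = record
      { rel = λ s s' → f s ≡ s'
      ; total = λ s → ret (f s , refl)
      ; cototal = λ s → ret (g s , fg s)
      ; functional = λ { refl refl → ret refl }
      ; cofunctional = λ {_} {a} {b} p q → ret (trans (sym (gf a)) (trans (cong g (trans p (sym q))) (gf b))) }

    involution : (f : S → S) → (∀ s → f (f s) ≡ s) → RPerm
    involution f ff = perm f f ff ff

-- Shifts and exchanges of residue classes of integers

module ResidueClasses where

  open import Data.Empty using (⊥-elim)
  open import Data.Integer using (ℤ; +_; -_; _+_; _*_; _-_; ∣_∣)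
  open import Data.Integer.DivMod using (_%ℕ_; _/ℕ_; a≡a%ℕn+[a/ℕn]*n; n%ℕd<d)
  import Data.Integer.Properties as ℤₚ
  open import Algebra.Properties.AbelianGroup ℤₚ.+-0-abelianGroup using () renaming (∙-cancelʳ to +-cancelʳ)
  open import Data.Integer.Solver using (module +-*-Solver)
  open import Data.Nat as ℕ using (ℕ; zero; suc; z≤n; NonZero; >-nonZero)
  import Data.Nat.Properties as ℕₚ
  open import Data.Product using (Σ; _,_)
  open import Relation.Binary.PropositionalEquality using (_≡_; _≢_; refl; cong; subst; sym; trans)
  open import Relation.Nullary using (Dec; yes; no; ¬_)

  private
    unique-quotient : ∀ {M a b} j k → a ℕ.< M → b ℕ.< M → + a + j * + M ≡ + b + k * + M → j ≡ k
    unique-quotient {M} {a} {b} j k a<M b<M e = ℤₚ.i-j≡0⇒i≡j j k (ℤₚ.∣i∣≡0⇒i≡0 small)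
      where
      open +-*-Solver
      diff : (j - k) * + M ≡ + b - + a
      diff = trans (solve 5 (λ J K m A B → (J :- K) :* m := (A :+ J :* m) :- (A :+ K :* m)) refl j k (+ M) (+ a) (+ b))
        (trans (cong (_- (+ a + k * + M)) e)
          (solve 4 (λ K m A B → (B :+ K :* m) :- (A :+ K :* m) := B :- A) refl k (+ M) (+ a) (+ b)))
      bound : ∣ + b - + a ∣ ℕ.< M
      bound = ℕₚ.≤-<-trans (ℕₚ.≤-reflexive (cong ∣_∣ (ℤₚ.m-n≡m⊖n b a)))
        (ℕₚ.≤-<-trans (ℤₚ.∣m⊝n∣≤m⊔n b a) (ℕₚ.⊔-pres-<m b<M a<M))
      small : ∣ j - k ∣ ≡ 0
      small = vanish ∣ j - k ∣ (subst (ℕ._< M) (trans (cong ∣_∣ (sym diff)) (ℤₚ.abs-* (j - k) (+ M))) bound)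
        where
        vanish : ∀ n → n ℕ.* M ℕ.< M → n ≡ 0
        vanish zero _ = refl
        vanish (suc n) h = ⊥-elim (ℕₚ.<⇒≱ h (ℕₚ.m≤m+n M (n ℕ.* M)))

  unique-remainder : ∀ {M a b} j k → a ℕ.< M → b ℕ.< M → + a + j * + M ≡ + b + k * + M → a ≡ b
  unique-remainder {M} {a} {b} j k a<M b<M e with unique-quotient j k a<M b<M e
  ... | refl = ℤₚ.+-injective (+-cancelʳ (j * + M) (+ a) (+ b) e)

  module Class (α M : ℕ) (α<M : α ℕ.< M) where

    pt : ℤ → ℤ
    pt j = + α + j * + M

    pt-injective : ∀ {j k} → pt j ≡ pt k → j ≡ k
    pt-injective {j} {k} = unique-quotient j k α<M α<M

    Member : ℤ → Set
    Member n = Σ ℤ λ j → n ≡ pt j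

    private
      M≢0 : NonZero M
      M≢0 = >-nonZero (ℕₚ.≤-<-trans z≤n α<M)

    abstract
      member? : ∀ n → Dec (Member n)
      member? n with (n %ℕ M) {{M≢0}} ℕₚ.≟ α
      ... | yes e = yes ((n /ℕ M) {{M≢0}} , trans (a≡a%ℕn+[a/ℕn]*n n M {{M≢0}}) (cong (λ z → + z + (n /ℕ M) {{M≢0}} * + M) e))
      ... | no ne = no λ (j , e) → ne (unique-remainder ((n /ℕ M) {{M≢0}}) j (n%ℕd<d n M {{M≢0}}) α<M
          (trans (sym (a≡a%ℕn+[a/ℕn]*n n M {{M≢0}})) e))

    abstract
      onClass : (ℤ → ℤ) → ℤ → ℤ
      onClass φ n with member? n
      ... | yes (j , _) = pt (φ j)
      ... | no _ = n

      onClass-pt : ∀ φ j → onClass φ (pt j) ≡ pt (φ j)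
      onClass-pt φ j with member? (pt j)
      ... | yes (k , e) = cong (λ z → pt (φ z)) (sym (pt-injective {j} {k} e))
      ... | no ¬m = ⊥-elim (¬m (j , refl))

      onClass-off : ∀ φ {n} → ¬ Member n → onClass φ n ≡ n
      onClass-off φ {n} ¬m with member? n
      ... | yes m = ⊥-elim (¬m m)
      ... | no _ = refl

      onClass-involutive : ∀ φ → (∀ j → φ (φ j) ≡ j) → ∀ n → onClass φ (onClass φ n) ≡ n
      onClass-involutive φ φφ n with member? n
      ... | yes (j , e) = trans (onClass-pt φ (φ j)) (trans (cong pt (φφ j)) (sym e))
      ... | no ¬m = onClass-off φ ¬m

    pt-suc : ∀ j → + M + pt j ≡ pt (+ 1 + j)
    pt-suc j = solve 3 (λ a m x → m :+ (a :+ x :* m) := a :+ (con (+ 1) :+ x) :* m) refl (+ α) (+ M) j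
      where open +-*-Solver

    -- A map that is the shift by M on the class and the identity off it commutes with the quotient
    -- of the shift by M of all of ℤ by it.
    module Glide (y y⁻ : ℤ → ℤ) (y-pt : ∀ j → y (pt j) ≡ pt (+ 1 + j)) (y-off : ∀ {n} → ¬ Member n → y n ≡ n)
      (yy⁻ : ∀ n → y (y⁻ n) ≡ n) (y⁻y : ∀ n → y⁻ (y n) ≡ n) where

      z : ℤ → ℤ
      z n = + M + y⁻ n

      z-pt : ∀ j → z (pt j) ≡ pt j
      z-pt j = trans (cong (λ p → + M + y⁻ p) (trans (cong pt pred+1) (sym (y-pt (- (+ 1) + j)))))
        (trans (cong (λ n → + M + n) (y⁻y _)) (trans (pt-suc (- (+ 1) + j)) (cong pt (sym pred+1))))
        where
        open +-*-Solver
        pred+1 : j ≡ + 1 + (- (+ 1) + j)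
        pred+1 = solve 1 (λ x → x := con (+ 1) :+ (con (- (+ 1)) :+ x)) refl j

      z-off : ∀ {n} → ¬ Member n → z n ≡ + M + n
      z-off ¬m = cong (λ n → + M + n) (trans (cong y⁻ (sym (y-off ¬m))) (y⁻y _))

      zy : ∀ n → z (y n) ≡ y (z n)
      zy n with member? n
      ... | yes (j , refl) = trans (trans (cong z (y-pt j)) (z-pt (+ 1 + j))) (trans (sym (y-pt j)) (cong y (sym (z-pt j))))
      ... | no ¬m = trans (cong z (y-off ¬m)) (sym (trans (cong y (z-off ¬m)) (trans (y-off ¬m') (sym (z-off ¬m)))))
        where
        ¬m' : ¬ Member (+ M + n)
        ¬m' (j , e) = ¬m (- (+ 1) + j , trans (solve 2 (λ m x → x := (:- m) :+ (m :+ x)) refl (+ M) n)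
          (trans (cong (λ n → - + M + n) e)
            (solve 3 (λ a m x → (:- m) :+ (a :+ x :* m) := a :+ (con (- (+ 1)) :+ x) :* m) refl (+ α) (+ M) j)))
          where open +-*-Solver

  module Transposition (α M α' M' : ℕ) (α<M : α ℕ.< M) (α'<M' : α' ℕ.< M')
    (disjoint : ∀ j k → Class.pt α M α<M j ≢ Class.pt α' M' α'<M' k) where
    private
      module C = Class α M α<M
      module C' = Class α' M' α'<M'

    abstract
      swap : ℤ → ℤ
      swap n with C.member? n | C'.member? n
      ... | yes (j , _) | _ = C'.pt j
      ... | no _ | yes (j , _) = C.pt j
      ... | no _ | no _ = n

      swap-pt : ∀ j → swap (C.pt j) ≡ C'.pt j
      swap-pt j with C.member? (C.pt j) | C'.member? (C.pt j)
      ... | yes (k , e) | _ = cong C'.pt (sym (C.pt-injective {j} {k} e))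
      ... | no ¬m | _ = ⊥-elim (¬m (j , refl))

      swap-pt' : ∀ j → swap (C'.pt j) ≡ C.pt j
      swap-pt' j with C.member? (C'.pt j) | C'.member? (C'.pt j)
      ... | yes (k , e) | _ = ⊥-elim (disjoint k j (sym e))
      ... | no _ | yes (k , e) = cong C.pt (sym (C'.pt-injective {j} {k} e))
      ... | no _ | no ¬m = ⊥-elim (¬m (j , refl))

      swap-off : ∀ {n} → ¬ C.Member n → ¬ C'.Member n → swap n ≡ n
      swap-off {n} ¬m ¬m' with C.member? n | C'.member? n
      ... | yes m | _ = ⊥-elim (¬m m)
      ... | no _ | yes m = ⊥-elim (¬m' m)
      ... | no _ | no _ = refl

      swap-involutive : ∀ n → swap (swap n) ≡ n
      swap-involutive n with C.member? n | C'.member? n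
      ... | yes (j , e) | _ = trans (swap-pt' j) (sym e)
      ... | no _ | yes (j , e) = trans (swap-pt j) (sym e)
      ... | no ¬m | no ¬m' = swap-off ¬m ¬m'

    -- The exchange conjugates the shift of the source class to that of the target class. A point of
    -- the source class goes to the target class, where `y` is the identity by disjointness, and
    -- returns.
    module Transport (y : ℤ → ℤ) (y-pt : ∀ j → y (C.pt j) ≡ C.pt (+ 1 + j)) (y-off : ∀ {n} → ¬ C.Member n → y n ≡ n) where

      conj-pt : ∀ j → swap (y (swap (C'.pt j))) ≡ C'.pt (+ 1 + j)
      conj-pt j = trans (cong (λ n → swap (y n)) (swap-pt' j)) (trans (cong swap (y-pt j)) (swap-pt (+ 1 + j)))

      conj-off : ∀ {n} → ¬ C'.Member n → swap (y (swap n)) ≡ n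
      conj-off {n} ¬m' = go (C.member? n)
        where
        go : Dec (C.Member n) → swap (y (swap n)) ≡ n
        go (yes (j , refl)) = trans (cong (λ n → swap (y n)) (swap-pt j))
          (trans (cong swap (y-off (λ (k , e) → disjoint k j (sym e)))) (swap-pt' j))
        go (no ¬m) = trans (cong (λ n → swap (y n)) (swap-off ¬m ¬m')) (trans (cong swap (y-off ¬m)) (swap-off ¬m ¬m'))

-- An action in which the shift has infinite order unless R holds

module PermutationModel where

  open import Data.Bool using (Bool; true; false; not; if_then_else_)
  open import Data.Empty using (⊥; ⊥-elim)
  open import Data.Fin using (Fin; zero; suc)
  open import Data.Integer using (ℤ; +_; -_; _+_; _*_; _-_) renaming (-[1+_] to neg)
  import Data.Integer.Properties as ℤₚ
  open import Data.Integer.Solver using (module +-*-Solver)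
  open import Data.List using (List; []; _∷_; _++_)
  open import Data.List.Relation.Unary.All using (All; []; _∷_)
  import Data.List.Relation.Unary.All.Properties as Allₚ
  open import Data.Nat as ℕ using (ℕ; zero; suc)
  import Data.Nat.Properties as ℕₚ
  open import Data.Product using (Σ; _×_; _,_; proj₁; proj₂)
  open import Data.Sum using (inj₁; inj₂)
  open import Data.Unit using (⊤; tt)
  open import Data.Vec using (Vec; []; _∷_; lookup)
  open import Data.Vec.Relation.Unary.All using ([]; _∷_) renaming (All to Allᵥ)
  open import Function using (_∘_)
  open import Relation.Binary.PropositionalEquality using (_≡_; _≢_; refl; cong; cong₂; subst; sym; trans)
  open import Relation.Nullary using (Dec; yes; no; ¬_; does)
  open MachineRules using (Rule)
  open Presentations
  open RelationalPermutations
  open ResidueClasses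

  Layer : Set
  Layer = Fin 5

  pattern 0# = zero
  pattern 1# = suc zero
  pattern 2# = suc (suc zero)
  pattern 3# = suc (suc (suc zero))
  pattern 4# = suc (suc (suc (suc zero)))

  -- In cycles, `θf` is (0 1)(2 3), `ηf` is (0 2 4) and `κf` is (0 2 1). They are chosen such that
  -- `θf` after `ηf` and `κf` after this product are 5-cycles, and `κf` after `θf` is the 3-cycle (1
  -- 2 3). Layer 4 is fixed by `θf` and `κf`.
  θf ηf ηf⁻ κf : Layer → Layer
  θf 0# = 1#
  θf 1# = 0#
  θf 2# = 3#
  θf 3# = 2#
  θf 4# = 4#
  ηf 0# = 2#
  ηf 1# = 1#
  ηf 2# = 4#
  ηf 3# = 3#
  ηf 4# = 0#
  ηf⁻ 0# = 4#
  ηf⁻ 1# = 1#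
  ηf⁻ 2# = 0#
  ηf⁻ 3# = 3#
  ηf⁻ 4# = 2#
  κf 0# = 2#
  κf 1# = 0#
  κf 2# = 1#
  κf 3# = 3#
  κf 4# = 4#

  -- The head of the list is the position. Lists serve to make the set marked by 0 equivalent to its
  -- complement: a single integer 0 could not be exchanged with all the other integers, but the
  -- lists starting with 0 can be exchanged with all other lists.
  S : Set
  S = List ℤ × Layer

  sel : Layer → (List ℤ → List ℤ) → List ℤ → List ℤ
  sel 0# F p = F p
  sel 1# F p = F p
  sel 2# F p = F p
  sel 3# F p = F p
  sel 4# F p = p

  -- Five rounds of the 5-cycle pass through every layer once. With layer 4 left out, an involution
  -- `F` is applied four times, an even number, so the relators `five` hold for it.
  lam : (List ℤ → List ℤ) → S → S
  lam F (p , l) = sel l F p , l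

  hd : (ℤ → ℤ) → List ℤ → List ℤ
  hd F [] = []
  hd F (n ∷ w) = F n ∷ w

  private
    sel-∘ : ∀ l {F G H : List ℤ → List ℤ} → (∀ p → F (G p) ≡ H p) → ∀ p → sel l F (sel l G p) ≡ sel l H p
    sel-∘ 0# h p = h p
    sel-∘ 1# h p = h p
    sel-∘ 2# h p = h p
    sel-∘ 3# h p = h p
    sel-∘ 4# h p = refl

    sel-id : ∀ l {F : List ℤ → List ℤ} → (∀ p → F p ≡ p) → ∀ p → sel l F p ≡ p
    sel-id 0# h p = h p
    sel-id 1# h p = h p
    sel-id 2# h p = h p
    sel-id 3# h p = h p
    sel-id 4# h p = refl

    hd-∘ : ∀ F G p → hd F (hd G p) ≡ hd (F ∘ G) p
    hd-∘ F G [] = refl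
    hd-∘ F G (n ∷ w) = refl

    hd-id : ∀ {F} → (∀ n → F n ≡ n) → ∀ p → hd F p ≡ p
    hd-id h [] = refl
    hd-id h (n ∷ w) = cong (_∷ w) (h n)

    hd-involutive : ∀ {F} → (∀ n → F (F n) ≡ n) → ∀ p → hd F (hd F p) ≡ p
    hd-involutive {F} h p = trans (hd-∘ F F p) (hd-id h p)

    lam-involutive : ∀ {F} → (∀ p → F (F p) ≡ p) → ∀ s → lam F (lam F s) ≡ s
    lam-involutive {F} h (p , l) = cong (_, l) (trans (sel-∘ l {F} {F} {F ∘ F} (λ _ → refl) p) (sel-id l h p))

  headIs : ℤ → List ℤ → Bool
  headIs n [] = false
  headIs n (m ∷ w) = does (m ℤₚ.≟ n)

  tl : Bool → Layer → Layer
  tl b l = if b then θf l else l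

  tau : ℤ → S → S
  tau n (p , l) = p , tl (headIs n p) l

  θ-involutive : ∀ l → θf (θf l) ≡ l
  θ-involutive 0# = refl
  θ-involutive 1# = refl
  θ-involutive 2# = refl
  θ-involutive 3# = refl
  θ-involutive 4# = refl

  private
    tl-involutive : ∀ b l → tl b (tl b l) ≡ l
    tl-involutive true = θ-involutive
    tl-involutive false l = refl

  tau-involutive : ∀ n s → tau n (tau n s) ≡ s
  tau-involutive n (p , l) = cong (p ,_) (tl-involutive (headIs n p) l)

  -- exchanges the lists starting with 0 and the other ones
  skips uf : List ℤ → List ℤ
  skips [] = []
  skips (+ n ∷ w) = + suc n ∷ w
  skips (neg n ∷ w) = neg n ∷ w
  uf [] = + 0 ∷ []
  uf (+ zero ∷ w) = skips w
  uf (+ suc n ∷ w) = + 0 ∷ + n ∷ w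
  uf (neg n ∷ w) = + 0 ∷ neg n ∷ w

  uf-involutive : ∀ p → uf (uf p) ≡ p
  uf-involutive [] = refl
  uf-involutive (+ zero ∷ []) = refl
  uf-involutive (+ zero ∷ + n ∷ w) = refl
  uf-involutive (+ zero ∷ neg n ∷ w) = refl
  uf-involutive (+ suc n ∷ w) = refl
  uf-involutive (neg n ∷ w) = refl

  uf-head : ∀ p → headIs (+ 0) (uf p) ≡ not (headIs (+ 0) p)
  uf-head [] = refl
  uf-head (+ zero ∷ []) = refl
  uf-head (+ zero ∷ + n ∷ w) = refl
  uf-head (+ zero ∷ neg n ∷ w) = refl
  uf-head (+ suc n ∷ w) = refl
  uf-head (neg n ∷ w) = refl

  layer : (Layer → Layer) → S → S
  layer f (p , l) = p , f l

  private
    five-lam : ∀ {F} → (∀ p → F (F p) ≡ p) → let step = λ s → lam F (layer θf (layer ηf s)) in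
      ∀ s → step (step (step (step (step s)))) ≡ s
    five-lam {F} h (p , 0#) = cong (_, 0#) (trans (cong (F ∘ F) (h p)) (h p))
    five-lam {F} h (p , 1#) = cong (_, 1#) (trans (cong (F ∘ F) (h p)) (h p))
    five-lam {F} h (p , 2#) = cong (_, 2#) (trans (cong (F ∘ F) (h p)) (h p))
    five-lam {F} h (p , 3#) = cong (_, 3#) (trans (cong (F ∘ F) (h p)) (h p))
    five-lam {F} h (p , 4#) = cong (_, 4#) (trans (cong (F ∘ F) (h p)) (h p))

    -- On layers 0 to 3, exactly one of `p` and `uf p` starts with 0, so exactly one of the two
    -- marks acts. On layer 4 everything in sight is the identity on layers.
    θ-tutu : ∀ s → layer θf s ≡ tau (+ 0) (lam uf (tau (+ 0) (lam uf s)))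
    θ-tutu (p , 0#) rewrite uf-head p with headIs (+ 0) p in e
    ... | true rewrite uf-involutive p | e = refl
    ... | false rewrite uf-involutive p | e = refl
    θ-tutu (p , 1#) rewrite uf-head p with headIs (+ 0) p in e
    ... | true rewrite uf-involutive p | e = refl
    ... | false rewrite uf-involutive p | e = refl
    θ-tutu (p , 2#) rewrite uf-head p with headIs (+ 0) p in e
    ... | true rewrite uf-involutive p | e = refl
    ... | false rewrite uf-involutive p | e = refl
    θ-tutu (p , 3#) rewrite uf-head p with headIs (+ 0) p in e
    ... | true rewrite uf-involutive p | e = refl
    ... | false rewrite uf-involutive p | e = refl
    θ-tutu (p , 4#) with headIs (+ 0) p in e
    ... | true rewrite e = refl
    ... | false rewrite e = refl

  module Action (R : Set) (Q ρ : ℕ) (rule : Fin ρ → Rule Q) (machine : Fin ρ → Bool) (dbl undbl : Fin ρ) (h β c₀ : ℕ)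
    (Halts : ℤ → Set) (halts-h : Halts (+ h)) (halts-c₀ : Halts (+ c₀) → R) where

    open Presentation Q ρ rule machine dbl undbl h β
    open Permutations R S

    private
      bounded : ∀ {q a m} → q ℕ.< Q → a ℕ.< m → q ℕ.+ a ℕ.* Q ℕ.< m ℕ.* Q
      bounded {q} {a} {m} q<Q a<m = ℕₚ.<-≤-trans (ℕₚ.+-monoˡ-< (a ℕ.* Q) q<Q) (ℕₚ.*-monoˡ-≤ Q a<m)

    module Src (i : Fin ρ) = Class (Rule.α (rule i)) (Rule.M (rule i)) (bounded (Rule.q<Q (rule i)) (Rule.a<m (rule i)))
    module Tgt (i : Fin ρ) = Class (Rule.α' (rule i)) (Rule.M' (rule i)) (bounded (Rule.q'<Q (rule i)) (Rule.a'<m' (rule i)))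

    regroup : ∀ q a m j → + (q ℕ.+ a ℕ.* Q) + j * + (m ℕ.* Q) ≡ + q + (+ a + j * + m) * + Q
    regroup q a m j = trans (cong₂ _+_ (trans (ℤₚ.pos-+ q (a ℕ.* Q)) (cong (λ z → + q + z) (ℤₚ.pos-* a Q))) (cong (j *_) (ℤₚ.pos-* m Q)))
      (solve 5 (λ q a m j Q → (q :+ a :* Q) :+ j :* (m :* Q) := q :+ (a :+ j :* m) :* Q) refl (+ q) (+ a) (+ m) j (+ Q))
      where open +-*-Solver

    private
      disjoint : ∀ i j k → Src.pt i j ≢ Tgt.pt i k
      disjoint i j k e = q≢q' (unique-remainder (+ a + j * + m) (+ a' + k * + m') q<Q q'<Q
        (trans (sym (regroup q a m j)) (trans e (regroup q' a' m' k))))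
        where open Rule (rule i)

    module Swp (i : Fin ρ) = Transposition (Rule.α (rule i)) (Rule.M (rule i)) (Rule.α' (rule i)) (Rule.M' (rule i))
      (bounded (Rule.q<Q (rule i)) (Rule.a<m (rule i))) (bounded (Rule.q'<Q (rule i)) (Rule.a'<m' (rule i))) (disjoint i)

    module Verify
      (halts-rule : ∀ i → machine i ≡ true → ∀ j → (Halts (Src.pt i j) → Halts (Tgt.pt i j)) × (Halts (Tgt.pt i j) → Halts (Src.pt i j))) where

      private
        negate mirror : ℤ → ℤ
        negate n = - n
        mirror n = - (+ 1) - n

        mirror-involutive : ∀ n → mirror (mirror n) ≡ n
        mirror-involutive n = solve 1 (λ n → con (- (+ 1)) :- (con (- (+ 1)) :- n) := n) refl n
          where open +-*-Solver

        neg-mirror : ∀ n → - mirror n ≡ + 1 + n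
        neg-mirror n = solve 1 (λ n → :- (con (- (+ 1)) :- n) := con (+ 1) :+ n) refl n
          where open +-*-Solver

      -- `𝐚` and `𝐛` are two reflections of the infinite dihedral group: `mirror` followed by
      -- `negate` is the shift by one. `𝐲₁` and `𝐲₂` repeat this on the indices of the source class.
      az : Letter → ℤ → ℤ
      az 𝐚 = negate
      az 𝐛 = mirror
      az (𝐫 i) = Swp.swap i
      az (𝐲₁ i) = Src.onClass i negate
      az (𝐲₂ i) = Src.onClass i mirror
      az _ n = n

      az-involutive : ∀ g n → az g (az g n) ≡ n
      az-involutive 𝐚 n = ℤₚ.neg-involutive n
      az-involutive 𝐛 n = mirror-involutive n
      az-involutive 𝐭 n = refl
      az-involutive 𝐮 n = refl
      az-involutive 𝐤 n = refl
      az-involutive 𝛉 n = refl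
      az-involutive 𝛈 n = refl
      az-involutive 𝐞 n = refl
      az-involutive (𝐫 i) n = Swp.swap-involutive i n
      az-involutive (𝐲₁ i) n = Src.onClass-involutive i negate ℤₚ.neg-involutive n
      az-involutive (𝐲₂ i) n = Src.onClass-involutive i mirror mirror-involutive n

      act : Bool → Letter → S → S
      act b 𝐭 = tau (+ 0)
      act b 𝐮 = lam uf
      act b 𝐤 s = s
      act b 𝛉 = layer θf
      act b 𝐞 s = s
      act true 𝛈 = layer ηf
      act false 𝛈 = layer ηf⁻
      act b 𝐚 = lam (hd (az 𝐚))
      act b 𝐛 = lam (hd (az 𝐛))
      act b (𝐫 i) = lam (hd (az (𝐫 i)))
      act b (𝐲₁ i) = lam (hd (az (𝐲₁ i)))
      act b (𝐲₂ i) = lam (hd (az (𝐲₂ i)))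

      private
        η-inverse : ∀ l → (ηf (ηf⁻ l) ≡ l) × (ηf⁻ (ηf l) ≡ l)
        η-inverse 0# = refl , refl
        η-inverse 1# = refl , refl
        η-inverse 2# = refl , refl
        η-inverse 3# = refl , refl
        η-inverse 4# = refl , refl

      act-inverse : ∀ b g s → act b g (act (not b) g s) ≡ s
      act-inverse b 𝐚 s = lam-involutive (hd-involutive (az-involutive 𝐚)) s
      act-inverse b 𝐛 s = lam-involutive (hd-involutive (az-involutive 𝐛)) s
      act-inverse b 𝐭 s = tau-involutive (+ 0) s
      act-inverse b 𝐮 s = lam-involutive uf-involutive s
      act-inverse b 𝐤 s = refl
      act-inverse b 𝛉 (p , l) = cong (p ,_) (θ-involutive l)
      act-inverse true 𝛈 (p , l) = cong (p ,_) (proj₁ (η-inverse l))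
      act-inverse false 𝛈 (p , l) = cong (p ,_) (proj₂ (η-inverse l))
      act-inverse b 𝐞 s = refl
      act-inverse b (𝐫 i) s = lam-involutive (hd-involutive (az-involutive (𝐫 i))) s
      act-inverse b (𝐲₁ i) s = lam-involutive (hd-involutive (az-involutive (𝐲₁ i))) s
      act-inverse b (𝐲₂ i) s = lam-involutive (hd-involutive (az-involutive (𝐲₂ i))) s

      κb : Bool → Layer → Layer
      κb true = κf
      κb false l = l

      -- b tells whether 𝐤 acts at p, that is, whether the head of p does not halt
      Active : List ℤ → Bool → Set
      Active [] b = b ≡ false
      Active (n ∷ w) true = Halts n → R
      Active (n ∷ w) false = Halts n

      active? : ∀ p → 𝕄 (Σ Bool (Active p))
      active? [] = ret (false , refl)
      active? (n ∷ w) k = k (true , λ x → k (false , x))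

      private
        active-unique : ∀ p {b c} → Active p b → Active p c → 𝕄 (b ≡ c)
        active-unique [] refl refl = ret refl
        active-unique (n ∷ w) {true} {true} x y = ret refl
        active-unique (n ∷ w) {true} {false} x y k = x y
        active-unique (n ∷ w) {false} {true} x y k = y x
        active-unique (n ∷ w) {false} {false} x y = ret refl

        κ⁻ : Bool → Layer → Layer
        κ⁻ b l = κb b (κb b l)

        κ-cube : ∀ b l → κb b (κb b (κb b l)) ≡ l
        κ-cube false l = refl
        κ-cube true 0# = refl
        κ-cube true 1# = refl
        κ-cube true 2# = refl
        κ-cube true 3# = refl
        κ-cube true 4# = refl

      -- Whether the head halts cannot be decided, so the bit is obtained only inside `𝕄`. Two
      -- contradictory bits for one list yield R, which is what functionality means here.
      kperm : RPerm
      kperm = record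
        { rel = krel
        ; total = λ (p , l) → active? p >>= λ (b , a) → ret ((p , κb b l) , b , a , refl)
        ; cototal = λ (p , l) → active? p >>= λ (b , a) → ret ((p , κ⁻ b l) , b , a , cong (p ,_) (sym (κ-cube b l)))
        ; functional = λ { {p , l} (b , a , refl) (c , a' , refl) → active-unique p a a' >>= λ { refl → ret refl } }
        ; cofunctional = λ { {s} {p , l} {p' , l'} (b , a , refl) (c , a' , e) → cofun p p' l l' a a' e } }
        where
        krel : S → S → Set
        krel (p , l) s = Σ Bool λ b → Active p b × s ≡ (p , κb b l)
        κ-injective : ∀ b {l l'} → κb b l ≡ κb b l' → l ≡ l'
        κ-injective b {l} {l'} e = trans (sym (κ-cube b l)) (trans (cong (λ z → κb b (κb b z)) e) (κ-cube b l'))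
        cofun : ∀ p p' l l' {b c} → Active p b → Active p' c → (p , κb b l) ≡ (p' , κb c l') → 𝕄 ((p , l) ≡ (p' , l'))
        cofun p p' l l' {b} a a' e with cong proj₁ e
        ... | refl = active-unique p a a' >>= λ { refl → ret (cong (p ,_) (κ-injective b (cong proj₂ e))) }

      tauP : ℕ → RPerm
      tauP n = involution (tau (+ n)) (tau-involutive (+ n))

      module Valued (e : RPerm) where

        val : Letter → RPerm
        val 𝐤 = kperm
        val 𝐞 = e
        val g = perm (act true g) (act false g) (act-inverse true g) (act-inverse false g)

        -- Plain letters act by honest functions, so their relators can be checked pointwise. `Mach`
        -- letters act on the head alone, which reduces their relators to identities between maps of
        -- ℤ.
        Plain Mach : Letter → Set
        Plain 𝐤 = ⊥
        Plain 𝐞 = ⊥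
        Plain _ = ⊤
        Mach 𝐚 = ⊤
        Mach 𝐛 = ⊤
        Mach (inj₂ _) = ⊤
        Mach _ = ⊥

        open GroupKit group using (_≈_; _∙_; ε; pow; ≈-refl)
        open Eval group val

        PlainW MachW : Word → Set
        PlainW = All (λ x → Plain (proj₂ x))
        MachW = All (λ x → Mach (proj₂ x))

        private
          mach⇒plain : ∀ {w} → MachW w → PlainW w
          mach⇒plain [] = []
          mach⇒plain {(_ , g) ∷ w} (m ∷ ms) = one g m ∷ mach⇒plain ms
            where
            one : ∀ g → Mach g → Plain g
            one 𝐚 m = tt
            one 𝐛 m = tt
            one (𝐫 i) m = tt
            one (𝐲₁ i) m = tt
            one (𝐲₂ i) m = tt

          all-inv : ∀ {P : Letter → Set} w → All (λ x → P (proj₂ x)) w → All (λ x → P (proj₂ x)) (inv w)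
          all-inv [] [] = []
          all-inv ((s , g) ∷ w) (p ∷ ps) = Allₚ.++⁺ (all-inv w ps) (p ∷ [])

          all-pow : ∀ {P : Letter → Set} n w → All (λ x → P (proj₂ x)) w → All (λ x → P (proj₂ x)) (powW n w)
          all-pow zero w p = []
          all-pow (suc n) w p = Allₚ.++⁺ p (all-pow n w p)

          all-conj : ∀ {P : Letter → Set} u v → All (λ x → P (proj₂ x)) u → All (λ x → P (proj₂ x)) v → All (λ x → P (proj₂ x)) (conjW u v)
          all-conj u v p q = Allₚ.++⁺ p (Allₚ.++⁺ q (all-inv u p))

          all-eq : ∀ {P : Letter → Set} u v → All (λ x → P (proj₂ x)) u → All (λ x → P (proj₂ x)) v → All (λ x → P (proj₂ x)) (eqW u v)
          all-eq u v p q = Allₚ.++⁺ p (all-inv v q)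

        actW : Word → S → S
        actW [] s = s
        actW ((b , g) ∷ w) s = act b g (actW w s)

        actZ : Word → ℤ → ℤ
        actZ [] n = n
        actZ ((b , g) ∷ w) n = az g (actZ w n)

        private
          actW-++ : ∀ u v s → actW (u ++ v) s ≡ actW u (actW v s)
          actW-++ [] v s = refl
          actW-++ ((b , g) ∷ u) v s = cong (act b g) (actW-++ u v s)

          actZ-++ : ∀ u v n → actZ (u ++ v) n ≡ actZ u (actZ v n)
          actZ-++ [] v n = refl
          actZ-++ ((b , g) ∷ u) v n = cong (az g) (actZ-++ u v n)

          actW-inv : ∀ w s → actW w (actW (inv w) s) ≡ s
          actW-inv [] s = refl
          actW-inv ((b , g) ∷ w) s = trans (cong (λ z → act b g (actW w z)) (actW-++ (inv w) _ s))
            (trans (cong (act b g) (actW-inv w _)) (act-inverse b g s))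

          actZ-inv : ∀ w n → actZ w (actZ (inv w) n) ≡ n
          actZ-inv [] n = refl
          actZ-inv ((b , g) ∷ w) n = trans (cong (λ z → az g (actZ w z)) (actZ-++ (inv w) _ n))
            (trans (cong (az g) (actZ-inv w _)) (az-involutive g n))

          actZ-inv' : ∀ w n → actZ (inv w) (actZ w n) ≡ n
          actZ-inv' [] n = refl
          actZ-inv' ((b , g) ∷ w) n = trans (actZ-++ (inv w) _ _)
            (trans (cong (actZ (inv w)) (az-involutive g (actZ w n))) (actZ-inv' w n))

          actW-mach : ∀ {w} → MachW w → ∀ s → actW w s ≡ lam (hd (actZ w)) s
          actW-mach [] (p , l) = cong (_, l) (sym (sel-id l (hd-id (λ _ → refl)) p))
          actW-mach {(b , g) ∷ w} (m ∷ ms) (p , l) = trans (cong (act b g) (actW-mach ms (p , l)))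
              (trans (one b g m _) (cong (_, l) (sel-∘ l (hd-∘ (az g) (actZ w)) p)))
            where
            one : ∀ b g → Mach g → ∀ s → act b g s ≡ lam (hd (az g)) s
            one b 𝐚 m s = refl
            one b 𝐛 m s = refl
            one b (𝐫 i) m s = refl
            one b (𝐲₁ i) m s = refl
            one b (𝐲₂ i) m s = refl

          track : ∀ {w} → PlainW w → ∀ s → rel (ev w) s (actW w s)
          track [] s = refl
          track {(b , g) ∷ w} (m ∷ ms) s = actW w s , track ms s , one b g m _
            where
            one : ∀ b g → Plain g → ∀ s → rel (sgn b (val g)) s (act b g s)
            one true 𝐤 ()
            one true 𝐞 ()
            one false 𝐤 ()
            one false 𝐞 ()
            one true 𝐚 m s = refl
            one true 𝐛 m s = refl
            one true 𝐭 m s = refl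
            one true 𝐮 m s = refl
            one true 𝛉 m s = refl
            one true 𝛈 m s = refl
            one true (𝐫 i) m s = refl
            one true (𝐲₁ i) m s = refl
            one true (𝐲₂ i) m s = refl
            one false 𝐚 m s = act-inverse true 𝐚 s
            one false 𝐛 m s = act-inverse true 𝐛 s
            one false 𝐭 m s = act-inverse true 𝐭 s
            one false 𝐮 m s = act-inverse true 𝐮 s
            one false 𝛉 m s = act-inverse true 𝛉 s
            one false 𝛈 m s = act-inverse true 𝛈 s
            one false (𝐫 i) m s = act-inverse true (𝐫 i) s
            one false (𝐲₁ i) m s = act-inverse true (𝐲₁ i) s
            one false (𝐲₂ i) m s = act-inverse true (𝐲₂ i) s

          plain≈ε : ∀ {w} → PlainW w → (∀ s → actW w s ≡ s) → ev w ≈ ε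
          plain≈ε {w} P h s = ret (s , subst (rel (ev w) s) (h s) (track P s) , refl)

          plain-eq : ∀ u v → PlainW u → PlainW v → (∀ s → actW u s ≡ actW v s) → ev (eqW u v) ≈ ε
          plain-eq u v P P' h = plain≈ε (all-eq u v P P') λ s →
            trans (actW-++ u (inv v) s) (trans (h (actW (inv v) s)) (actW-inv v s))

          mach-comm : ∀ u v → MachW u → MachW v → (∀ n → actZ u (actZ v n) ≡ actZ v (actZ u n)) → ev (commW u v) ≈ ε
          mach-comm u v P P' h = plain-eq (conjW u v) v (mach⇒plain (all-conj u v P P')) (mach⇒plain P') λ (p , l) →
            trans (actW-mach (all-conj u v P P') (p , l)) (trans (cong (_, l) (sel-cong l p)) (sym (actW-mach P' (p , l))))
            where
            eq : ∀ n → actZ (conjW u v) n ≡ actZ v n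
            eq n = trans (actZ-++ u (v ++ inv u) n) (trans (cong (actZ u) (actZ-++ v (inv u) n))
              (trans (h (actZ (inv u) n)) (cong (actZ v) (actZ-inv u n))))
            hd-cong : ∀ p → hd (actZ (conjW u v)) p ≡ hd (actZ v) p
            hd-cong [] = refl
            hd-cong (n ∷ w) = cong (_∷ w) (eq n)
            sel-cong : ∀ l p → sel l (hd (actZ (conjW u v))) p ≡ sel l (hd (actZ v)) p
            sel-cong 0# p = hd-cong p
            sel-cong 1# p = hd-cong p
            sel-cong 2# p = hd-cong p
            sel-cong 3# p = hd-cong p
            sel-cong 4# p = refl

          -- A mark at position `n` is moved to the image of `n`. On layer 4 the word `u` does not
          -- act, but neither does the mark, since `θf` fixes that layer.
          conj-tau : ∀ u v {n n'} → MachW u → (∀ s → actW v s ≡ tau n s) → actZ u n ≡ n' → ∀ s → actW (conjW u v) s ≡ tau n' s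
          conj-tau u v {n} {n'} P hv hu s = trans (actW-++ u (v ++ inv u) s) (trans (actW-mach P _)
              (trans (cong (lam (hd (actZ u))) (trans (actW-++ v (inv u) s) (trans (hv _) (cong (tau n) (actW-mach (all-inv u P) s))))) (go s)))
            where
            same : ∀ m → does (actZ (inv u) m ℤₚ.≟ n) ≡ does (m ℤₚ.≟ n')
            same m with actZ (inv u) m ℤₚ.≟ n | m ℤₚ.≟ n'
            ... | yes _ | yes _ = refl
            ... | no _ | no _ = refl
            ... | yes a | no b = ⊥-elim (b (trans (sym (actZ-inv u m)) (trans (cong (actZ u) a) hu)))
            ... | no a | yes b = ⊥-elim (a (trans (cong (actZ (inv u)) (trans b (sym hu))) (actZ-inv' u n)))
            inΛ : ∀ l b m w → sel l (hd (actZ u)) (actZ (inv u) m ∷ w) ≡ m ∷ w →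
              sel (tl b l) (hd (actZ u)) (actZ (inv u) m ∷ w) ≡ m ∷ w
            inΛ l false m w e = e
            inΛ 0# true m w e = e
            inΛ 1# true m w e = e
            inΛ 2# true m w e = e
            inΛ 3# true m w e = e
            inΛ 4# true m w e = e
            move : ∀ l m w → sel l (hd (actZ (inv u))) (m ∷ w) ≡ actZ (inv u) m ∷ w → sel l (hd (actZ u)) (actZ (inv u) m ∷ w) ≡ m ∷ w →
              lam (hd (actZ u)) (tau n (lam (hd (actZ (inv u))) (m ∷ w , l))) ≡ tau n' (m ∷ w , l)
            move l m w e e' rewrite e = cong₂ _,_ (inΛ l (does (actZ (inv u) m ℤₚ.≟ n)) m w e') (cong (λ b → tl b l) (same m))
            back : ∀ m w → hd (actZ u) (actZ (inv u) m ∷ w) ≡ m ∷ w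
            back m w = cong (_∷ w) (actZ-inv u m)
            go : ∀ s → lam (hd (actZ u)) (tau n (lam (hd (actZ (inv u))) s)) ≡ tau n' s
            go ([] , 0#) = refl
            go ([] , 1#) = refl
            go ([] , 2#) = refl
            go ([] , 3#) = refl
            go ([] , 4#) = refl
            go (m ∷ w , 0#) = move 0# m w refl (back m w)
            go (m ∷ w , 1#) = move 1# m w refl (back m w)
            go (m ∷ w , 2#) = move 2# m w refl (back m w)
            go (m ∷ w , 3#) = move 3# m w refl (back m w)
            go (m ∷ w , 4#) with does (m ℤₚ.≟ n) | does (m ℤₚ.≟ n')
            ... | true | true = refl
            ... | true | false = refl
            ... | false | true = refl
            ... | false | false = refl

          x-mach : MachW 𝐱
          x-mach = tt ∷ tt ∷ []

          x-pow : ∀ k n → actZ (powW k 𝐱) n ≡ + k + n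
          x-pow zero n = sym (ℤₚ.+-identityˡ n)
          x-pow (suc k) n = trans (actZ-++ 𝐱 (powW k 𝐱) n) (trans (neg-mirror (actZ (powW k 𝐱) n))
            (trans (cong (λ z → + 1 + z) (x-pow k n)) (sym (ℤₚ.+-assoc (+ 1) (+ k) n))))

          T-plain : ∀ n → PlainW (𝐓 n)
          T-plain n = all-conj (powW n 𝐱) (gen 𝐭) (mach⇒plain (all-pow n 𝐱 x-mach)) (tt ∷ [])

          actW-T : ∀ n s → actW (𝐓 n) s ≡ tau (+ n) s
          actW-T n = conj-tau (powW n 𝐱) (gen 𝐭) (all-pow n 𝐱 x-mach) (λ _ → refl)
            (trans (x-pow n (+ 0)) (ℤₚ.+-identityʳ (+ n)))

          module _ (i : Fin ρ) where
            open Rule (rule i) using (α; M; α'; M')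

            y-mach : MachW (𝐲 i)
            y-mach = tt ∷ tt ∷ []
            y'-mach : MachW (𝐲' i)
            y'-mach = all-conj (gen (𝐫 i)) (𝐲 i) (tt ∷ []) y-mach
            z-mach : MachW (𝐳 i)
            z-mach = all-eq (powW M 𝐱) (𝐲 i) (all-pow M 𝐱 x-mach) y-mach
            z'-mach : MachW (𝐳' i)
            z'-mach = all-eq (powW M' 𝐱) (𝐲' i) (all-pow M' 𝐱 x-mach) y'-mach

            y-pt : ∀ j → actZ (𝐲 i) (Src.pt i j) ≡ Src.pt i (+ 1 + j)
            y-pt j = trans (cong (az (𝐲₁ i)) (Src.onClass-pt i mirror j))
              (trans (Src.onClass-pt i negate (mirror j)) (cong (Src.pt i) (neg-mirror j)))

            y-off : ∀ {n} → ¬ Src.Member i n → actZ (𝐲 i) n ≡ n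
            y-off ¬m = trans (cong (az (𝐲₁ i)) (Src.onClass-off i mirror ¬m)) (Src.onClass-off i negate ¬m)

            module Tr = Swp.Transport i (actZ (𝐲 i)) y-pt y-off

            y'-pt : ∀ j → actZ (𝐲' i) (Tgt.pt i j) ≡ Tgt.pt i (+ 1 + j)
            y'-pt = Tr.conj-pt
            y'-off : ∀ {n} → ¬ Tgt.Member i n → actZ (𝐲' i) n ≡ n
            y'-off = Tr.conj-off

            module Gl = Src.Glide i (actZ (𝐲 i)) (actZ (inv (𝐲 i))) y-pt y-off (actZ-inv (𝐲 i)) (actZ-inv' (𝐲 i))
            module Gl' = Tgt.Glide i (actZ (𝐲' i)) (actZ (inv (𝐲' i))) y'-pt y'-off (actZ-inv (𝐲' i)) (actZ-inv' (𝐲' i))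

            z≡ : ∀ n → actZ (𝐳 i) n ≡ Gl.z n
            z≡ n = trans (actZ-++ (powW M 𝐱) (inv (𝐲 i)) n) (x-pow M _)
            z'≡ : ∀ n → actZ (𝐳' i) n ≡ Gl'.z n
            z'≡ n = trans (actZ-++ (powW M' 𝐱) (inv (𝐲' i)) n) (x-pow M' _)

            α≡pt : + α ≡ Src.pt i (+ 0)
            α≡pt = sym (ℤₚ.+-identityʳ (+ α))
            α'≡pt : + α' ≡ Tgt.pt i (+ 0)
            α'≡pt = sym (ℤₚ.+-identityʳ (+ α'))

            rel-zy : ev (commW (𝐳 i) (𝐲 i)) ≈ ε
            rel-zy = mach-comm (𝐳 i) (𝐲 i) z-mach y-mach λ n →
              trans (z≡ _) (trans (Gl.zy n) (cong (actZ (𝐲 i)) (sym (z≡ n))))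
            rel-zy' : ev (commW (𝐳' i) (𝐲' i)) ≈ ε
            rel-zy' = mach-comm (𝐳' i) (𝐲' i) z'-mach y'-mach λ n →
              trans (z'≡ _) (trans (Gl'.zy n) (cong (actZ (𝐲' i)) (sym (z'≡ n))))

            conj-T : ∀ u {n n'} → MachW u → actZ u (+ n) ≡ + n' → ev (eqW (conjW u (𝐓 n)) (𝐓 n')) ≈ ε
            conj-T u {n} {n'} P hu = plain-eq (conjW u (𝐓 n)) (𝐓 n') (all-conj u (𝐓 n) (mach⇒plain P) (T-plain n)) (T-plain n')
              λ s → trans (conj-tau u (𝐓 n) P (actW-T n) hu s) (sym (actW-T n' s))

            rel-zT : ev (commW (𝐳 i) (𝐓 α)) ≈ ε
            rel-zT = conj-T (𝐳 i) z-mach (trans (z≡ (+ α)) (trans (cong Gl.z α≡pt) (trans (Gl.z-pt (+ 0)) (sym α≡pt))))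
            rel-zT' : ev (commW (𝐳' i) (𝐓 α')) ≈ ε
            rel-zT' = conj-T (𝐳' i) z'-mach (trans (z'≡ (+ α')) (trans (cong Gl'.z α'≡pt) (trans (Gl'.z-pt (+ 0)) (sym α'≡pt))))
            rel-rT : ev (eqW (conjW (gen (𝐫 i)) (𝐓 α)) (𝐓 α')) ≈ ε
            rel-rT = conj-T (gen (𝐫 i)) (tt ∷ []) (trans (cong (Swp.swap i) α≡pt) (trans (Swp.swap-pt i (+ 0)) (sym α'≡pt)))

          rho : S → S
          rho s = layer θf (layer ηf s)

          five-plain : ∀ g → Plain g → ∀ {F} → (∀ p → F (F p) ≡ p) → (∀ s → act true g s ≡ lam F s) → ev (five 5 g) ≈ ε
          five-plain g P {F} FF h = plain≈ε {five 5 g} (all-pow 5 (gen g ++ 𝛒) (P ∷ tt ∷ tt ∷ [])) λ s →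
            trans (step (step (step (step (h _))))) (five-lam FF s)
            where
            step : ∀ {s s'} → s ≡ lam F s' → act true g (rho s) ≡ lam F (rho (lam F s'))
            step refl = h _

          two-plain : ∀ g → Plain g → (∀ s → act true g (act true g s) ≡ s) → ev (order 2 g) ≈ ε
          two-plain g P h = plain≈ε {order 2 g} (P ∷ P ∷ []) h

          mach-inv : ∀ g p → hd (az g) (hd (az g) p) ≡ p
          mach-inv g = hd-involutive (az-involutive g)

          Lay : List ℤ → RPerm → (Layer → Layer) → Set
          Lay p f F = ∀ l → rel f (p , l) (p , F l)

          lay : Bool → Letter → Layer → Layer
          lay b 𝐤 = κb b
          lay b 𝛉 = θf
          lay b 𝛈 = ηf
          lay b _ l = l

          layW : Bool → Word → Layer → Layer
          layW b [] l = l
          layW b ((_ , g) ∷ w) l = lay b g (layW b w l)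

          LayerW : Word → Set
          LayerW = All λ { (true , 𝐤) → ⊤ ; (true , 𝛉) → ⊤ ; (true , 𝛈) → ⊤ ; _ → ⊥ }

          Lay-k : ∀ {p b} → Active p b → Lay p kperm (κb b)
          Lay-k {p} {b} a l = b , a , refl

          lay-word : ∀ {p b w} → Active p b → LayerW w → Lay p (ev w) (layW b w)
          lay-word a [] l = refl
          lay-word {w = (true , 𝐤) ∷ w} a (_ ∷ ms) l = _ , lay-word a ms l , Lay-k a _
          lay-word {w = (true , 𝛉) ∷ w} a (_ ∷ ms) l = _ , lay-word a ms l , refl
          lay-word {w = (true , 𝛈) ∷ w} a (_ ∷ ms) l = _ , lay-word a ms l , refl

          -- Such words leave the list alone and depend on it only through the bit for `𝐤`, so
          -- checking both bits on five layers is enough.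
          layer≈ε : ∀ {w} → LayerW w → (∀ b l → layW b w l ≡ l) → ev w ≈ ε
          layer≈ε {w} P h (p , l) = active? p >>= λ (b , a) →
            ret ((p , l) , subst (λ z → rel (ev w) (p , l) (p , z)) (h b l) (lay-word a P l) , refl)

          rel-k³ : ev (order 3 𝐤) ≈ ε
          rel-k³ = layer≈ε {order 3 𝐤} (tt ∷ tt ∷ tt ∷ []) κ-cube

          rel-kρ : ev (five 5 𝐤) ≈ ε
          rel-kρ = layer≈ε {five 5 𝐤} (tt ∷ tt ∷ tt ∷ tt ∷ tt ∷ tt ∷ tt ∷ tt ∷ tt ∷ tt ∷ tt ∷ tt ∷ tt ∷ tt ∷ tt ∷ []) check
            where
            check : ∀ b l → layW b (five 5 𝐤) l ≡ l
            check true 0# = refl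
            check true 1# = refl
            check true 2# = refl
            check true 3# = refl
            check true 4# = refl
            check false 0# = refl
            check false 1# = refl
            check false 2# = refl
            check false 3# = refl
            check false 4# = refl

          rel-η³ : ev (order 3 𝛈) ≈ ε
          rel-η³ = layer≈ε {order 3 𝛈} (tt ∷ tt ∷ tt ∷ []) check
            where
            check : ∀ b l → layW b (order 3 𝛈) l ≡ l
            check b 0# = refl
            check b 1# = refl
            check b 2# = refl
            check b 3# = refl
            check b 4# = refl

          rel-ρ⁵ : ev (powW 5 𝛒) ≈ ε
          rel-ρ⁵ = layer≈ε {powW 5 𝛒} (tt ∷ tt ∷ tt ∷ tt ∷ tt ∷ tt ∷ tt ∷ tt ∷ tt ∷ tt ∷ []) check
            where
            check : ∀ b l → layW b (powW 5 𝛒) l ≡ l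
            check b 0# = refl
            check b 1# = refl
            check b 2# = refl
            check b 3# = refl
            check b 4# = refl

          Lay-T : ∀ p n → Lay p (ev (𝐓 n)) (tl (headIs (+ n) p))
          Lay-T p n l = subst (rel (ev (𝐓 n)) (p , l)) (actW-T n (p , l)) (track (T-plain n) (p , l))

          inactive : ∀ p n {b} → Active p b → headIs n p ≡ true → Halts n → 𝕄 (b ≡ false)
          inactive (m ∷ w) n {b} a e hn with m ℤₚ.≟ n
          inactive (m ∷ w) n {true} a e hn | yes refl = λ _ → a hn
          inactive (m ∷ w) n {false} a e hn | yes refl = ret refl

          active : ∀ p n {b} → Active p b → headIs n p ≡ true → (Halts n → R) → 𝕄 (b ≡ true)
          active (m ∷ w) n {b} a e hn with m ℤₚ.≟ n
          active (m ∷ w) n {true} a e hn | yes refl = ret refl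
          active (m ∷ w) n {false} a e hn | yes refl = λ _ → hn a

          -- `𝐓 h` acts only on lists with head `h`. This head halts, so `𝐤` is the identity there.
          rel-kT : ev (commW (gen 𝐤) (𝐓 h)) ≈ ε
          rel-kT = comm-ev (gen 𝐤) (𝐓 h) kperm (ev (𝐓 h)) (ev-gen 𝐤) (≈-refl {ev (𝐓 h)}) commute
            where
            commute : kperm ∙ ev (𝐓 h) ≈ ev (𝐓 h) ∙ kperm
            commute (p , l) = active? p >>= λ (b , a) → go b a (headIs (+ h) p) refl
              where
              chain : ∀ b → Active p b → κb b (tl (headIs (+ h) p) l) ≡ tl (headIs (+ h) p) (κb b l) →
                𝕄 (Σ S λ s' → rel (kperm ∙ ev (𝐓 h)) (p , l) s' × rel (ev (𝐓 h) ∙ kperm) (p , l) s')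
              chain b a eq = ret (_ , ((p , tl (headIs (+ h) p) l) , Lay-T p h l , Lay-k a _)
                , ((p , κb b l) , Lay-k a l , subst (λ z → rel (ev (𝐓 h)) (p , κb b l) (p , z)) (sym eq) (Lay-T p h (κb b l))))
              go : ∀ b → Active p b → ∀ c → headIs (+ h) p ≡ c →
                𝕄 (Σ S λ s' → rel (kperm ∙ ev (𝐓 h)) (p , l) s' × rel (ev (𝐓 h) ∙ kperm) (p , l) s')
              go b a false e = chain b a (trans (cong (λ c → κb b (tl c l)) e) (sym (cong (λ c → tl c (κb b l)) e)))
              go b a true e = inactive p (+ h) a e halts-h >>= λ { refl → chain false a refl }

        T≈tauP : ∀ n → ev (𝐓 n) ≈ tauP n
        T≈tauP n s = ret (tau (+ n) s , subst (rel (ev (𝐓 n)) s) (actW-T n s) (track (T-plain n) s) , refl)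

        -- Away from the head `c₀` only `κf` or the identity acts, with trivial cube. At `c₀`,
        -- halting would yield R, so `𝐤` may be taken to act, and `κf` after `θf` is a 3-cycle.
        cube : pow 3 (kperm ∙ ev (𝐓 c₀)) ≈ ε
        cube (p , l) = active? p >>= λ (b , a) → go b a (headIs (+ c₀) p) refl
          where
          chain : ∀ b → Active p b → (let f = λ l → κb b (tl (headIs (+ c₀) p) l) in f (f (f l)) ≡ l) →
            𝕄 (Σ S λ s' → rel (pow 3 (kperm ∙ ev (𝐓 c₀))) (p , l) s' × ((p , l) ≡ s'))
          chain b a eq = ret ((p , l) , (_ , (_ , (_ , refl , kT l) , kT (f l)) , subst (λ z → rel (kperm ∙ ev (𝐓 c₀)) (p , f (f l)) (p , z)) eq (kT (f (f l)))) , refl)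
            where
            f : Layer → Layer
            f l = κb b (tl (headIs (+ c₀) p) l)
            kT : ∀ l → rel (kperm ∙ ev (𝐓 c₀)) (p , l) (p , f l)
            kT l = (p , tl (headIs (+ c₀) p) l) , Lay-T p c₀ l , Lay-k a _
          κθ : ∀ l → κf (θf (κf (θf (κf (θf l))))) ≡ l
          κθ 0# = refl
          κθ 1# = refl
          κθ 2# = refl
          κθ 3# = refl
          κθ 4# = refl
          go : ∀ b → Active p b → ∀ c → headIs (+ c₀) p ≡ c → 𝕄 (Σ S λ s' → rel (pow 3 (kperm ∙ ev (𝐓 c₀))) (p , l) s' × ((p , l) ≡ s'))
          go b a false e = chain b a (subst (λ c → κb b (tl c (κb b (tl c (κb b (tl c l))))) ≡ l) (sym e) (κ-cube b l))
          go b a true e = active p (+ c₀) a e halts-c₀ >>= λ { refl →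
            chain true a (subst (λ c → κf (tl c (κf (tl c (κf (tl c l))))) ≡ l) (sym e) (κθ l)) }

        private
          -- An instruction exchanges positions that halt together, so it preserves the bit for `𝐤`;
          -- and `κf` preserves the set of layers on which the exchange takes place.
          rel-rk : ∀ i → machine i ≡ true → ev (commW (gen (𝐫 i)) (gen 𝐤)) ≈ ε
          rel-rk i mi = comm-ev (gen (𝐫 i)) (gen 𝐤) (val (𝐫 i)) kperm (ev-gen (𝐫 i)) (ev-gen 𝐤) commute
            where
            F : List ℤ → List ℤ
            F = hd (Swp.swap i)
            move : ∀ n w {b} → Active (n ∷ w) b → Active (Swp.swap i n ∷ w) b
            move n w {b} a = go (Src.member? i n) (Tgt.member? i n)
              where
              transport : ∀ {n n'} b → (Halts n → Halts n') → (Halts n' → Halts n) → Active (n ∷ w) b → Active (n' ∷ w) b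
              transport true f g a = a ∘ g
              transport false f g a = f a
              go : Dec (Src.Member i n) → Dec (Tgt.Member i n) → Active (Swp.swap i n ∷ w) b
              go (yes (j , refl)) _ = subst (λ z → Active (z ∷ w) b) (sym (Swp.swap-pt i j))
                (transport b (proj₁ (halts-rule i mi j)) (proj₂ (halts-rule i mi j)) a)
              go (no _) (yes (j , refl)) = subst (λ z → Active (z ∷ w) b) (sym (Swp.swap-pt' i j))
                (transport b (proj₂ (halts-rule i mi j)) (proj₁ (halts-rule i mi j)) a)
              go (no ¬m) (no ¬m') = subst (λ z → Active (z ∷ w) b) (sym (Swp.swap-off i ¬m ¬m')) a
            moveF : ∀ p {b} → Active p b → Active (F p) b
            moveF [] a = a
            moveF (n ∷ w) {b} a = move n w {b} a
            movel : ∀ p l {b} → Active p b → Active (sel l F p) b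
            movel p 0# {b} a = moveF p {b} a
            movel p 1# {b} a = moveF p {b} a
            movel p 2# {b} a = moveF p {b} a
            movel p 3# {b} a = moveF p {b} a
            movel p 4# a = a
            sel-κ : ∀ b l p → sel (κb b l) F p ≡ sel l F p
            sel-κ false l p = refl
            sel-κ true 0# p = refl
            sel-κ true 1# p = refl
            sel-κ true 2# p = refl
            sel-κ true 3# p = refl
            sel-κ true 4# p = refl
            commute : val (𝐫 i) ∙ kperm ≈ kperm ∙ val (𝐫 i)
            commute (p , l) = active? p >>= λ (b , a) → ret (_ , (_ , Lay-k a l , refl) ,
              ((sel l F p , l) , refl , b , movel p l a , cong (_, κb b l) (sel-κ b l p)))

        relations : ∀ i → ev (relator false false i) ≈ ε
        relations (inj₁ i) = at base i
          where
          at : ∀ {n} {ws : Vec Word n} → Allᵥ (λ w → ev w ≈ ε) ws → ∀ i → ev (lookup ws i) ≈ ε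
          at (p ∷ ps) zero = p
          at (p ∷ ps) (suc i) = at ps i
          base : Allᵥ (λ w → ev w ≈ ε) (baseRel false false)
          base = rel-η³ ∷ rel-ρ⁵
            ∷ plain-eq (gen 𝛉) (gen 𝐭 ++ conjW (gen 𝐮) (gen 𝐭)) (tt ∷ []) (tt ∷ tt ∷ tt ∷ tt ∷ []) θ-tutu
            ∷ two-plain 𝐭 tt (tau-involutive (+ 0))
            ∷ rel-k³ ∷ rel-kρ ∷ rel-kT
            ∷ two-plain 𝐚 tt (lam-involutive (mach-inv 𝐚))
            ∷ two-plain 𝐛 tt (lam-involutive (mach-inv 𝐛))
            ∷ two-plain 𝐮 tt (lam-involutive uf-involutive)
            ∷ five-plain 𝐚 tt (mach-inv 𝐚) (λ _ → refl)
            ∷ five-plain 𝐛 tt (mach-inv 𝐛) (λ _ → refl)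
            ∷ five-plain 𝐮 tt uf-involutive (λ _ → refl)
            ∷ ≈-refl {ε} ∷ ≈-refl {ε} ∷ []
        relations (inj₂ (i , j)) = at rules j
          where
          at : ∀ {n} {ws : Vec Word n} → Allᵥ (λ w → ev w ≈ ε) ws → ∀ i → ev (lookup ws i) ≈ ε
          at (p ∷ ps) zero = p
          at (p ∷ ps) (suc i) = at ps i
          guarded : ∀ b → machine i ≡ b → ev (when b (commW (gen (𝐫 i)) (gen 𝐤))) ≈ ε
          guarded true e = rel-rk i e
          guarded false e = ≈-refl {ε}
          rules : Allᵥ (λ w → ev w ≈ ε) (ruleRel i)
          rules = rel-zy i ∷ rel-zT i ∷ rel-zy' i ∷ rel-zT' i ∷ rel-rT i ∷ guarded (machine i) refl
            ∷ two-plain (𝐫 i) tt (lam-involutive (mach-inv (𝐫 i)))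
            ∷ two-plain (𝐲₁ i) tt (lam-involutive (mach-inv (𝐲₁ i)))
            ∷ two-plain (𝐲₂ i) tt (lam-involutive (mach-inv (𝐲₂ i)))
            ∷ five-plain (𝐫 i) tt (mach-inv (𝐫 i)) (λ _ → refl)
            ∷ five-plain (𝐲₁ i) tt (mach-inv (𝐲₁ i)) (λ _ → refl)
            ∷ five-plain (𝐲₂ i) tt (mach-inv (𝐲₂ i)) (λ _ → refl)
            ∷ []

        -- The i-th power of the shift takes the list with single entry 0 to that with entry i, so
        -- equal powers give equal entries, up to R.
        shift-infinite : ∀ i j → i ≢ j → ev (powW i 𝐱) ≈ ev (powW j 𝐱) → R
        shift-infinite i j i≢j p = p s₀ λ (s' , r , r') →
          functional (ev (powW i 𝐱)) r (lands i) λ e →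
          functional (ev (powW j 𝐱)) r' (lands j) λ e' → ⊥-elim (i≢j (position (trans (sym e) e')))
          where
          s₀ : S
          s₀ = (+ 0 ∷ []) , 0#
          lands : ∀ k → rel (ev (powW k 𝐱)) s₀ ((+ k ∷ []) , 0#)
          lands k = subst (rel (ev (powW k 𝐱)) s₀)
            (trans (actW-mach (all-pow k 𝐱 x-mach) s₀) (cong (λ n → (n ∷ []) , 0#) (trans (x-pow k (+ 0)) (ℤₚ.+-identityʳ (+ k)))))
            (track (mach⇒plain (all-pow k 𝐱 x-mach)) s₀)
          position : ∀ {i j} → _≡_ {A = S} ((+ i ∷ []) , 0#) ((+ j ∷ []) , 0#) → i ≡ j
          position refl = refl

-- Gluing discs along closed walks without unwanted triangles

module Discs where

  open import Algebra.Bundles using (Group)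
  open import Data.Empty using (⊥; ⊥-elim)
  open import Data.Bool using (Bool; true; false; not)
  open import Data.Fin using (Fin; zero; suc; toℕ; fromℕ<)
  open import Data.Fin.Properties using (toℕ-fromℕ<; toℕ-injective)
  open import Data.List using (List; []; _∷_; _++_)
  open import Data.List.Properties using (++-assoc; ++-identityʳ)
  open import Data.Nat using (ℕ; zero; suc; _+_; _≤_; _<_; z≤n; s≤s)
  open import Data.Nat.Properties
  open import Data.Product using (Σ; _×_; _,_; proj₁; proj₂)
  open import Data.Sum using (_⊎_; inj₁; inj₂)
  open import Relation.Binary.PropositionalEquality using (_≡_; _≢_; refl; cong; cong₂; subst; sym; trans)
  open import Relation.Nullary using (Dec; yes; no)
  open Presentations using (module GroupKit)
  open Walks

  record Attachment : Set₁ where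
    field
      Y : Set
      _∼_ : Y → Y → Set
      ∼-sym : ∀ {x y} → x ∼ y → y ∼ x
      colour : Y → Bool
      bipartite : ∀ {x y} → x ∼ y → colour x ≢ colour y
      I : Set
      L : ℕ
      len : I → ℕ
      w : I → ℕ → Y
      1<len : ∀ i → 1 < len i
      len≤L : ∀ i → len i ≤ L
      closed : ∀ i → w i (len i) ≡ w i 0
      w-edge : ∀ i {j} → j < len i → w i j ∼ w i (suc j)

  -- A graph Y with a disc glued along each closed walk w i: a ring of vertices alongside the walk
  -- and a hub. The ring keeps the filled graph free of cliques other than those of the discs even
  -- if the walk visits vertices repeatedly.
  module Attach (𝒜 : Attachment) where
    open Attachment 𝒜

    -- Every disc receives `L` ring vertices whatever the length of its walk, so that the number of
    -- vertices is the same for all discs. Those beyond the length are padding, joined to the hub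
    -- only.
    data V : Set where
      pt : Y → V
      ring : I → Fin L → V
      hub : I → V

    infix 4 _~_
    data _~_ : V → V → Set where
      base : ∀ {x y} → x ∼ y → pt x ~ pt y
      here : ∀ {i j y} → toℕ j < len i → w i (toℕ j) ≡ y → pt y ~ ring i j
      here⁻ : ∀ {i j y} → toℕ j < len i → w i (toℕ j) ≡ y → ring i j ~ pt y
      there : ∀ {i j y} → toℕ j < len i → w i (suc (toℕ j)) ≡ y → pt y ~ ring i j
      there⁻ : ∀ {i j y} → toℕ j < len i → w i (suc (toℕ j)) ≡ y → ring i j ~ pt y
      next : ∀ {i j j'} → toℕ j' ≡ suc (toℕ j) → toℕ j' < len i → ring i j ~ ring i j'
      next⁻ : ∀ {i j j'} → toℕ j' ≡ suc (toℕ j) → toℕ j' < len i → ring i j' ~ ring i j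
      wrap : ∀ {i j j'} → suc (toℕ j) ≡ len i → toℕ j' ≡ 0 → ring i j ~ ring i j'
      wrap⁻ : ∀ {i j j'} → suc (toℕ j) ≡ len i → toℕ j' ≡ 0 → ring i j' ~ ring i j
      spoke : ∀ {i j} → ring i j ~ hub i
      spoke⁻ : ∀ {i j} → hub i ~ ring i j

    ~-sym : ∀ {u v} → u ~ v → v ~ u
    ~-sym (base e) = base (∼-sym e)
    ~-sym (here h e) = here⁻ h e
    ~-sym (here⁻ h e) = here h e
    ~-sym (there h e) = there⁻ h e
    ~-sym (there⁻ h e) = there h e
    ~-sym (next h e) = next⁻ h e
    ~-sym (next⁻ h e) = next h e
    ~-sym (wrap h e) = wrap⁻ h e
    ~-sym (wrap⁻ h e) = wrap h e
    ~-sym spoke = spoke⁻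
    ~-sym spoke⁻ = spoke

    open Homotopy _~_ public
    open Symmetric ~-sym public

    private
      -- a step of the ring, possibly around the corner
      data Succ (i : I) (j j' : Fin L) : Set where
        succ : toℕ j < len i → toℕ j' < len i → w i (suc (toℕ j)) ≡ w i (toℕ j') → ring i j ~ ring i j' → Succ i j j'

      next-succ : ∀ {i j j'} → toℕ j' ≡ suc (toℕ j) → toℕ j' < len i → Succ i j j'
      next-succ {i} {j} {j'} e h = succ (<-trans (subst (toℕ j <_) (sym e) ≤-refl) h) h (cong (w i) (sym e)) (next e h)

      wrap-succ : ∀ {i j j'} → suc (toℕ j) ≡ len i → toℕ j' ≡ 0 → Succ i j j'
      wrap-succ {i} {j} {j'} e h = succ (≤-reflexive e) (subst (_< len i) (sym h) (<-trans (s≤s z≤n) (1<len i)))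
        (trans (cong (w i) e) (trans (closed i) (cong (w i) (sym h)))) (wrap e h)

    tail : (ℕ → Y) → ℕ → ℕ → List V
    tail f a zero = []
    tail f a (suc k) = pt (f (suc a)) ∷ tail f (suc a) k

    private
      tail-path : ∀ i a k → a + k ≤ len i → Path (pt (w i a)) (tail (w i) a k) (pt (w i (a + k)))
      tail-path i a zero h = subst (λ z → Path (pt (w i a)) [] (pt (w i z))) (sym (+-identityʳ a)) []
      tail-path i a (suc k) h = base (w-edge i (≤-trans (s≤s (m≤m+n a k)) h'))
          ∷ subst (λ z → Path (pt (w i (suc a))) (tail (w i) (suc a) k) (pt (w i z))) (sym (+-suc a k)) (tail-path i (suc a) k h')
        where
        h' : suc (a + k) ≤ len i
        h' = subst (_≤ len i) (+-suc a k) h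

    walk : I → List V
    walk i = tail (w i) 0 (len i)

    private
      module _ (i : I) where
        y : ∀ {j} → j < len i → V
        y h = ring i (fromℕ< (<-≤-trans h (len≤L i)))

        idx : ∀ {j} (h : j < len i) → toℕ (fromℕ< (<-≤-trans h (len≤L i))) ≡ j
        idx h = toℕ-fromℕ< (<-≤-trans h (len≤L i))

        y-here : ∀ {j} (h : j < len i) → pt (w i j) ~ y h
        y-here h = here (subst (_< len i) (sym (idx h)) h) (cong (w i) (idx h))

        y-there : ∀ {j} (h : j < len i) → pt (w i (suc j)) ~ y h
        y-there h = there (subst (_< len i) (sym (idx h)) h) (cong (λ z → w i (suc z)) (idx h))

        y-next : ∀ {j} (h : j < len i) (h' : suc j < len i) → y h ~ y h'
        y-next h h' = next (trans (idx h') (cong suc (sym (idx h)))) (subst (_< len i) (sym (idx h')) h')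

        -- from w_a, go to y_a, walk along the ring and come back at the end
        slide : ∀ a k (h : a < len i) (e : suc a + k ≡ len i) →
          pt (w i a) ∷ tail (w i) a (suc k) ≃ pt (w i a) ∷ y h ∷ hub i ∷ y {a + k} (≤-reflexive e) ∷ pt (w i (len i)) ∷ []
        slide a zero h e = begin
          pt (w i a) ∷ pt (w i (suc a)) ∷ []                 ≈⟨ ≃-sym (shortcut [] (base (w-edge i h)) (y-there h) (y-here h)) ⟩
          pt (w i a) ∷ y h ∷ pt (w i (suc a)) ∷ []           ≈⟨ prefix (pt (w i a) ∷ []) (≃-sym (backtrack _ spoke)) ⟩
          pt (w i a) ∷ y h ∷ hub i ∷ y h ∷ pt (w i (suc a)) ∷ []
            ≡⟨ cong₂ (λ u v → pt (w i a) ∷ y h ∷ hub i ∷ u ∷ pt (w i v) ∷ []) (y-cong h (≤-reflexive e) (sym (+-identityʳ a))) (trans (sym (+-identityʳ (suc a))) e) ⟩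
          pt (w i a) ∷ y h ∷ hub i ∷ y (≤-reflexive e) ∷ pt (w i (len i)) ∷ []  ∎
          where
          open ≃-Reasoning
          y-cong : ∀ {j j'} (h : j < len i) (h' : j' < len i) → j ≡ j' → y h ≡ y h'
          y-cong h h' refl = cong y (<-irrelevant h h')
        slide a (suc k) h e = begin
          pt (w i a) ∷ pt (w i (suc a)) ∷ tail (w i) (suc a) (suc k)
            ≈⟨ prefix (pt (w i a) ∷ []) (slide (suc a) k h' (trans (sym (+-suc (suc a) k)) e)) ⟩
          pt (w i a) ∷ pt (w i (suc a)) ∷ y h' ∷ rest (≤-reflexive (trans (sym (+-suc (suc a) k)) e))
            ≈⟨ ≃-sym (shortcut _ (base (w-edge i h)) (y-there h) (y-here h)) ⟩
          pt (w i a) ∷ y h ∷ pt (w i (suc a)) ∷ y h' ∷ rest (≤-reflexive (trans (sym (+-suc (suc a) k)) e))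
            ≈⟨ prefix (pt (w i a) ∷ []) (shortcut _ (y-next h h') (~-sym (y-here h')) (~-sym (y-there h))) ⟩
          pt (w i a) ∷ y h ∷ y h' ∷ rest (≤-reflexive (trans (sym (+-suc (suc a) k)) e))
            ≈⟨ prefix (pt (w i a) ∷ []) (shortcut _ spoke spoke⁻ (y-next h h')) ⟩
          pt (w i a) ∷ y h ∷ rest (≤-reflexive (trans (sym (+-suc (suc a) k)) e))
            ≡⟨ cong (λ u → pt (w i a) ∷ y h ∷ hub i ∷ u ∷ pt (w i (len i)) ∷ []) (y-cong (≤-reflexive (trans (sym (+-suc (suc a) k)) e)) (≤-reflexive e) (sym (+-suc a k))) ⟩
          pt (w i a) ∷ y h ∷ rest (≤-reflexive e)   ∎
          where
          open ≃-Reasoning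
          h' : suc a < len i
          h' = subst (suc a <_) e (s≤s (subst (suc a ≤_) (sym (+-suc a k)) (s≤s (m≤m+n a k))))
          rest : ∀ {j} → j < len i → List V
          rest h = hub i ∷ y h ∷ pt (w i (len i)) ∷ []
          y-cong : ∀ {j j'} (h : j < len i) (h' : j' < len i) → j ≡ j' → y h ≡ y h'
          y-cong h h' refl = cong y (<-irrelevant h h')

    private
      predecessor : ∀ i → Σ ℕ λ k → suc k ≡ len i
      predecessor i = go (len i) (1<len i)
        where
        go : ∀ n → 1 < n → Σ ℕ λ k → suc k ≡ n
        go (suc k) _ = k , refl

    -- Pushed into the disc, the walk passes from the first ring vertex over the hub to the last
    -- one. These two are adjacent, and the detour is cancelled.
    contractible : ∀ i → pt (w i 0) ∷ walk i ≃ pt (w i 0) ∷ []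
    contractible i = begin
      pt (w i 0) ∷ tail (w i) 0 (len i)                         ≡⟨ cong (λ n → pt (w i 0) ∷ tail (w i) 0 n) (sym e) ⟩
      pt (w i 0) ∷ tail (w i) 0 (suc k)                         ≈⟨ slide i 0 k h₀ e ⟩
      pt (w i 0) ∷ y₀ ∷ hub i ∷ yₖ ∷ pt (w i (len i)) ∷ []      ≡⟨ cong (λ z → pt (w i 0) ∷ y₀ ∷ hub i ∷ yₖ ∷ pt z ∷ []) (closed i) ⟩
      pt (w i 0) ∷ y₀ ∷ hub i ∷ yₖ ∷ pt (w i 0) ∷ []            ≈⟨ prefix (pt (w i 0) ∷ y₀ ∷ hub i ∷ []) (≃-sym (shortcut [] yₖ~w (y-here i h₀) yₖ~y₀)) ⟩
      pt (w i 0) ∷ y₀ ∷ hub i ∷ yₖ ∷ y₀ ∷ pt (w i 0) ∷ []       ≈⟨ prefix (pt (w i 0) ∷ y₀ ∷ []) (shortcut _ spoke⁻ (~-sym yₖ~y₀) spoke⁻) ⟩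
      pt (w i 0) ∷ y₀ ∷ hub i ∷ y₀ ∷ pt (w i 0) ∷ []            ≈⟨ prefix (pt (w i 0) ∷ []) (backtrack _ spoke) ⟩
      pt (w i 0) ∷ y₀ ∷ pt (w i 0) ∷ []                         ≈⟨ backtrack [] (y-here i h₀) ⟩
      pt (w i 0) ∷ []                                           ∎
      where
      open ≃-Reasoning
      k = proj₁ (predecessor i)
      e = proj₂ (predecessor i)
      h₀ : 0 < len i
      h₀ = <-trans (s≤s z≤n) (1<len i)
      y₀ = y i h₀
      yₖ = y i {k} (≤-reflexive e)
      yₖ~y₀ : yₖ ~ y₀
      yₖ~y₀ = wrap (trans (cong suc (idx i (≤-reflexive e))) e) (idx i h₀)
      yₖ~w : yₖ ~ pt (w i 0)
      yₖ~w = subst (λ z → yₖ ~ pt z) (trans (cong (w i) e) (closed i)) (~-sym (y-there i (≤-reflexive e)))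

    module Routes (o : Y) (ωY : Y → List V) (ωY-path : ∀ x → Path (pt o) (ωY x) (pt x)) where

      private
        h₀ : ∀ i → 0 < len i
        h₀ i = <-trans (s≤s z≤n) (1<len i)

        ω-ring : ∀ {i j} → Dec (toℕ j < len i) → List V
        ω-ring {i} {j} (yes _) = ωY (w i (toℕ j)) ++ ring i j ∷ []
        -- A padding vertex can be reached only through the hub.
        ω-ring {i} {j} (no _) = ωY (w i 0) ++ y i (h₀ i) ∷ hub i ∷ ring i j ∷ []

      ω : V → List V
      ω (pt x) = ωY x
      ω (ring i j) = ω-ring {i} {j} (toℕ j <? len i)
      ω (hub i) = ωY (w i 0) ++ y i (h₀ i) ∷ hub i ∷ []

      private
        active : ∀ {i j} → toℕ j < len i → ω (ring i j) ≡ ωY (w i (toℕ j)) ++ ring i j ∷ []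
        active {i} {j} h with toℕ j <? len i
        ... | yes _ = refl
        ... | no ¬h = ⊥-elim (¬h h)

      ω-path : ∀ v → Path (pt o) (ω v) v
      ω-path (pt x) = ωY-path x
      ω-path (ring i j) with toℕ j <? len i
      ... | yes h = ωY-path _ ⁀ (here h refl ∷ [])
      ... | no _ = ωY-path _ ⁀ (y-here i (h₀ i) ∷ spoke ∷ spoke⁻ ∷ [])
      ω-path (hub i) = ωY-path _ ⁀ (y-here i (h₀ i) ∷ spoke ∷ [])

      module Compatibility (ωY-edge : ∀ {x x'} → x ∼ x' → pt o ∷ ωY x ++ pt x' ∷ [] ≃ pt o ∷ ωY x') where
        private
          Compatible : V → V → Set
          Compatible u v = pt o ∷ ω u ++ v ∷ [] ≃ pt o ∷ ω v

          reverse : ∀ {u v} → u ~ v → Compatible u v → Compatible v u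
          reverse {u} {v} e h = begin
            pt o ∷ ω v ++ u ∷ []              ≈⟨ suffix _ (≃-sym h) ⟩
            pt o ∷ (ω u ++ v ∷ []) ++ u ∷ []  ≡⟨ cong (pt o ∷_) (++-assoc (ω u) _ _) ⟩
            pt o ∷ ω u ++ v ∷ u ∷ []          ≈⟨ after (ω-path u) (backtrack [] e) ⟩
            pt o ∷ ω u ++ []                  ≡⟨ cong (pt o ∷_) (++-identityʳ (ω u)) ⟩
            pt o ∷ ω u                        ∎
            where open ≃-Reasoning

          -- compatibility with the sides a b and b c of a triangle gives it for a c
          third : ∀ {a b c} → a ~ b → b ~ c → a ~ c → Compatible a b → Compatible b c → Compatible a c
          third {a} {b} {c} e f g h k = begin
            pt o ∷ ω a ++ c ∷ []              ≈⟨ after (ω-path a) (≃-sym (shortcut [] g (~-sym f) e)) ⟩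
            pt o ∷ ω a ++ b ∷ c ∷ []          ≡⟨ cong (pt o ∷_) (sym (++-assoc (ω a) _ _)) ⟩
            pt o ∷ (ω a ++ b ∷ []) ++ c ∷ []  ≈⟨ suffix _ h ⟩
            pt o ∷ ω b ++ c ∷ []              ≈⟨ k ⟩
            pt o ∷ ω c                        ∎
            where open ≃-Reasoning

          c-here : ∀ {i j} → toℕ j < len i → Compatible (pt (w i (toℕ j))) (ring i j)
          c-here h = ≃-reflexive (cong (pt o ∷_) (sym (active h)))

          c-there : ∀ {i j} → toℕ j < len i → Compatible (pt (w i (suc (toℕ j)))) (ring i j)
          c-there {i} h = third (base (∼-sym (w-edge i h))) (here h refl) (there h refl) (ωY-edge (∼-sym (w-edge i h))) (c-here h)

          c-succ : ∀ {i j j'} → Succ i j j' → Compatible (ring i j) (ring i j')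
          c-succ {i} {j} {j'} (succ h h' e r) = third (there⁻ h e) (here h' refl) r
            (subst (λ x → Compatible (ring i j) (pt x)) e (reverse (there h refl) (c-there h))) (c-here h')

          c-spoke : ∀ {i} k {j} → toℕ j ≡ k → k < len i → Compatible (ring i j) (hub i)
          c-spoke {i} zero {j} e h = ≃-reflexive (cong (pt o ∷_) (trans (cong (_++ hub i ∷ []) (active (subst (_< len i) (sym e) h)))
            (trans (++-assoc (ωY (w i (toℕ j))) _ _)
              (cong₂ (λ n r → ωY (w i n) ++ r ∷ hub i ∷ []) e (cong (ring i) (toℕ-injective (trans e (sym (idx i (h₀ i))))))))))
          c-spoke {i} (suc k) {j} e h = third (~-sym (nx)) spoke spoke
              (reverse nx (c-succ (next-succ (trans e (cong suc (sym e'))) (subst (_< len i) (sym e) h)))) (c-spoke k e' (<-trans ≤-refl h))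
            where
            j₀ : Fin L
            j₀ = fromℕ< (<-≤-trans (<-trans ≤-refl h) (len≤L i))
            e' : toℕ j₀ ≡ k
            e' = toℕ-fromℕ< (<-≤-trans (<-trans ≤-refl h) (len≤L i))
            nx : ring i j₀ ~ ring i j
            nx = next (trans e (cong suc (sym e'))) (subst (_< len i) (sym e) h)

          c-spokes : ∀ {i j} → Compatible (hub i) (ring i j)
          c-spokes {i} {j} = go (toℕ j <? len i) refl
            where
            go : (d : Dec (toℕ j < len i)) → (toℕ j <? len i) ≡ d → Compatible (hub i) (ring i j)
            go (yes h) _ = reverse spoke (c-spoke (toℕ j) refl h)
            go (no h) e = ≃-reflexive (cong (pt o ∷_) (trans (++-assoc (ωY (w i 0)) _ _) (cong ω-ring (sym e))))

        ω-edge : ∀ {u v} → u ~ v → pt o ∷ ω u ++ v ∷ [] ≃ pt o ∷ ω v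
        ω-edge (base e) = ωY-edge e
        ω-edge (here h refl) = c-here h
        ω-edge (here⁻ h refl) = reverse (here h refl) (c-here h)
        ω-edge (there h refl) = c-there h
        ω-edge (there⁻ h refl) = reverse (there h refl) (c-there h)
        ω-edge (next e h) = c-succ (next-succ e h)
        ω-edge (next⁻ e h) = reverse (next e h) (c-succ (next-succ e h))
        ω-edge (wrap e h) = c-succ (wrap-succ e h)
        ω-edge (wrap⁻ e h) = reverse (wrap e h) (c-succ (wrap-succ e h))
        ω-edge spoke = reverse spoke⁻ c-spokes
        ω-edge spoke⁻ = c-spokes

    module Labelling {c ℓ} (H : Group c ℓ) (labY : Y → Y → Group.Carrier H)
      (labY-refl : ∀ x → Group._≈_ H (labY x x) (Group.ε H))
      (labY-inv : ∀ {x y} → x ∼ y → Group._≈_ H (Group._∙_ H (labY x y) (labY y x)) (Group.ε H)) where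
      open GroupKit H hiding (swap) renaming (sym to ≈-sym; trans to ≈-trans)

      along : (ℕ → Y) → ℕ → Carrier
      along f zero = ε
      along f (suc j) = along f j ∙ labY (f j) (f (suc j))

      along-suc : ∀ f j → along f (suc j) ≈ labY (f 0) (f 1) ∙ along (λ k → f (suc k)) j
      along-suc f zero = ≈-trans (identityˡ _) (≈-sym (identityʳ _))
      along-suc f (suc j) = ≈-trans (∙-congʳ (along-suc f j)) (assoc _ _ _)

      private
        P : I → ℕ → Carrier
        P i = along (w i)

      -- the monodromy from the start of the walk w i to the vertex x next to ring i j
      mono : I → ℕ → Y → Carrier
      mono i j x = P i (suc j) ∙ labY (w i (suc j)) x

      -- The disc is a chart based at the start of its walk: edges among ring and hub carry `ε`, and
      -- an edge from the ring to the walk carries the monodromy from the start to its end.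
      lab : V → V → Carrier
      lab (pt x) (pt y) = labY x y
      lab (ring i j) (pt x) = mono i (toℕ j) x
      lab (pt x) (ring i j) = mono i (toℕ j) x ⁻¹
      lab _ _ = ε

      lab-inv : ∀ {u v} → u ~ v → lab u v ∙ lab v u ≈ ε
      lab-inv (base e) = labY-inv e
      lab-inv (here _ _) = inverseˡ _
      lab-inv (here⁻ _ _) = inverseʳ _
      lab-inv (there _ _) = inverseˡ _
      lab-inv (there⁻ _ _) = inverseʳ _
      lab-inv (next _ _) = identityˡ ε
      lab-inv (next⁻ _ _) = identityˡ ε
      lab-inv (wrap _ _) = identityˡ ε
      lab-inv (wrap⁻ _ _) = identityˡ ε
      lab-inv spoke = identityˡ ε
      lab-inv spoke⁻ = identityˡ ε

      module Flat (relator : ∀ i → along (w i) (len i) ≈ ε) where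
        private
          At : I → Fin L → Y → Set
          At i j x = toℕ j < len i × (w i (toℕ j) ≡ x ⊎ w i (suc (toℕ j)) ≡ x)

          at : ∀ {i j x} → pt x ~ ring i j → At i j x
          at (here h e) = h , inj₁ e
          at (there h e) = h , inj₂ e

          mono-base : ∀ {i j x} → At i j x → mono i (toℕ j) x ≈ P i (toℕ j) ∙ labY (w i (toℕ j)) x
          mono-base {i} {j} (h , inj₁ refl) = ≈-trans (assoc _ _ _) (∙-congˡ (≈-trans (labY-inv (w-edge i h)) (≈-sym (labY-refl _))))
          mono-base {i} {j} (h , inj₂ refl) = ≈-trans (∙-congˡ (labY-refl _)) (identityʳ _)

          P-succ : ∀ {i j j'} → Succ i j j' → P i (suc (toℕ j)) ≈ P i (toℕ j') → ∀ {x} → At i j' x → mono i (toℕ j) x ≈ mono i (toℕ j') x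
          P-succ {i} (succ _ _ e _) p a = ≈-trans (∙-cong p (≈-reflexive′ (cong (λ z → labY z _) e))) (≈-sym (mono-base a))
            where
            ≈-reflexive′ : ∀ {x y} → x ≡ y → x ≈ y
            ≈-reflexive′ refl = ≈-refl

          around : ∀ {i j j' x} → ring i j ~ ring i j' → At i j x → At i j' x → mono i (toℕ j) x ≈ mono i (toℕ j') x
          around {i} {j} {j'} (next e h) a a' = P-succ (next-succ e h) (reflexive (cong (P i) (sym e))) a'
          around {i} {j} {j'} (next⁻ e h) a a' = ≈-sym (P-succ (next-succ e h) (reflexive (cong (P i) (sym e))) a)
          -- Only where the ring closes up is the relator needed: there the monodromy of the whole
          -- walk is compared with that of the empty one.
          around {i} {j} {j'} (wrap e h) a a' = P-succ (wrap-succ e h) (≈-trans (reflexive (cong (P i) e)) (≈-trans (relator i) (reflexive (cong (P i) (sym h))))) a'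
          around {i} {j} {j'} (wrap⁻ e h) a a' = ≈-sym (P-succ (wrap-succ e h) (≈-trans (reflexive (cong (P i) e)) (≈-trans (relator i) (reflexive (cong (P i) (sym h))))) a)

          side : ∀ {i j x x'} → At i j x → At i j x' → x ∼ x' → mono i (toℕ j) x ∙ labY x x' ≈ mono i (toℕ j) x'
          side (h , inj₁ refl) (_ , inj₁ refl) e = ⊥-elim (bipartite e refl)
          side (h , inj₂ refl) (_ , inj₂ refl) e = ⊥-elim (bipartite e refl)
          side (h , inj₁ refl) (_ , inj₂ refl) e = ≈-trans (assoc _ _ _) (∙-congˡ (≈-trans (labY-inv (∼-sym e)) (≈-sym (labY-refl _))))
          side (h , inj₂ refl) (_ , inj₁ refl) e = ∙-congʳ (≈-trans (∙-congˡ (labY-refl _)) (identityʳ _))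

          ring-same : ∀ {i i' j j'} → ring i j ~ ring i' j' → i ≡ i'
          ring-same (next _ _) = refl
          ring-same (next⁻ _ _) = refl
          ring-same (wrap _ _) = refl
          ring-same (wrap⁻ _ _) = refl

          three : ∀ a b c → a ≡ not b → b ≡ not c → a ≡ not c → ⊥
          three true true _ () _ _
          three true false true _ _ ()
          three true false false _ () _
          three false false _ () _ _
          three false true false _ _ ()
          three false true true _ () _

          differ : ∀ {a b} → a ≢ b → a ≡ not b
          differ {true} {true} h = ⊥-elim (h refl)
          differ {true} {false} h = refl
          differ {false} {true} h = refl
          differ {false} {false} h = ⊥-elim (h refl)

          cancel : ∀ {a b c} → a ∙ c ≈ b → a ⁻¹ ∙ b ≈ c
          cancel {a} {b} {c} p = ≈-trans (∙-congˡ (≈-sym p)) (≈-trans (≈-sym (assoc _ _ _)) (≈-trans (∙-congʳ (inverseˡ a)) (identityˡ c)))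

        lab-tri : ∀ {a b c} → a ~ b → b ~ c → a ~ c → lab a c ∙ lab c b ≈ lab a b
        lab-tri {pt x} {pt y} {pt z} (base e) (base f) (base g) =
          ⊥-elim (three (colour x) (colour y) (colour z) (differ (bipartite e)) (differ (bipartite f)) (differ (bipartite g)))
        lab-tri {pt x} {pt y} {ring i j} (base e) f g = cancel (side (at g) (at f) e)
        lab-tri {pt x} {ring i j} {pt y} e f (base g) = ≈-trans (∙-congʳ (≈-sym (cancel (side (at e) (at (~-sym f)) g))))
          (≈-trans (assoc _ _ _) (≈-trans (∙-congˡ (inverseʳ _)) (identityʳ _)))
        lab-tri {ring i j} {pt y} {pt x} e (base f) g = side (at (~-sym g)) (at (~-sym e)) (∼-sym f)
        lab-tri {pt x} {ring i j} {ring i' j'} e f g with ring-same f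
        ... | refl = ≈-trans (identityʳ _) (⁻¹-cong (≈-sym (around f (at e) (at g))))
        lab-tri {ring i j} {pt x} {ring i' j'} e f g with ring-same g
        ... | refl = ≈-trans (identityˡ _) (≈-sym (around g (at (~-sym e)) (at f)))
        lab-tri {ring i j} {ring i' j'} {pt x} e f g with ring-same e
        ... | refl = ≈-trans (∙-congʳ (around e (at (~-sym g)) (at (~-sym f)))) (inverseʳ _)
        lab-tri {ring i j} {ring i' j'} {ring i'' j''} e f g = identityˡ ε
        lab-tri {ring i j} {ring i' j'} {hub i''} e f g = identityˡ ε
        lab-tri {ring i j} {hub i'} {ring i'' j''} e f g = identityˡ ε
        lab-tri {hub i'} {ring i j} {ring i'' j''} e f g = identityˡ ε
        lab-tri {pt x} {hub i} () f g
        lab-tri {pt x} {_} {hub i} e f ()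
        lab-tri {hub i} {pt x} () f g
        lab-tri {hub i} {_} {pt x} e f ()
        lab-tri {ring i j} {pt x} {hub i'} e () g
        lab-tri {ring i j} {hub i'} {pt x} e () g
        lab-tri {hub i} {hub i'} () f g
        lab-tri {hub i} {_} {hub i'} e f ()
        lab-tri {_} {hub i} {hub i'} e () g

-- The graph: a tower of blocks of bounded shape

module Blocks where

  open import Defs hiding (Eval)
  open import Algebra.Bundles using (Group)
  open import Data.Bool using (Bool; true; false)
  open import Data.Empty using (⊥; ⊥-elim)
  open import Data.Unit using (⊤; tt)
  open import Data.Fin using (Fin; zero; suc; toℕ; fromℕ<; combine; remQuot)
  open import Data.Fin.Properties using (+↔⊎; *↔×; toℕ-injective; toℕ-fromℕ<; toℕ<n; remQuot-combine; combine-remQuot)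
  import Data.Fin.Properties as Finₚ
  open import Data.List using (List; []; _∷_; _++_; map; length)
  open import Data.List.Properties using (length-++; ++-assoc; ++-identityʳ; map-++; map-∘; map-cong; map-id)
  open import Data.Nat using (ℕ; zero; suc; _+_; _*_; _∸_; _≤_; _<_; z≤n; s≤s; _≡ᵇ_)
  open import Data.Nat.Properties
  open import Data.Product using (Σ; _×_; _,_; proj₁; proj₂)
  open import Data.Product.Properties using () renaming (≡-dec to ×-≡-dec)
  open import Data.Sum using (_⊎_; inj₁; inj₂)
  open import Data.Product.Function.NonDependent.Propositional using (_×-↔_)
  open import Data.Sum.Function.Propositional using (_⊎-↔_)
  open import Function using (_∘_)
  open import Function.Bundles using (_↔_; Inverse)
  open import Function.Construct.Composition using () renaming (inverse to _⊙_)
  open import Function.Construct.Identity using () renaming (inverse to id↔)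
  open import Function.Construct.Symmetry using () renaming (inverse to sym↔)
  open import Relation.Binary.PropositionalEquality using (_≡_; _≢_; refl; cong; cong₂; subst; subst₂; sym; trans)
  open import Relation.Binary.Construct.Closure.ReflexiveTransitive using (Star; ε; _◅_; _◅◅_)
  open import Relation.Binary.Definitions using (DecidableEquality)
  open import Relation.Nullary using (Dec; yes; no; ¬_; does)
  open import Relation.Nullary.Decidable using (_×-dec_; _⊎-dec_; map′; dec-true)
  open RecursiveFunctions using (divmod3; rem3; quot3)
  open Developments using (witness)
  open Walks
  open Labels
  open Presentations using (module Words; module GroupKit)

  data Diff : Set where
    same up down far : Diff

  cmp : ℕ → ℕ → Diff
  cmp (suc a) (suc b) = cmp a b
  cmp zero zero = same
  cmp zero (suc zero) = up
  cmp zero (suc (suc _)) = far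
  cmp (suc zero) zero = down
  cmp (suc (suc _)) zero = far

  cmp-refl : ∀ a → cmp a a ≡ same
  cmp-refl zero = refl
  cmp-refl (suc a) = cmp-refl a

  cmp-up : ∀ a → cmp a (suc a) ≡ up
  cmp-up zero = refl
  cmp-up (suc a) = cmp-up a

  cmp-down : ∀ a → cmp (suc a) a ≡ down
  cmp-down zero = refl
  cmp-down (suc a) = cmp-down a

  cmp-shift : ∀ k a b → cmp (k + a) (k + b) ≡ cmp a b
  cmp-shift zero a b = refl
  cmp-shift (suc k) a b = cmp-shift k a b

  data Compare (a b : ℕ) : Diff → Set where
    same : b ≡ a → Compare a b same
    up : b ≡ suc a → Compare a b up
    down : a ≡ suc b → Compare a b down
    far : Compare a b far

  compare′ : ∀ a b → Compare a b (cmp a b)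
  compare′ zero zero = same refl
  compare′ zero (suc zero) = up refl
  compare′ zero (suc (suc b)) = far
  compare′ (suc zero) zero = down refl
  compare′ (suc (suc a)) zero = far
  compare′ (suc a) (suc b) with cmp a b | compare′ a b
  ... | _ | same e = same (cong suc e)
  ... | _ | up e = up (cong suc e)
  ... | _ | down e = down (cong suc e)
  ... | _ | far = far

  record Blueprint : Set₁ where
    field
      Letter Rel : Set
      λ# ρ# : ℕ
      Letter↔ : Letter ↔ Fin λ#
      Rel↔ : Rel ↔ Fin ρ#
      relator : Bool → Bool → Rel → List (Bool × Letter)
      cross : Letter → List (Bool × Letter)

  -- The type of a vertex (see Ty below) determines its neighbours up to translation by a number of blocks,
  -- except for the flags telling whether a block is the first or the last one.
  module Shape (𝒫 : Blueprint) where
    open Blueprint 𝒫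

    -- The loop of a letter is a 4-cycle through `star`, `lo`, `hi` and `circ`, of even length to
    -- keep the 1-skeleton bipartite and thus free of triangles. Discs belong to relators, or to
    -- letters for the passage to the next block. `star` has number 0, where the simulated agent
    -- starts.
    X RI : Set
    X = Fin 2 ⊎ (Letter × Fin 2)
    RI = Rel ⊎ Letter

    pattern star = inj₁ zero
    pattern circ = inj₁ (suc zero)
    pattern lo g = inj₂ (g , zero)
    pattern hi g = inj₂ (g , suc zero)

    RI↔ : RI ↔ Fin (ρ# + λ#)
    RI↔ = (Rel↔ ⊎-↔ Letter↔) ⊙ sym↔ +↔⊎

    X↔ : X ↔ Fin (2 + λ# * 2)
    X↔ = (id↔ _ ⊎-↔ ((Letter↔ ×-↔ id↔ _) ⊙ sym↔ *↔×)) ⊙ sym↔ +↔⊎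

    private
      dec↔ : ∀ {A : Set} {n} → A ↔ Fin n → DecidableEquality A
      dec↔ A↔ a b = map′ (λ e → trans (sym (Inverse.strictlyInverseʳ A↔ a)) (trans (cong (Inverse.from A↔) e) (Inverse.strictlyInverseʳ A↔ b)))
        (cong (Inverse.to A↔)) (Inverse.to A↔ a Finₚ.≟ Inverse.to A↔ b)

      _≟L_ : DecidableEquality Letter
      _≟L_ = dec↔ Letter↔

      _≟X_ : DecidableEquality X
      _≟X_ = dec↔ X↔

      _≟R_ : DecidableEquality RI
      _≟R_ = dec↔ RI↔

    E₀ : X → X → Set
    E₀ star circ = ⊤
    E₀ circ star = ⊤
    E₀ star (lo _) = ⊤
    E₀ (lo _) star = ⊤
    E₀ (lo g) (hi g') = g ≡ g'
    E₀ (hi g) (lo g') = g' ≡ g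
    E₀ (hi _) circ = ⊤
    E₀ circ (hi _) = ⊤
    E₀ _ _ = ⊥

    E₀-sym : ∀ x y → E₀ x y → E₀ y x
    E₀-sym star circ e = e
    E₀-sym circ star e = e
    E₀-sym star (lo _) e = e
    E₀-sym (lo _) star e = e
    E₀-sym (lo g) (hi g') e = e
    E₀-sym (hi g) (lo g') e = e
    E₀-sym (hi _) circ e = e
    E₀-sym circ (hi _) e = e

    private
      E₀? : ∀ x y → Dec (E₀ x y)
      E₀? star circ = yes tt
      E₀? circ star = yes tt
      E₀? star (lo _) = yes tt
      E₀? (lo _) star = yes tt
      E₀? (lo g) (hi g') = g ≟L g'
      E₀? (hi g) (lo g') = g' ≟L g
      E₀? (hi _) circ = yes tt
      E₀? circ (hi _) = yes tt
      E₀? star star = no λ ()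
      E₀? star (hi _) = no λ ()
      E₀? circ circ = no λ ()
      E₀? circ (lo _) = no λ ()
      E₀? (lo _) circ = no λ ()
      E₀? (lo _) (lo _) = no λ ()
      E₀? (hi _) star = no λ ()
      E₀? (hi _) (hi _) = no λ ()

    tint : X → Bool
    tint star = true
    tint circ = false
    tint (lo _) = false
    tint (hi _) = true

    tint-E₀ : ∀ x y → E₀ x y → tint x ≢ tint y
    tint-E₀ star circ e = λ ()
    tint-E₀ circ star e = λ ()
    tint-E₀ star (lo _) e = λ ()
    tint-E₀ (lo _) star e = λ ()
    tint-E₀ (lo g) (hi g') e = λ ()
    tint-E₀ (hi g) (lo g') e = λ ()
    tint-E₀ (hi _) circ e = λ ()
    tint-E₀ circ (hi _) e = λ ()

    -- a vertex of the present (false) or of the next (true) block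
    Spot : Set
    Spot = X × Bool

    loop : Bool → Bool × Letter → List Spot
    loop o (true , g) = (lo g , o) ∷ (hi g , o) ∷ (circ , o) ∷ (star , o) ∷ []
    loop o (false , g) = (circ , o) ∷ (hi g , o) ∷ (lo g , o) ∷ (star , o) ∷ []

    loops : Bool → List (Bool × Letter) → List Spot
    loops o [] = []
    loops o (x ∷ u) = loop o x ++ loops o u

    Flags : Set
    Flags = Bool × Bool

    -- A backtrack appended to every boundary walk, so that an empty relator too gives a disc with a
    -- ring of at least two vertices.
    end : List Spot
    end = (circ , false) ∷ (star , false) ∷ []

    -- The boundary of a disc equating the word `cross g` with the loop of `g` one block higher,
    -- carried down along the edge between the blocks.
    crossing : Letter → List Spot
    crossing g = loops false (cross g) ++ (circ , true) ∷ (star , true) ∷ loop true (false , g) ++ (circ , true) ∷ (star , false) ∷ []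

    track : Flags → RI → List Spot
    track (first , last) (inj₁ r) = loops false (relator first last r) ++ end
    track (first , true) (inj₂ g) = end
    track (first , false) (inj₂ g) = crossing g ++ end

    -- adjacency of spots; only a block that is not the last one has a next block
    data Spot-edge (last : Bool) : Spot → Spot → Set where
      level : ∀ {x y o} → E₀ x y → Spot-edge last (x , o) (y , o)
      rise : last ≡ false → Spot-edge last (star , false) (circ , true)
      fall : last ≡ false → Spot-edge last (circ , true) (star , false)

    module SP (last : Bool) = Homotopy (Spot-edge last)

    private
      loop-path : ∀ {last} o x → SP.Path last (star , o) (loop o x) (star , o)
      loop-path o (true , g) = level tt SP.∷ (level refl SP.∷ (level tt SP.∷ (level tt SP.∷ SP.[])))
      loop-path o (false , g) = level tt SP.∷ (level tt SP.∷ (level refl SP.∷ (level tt SP.∷ SP.[])))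

      loops-path : ∀ {last} o u → SP.Path last (star , o) (loops o u) (star , o)
      loops-path o [] = SP.[]
      loops-path {last} o (x ∷ u) = SP._⁀_ last (loop-path o x) (loops-path o u)

      end-path : ∀ {last} → SP.Path last (star , false) end (star , false)
      end-path = level tt SP.∷ (level tt SP.∷ SP.[])

    track-path : ∀ f r → SP.Path (proj₂ f) (star , false) (track f r) (star , false)
    track-path (first , last) (inj₁ r) = SP._⁀_ last (loops-path false (relator first last r)) end-path
    track-path (first , true) (inj₂ g) = end-path
    track-path (first , false) (inj₂ g) = SP._⁀_ false
      (SP._⁀_ false (loops-path false (cross g)) (rise refl SP.∷ (level tt SP.∷ SP._⁀_ false (loop-path true (false , g)) (level tt SP.∷ (fall refl SP.∷ SP.[]))))) end-path

    nth : Spot → List Spot → ℕ → Spot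
    nth u xs zero = u
    nth u [] (suc j) = u
    nth u (x ∷ xs) (suc j) = nth x xs j

    private
      nth-edge : ∀ {last u xs v} → SP.Path last u xs v → ∀ {j} → j < length xs → Spot-edge last (nth u xs j) (nth u xs (suc j))
      nth-edge (e SP.∷ SP.[]) {zero} h = e
      nth-edge (e SP.∷ (_ SP.∷ _)) {zero} h = e
      nth-edge (e SP.∷ P) {suc j} (s≤s h) = nth-edge P h

      nth-last : ∀ {last u xs v} → SP.Path last u xs v → nth u xs (length xs) ≡ v
      nth-last SP.[] = refl
      nth-last (e SP.∷ P) = nth-last P

      nth-low : ∀ {u xs v} → SP.Path true u xs v → proj₂ u ≡ false → ∀ j → proj₂ (nth u xs j) ≡ false
      nth-low P h zero = h
      nth-low SP.[] h (suc j) = h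
      nth-low (level e SP.∷ P) h (suc j) = nth-low P h j

    at : Flags → RI → ℕ → Spot
    at f r = nth (star , false) (track f r)

    len : Flags → RI → ℕ
    len f r = length (track f r)

    at-edge : ∀ f r {j} → j < len f r → Spot-edge (proj₂ f) (at f r j) (at f r (suc j))
    at-edge f r = nth-edge (track-path f r)

    at-len : ∀ f r → at f r (len f r) ≡ (star , false)
    at-len f r = nth-last (track-path f r)

    at-low : ∀ {first} r j → proj₂ (at (first , true) r j) ≡ false
    at-low {first} r = nth-low (track-path (first , true) r) refl

    1<len : ∀ f r → 1 < len f r
    1<len f r = go f r
      where
      go' : ∀ (xs : List Spot) → 1 < length (xs ++ end)
      go' xs = subst (1 <_) (sym (length-++ xs)) (m≤n+m 2 (length xs))
      go : ∀ f r → 1 < len f r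
      go (first , last) (inj₁ r) = go' (loops false (relator first last r))
      go (first , true) (inj₂ g) = ≤-refl
      go (first , false) (inj₂ g) = go' (crossing g)

    private
      sumᶠ : ∀ {n} → (Fin n → ℕ) → ℕ
      sumᶠ {zero} f = 0
      sumᶠ {suc n} f = f zero + sumᶠ (f ∘ suc)

      ≤sumᶠ : ∀ {n} (f : Fin n → ℕ) i → f i ≤ sumᶠ f
      ≤sumᶠ f zero = m≤m+n _ _
      ≤sumᶠ f (suc i) = ≤-trans (≤sumᶠ (f ∘ suc) i) (m≤n+m _ _)

      lens : Flags → ℕ
      lens f = sumᶠ (λ i → len f (Inverse.from RI↔ i))

      len≤lens : ∀ f r → len f r ≤ lens f
      len≤lens f r = subst (λ z → len f z ≤ lens f) (Inverse.strictlyInverseʳ RI↔ r) (≤sumᶠ (λ i → len f (Inverse.from RI↔ i)) (Inverse.to RI↔ r))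

    abstract
      -- A bound valid for all flags at once, so that all blocks have the same set of types of
      -- vertices, independent of ℓ.
      L : ℕ
      L = lens (false , false) + (lens (false , true) + (lens (true , false) + lens (true , true)))

      len≤L : ∀ f r → len f r ≤ L
      len≤L (false , false) r = ≤-trans (len≤lens _ r) (m≤m+n _ _)
      len≤L (false , true) r = ≤-trans (len≤lens _ r) (≤-trans (m≤m+n _ _) (m≤n+m _ (lens (false , false))))
      len≤L (true , false) r = ≤-trans (len≤lens _ r) (≤-trans (m≤m+n _ _) (≤-trans (m≤n+m _ (lens (false , true))) (m≤n+m _ (lens (false , false)))))
      len≤L (true , true) r = ≤-trans (len≤lens _ r) (≤-trans (m≤n+m _ (lens (true , false))) (≤-trans (m≤n+m _ (lens (false , true))) (m≤n+m _ (lens (false , false)))))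

    Ty : Set
    Ty = X ⊎ ((RI × Fin L) ⊎ RI)

    pattern cell x = inj₁ x
    pattern rim r j = inj₂ (inj₁ (r , j))
    pattern nave r = inj₂ (inj₂ r)

    K : ℕ
    K = (2 + λ# * 2) + ((ρ# + λ#) * L + (ρ# + λ#))

    Ty↔ : Ty ↔ Fin K
    Ty↔ = (X↔ ⊎-↔ ((((RI↔ ×-↔ id↔ _) ⊙ sym↔ *↔×) ⊎-↔ RI↔) ⊙ sym↔ +↔⊎)) ⊙ sym↔ +↔⊎

    At : Flags → RI → Fin L → Spot → Set
    At f r j s = (toℕ j < len f r) × (at f r (toℕ j) ≡ s ⊎ at f r (suc (toℕ j)) ≡ s)

    Next : Flags → RI → Fin L → Fin L → Set
    Next f r j j' = (toℕ j' ≡ suc (toℕ j) × toℕ j' < len f r) ⊎ (suc (toℕ j) ≡ len f r × toℕ j' ≡ 0)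

    Inside : Flags → Ty → Ty → Set
    Inside f (cell x) (cell y) = E₀ x y
    Inside f (cell x) (rim r j) = At f r j (x , false)
    Inside f (rim r j) (cell x) = At f r j (x , false)
    Inside f (rim r j) (rim r' j') = r ≡ r' × (Next f r j j' ⊎ Next f r j' j)
    Inside f (rim r j) (nave r') = r ≡ r'
    Inside f (nave r') (rim r j) = r ≡ r'
    Inside f _ _ = ⊥

    Upward : Flags → Ty → Ty → Set
    Upward f (cell x) (cell y) = x ≡ star × y ≡ circ
    Upward f (rim r j) (cell x) = At f r j (x , true)
    Upward f _ _ = ⊥

    Adjacent : Diff → Flags → Flags → Ty → Ty → Set
    Adjacent same f f' c c' = Inside f c c'
    Adjacent up f f' c c' = Upward f c c'
    Adjacent down f f' c c' = Upward f' c' c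
    Adjacent far f f' c c' = ⊥

    private
      at? : ∀ f r j s → Dec (At f r j s)
      at? f r j s = (toℕ j <? len f r) ×-dec ((at f r (toℕ j) ≟S s) ⊎-dec (at f r (suc (toℕ j)) ≟S s))
        where
        _≟S_ : DecidableEquality Spot
        _≟S_ = ×-≡-dec _≟X_ Data.Bool._≟_

      next? : ∀ f r j j' → Dec (Next f r j j')
      next? f r j j' = ((toℕ j' ≟ suc (toℕ j)) ×-dec (toℕ j' <? len f r)) ⊎-dec ((suc (toℕ j) ≟ len f r) ×-dec (toℕ j' ≟ 0))

      inside? : ∀ f c c' → Dec (Inside f c c')
      inside? f (cell x) (cell y) = E₀? x y
      inside? f (cell x) (rim r j) = at? f r j (x , false)
      inside? f (rim r j) (cell x) = at? f r j (x , false)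
      inside? f (rim r j) (rim r' j') = (r ≟R r') ×-dec (next? f r j j' ⊎-dec next? f r j' j)
      inside? f (rim r j) (nave r') = r ≟R r'
      inside? f (nave r') (rim r j) = r ≟R r'
      inside? f (cell _) (nave _) = no λ ()
      inside? f (nave _) (cell _) = no λ ()
      inside? f (nave _) (nave _) = no λ ()

      upward? : ∀ f c c' → Dec (Upward f c c')
      upward? f (cell x) (cell y) = (x ≟X star) ×-dec (y ≟X circ)
      upward? f (rim r j) (cell x) = at? f r j (x , true)
      upward? f (cell _) (rim _ _) = no λ ()
      upward? f (cell _) (nave _) = no λ ()
      upward? f (rim _ _) (rim _ _) = no λ ()
      upward? f (rim _ _) (nave _) = no λ ()
      upward? f (nave _) _ = no λ ()

    abstract
      adjacent? : ∀ d f f' c c' → Dec (Adjacent d f f' c c')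
      adjacent? same f f' c c' = inside? f c c'
      adjacent? up f f' c c' = upward? f c c'
      adjacent? down f f' c c' = upward? f' c' c
      adjacent? far f f' c c' = no λ ()

    module Tower (ℓ : ℕ) where

      flag : ℕ → Flags
      flag b = (b ≡ᵇ 0) , (b ≡ᵇ ℓ)

      Block : Set
      Block = Fin (suc ℓ)

      blk : ℕ → Block
      blk b = fromℕ< (s≤s (m⊓n≤n b ℓ))

      toℕ-blk : ∀ {b} → b ≤ ℓ → toℕ (blk b) ≡ b
      toℕ-blk {b} h = trans (toℕ-fromℕ< (s≤s (m⊓n≤n b ℓ))) (m≤n⇒m⊓n≡m h)

      blk-toℕ : ∀ (b : Block) → blk (toℕ b) ≡ b
      blk-toℕ b = toℕ-injective (toℕ-blk (≤-pred (toℕ<n b)))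

      Y : Set
      Y = X × Block

      data _∼_ : Y → Y → Set where
        level : ∀ {x y b} → E₀ x y → (x , b) ∼ (y , b)
        rise : ∀ {b b'} → toℕ b' ≡ suc (toℕ b) → (star , b) ∼ (circ , b')
        fall : ∀ {b b'} → toℕ b' ≡ suc (toℕ b) → (circ , b') ∼ (star , b)

      ∼-sym : ∀ {x y} → x ∼ y → y ∼ x
      ∼-sym (level e) = level (E₀-sym _ _ e)
      ∼-sym (rise e) = fall e
      ∼-sym (fall e) = rise e

      place : Block → Spot → Y
      place b (x , false) = x , b
      place b (x , true) = x , blk (suc (toℕ b))

      private
        ≡ᵇ-refl : ∀ n → (n ≡ᵇ n) ≡ true
        ≡ᵇ-refl zero = refl
        ≡ᵇ-refl (suc n) = ≡ᵇ-refl n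

        not-last : ∀ (b : Block) → proj₂ (flag (toℕ b)) ≡ false → toℕ b < ℓ
        not-last b e with m≤n⇒m<n∨m≡n (≤-pred (toℕ<n b))
        ... | inj₁ h = h
        ... | inj₂ h with trans (sym e) (trans (cong (_≡ᵇ ℓ) h) (≡ᵇ-refl ℓ))
        ...   | ()

        place-edge : ∀ b {last s s'} → last ≡ proj₂ (flag (toℕ b)) → Spot-edge last s s' → place b s ∼ place b s'
        place-edge b refl (level {o = false} e) = level e
        place-edge b refl (level {o = true} e) = level e
        place-edge b refl (rise e) = rise (toℕ-blk (not-last b e))
        place-edge b refl (fall e) = fall (toℕ-blk (not-last b e))

      private
        tint-proper : ∀ {y y'} → y ∼ y' → tint (proj₁ y) ≢ tint (proj₁ y')
        tint-proper (level e) = tint-E₀ _ _ e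
        tint-proper (rise _) = λ ()
        tint-proper (fall _) = λ ()

      attachment : Discs.Attachment
      Discs.Attachment.Y attachment = Y
      Discs.Attachment._∼_ attachment = _∼_
      Discs.Attachment.∼-sym attachment = ∼-sym
      Discs.Attachment.colour attachment y = tint (proj₁ y)
      Discs.Attachment.bipartite attachment = tint-proper
      Discs.Attachment.I attachment = RI × Block
      Discs.Attachment.L attachment = L
      Discs.Attachment.len attachment (r , b) = len (flag (toℕ b)) r
      Discs.Attachment.w attachment (r , b) j = place b (at (flag (toℕ b)) r j)
      Discs.Attachment.1<len attachment (r , b) = 1<len (flag (toℕ b)) r
      Discs.Attachment.len≤L attachment (r , b) = len≤L (flag (toℕ b)) r
      Discs.Attachment.closed attachment (r , b) = cong (place b) (at-len (flag (toℕ b)) r)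
      Discs.Attachment.w-edge attachment (r , b) h = place-edge b refl (at-edge (flag (toℕ b)) r h)

      open Discs.Attach attachment public

      Vtx : Set
      Vtx = Ty × Block

      toV : Vtx → V
      toV (cell x , b) = pt (x , b)
      toV (rim r j , b) = ring (r , b) j
      toV (nave r , b) = hub (r , b)

      fromV : V → Vtx
      fromV (pt (x , b)) = cell x , b
      fromV (ring (r , b) j) = rim r j , b
      fromV (hub (r , b)) = nave r , b

      toV-fromV : ∀ v → toV (fromV v) ≡ v
      toV-fromV (pt _) = refl
      toV-fromV (ring _ _) = refl
      toV-fromV (hub _) = refl

      fromV-toV : ∀ u → fromV (toV u) ≡ u
      fromV-toV (cell x , b) = refl
      fromV-toV (rim r j , b) = refl
      fromV-toV (nave r , b) = refl

      AdjV : Vtx → Vtx → Set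
      AdjV (c , b) (c' , b') = Adjacent (cmp (toℕ b) (toℕ b')) (flag (toℕ b)) (flag (toℕ b')) c c'

      private
        at⇒ : ∀ {b : Block} {r j x} → At (flag (toℕ b)) r j (x , false) → ring (r , b) j ~ pt (x , b)
        at⇒ {b} (h , inj₁ e) = here⁻ h (cong (place b) e)
        at⇒ {b} (h , inj₂ e) = there⁻ h (cong (place b) e)

        at⇒′ : ∀ {b b' : Block} {r j x} → toℕ b' ≡ suc (toℕ b) → At (flag (toℕ b)) r j (x , true) → ring (r , b) j ~ pt (x , b')
        at⇒′ {b} {b'} {x = x} q (h , inj₁ e) = here⁻ h (trans (cong (place b) e) (cong (x ,_) (trans (cong blk (sym q)) (blk-toℕ b'))))
        at⇒′ {b} {b'} {x = x} q (h , inj₂ e) = there⁻ h (trans (cong (place b) e) (cong (x ,_) (trans (cong blk (sym q)) (blk-toℕ b'))))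

        next⇒ : ∀ {b : Block} {r j j'} → Next (flag (toℕ b)) r j j' → ring (r , b) j ~ ring (r , b) j'
        next⇒ (inj₁ (e , h)) = next e h
        next⇒ (inj₂ (e , h)) = wrap e h

        inside⇒ : ∀ c c' {b : Block} → Inside (flag (toℕ b)) c c' → toV (c , b) ~ toV (c' , b)
        inside⇒ (cell x) (cell y) e = base (level e)
        inside⇒ (cell x) (rim r j) e = ~-sym (at⇒ e)
        inside⇒ (rim r j) (cell x) e = at⇒ e
        inside⇒ (rim r j) (rim .r j') (refl , inj₁ e) = next⇒ e
        inside⇒ (rim r j) (rim .r j') (refl , inj₂ e) = ~-sym (next⇒ e)
        inside⇒ (rim r j) (nave .r) refl = spoke
        inside⇒ (nave r) (rim .r j) refl = spoke⁻

        upward⇒ : ∀ c c' {b b' : Block} → toℕ b' ≡ suc (toℕ b) → Upward (flag (toℕ b)) c c' → toV (c , b) ~ toV (c' , b')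
        upward⇒ (cell .star) (cell .circ) q (refl , refl) = base (rise q)
        upward⇒ (rim r j) (cell x) q e = at⇒′ q e

      adj⇒ : ∀ u v → AdjV u v → toV u ~ toV v
      adj⇒ (c , b) (c' , b') = go (compare′ (toℕ b) (toℕ b'))
        where
        go : ∀ {d} → Compare (toℕ b) (toℕ b') d → Adjacent d (flag (toℕ b)) (flag (toℕ b')) c c' → toV (c , b) ~ toV (c' , b')
        go (same q) e with toℕ-injective q
        ... | refl = inside⇒ c c' e
        go (up q) e = upward⇒ c c' q e
        go (down q) e = ~-sym (upward⇒ c' c q e)

      private
        ⇒same : ∀ c c' (b : Block) → Inside (flag (toℕ b)) c c' → AdjV (c , b) (c' , b)
        ⇒same c c' b e rewrite cmp-refl (toℕ b) = e

        ⇒up : ∀ c c' (b b' : Block) → toℕ b' ≡ suc (toℕ b) → Upward (flag (toℕ b)) c c' → AdjV (c , b) (c' , b')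
        ⇒up c c' b b' q e rewrite q | cmp-up (toℕ b) = e

        ⇒down : ∀ c c' (b b' : Block) → toℕ b' ≡ suc (toℕ b) → Upward (flag (toℕ b)) c c' → AdjV (c' , b') (c , b)
        ⇒down c c' b b' q e rewrite q | cmp-down (toℕ b) = e

        touch : ∀ {r j} {b : Block} {y} → toℕ j < len (flag (toℕ b)) r →
          ∀ s → (at (flag (toℕ b)) r (toℕ j) ≡ s ⊎ at (flag (toℕ b)) r (suc (toℕ j)) ≡ s) → (proj₂ (flag (toℕ b)) ≡ true → proj₂ s ≡ false) →
          place b s ≡ y → AdjV (cell (proj₁ y) , proj₂ y) (rim r j , b) × AdjV (rim r j , b) (cell (proj₁ y) , proj₂ y)
        touch {r} {j} {b} h (x , false) e _ refl = ⇒same (cell x) (rim r j) b (h , e) , ⇒same (rim r j) (cell x) b (h , e)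
        touch {r} {j} {b} h (x , true) e low refl = ⇒down (rim r j) (cell x) b _ q (h , e) , ⇒up (rim r j) (cell x) b _ q (h , e)
          where
          q : toℕ (blk (suc (toℕ b))) ≡ suc (toℕ b)
          q with proj₂ (flag (toℕ b)) in eq
          ... | false = toℕ-blk (not-last b eq)
          ... | true with low refl
          ...   | ()

        low : ∀ (b : Block) r j → proj₂ (flag (toℕ b)) ≡ true → proj₂ (at (flag (toℕ b)) r j) ≡ false
        low b r j e = subst (λ l → proj₂ (at (proj₁ (flag (toℕ b)) , l) r j) ≡ false) (sym e) (at-low r j)

      ⇒adj : ∀ {u v} → u ~ v → AdjV (fromV u) (fromV v)
      ⇒adj (base (level {x} {y} {b} e)) = ⇒same (cell x) (cell y) b e
      ⇒adj (base (rise {b} {b'} q)) = ⇒up (cell star) (cell circ) b b' q (refl , refl)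
      ⇒adj (base (fall {b} {b'} q)) = ⇒down (cell star) (cell circ) b b' q (refl , refl)
      ⇒adj (here {r , b} {j} h e) = proj₁ (touch h (at (flag (toℕ b)) r (toℕ j)) (inj₁ refl) (low b r (toℕ j)) e)
      ⇒adj (here⁻ {r , b} {j} h e) = proj₂ (touch h (at (flag (toℕ b)) r (toℕ j)) (inj₁ refl) (low b r (toℕ j)) e)
      ⇒adj (there {r , b} {j} h e) = proj₁ (touch h (at (flag (toℕ b)) r (suc (toℕ j))) (inj₂ refl) (low b r (suc (toℕ j))) e)
      ⇒adj (there⁻ {r , b} {j} h e) = proj₂ (touch h (at (flag (toℕ b)) r (suc (toℕ j))) (inj₂ refl) (low b r (suc (toℕ j))) e)
      ⇒adj (next {r , b} {j} {j'} e h) = ⇒same (rim r j) (rim r j') b (refl , inj₁ (inj₁ (e , h)))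
      ⇒adj (next⁻ {r , b} {j} {j'} e h) = ⇒same (rim r j') (rim r j) b (refl , inj₂ (inj₁ (e , h)))
      ⇒adj (wrap {r , b} {j} {j'} e h) = ⇒same (rim r j) (rim r j') b (refl , inj₁ (inj₂ (e , h)))
      ⇒adj (wrap⁻ {r , b} {j} {j'} e h) = ⇒same (rim r j') (rim r j) b (refl , inj₂ (inj₂ (e , h)))
      ⇒adj (spoke {r , b} {j}) = ⇒same (rim r j) (nave r) b refl
      ⇒adj (spoke⁻ {r , b} {j}) = ⇒same (nave r) (rim r j) b refl

      private
        climb : List V → ℕ → List V
        climb p b = p ++ pt (circ , blk (suc b)) ∷ pt (star , blk (suc b)) ∷ []

      U : ℕ → List V
      U zero = []
      U (suc b) = climb (U b) b

      o : Y
      o = star , blk 0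

      U-path : ∀ {b} → b ≤ ℓ → Path (pt o) (U b) (pt (star , blk b))
      U-path {zero} h = []
      U-path {suc b} h = U-path (<⇒≤ h) ⁀ (base (rise (trans (toℕ-blk h) (cong suc (sym (toℕ-blk (<⇒≤ h)))))) ∷ base (level tt) ∷ [])

      Ub-path : ∀ (b : Block) → Path (pt o) (U (toℕ b)) (pt (star , b))
      Ub-path b = subst (λ z → Path (pt o) (U (toℕ b)) (pt (star , z))) (blk-toℕ b) (U-path (≤-pred (toℕ<n b)))

      leg : Y → List V
      leg (star , b) = []
      leg (circ , b) = pt (circ , b) ∷ []
      leg (lo g , b) = pt (lo g , b) ∷ []
      leg (hi g , b) = pt (circ , b) ∷ pt (hi g , b) ∷ []

      leg-path : ∀ y → Path (pt (star , proj₂ y)) (leg y) (pt y)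
      leg-path (star , b) = []
      leg-path (circ , b) = base (level tt) ∷ []
      leg-path (lo g , b) = base (level tt) ∷ []
      leg-path (hi g , b) = base (level tt) ∷ base (level tt) ∷ []

      ωY : Y → List V
      ωY y = U (toℕ (proj₂ y)) ++ leg y

      ωY-path : ∀ y → Path (pt o) (ωY y) (pt y)
      ωY-path y = Ub-path (proj₂ y) ⁀ leg-path y

      open Routes o ωY ωY-path public

      n : ℕ
      n = K * suc ℓ

      abstract
        enc : Vtx → Fin n
        enc (c , b) = combine (Inverse.to Ty↔ c) b

        dec : Fin n → Vtx
        dec v = Inverse.from Ty↔ (proj₁ (remQuot {K} (suc ℓ) v)) , proj₂ (remQuot {K} (suc ℓ) v)

        dec-enc : ∀ u → dec (enc u) ≡ u
        dec-enc (c , b) = trans (cong (λ p → Inverse.from Ty↔ (proj₁ p) , proj₂ p) (remQuot-combine {K} (Inverse.to Ty↔ c) b))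
          (cong (_, b) (Inverse.strictlyInverseʳ Ty↔ c))

        enc-dec : ∀ v → enc (dec v) ≡ v
        enc-dec v = trans (cong (λ c → combine {K} c (proj₂ (remQuot {K} (suc ℓ) v))) (Inverse.strictlyInverseˡ Ty↔ (proj₁ (remQuot {K} (suc ℓ) v))))
          (combine-remQuot {K} (suc ℓ) v)

        adjᵇ : Vtx → Vtx → Bool
        adjᵇ (c , b) (c' , b') = does (adjacent? (cmp (toℕ b) (toℕ b')) (flag (toℕ b)) (flag (toℕ b')) c c')

        adjᵇ-≡ : ∀ c b c' b' → adjᵇ (c , b) (c' , b') ≡ does (adjacent? (cmp (toℕ b) (toℕ b')) (flag (toℕ b)) (flag (toℕ b')) c c')
        adjᵇ-≡ c b c' b' = refl

        adjᵇ-sound : ∀ {u v} → adjᵇ u v ≡ true → AdjV u v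
        adjᵇ-sound {c , b} {c' , b'} = witness (adjacent? (cmp (toℕ b) (toℕ b')) (flag (toℕ b)) (flag (toℕ b')) c c')

        adjᵇ-complete : ∀ {u v} → AdjV u v → adjᵇ u v ≡ true
        adjᵇ-complete {c , b} {c' , b'} e = dec-true (adjacent? (cmp (toℕ b) (toℕ b')) (flag (toℕ b)) (flag (toℕ b')) c c') e

      vtx : Fin n → V
      vtx v = toV (dec v)

      idx : V → Fin n
      idx x = enc (fromV x)

      vtx-idx : ∀ x → vtx (idx x) ≡ x
      vtx-idx x = trans (cong toV (dec-enc (fromV x))) (toV-fromV x)

      idx-vtx : ∀ v → idx (vtx v) ≡ v
      idx-vtx v = trans (cong enc (fromV-toV (dec v))) (enc-dec v)

      private
        _≈ᵇ_ : Fin n → Fin n → Set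
        u ≈ᵇ v = adjᵇ (dec u) (dec v) ≡ true

      vtx-hom : ∀ {u v} → u ≈ᵇ v → vtx u ~ vtx v
      vtx-hom {u} {v} e = adj⇒ (dec u) (dec v) (adjᵇ-sound e)

      idx-hom : ∀ {x y} → x ~ y → idx x ≈ᵇ idx y
      idx-hom {x} {y} e = adjᵇ-complete (subst₂ AdjV (sym (dec-enc (fromV x))) (sym (dec-enc (fromV y))) (⇒adj e))

      private
        ~-irrefl : ∀ {x} → ¬ x ~ x
        ~-irrefl (base (level {x} e)) = tint-E₀ x x e refl
        ~-irrefl (next e h) = 1+n≢n (sym e)
        ~-irrefl (next⁻ e h) = 1+n≢n (sym e)
        ~-irrefl {ring (r , b) j} (wrap e h) = <-irrefl (trans (cong suc (sym h)) e) (1<len (flag (toℕ b)) r)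
        ~-irrefl {ring (r , b) j} (wrap⁻ e h) = <-irrefl (trans (cong suc (sym h)) e) (1<len (flag (toℕ b)) r)

        bool-iff : ∀ {a b} → (a ≡ true → b ≡ true) → (b ≡ true → a ≡ true) → a ≡ b
        bool-iff {true} {b} f g = sym (f refl)
        bool-iff {false} {true} f g = g refl
        bool-iff {false} {false} f g = refl

        ≈ᵇ-sym : ∀ {u v} → u ≈ᵇ v → v ≈ᵇ u
        ≈ᵇ-sym {u} {v} e = subst₂ _≈ᵇ_ (idx-vtx v) (idx-vtx u) (idx-hom (~-sym (vtx-hom {u} {v} e)))

        path⇒star : ∀ {x p y} → Path x p y → Star _≈ᵇ_ (idx x) (idx y)
        path⇒star [] = ε
        path⇒star (e ∷ P) = idx-hom e ◅ path⇒star P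

      G : Graph n
      G = record
        { adj = λ u v → adjᵇ (dec u) (dec v)
        ; sym = λ u v → bool-iff (≈ᵇ-sym {u} {v}) (≈ᵇ-sym {v} {u})
        ; irrefl = irrefl
        ; conn = λ u v → subst₂ (Star _≈ᵇ_) (idx-vtx u) (idx-vtx v)
            (path⇒star (rev-path (ω-path (vtx u))) ◅◅ path⇒star (ω-path (vtx v))) }
        where
        irrefl : ∀ v → adjᵇ (dec v) (dec v) ≡ false
        irrefl v with adjᵇ (dec v) (dec v) in e
        ... | false = refl
        ... | true = ⊥-elim (~-irrefl (vtx-hom {v} {v} e))

      tyℕ : Ty → ℕ
      tyℕ c = toℕ (Inverse.to Ty↔ c)

      -- Built from the type of the target and the displacement of blocks, which is 0, 1 or 2 after
      -- adding 1. It thus does not depend on the absolute position of the block, and the port back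
      -- can be computed from it.
      port : Vtx → Vtx → ℕ
      port (c , b) (c' , b') = 3 * tyℕ c' + (suc (toℕ b') ∸ toℕ b)

      span : ∀ {u v} → AdjV u v → Σ ℕ λ s → s ≤ 2 × suc (toℕ (proj₂ v)) ∸ toℕ (proj₂ u) ≡ s × suc (toℕ (proj₂ v)) ≡ toℕ (proj₂ u) + s
      span {c , b} {c' , b'} = go (compare′ (toℕ b) (toℕ b'))
        where
        go : ∀ {d} → Compare (toℕ b) (toℕ b') d → Adjacent d (flag (toℕ b)) (flag (toℕ b')) c c' →
          Σ ℕ λ s → s ≤ 2 × suc (toℕ b') ∸ toℕ b ≡ s × suc (toℕ b') ≡ toℕ b + s
        go (same q) _ rewrite q = 1 , s≤s z≤n , m+n∸n≡m 1 (toℕ b) , +-comm 1 (toℕ b)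
        go (up q) _ rewrite q = 2 , ≤-refl , m+n∸n≡m 2 (toℕ b) , +-comm 2 (toℕ b)
        go (down q) _ rewrite q = 0 , z≤n , n∸n≡0 (suc (toℕ b')) , sym (+-identityʳ _)

      PG : Ports G
      PG = record
        { δ = λ u v → port (dec u) (dec v)
        ; inj = λ u v v' e e' p → trans (sym (enc-dec v)) (trans (cong enc (same-target (dec u) (dec v) (dec v') (adjᵇ-sound e) (adjᵇ-sound e') p)) (enc-dec v')) }
        where
        same-target : ∀ u v v' → AdjV u v → AdjV u v' → port u v ≡ port u v' → v ≡ v'
        same-target u@(c , b) (c₁ , b₁) (c₂ , b₂) e e' p with span {u} {c₁ , b₁} e | span {u} {c₂ , b₂} e'
        ... | s , s≤2 , eq , q | s' , s'≤2 , eq' , q' = cong₂ _,_ c≡ (toℕ-injective (suc-injective (trans q (trans (cong (toℕ b +_) s≡) (sym q')))))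
          where
          p' : 3 * tyℕ c₁ + s ≡ 3 * tyℕ c₂ + s'
          p' = trans (cong (3 * tyℕ c₁ +_) (sym eq)) (trans p (cong (3 * tyℕ c₂ +_) eq'))
          s≡ : s ≡ s'
          s≡ = trans (sym (proj₁ (divmod3 (tyℕ c₁) s≤2))) (trans (cong rem3 p') (proj₁ (divmod3 (tyℕ c₂) s'≤2)))
          c≡ : c₁ ≡ c₂
          c≡ = trans (sym (Inverse.strictlyInverseʳ Ty↔ c₁)) (trans (cong (Inverse.from Ty↔) (toℕ-injective
            (trans (sym (proj₂ (divmod3 (tyℕ c₁) s≤2))) (trans (cong quot3 p') (proj₂ (divmod3 (tyℕ c₂) s'≤2))))))
            (Inverse.strictlyInverseʳ Ty↔ c₂))

      cellsAt : Block → List Spot → List V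
      cellsAt b = map (λ s → pt (place b s))

      private
        cells-path : ∀ (b : Block) {u xs v} → SP.Path (proj₂ (flag (toℕ b))) u xs v → Path (pt (place b u)) (cellsAt b xs) (pt (place b v))
        cells-path b = map-path (λ s → pt (place b s)) (λ e → base (place-edge b refl e))

      loopAt : Block → Bool × Letter → List V
      loopAt b x = cellsAt b (loop false x)

      loopAt-path : ∀ b x → Path (pt (star , b)) (loopAt b x) (pt (star , b))
      loopAt-path b x = cells-path b (loop-path false x)

      loopsAt : Block → List (Bool × Letter) → List V
      loopsAt b u = cellsAt b (loops false u)

      loopsAt-path : ∀ b u → Path (pt (star , b)) (loopsAt b u) (pt (star , b))
      loopsAt-path b u = cells-path b (loops-path false u)

      -- The routes follow a spanning tree that contains all edges between cells except those from
      -- `lo g` to `hi g`. Each of these closes up the loop of its letter, so contracting the loops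
      -- makes the routes compatible with all edges.
      module Simple (loop-trivial : ∀ b g → pt (star , b) ∷ loopAt b (true , g) ≃ pt (star , b) ∷ []) where
        private
          Compatible : Y → Y → Set
          Compatible x y = pt o ∷ ωY x ++ pt y ∷ [] ≃ pt o ∷ ωY y

          reverse : ∀ {x y} → x ∼ y → Compatible x y → Compatible y x
          reverse {x} {y} e h = begin
            pt o ∷ ωY y ++ pt x ∷ []                 ≈⟨ suffix _ (≃-sym h) ⟩
            pt o ∷ (ωY x ++ pt y ∷ []) ++ pt x ∷ []  ≡⟨ cong (pt o ∷_) (++-assoc (ωY x) _ _) ⟩
            pt o ∷ ωY x ++ pt y ∷ pt x ∷ []          ≈⟨ after (ωY-path x) (backtrack [] (base e)) ⟩
            pt o ∷ ωY x ++ []                        ≡⟨ cong (pt o ∷_) (++-identityʳ (ωY x)) ⟩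
            pt o ∷ ωY x                              ∎
            where open ≃-Reasoning

          local : ∀ x y b → pt (star , b) ∷ leg (x , b) ++ pt (y , b) ∷ [] ≃ pt (star , b) ∷ leg (y , b) → Compatible (x , b) (y , b)
          local x y b h = ≃-trans (≃-reflexive (cong (pt o ∷_) (++-assoc (U (toℕ b)) (leg (x , b)) _))) (after (Ub-path b) h)

          loop-edge : ∀ g b → pt (star , b) ∷ pt (lo g , b) ∷ pt (hi g , b) ∷ [] ≃ pt (star , b) ∷ pt (circ , b) ∷ pt (hi g , b) ∷ []
          loop-edge g b = begin
            pt (star , b) ∷ pt (lo g , b) ∷ pt (hi g , b) ∷ []
              ≈⟨ prefix (pt (star , b) ∷ pt (lo g , b) ∷ []) (≃-sym (backtrack [] (base (level tt)))) ⟩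
            pt (star , b) ∷ pt (lo g , b) ∷ pt (hi g , b) ∷ pt (circ , b) ∷ pt (hi g , b) ∷ []
              ≈⟨ prefix (pt (star , b) ∷ pt (lo g , b) ∷ pt (hi g , b) ∷ []) (≃-sym (backtrack _ (base (level tt)))) ⟩
            pt (star , b) ∷ loopAt b (true , g) ++ pt (circ , b) ∷ pt (hi g , b) ∷ []
              ≈⟨ suffix _ (loop-trivial b g) ⟩
            pt (star , b) ∷ pt (circ , b) ∷ pt (hi g , b) ∷ []  ∎
            where open ≃-Reasoning

          rise-edge : ∀ {b b'} → toℕ b' ≡ suc (toℕ b) → Compatible (star , b) (circ , b')
          rise-edge {b} {b'} q = begin
            pt o ∷ (U (toℕ b) ++ []) ++ pt (circ , b') ∷ []   ≡⟨ cong (λ l → pt o ∷ l ++ pt (circ , b') ∷ []) (++-identityʳ _) ⟩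
            pt o ∷ U (toℕ b) ++ pt (circ , b') ∷ []           ≈⟨ after (Ub-path b) (prefix (pt (star , b) ∷ []) (≃-sym (backtrack [] (base (level tt))))) ⟩
            pt o ∷ U (toℕ b) ++ pt (circ , b') ∷ pt (star , b') ∷ pt (circ , b') ∷ []
              ≡⟨ cong (pt o ∷_) (sym (++-assoc (U (toℕ b)) _ _)) ⟩
            pt o ∷ (U (toℕ b) ++ pt (circ , b') ∷ pt (star , b') ∷ []) ++ pt (circ , b') ∷ []
              ≡⟨ cong (λ z → pt o ∷ (U (toℕ b) ++ pt (circ , z) ∷ pt (star , z) ∷ []) ++ pt (circ , b') ∷ []) (trans (sym (blk-toℕ b')) (cong blk q)) ⟩
            pt o ∷ U (suc (toℕ b)) ++ pt (circ , b') ∷ []     ≡⟨ cong (λ k → pt o ∷ U k ++ pt (circ , b') ∷ []) (sym q) ⟩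
            pt o ∷ ωY (circ , b')                             ∎
            where open ≃-Reasoning

        ωY-edge : ∀ {x y} → x ∼ y → pt o ∷ ωY x ++ pt y ∷ [] ≃ pt o ∷ ωY y
        ωY-edge (level {x} {y} {b} e) = go x y e
          where
          go : ∀ x y → E₀ x y → Compatible (x , b) (y , b)
          go star circ e = local star circ b ≃-refl
          go circ star e = reverse (level tt) (local star circ b ≃-refl)
          go star (lo g) e = local star (lo g) b ≃-refl
          go (lo g) star e = reverse (level tt) (local star (lo g) b ≃-refl)
          go (lo g) (hi .g) refl = local (lo g) (hi g) b (loop-edge g b)
          go (hi g) (lo .g) refl = reverse (level refl) (local (lo g) (hi g) b (loop-edge g b))
          go (hi g) circ e = reverse (level tt) (local circ (hi g) b ≃-refl)
          go circ (hi g) e = local circ (hi g) b ≃-refl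
        ωY-edge (rise q) = rise-edge q
        ωY-edge (fall q) = reverse (rise q) (rise-edge q)

        open Compatibility ωY-edge
        open Trivialisation (pt o) ω ω-path ω-edge

        private
          module GH = GraphHomotopy G

          round : ∀ p → map idx (map vtx p) ≡ p
          round p = trans (sym (map-∘ p)) (trans (map-cong idx-vtx p) (map-id p))

        simply-connected : InSC G
        simply-connected = GH.closed⇒SC λ {u} {p} Q → subst₂ GH._≃_ (round (u ∷ p)) (round (u ∷ []))
          (map-≃ idx idx-hom (parallel (map-path vtx vtx-hom Q) []))

      open Words Letter

      module Group-of-loops where
        π : Group _ _
        π = π₁ (pt o)

        private
          module π = Group π

          -- the loops of block b, as elements of the fundamental group at its own star
          module At (b : Block) where
            local : Letter → Group.Carrier (π₁ (pt (star , b)))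
            local g = loopAt b (true , g) , loopAt-path b (true , g)

            open Eval (π₁ (pt (star , b))) local public

            ev-list : ∀ u → proj₁ (ev u) ≡ loopsAt b u
            ev-list [] = refl
            ev-list ((true , g) ∷ u) = cong (loopAt b (true , g) ++_) (ev-list u)
            ev-list ((false , g) ∷ u) = cong (loopAt b (false , g) ++_) (ev-list u)

            open Conjugation (Ub-path b) public

            up-to : Group.Carrier (π₁ (pt (star , b))) → π.Carrier
            up-to (p , P) = conj p , conj-path P

        value : Block → Letter → π.Carrier
        value b g = At.up-to b (At.local b g)

        module Val (b : Block) = Eval π (value b)

        value-trivial : ∀ {b g} → value b g π.≈ π.ε → pt (star , b) ∷ loopAt b (true , g) ≃ pt (star , b) ∷ []
        value-trivial {b} {g} = At.conj-trivial b (loopAt-path b (true , g))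

        private
          ev-up : ∀ b u → Val.ev b u π.≈ At.up-to b (At.ev b u)
          ev-up b = ev-hom (π₁ (pt (star , b))) π (At.up-to b) (At.conj-cong b)
            (λ x y → At.conj-++ b (proj₁ y) (proj₂ x)) (At.local b)

          tail-shift : ∀ f a k → tail f (suc a) k ≡ tail (λ j → f (suc j)) a k
          tail-shift f a zero = refl
          tail-shift f a (suc k) = cong (_ ∷_) (tail-shift f (suc a) k)

          tail-cells : ∀ b u xs → tail (λ j → place b (nth u xs j)) 0 (length xs) ≡ cellsAt b xs
          tail-cells b u [] = refl
          tail-cells b u (x ∷ xs) = cong₂ _∷_ refl (trans (tail-shift (λ j → place b (nth u (x ∷ xs) j)) 0 (length xs)) (tail-cells b x xs))

          disc : ∀ b r → pt (star , b) ∷ cellsAt b (track (flag (toℕ b)) r) ≃ pt (star , b) ∷ []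
          disc b r = subst (λ l → pt (star , b) ∷ l ≃ pt (star , b) ∷ []) (tail-cells b (star , false) (track (flag (toℕ b)) r)) (contractible (r , b))

          drop-end : ∀ b {p} → Path (pt (star , b)) (cellsAt b p) (pt (star , b)) →
            pt (star , b) ∷ cellsAt b (p ++ end) ≃ pt (star , b) ∷ cellsAt b p
          drop-end b {p} Q = begin
            pt (star , b) ∷ cellsAt b (p ++ end)                                        ≡⟨ cong (pt (star , b) ∷_) (map-++ _ p end) ⟩
            pt (star , b) ∷ cellsAt b p ++ pt (circ , b) ∷ pt (star , b) ∷ []           ≈⟨ after Q (backtrack [] (base (level tt))) ⟩
            pt (star , b) ∷ cellsAt b p ++ []                                           ≡⟨ cong (pt (star , b) ∷_) (++-identityʳ _) ⟩
            pt (star , b) ∷ cellsAt b p                                                 ∎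
            where open ≃-Reasoning

        value-relator : ∀ b r → Val.ev b (relator (toℕ b ≡ᵇ 0) (toℕ b ≡ᵇ ℓ) r) π.≈ π.ε
        value-relator b r = ≃-trans (ev-up b u) (≃-trans (At.conj-cong b {q = []} local-relator) (rev-inverseʳ (Ub-path b)))
          where
          u = relator (toℕ b ≡ᵇ 0) (toℕ b ≡ᵇ ℓ) r
          local-relator : pt (star , b) ∷ proj₁ (At.ev b u) ≃ pt (star , b) ∷ []
          local-relator = ≃-trans (≃-reflexive (cong (pt (star , b) ∷_) (At.ev-list b u)))
            (≃-trans (≃-sym (drop-end b (cells-path b (loops-path false u)))) (disc b (inj₁ r)))

        -- The crossing disc makes the word `cross g` in block `b` homotopic to the loop of `g` in
        -- the next block conjugated by the edge between them; together with the route to block `b`,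
        -- this edge is the route to the next block.
        value-cross : ∀ b b' g → toℕ b' ≡ suc (toℕ b) → Val.ev b (cross g) π.≈ value b' g
        value-cross b b' g q = ≃-trans (ev-up b (cross g)) (≃-trans (At.conj-cong b local-cross) (≃-reflexive (cong (pt o ∷_) assemble)))
          where
          s = pt (star , b)
          c' = pt (circ , b')
          s' = pt (star , b')
          up-path : Path s (c' ∷ s' ∷ []) s'
          up-path = base (rise q) ∷ base (level tt) ∷ []
          module Up = Conjugation up-path
          C = loopsAt b (cross g)
          C-path : Path s C s
          C-path = subst (λ l → Path s l s) (At.ev-list b (cross g)) (proj₂ (At.ev b (cross g)))
          b'≡ : blk (suc (toℕ b)) ≡ b'
          b'≡ = trans (cong blk (sym q)) (blk-toℕ b')
          last≡ : (toℕ b ≡ᵇ ℓ) ≡ false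
          last≡ with toℕ b ≡ᵇ ℓ in e
          ... | false = refl
          ... | true = ⊥-elim (<-irrefl (≡ᵇ⇒≡ (toℕ b) ℓ (subst Data.Bool.T (sym e) tt)) (subst (_≤ ℓ) q (≤-pred (toℕ<n b'))))
          crossed : s ∷ C ++ c' ∷ s' ∷ loopAt b' (false , g) ++ c' ∷ s ∷ [] ≃ s ∷ []
          crossed = ≃-trans (≃-reflexive (cong (s ∷_) shape)) (≃-trans (≃-sym (drop-end b {crossing g} crossing-path))
            (subst (λ l → s ∷ cellsAt b (track ((toℕ b ≡ᵇ 0) , l) (inj₂ g)) ≃ s ∷ []) last≡ (disc b (inj₂ g))))
            where
            shape : C ++ c' ∷ s' ∷ loopAt b' (false , g) ++ c' ∷ s ∷ [] ≡ cellsAt b (crossing g)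
            shape = trans (cong (λ z → C ++ pt (circ , z) ∷ pt (star , z) ∷ loopAt z (false , g) ++ pt (circ , z) ∷ s ∷ []) (sym b'≡)) (sym (map-++ _ (loops false (cross g)) _))
            crossing-path : Path s (cellsAt b (crossing g)) s
            crossing-path = subst (λ l → Path s l s) shape (C-path ⁀ (Up.conj-path (loopAt-path b' (false , g))))
          local-cross : s ∷ proj₁ (At.ev b (cross g)) ≃ s ∷ Up.conj (loopAt b' (true , g))
          local-cross = begin
            s ∷ proj₁ (At.ev b (cross g))      ≡⟨ cong (s ∷_) (trans (At.ev-list b (cross g)) (sym (++-identityʳ C))) ⟩
            s ∷ C ++ []                        ≈⟨ after C-path (≃-sym inverse) ⟩
            s ∷ C ++ D ++ D'                   ≡⟨ cong (s ∷_) (sym (++-assoc C D D')) ⟩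
            s ∷ (C ++ D) ++ D'                 ≈⟨ suffix D' crossed ⟩
            s ∷ D'                             ∎
            where
            open ≃-Reasoning
            D = Up.conj (loopAt b' (false , g))
            D' = Up.conj (loopAt b' (true , g))
            inverse : s ∷ D ++ D' ≃ s ∷ []
            inverse = ≃-trans (≃-sym (Up.conj-++ (loopAt b' (true , g)) (loopAt-path b' (false , g))))
              (≃-trans (Up.conj-cong {q = []} (rev-inverseˡ (loopAt-path b' (true , g)))) (rev-inverseʳ up-path))
          assemble : At.conj b (Up.conj (loopAt b' (true , g))) ≡ At.conj b' (loopAt b' (true , g))
          assemble = trans (cong (λ l → U (toℕ b) ++ l) (++-assoc (c' ∷ s' ∷ []) (loopAt b' (true , g) ++ c' ∷ s ∷ []) (rev (pt o) (U (toℕ b)))))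
            (trans (sym (++-assoc (U (toℕ b)) (c' ∷ s' ∷ []) _))
            (trans (cong₂ (λ l r → l ++ loopAt b' (true , g) ++ r) climbed
              (trans (sym (rev-++ (Ub-path b) (c' ∷ s' ∷ []))) (cong (rev (pt o)) climbed))) refl))
            where
            climbed : U (toℕ b) ++ c' ∷ s' ∷ [] ≡ U (toℕ b')
            climbed = trans (cong (λ z → U (toℕ b) ++ pt (circ , z) ∷ pt (star , z) ∷ []) (sym b'≡)) (cong U (sym q))

      module Representation {c ℓ'} (H : Group c ℓ') (val : ℕ → Letter → Group.Carrier H)
        (val-relator : ∀ {b} → b ≤ ℓ → ∀ r → Group._≈_ H (Eval.ev H (val b) (relator (b ≡ᵇ 0) (b ≡ᵇ ℓ) r)) (Group.ε H))
        (val-cross : ∀ {b} → b < ℓ → ∀ g → Group._≈_ H (Eval.ev H (val b) (cross g)) (val (suc b) g)) where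
        open GroupKit H using (Carrier; _≈_; _∙_; _⁻¹; identityˡ; identityʳ; inverseˡ; inverseʳ; ∙-cong; ∙-congˡ; ∙-congʳ; assoc; ≈-refl; ε⁻¹≈ε) renaming (ε to 1#; sym to ≈-sym; trans to ≈-trans)
        private module Ev (b : ℕ) = Eval H (val b)

        -- The tree edges are trivial and the one remaining edge of each loop carries the value of
        -- its letter, so the holonomy of a word is its value.
        labY : Y → Y → Carrier
        labY (lo g , b) (hi _ , _) = val (toℕ b) g
        labY (hi g , b) (lo _ , _) = val (toℕ b) g ⁻¹
        labY _ _ = 1#

        private
          labY-refl : ∀ y → labY y y ≈ 1#
          labY-refl (star , b) = ≈-refl
          labY-refl (circ , b) = ≈-refl
          labY-refl (lo g , b) = ≈-refl
          labY-refl (hi g , b) = ≈-refl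

          labY-inv : ∀ {x y} → x ∼ y → labY x y ∙ labY y x ≈ 1#
          labY-inv (level {x} {y} e) = go x y e
            where
            go : ∀ {b} x y → E₀ x y → labY (x , b) (y , b) ∙ labY (y , b) (x , b) ≈ 1#
            go star circ e = identityˡ _
            go circ star e = identityˡ _
            go star (lo g) e = identityˡ _
            go (lo g) star e = identityˡ _
            go (lo g) (hi .g) refl = inverseʳ _
            go (hi g) (lo .g) refl = inverseˡ _
            go (hi g) circ e = identityˡ _
            go circ (hi g) e = identityˡ _
          labY-inv (rise _) = identityˡ _
          labY-inv (fall _) = identityˡ _

        open Labelling H labY labY-refl labY-inv

        private
          evS : Block → Spot → List Spot → Carrier
          evS b u [] = 1#
          evS b u (x ∷ xs) = labY (place b u) (place b x) ∙ evS b x xs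

          along-evS : ∀ b u xs → along (λ j → place b (nth u xs j)) (length xs) ≈ evS b u xs
          along-evS b u [] = ≈-refl
          along-evS b u (x ∷ xs) = ≈-trans (along-suc (λ j → place b (nth u (x ∷ xs) j)) (length xs)) (∙-congˡ (along-evS b x xs))

          1∙ : ∀ {x y} → x ≈ y → 1# ∙ x ≈ y
          1∙ h = ≈-trans (identityˡ _) h

          sgn : ℕ → Bool × Letter → Carrier
          sgn b (s , g) = Ev.sgn b s (val b g)

          evS-loop : ∀ b x xs → evS b (star , false) (loop false x ++ xs) ≈ sgn (toℕ b) x ∙ evS b (star , false) xs
          evS-loop b (true , g) xs = 1∙ (∙-congˡ (1∙ (1∙ ≈-refl)))
          evS-loop b (false , g) xs = 1∙ (1∙ (∙-congˡ (1∙ ≈-refl)))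

          evS-loops : ∀ b u xs → evS b (star , false) (loops false u ++ xs) ≈ Ev.ev (toℕ b) u ∙ evS b (star , false) xs
          evS-loops b [] xs = ≈-sym (identityˡ _)
          evS-loops b (x ∷ u) xs = ≈-trans (reflex (cong (evS b (star , false)) (++-assoc (loop false x) (loops false u) xs)))
              (≈-trans (evS-loop b x (loops false u ++ xs)) (≈-trans (∙-congˡ (evS-loops b u xs)) (≈-sym (assoc _ _ _))))
            where
            reflex : ∀ {x y} → x ≡ y → x ≈ y
            reflex refl = ≈-refl

          evS-end : ∀ b → evS b (star , false) end ≈ 1#
          evS-end b = 1∙ (1∙ ≈-refl)

          evS-crossing : ∀ b g → Ev.ev (toℕ b) (cross g) ≈ val (toℕ (blk (suc (toℕ b)))) g → evS b (star , false) (crossing g ++ end) ≈ 1#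
          evS-crossing b g h = ≈-trans (reflex (cong (evS b (star , false)) (++-assoc (loops false (cross g)) _ end)))
              (≈-trans (evS-loops b (cross g) _) (≈-trans (∙-cong h (1∙ (1∙ (1∙ (1∙ (≈-trans (∙-congˡ (1∙ (1∙ (1∙ (evS-end b))))) (identityʳ _))))))) (inverseʳ _)))
            where
            reflex : ∀ {x y} → x ≡ y → x ≈ y
            reflex refl = ≈-refl

          evS-track : ∀ b f r → (∀ r → Ev.ev (toℕ b) (relator (proj₁ f) (proj₂ f) r) ≈ 1#) →
            (proj₂ f ≡ false → ∀ g → Ev.ev (toℕ b) (cross g) ≈ val (toℕ (blk (suc (toℕ b)))) g) → evS b (star , false) (track f r) ≈ 1#
          evS-track b (first , last) (inj₁ r) h k = ≈-trans (evS-loops b (relator first last r) end) (≈-trans (∙-cong (h r) (evS-end b)) (identityˡ _))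
          evS-track b (first , true) (inj₂ g) h k = evS-end b
          evS-track b (first , false) (inj₂ g) h k = evS-crossing b g (k refl g)

          relators : ∀ i → along (λ j → place (proj₂ i) (at (flag (toℕ (proj₂ i))) (proj₁ i) j)) (len (flag (toℕ (proj₂ i))) (proj₁ i)) ≈ 1#
          relators (r , b) = ≈-trans (along-evS b (star , false) (track (flag (toℕ b)) r))
            (evS-track b (flag (toℕ b)) r (val-relator (≤-pred (toℕ<n b)))
              (λ e g → subst (λ k → Ev.ev (toℕ b) (cross g) ≈ val k g) (sym (toℕ-blk (not-last b e))) (val-cross (not-last b e) g)))

        open Flat relators
        open Monodromy H lab lab-inv lab-tri

        private
          ev-cells : ∀ b u xs → ev (pt (place b u)) (cellsAt b xs) ≈ evS b u xs
          ev-cells b u [] = ≈-refl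
          ev-cells b u (x ∷ xs) = ∙-congˡ (ev-cells b x xs)

        holonomy : ∀ b u → total (pt (star , b) ∷ loopsAt b u) ≈ Ev.ev (toℕ b) u
        holonomy b u = ≈-trans (ev-cells b (star , false) (loops false u))
          (≈-trans (reflex (cong (evS b (star , false)) (sym (++-identityʳ (loops false u))))) (≈-trans (evS-loops b u []) (identityʳ _)))
          where
          reflex : ∀ {x y} → x ≡ y → x ≈ y
          reflex refl = ≈-refl

        homotopic⇒≈ : ∀ b u u' → pt (star , b) ∷ loopsAt b u ≃ pt (star , b) ∷ loopsAt b u' → Ev.ev (toℕ b) u ≈ Ev.ev (toℕ b) u'
        homotopic⇒≈ b u u' h = ≈-trans (≈-sym (holonomy b u)) (≈-trans (total-resp h) (holonomy b u'))

-- Labels depend only on the type of a vertex and the kind of its block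

module LabelLocality where

  open import Defs hiding (Eval)
  open import Data.Bool using (Bool; true; false)
  open import Data.Empty using (⊥-elim)
  open import Data.Fin using (Fin; zero; suc; toℕ)
  open import Data.Fin.Properties using (toℕ<n)
  open import Data.Nat using (ℕ; zero; suc; _+_; _*_; _∸_; _≤_; z≤n; s≤s; _≡ᵇ_)
  open import Data.Nat.Properties
  open import Data.Product using (Σ; _×_; _,_; proj₁; proj₂)
  open import Data.Unit using (tt)
  open import Function.Bundles using (_↔_)
  open import Relation.Binary.PropositionalEquality using (_≡_; _≢_; refl; cong; cong₂; subst; subst₂; sym; trans)
  open import Relation.Nullary using (does)
  open AgentSimulation
  open Labels
  open Blocks

  private
    -- A label also sees vertices of the two adjacent blocks, whose discs depend on their own flags.
    -- Hence the neighbours of the first and of the last block form kinds of their own, and a tower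
    -- of five blocks has exactly one block of each kind.
    data Zone (ℓ b : ℕ) : ℕ → Set where
      first : b ≡ 0 → Zone ℓ b 0
      second : b ≡ 1 → Zone ℓ b 1
      middle : 2 ≤ b → 2 + b ≤ ℓ → Zone ℓ b 2
      penultimate : suc b ≡ ℓ → Zone ℓ b 3
      last : b ≡ ℓ → Zone ℓ b 4

    ≡ᵇ-true : ∀ m n → (m ≡ᵇ n) ≡ true → m ≡ n
    ≡ᵇ-true m n e = ≡ᵇ⇒≡ m n (subst Data.Bool.T (sym e) tt)

    ≡ᵇ-false : ∀ m n → (m ≡ᵇ n) ≡ false → m ≢ n
    ≡ᵇ-false zero zero () _
    ≡ᵇ-false (suc m) (suc n) e h = ≡ᵇ-false m n e (suc-injective h)

    ≡ᵇ-cong : ∀ {a b c d} → (a ≡ b → c ≡ d) → (c ≡ d → a ≡ b) → (a ≡ᵇ b) ≡ (c ≡ᵇ d)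
    ≡ᵇ-cong {a} {b} {c} {d} f g with a ≡ᵇ b in e | c ≡ᵇ d in e'
    ... | true | true = refl
    ... | false | false = refl
    ... | true | false = ⊥-elim (≡ᵇ-false c d e' (f (≡ᵇ-true a b e)))
    ... | false | true = ⊥-elim (≡ᵇ-false a b e (g (≡ᵇ-true c d e')))

    zone : ∀ {ℓ b} → b ≤ ℓ → Zone ℓ b (kap ℓ b)
    zone {ℓ} {zero} h = first refl
    zone {ℓ} {suc zero} h = second refl
    zone {ℓ} {suc (suc b)} h with ℓ ≡ᵇ suc (suc b) in e
    ... | true = last (sym (≡ᵇ-true ℓ _ e))
    ... | false with ℓ ≡ᵇ suc (suc (suc b)) in e'
    ...   | true = penultimate (sym (≡ᵇ-true ℓ _ e'))
    ...   | false = middle (s≤s (s≤s z≤n)) (≤∧≢⇒< (≤∧≢⇒< h (λ q → ≡ᵇ-false ℓ _ e (sym q))) (λ q → ≡ᵇ-false ℓ _ e' (sym q)))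

    zone≤4 : ∀ {ℓ b k} → Zone ℓ b k → k ≤ 4
    zone≤4 (first _) = z≤n
    zone≤4 (second _) = s≤s z≤n
    zone≤4 (middle _ _) = s≤s (s≤s z≤n)
    zone≤4 (penultimate _) = s≤s (s≤s (s≤s z≤n))
    zone≤4 (last _) = ≤-refl

    big : ∀ {m n s} → s ≤ 2 → 3 + m ≤ n → s + m ≢ n
    big {m} h h' e = <⇒≱ h' (subst (_≤ 2 + m) e (+-monoˡ-≤ m h))

    module _ {ℓ b k s : ℕ} (4≤ℓ : 4 ≤ ℓ) (s≤2 : s ≤ 2) where

      -- s + b = 1 means that the block b + s - 1 is the first one, s + b = 1 + ℓ that it is the last one
      zone-first : Zone ℓ b k → (s + b ≡ 1 → s + k ≡ 1) × (s + k ≡ 1 → s + b ≡ 1)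
      zone-first (first refl) = (λ e → e) , (λ e → e)
      zone-first (second refl) = (λ e → e) , (λ e → e)
      zone-first (middle h _) = (λ e → ⊥-elim (<⇒≱ h (subst (b ≤_) e (m≤n+m b s)))) , (λ e → ⊥-elim (<⇒≱ {1} {2} ≤-refl (subst (2 ≤_) e (m≤n+m 2 s))))
      zone-first (penultimate refl) = (λ e → ⊥-elim (<⇒≱ (≤-trans (s≤s (s≤s z≤n)) (≤-pred 4≤ℓ)) (subst (b ≤_) e (m≤n+m b s)))) , (λ e → ⊥-elim (<⇒≱ {1} {3} (s≤s (s≤s z≤n)) (subst (3 ≤_) e (m≤n+m 3 s))))
      zone-first (last refl) = (λ e → ⊥-elim (<⇒≱ (≤-trans (s≤s (s≤s z≤n)) 4≤ℓ) (subst (b ≤_) e (m≤n+m b s)))) , (λ e → ⊥-elim (<⇒≱ {1} {4} (s≤s (s≤s z≤n)) (subst (4 ≤_) e (m≤n+m 4 s))))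

      zone-last : Zone ℓ b k → (s + b ≡ suc ℓ → s + k ≡ 5) × (s + k ≡ 5 → s + b ≡ suc ℓ)
      zone-last (first refl) = (λ e → ⊥-elim (big s≤2 (≤-trans (s≤s (s≤s (s≤s z≤n))) (s≤s 4≤ℓ)) e)) , (λ e → ⊥-elim (big {0} s≤2 (s≤s (s≤s (s≤s z≤n))) e))
      zone-last (second refl) = (λ e → ⊥-elim (big s≤2 (≤-trans (s≤s (s≤s (s≤s (s≤s z≤n)))) (s≤s 4≤ℓ)) e)) , (λ e → ⊥-elim (big {1} s≤2 (s≤s (s≤s (s≤s (s≤s z≤n)))) e))
      zone-last (middle _ h) = (λ e → ⊥-elim (big s≤2 (s≤s h) e)) , (λ e → ⊥-elim (big {2} s≤2 ≤-refl e))
      zone-last (penultimate refl) = (λ e → cong (_+ 3) (+-cancelʳ-≡ b s 2 e)) , (λ e → cong (_+ b) (+-cancelʳ-≡ 3 s 2 e))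
      zone-last (last refl) = (λ e → cong (_+ 4) (+-cancelʳ-≡ b s 1 e)) , (λ e → cong (_+ b) (+-cancelʳ-≡ 4 s 1 e))

    data In (ℓ : ℕ) : ℕ → Set where
      inside : ∀ {b} → b ≤ ℓ → In ℓ (suc b)

    pre : ∀ {ℓ b k} → 4 ≤ ℓ → Zone ℓ b k → ∀ {s} → s ≤ 2 → In ℓ (s + b) → In 4 (s + k)
    pre 4≤ℓ (first refl) (s≤s z≤n) _ = inside z≤n
    pre 4≤ℓ (first refl) (s≤s (s≤s z≤n)) _ = inside (s≤s z≤n)
    pre 4≤ℓ (second refl) z≤n _ = inside z≤n
    pre 4≤ℓ (second refl) (s≤s z≤n) _ = inside (s≤s z≤n)
    pre 4≤ℓ (second refl) (s≤s (s≤s z≤n)) _ = inside (s≤s (s≤s z≤n))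
    pre 4≤ℓ (middle _ _) z≤n _ = inside (s≤s z≤n)
    pre 4≤ℓ (middle _ _) (s≤s z≤n) _ = inside (s≤s (s≤s z≤n))
    pre 4≤ℓ (middle _ _) (s≤s (s≤s z≤n)) _ = inside (s≤s (s≤s (s≤s z≤n)))
    pre 4≤ℓ (penultimate _) z≤n _ = inside (s≤s (s≤s z≤n))
    pre 4≤ℓ (penultimate _) (s≤s z≤n) _ = inside (s≤s (s≤s (s≤s z≤n)))
    pre 4≤ℓ (penultimate _) (s≤s (s≤s z≤n)) _ = inside ≤-refl
    pre 4≤ℓ (last _) z≤n _ = inside (s≤s (s≤s (s≤s z≤n)))
    pre 4≤ℓ (last _) (s≤s z≤n) _ = inside ≤-refl
    pre 4≤ℓ (last refl) (s≤s (s≤s z≤n)) (inside h) = ⊥-elim (1+n≰n h)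

    post : ∀ {ℓ b k} → 4 ≤ ℓ → Zone ℓ b k → ∀ {s} → s ≤ 2 → In 4 (s + k) → In ℓ (s + b)
    post 4≤ℓ (first refl) (s≤s z≤n) _ = inside z≤n
    post 4≤ℓ (first refl) (s≤s (s≤s z≤n)) _ = inside (≤-trans (s≤s z≤n) 4≤ℓ)
    post 4≤ℓ (second refl) z≤n _ = inside z≤n
    post 4≤ℓ (second refl) (s≤s z≤n) _ = inside (≤-trans (s≤s z≤n) 4≤ℓ)
    post 4≤ℓ (second refl) (s≤s (s≤s z≤n)) _ = inside (≤-trans (s≤s (s≤s z≤n)) 4≤ℓ)
    post 4≤ℓ (middle (s≤s _) h) z≤n _ = inside (≤-trans (n≤1+n _) (≤-trans (n≤1+n _) (≤-trans (n≤1+n _) h)))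
    post 4≤ℓ (middle _ h) (s≤s z≤n) _ = inside (≤-trans (n≤1+n _) (≤-trans (n≤1+n _) h))
    post 4≤ℓ (middle _ h) (s≤s (s≤s z≤n)) _ = inside (≤-trans (n≤1+n _) h)
    post {b = zero} (s≤s ()) (penultimate refl) z≤n _
    post {b = suc b} 4≤ℓ (penultimate refl) z≤n _ = inside (≤-trans (n≤1+n _) (n≤1+n _))
    post 4≤ℓ (penultimate refl) (s≤s z≤n) _ = inside (n≤1+n _)
    post 4≤ℓ (penultimate refl) (s≤s (s≤s z≤n)) _ = inside ≤-refl
    post {b = zero} () (last refl) z≤n _
    post {b = suc b} 4≤ℓ (last refl) z≤n _ = inside (n≤1+n _)
    post 4≤ℓ (last refl) (s≤s z≤n) _ = inside ≤-refl
    post 4≤ℓ (last refl) (s≤s (s≤s z≤n)) (inside (s≤s (s≤s (s≤s (s≤s ())))))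

  kap≤4 : ∀ {ℓ b} → b ≤ ℓ → kap ℓ b ≤ 4
  kap≤4 h = zone≤4 (zone h)

  module Locality (𝒫 : Blueprint) where
    open Blueprint 𝒫
    open Shape 𝒫
    private module T₄ = Tower 4

    module _ {ℓ : ℕ} (4≤ℓ : 4 ≤ ℓ) where
      private module T = Tower ℓ

      module _ (c : Ty) (b : T.Block) where
        private
          k : ℕ
          k = kap ℓ (toℕ b)

          Z : Zone ℓ (toℕ b) k
          Z = zone (≤-pred (toℕ<n b))

          k≤4 : k ≤ 4
          k≤4 = zone≤4 Z

          b₄ : T₄.Block
          b₄ = T₄.blk k

          k≡ : toℕ b₄ ≡ k
          k≡ = T₄.toℕ-blk k≤4

          -- Equal displacement from the central blocks; 1 is added to stay within the natural
          -- numbers.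
          Corr : T.Block → T₄.Block → Set
          Corr b₁ b₁' = Σ ℕ λ s → s ≤ 2 × suc (toℕ b₁) ≡ s + toℕ b × suc (toℕ b₁') ≡ s + k

          centre : Corr b b₄
          centre = 1 , s≤s z≤n , refl , cong suc k≡

          corr-flag : ∀ {b₁ b₁'} → Corr b₁ b₁' → T.flag (toℕ b₁) ≡ T₄.flag (toℕ b₁')
          corr-flag {b₁} {b₁'} (s , s≤2 , e , e') = cong₂ _,_
            (≡ᵇ-cong (λ q → suc-injective (trans e' (proj₁ zf (trans (sym e) (cong suc q))))) (λ q → suc-injective (trans e (proj₂ zf (trans (sym e') (cong suc q))))))
            (≡ᵇ-cong (λ q → suc-injective (trans e' (proj₁ zl (trans (sym e) (cong suc q))))) (λ q → suc-injective (trans e (proj₂ zl (trans (sym e') (cong suc q))))))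
            where
            zf = zone-first 4≤ℓ s≤2 Z
            zl = zone-last 4≤ℓ s≤2 Z

          cmp-+ : ∀ s s' m → cmp (s + m) (s' + m) ≡ cmp s s'
          cmp-+ s s' m = trans (cong₂ cmp (+-comm s m) (+-comm s' m)) (cmp-shift m s s')

          corr-cmp : ∀ {b₁ b₁' b₂ b₂'} → Corr b₁ b₁' → Corr b₂ b₂' → cmp (toℕ b₁) (toℕ b₂) ≡ cmp (toℕ b₁') (toℕ b₂')
          corr-cmp (s , _ , e , e') (s' , _ , q , q') = trans (cong₂ cmp e q) (trans (cmp-+ s s' (toℕ b)) (sym (trans (cong₂ cmp e' q') (cmp-+ s s' k))))

          corr-adj : ∀ c₁ c₂ {b₁ b₁' b₂ b₂'} → Corr b₁ b₁' → Corr b₂ b₂' → T.adjᵇ (c₁ , b₁) (c₂ , b₂) ≡ T₄.adjᵇ (c₁ , b₁') (c₂ , b₂')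
          corr-adj c₁ c₂ {b₁} {b₁'} {b₂} {b₂'} x y = trans (T.adjᵇ-≡ c₁ b₁ c₂ b₂)
            (trans (cong₃ (λ d f f' → does (adjacent? d f f' c₁ c₂)) (corr-cmp x y) (corr-flag x) (corr-flag y)) (sym (T₄.adjᵇ-≡ c₁ b₁' c₂ b₂')))
            where
            cong₃ : ∀ {A B C D : Set} (f : A → B → C → D) {a a' b b' c c'} → a ≡ a' → b ≡ b' → c ≡ c' → f a b c ≡ f a' b' c'
            cong₃ f refl refl refl = refl

          corr-port : ∀ c₁ c₂ {b₁ b₁' b₂ b₂'} → Corr b₁ b₁' → Corr b₂ b₂' → T.port (c₁ , b₁) (c₂ , b₂) ≡ T₄.port (c₁ , b₁') (c₂ , b₂')
          corr-port c₁ c₂ (s , _ , e , e') (s' , _ , q , q') = cong (3 * T.tyℕ c₂ +_)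
            (trans (cong₂ _∸_ (cong suc q) e) (trans (gap s s' (toℕ b)) (sym (trans (cong₂ _∸_ (cong suc q') e') (gap s s' k)))))
            where
            gap : ∀ s s' m → suc (s' + m) ∸ (s + m) ≡ suc s' ∸ s
            gap s s' m = [m+n]∸[m+o]≡n∸o′ m (suc s') s
              where
              [m+n]∸[m+o]≡n∸o′ : ∀ m n o → (n + m) ∸ (o + m) ≡ n ∸ o
              [m+n]∸[m+o]≡n∸o′ m n o = trans (cong₂ _∸_ (+-comm n m) (+-comm o m)) ([m+n]∸[m+o]≡n∸o m n o)

          corr-image : ∀ {c₁ b₁} → T.AdjV (c , b) (c₁ , b₁) → Σ T₄.Block (Corr b₁)
          corr-image {c₁} {b₁} e with T.span {c , b} {c₁ , b₁} e
          ... | s , s≤2 , _ , q = go (pre 4≤ℓ Z s≤2 (subst (In ℓ) q' (inside (≤-pred (toℕ<n b₁))))) refl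
            where
            q' : suc (toℕ b₁) ≡ s + toℕ b
            q' = trans q (+-comm (toℕ b) s)
            go : ∀ {m} → In 4 m → m ≡ s + k → Σ T₄.Block (Corr b₁)
            go (inside {b'} h) eq = T₄.blk b' , s , s≤2 , q' , trans (cong suc (T₄.toℕ-blk h)) eq

          corr-preimage : ∀ {c₁ b₁'} → T₄.AdjV (c , b₄) (c₁ , b₁') → Σ T.Block λ b₁ → Corr b₁ b₁'
          corr-preimage {c₁} {b₁'} e with T₄.span {c , b₄} {c₁ , b₁'} e
          ... | s , s≤2 , _ , q = go (post 4≤ℓ Z s≤2 (subst (In 4) q' (inside (≤-pred (toℕ<n b₁'))))) refl
            where
            q' : suc (toℕ b₁') ≡ s + k
            q' = trans q (trans (+-comm (toℕ b₄) s) (cong (s +_) k≡))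
            go : ∀ {m} → In ℓ m → m ≡ s + toℕ b → Σ T.Block λ b₁ → Corr b₁ b₁'
            go (inside {b'} h) eq = T.blk b' , s , s≤2 , trans (cong suc (T.toℕ-blk h)) eq , q'

          _⇄_ : Fin T.n → Fin T₄.n → Set
          u ⇄ u' = Σ Ty λ c₁ → Σ T.Block λ b₁ → Σ T₄.Block λ b₁' →
            T.dec u ≡ (c₁ , b₁) × T₄.dec u' ≡ (c₁ , b₁') × Corr b₁ b₁' × (T.adjᵇ (c , b) (c₁ , b₁) ≡ true)

          v₀ : Fin T.n
          v₀ = T.enc (c , b)

          v₀' : Fin T₄.n
          v₀' = T₄.enc (c , b₄)

          iso : StarIso T.G T.PG v₀ T₄.G T₄.PG v₀'
          iso = record
            { _↔_ = _⇄_
            ; image = λ {u} e → image u (subst (λ z → T.adjᵇ z (T.dec u) ≡ true) (T.dec-enc (c , b)) e)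
            ; preimage = λ {u'} e → preimage u' (subst (λ z → T₄.adjᵇ z (T₄.dec u') ≡ true) (T₄.dec-enc (c , b₄)) e)
            ; adjacent = λ { (c₁ , b₁ , b₁' , d , d' , x , a) →
                subst₂ (λ z z' → T.adjᵇ z z' ≡ true) (sym (T.dec-enc (c , b))) (sym d) a ,
                subst₂ (λ z z' → T₄.adjᵇ z z' ≡ true) (sym (T₄.dec-enc (c , b₄))) (sym d') (trans (sym (corr-adj c c₁ centre x)) a) }
            ; port-out = λ { (c₁ , b₁ , b₁' , d , d' , x , a) → trans (cong₂ T.port (T.dec-enc (c , b)) d)
                (trans (corr-port c c₁ centre x) (sym (cong₂ T₄.port (T₄.dec-enc (c , b₄)) d'))) }
            ; port-in = λ { (c₁ , b₁ , b₁' , d , d' , x , a) → trans (cong₂ T.port d (T.dec-enc (c , b)))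
                (trans (corr-port c₁ c x centre) (sym (cong₂ T₄.port d' (T₄.dec-enc (c , b₄))))) }
            ; adj-eq = λ { (c₁ , b₁ , b₁' , d , d' , x , _) (c₂ , b₂ , b₂' , q , q' , y , _) →
                trans (cong₂ T.adjᵇ d q) (trans (corr-adj c₁ c₂ x y) (sym (cong₂ T₄.adjᵇ d' q'))) }
            ; port-eq = λ { (c₁ , b₁ , b₁' , d , d' , x , _) (c₂ , b₂ , b₂' , q , q' , y , _) _ →
                trans (cong₂ T.port d q) (trans (corr-port c₁ c₂ x y) (sym (cong₂ T₄.port d' q'))) } }
            where
            image : ∀ u → T.adjᵇ (c , b) (T.dec u) ≡ true → Σ (Fin T₄.n) (u ⇄_)
            image u e = let b₁' , x = corr-image (T.adjᵇ-sound e) in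
              T₄.enc (proj₁ (T.dec u) , b₁') , proj₁ (T.dec u) , proj₂ (T.dec u) , b₁' , refl , T₄.dec-enc _ , x , e
            preimage : ∀ u' → T₄.adjᵇ (c , b₄) (T₄.dec u') ≡ true → Σ (Fin T.n) (_⇄ u')
            preimage u' e = let b₁ , x = corr-preimage (T₄.adjᵇ-sound e) in
              T.enc (proj₁ (T₄.dec u') , b₁) , proj₁ (T₄.dec u') , b₁ , proj₂ (T₄.dec u') , T.dec-enc _ , refl , x ,
              trans (corr-adj c _ centre x) e

        label-local : Label.label T.G T.PG (T.enc (c , b)) ≡ Label.label T₄.G T₄.PG (T₄.enc (c , T₄.blk (kap ℓ (toℕ b))))
        label-local = label-eq iso

-- The graph that a program with input ℓ knows

module SelfReference where

  open import Level using (0ℓ) renaming (suc to lsuc)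
  open import Algebra.Bundles using (Group)
  open import Defs hiding (Tri) renaming (Eval to PR-Eval)
  open import Data.Bool using (Bool; false)
  open import Data.Empty using (⊥-elim)
  open import Data.Fin using (Fin; zero; suc; toℕ; combine; remQuot)
  open import Data.Fin.Properties using (toℕ<n; remQuot-combine; toℕ-combine)
  open import Data.List using (List; []; _∷_; _++_; map; tabulate)
  open import Data.List.Properties using (map-++; map-∘; map-cong; map-id)
  open import Data.Nat using (ℕ; zero; suc; _+_; _*_; _∸_; _⊓_; _≤_; _<_; z≤n; s≤s; _≡ᵇ_)
  open import Data.Nat.Properties
  open import Data.Product using (Σ; _×_; _,_; proj₁; proj₂)
  open import Data.Vec using () renaming ([] to []ᵥ; _∷_ to _∷ᵥ_)
  open import Function.Bundles using (Inverse)
  open import Relation.Binary.PropositionalEquality using (_≡_; refl; cong; cong₂; subst; subst₂; sym; trans)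
  open import Relation.Binary.Definitions using (Tri; tri<; tri≈; tri>)
  open import Relation.Nullary using (Dec; yes; no; ¬_)
  open RecursiveFunctions using (nth; nth-zero; nth-suc; rem3; quot3; divmod3)
  open AgentSimulation
  open Determinism
  open Walks
  open Developments using (power)
  open Presentations using (module Words)
  open Blocks
  open LabelLocality

  private
    nth-tabulate : ∀ {n} (f : Fin n → ℕ) i → nth (encList (tabulate f)) (toℕ i) ≡ f i
    nth-tabulate f zero = nth-zero (f zero) (tabulate (λ i → f (suc i)))
    nth-tabulate f (suc i) = trans (nth-suc (f zero) (tabulate (λ i → f (suc i))) (toℕ i)) (nth-tabulate (λ i → f (suc i)) i)

    pick : ∀ {P : Set} → Dec P → ℕ → ℕ → ℕ
    pick (yes _) a b = a
    pick (no _) a b = b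

    pick-yes : ∀ {P : Set} (d : Dec P) {a b} → P → pick d a b ≡ a
    pick-yes (yes _) _ = refl
    pick-yes (no ¬p) p = ⊥-elim (¬p p)

    pick-no : ∀ {P : Set} (d : Dec P) {a b} → ¬ P → pick d a b ≡ b
    pick-no (yes p) ¬p = ⊥-elim (¬p p)
    pick-no (no _) _ = refl

  module _ {Letter Rel : Set} (relator : Bool → Bool → Rel → List (Bool × Letter)) (cross : Letter → List (Bool × Letter)) where

    -- One family of values for each block, subject to the relators of the block and the passage to
    -- the next one: this presents the fundamental group of the tower by its generating loops,
    -- without forming the group.
    record Linked (ℓ : ℕ) {c ℓ'} (H : Group c ℓ') (val : ℕ → Letter → Group.Carrier H) : Set ℓ' where
      open Group H using (_≈_; ε)
      open Words Letter
      field
        relators : ∀ {b} → b ≤ ℓ → ∀ r → Eval.ev H (val b) (relator (b ≡ᵇ 0) (b ≡ᵇ ℓ) r) ≈ ε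
        crosses : ∀ {b} → b < ℓ → ∀ g → Eval.ev H (val b) (cross g) ≈ val (suc b) g

    -- An opaque interface: it keeps the enormous ℓ and the graph from being unfolded. There are two
    -- levels of groups because the fundamental group is small, whereas relational permutations form
    -- a group one level up.
    record Surface (A : Agent) (f : ℕ → ℕ) (f-computable : Computable f) : Set₂ where
      open Simulator A f f-computable using (program)
      open Words Letter using (powW; module Eval)
      field
        ℓ n : ℕ
        G : Graph n
        P : Ports G
        source : Fin n
        long-run : ∀ {v h} → Run.Reach A G P source (suc (f n)) v h → PR-Eval program (ℓ ∷ᵥ []ᵥ) 0
        short-run : ∀ {k v h} → k ≤ f n → Run.Reach A G P source k v h → PR-Eval A (encList h ∷ᵥ []ᵥ) 0 → PR-Eval program (ℓ ∷ᵥ []ᵥ) 1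
        simply-connected : (∀ (H : Group 0ℓ 0ℓ) val → Linked ℓ H val → ∀ {b} → b ≤ ℓ → ∀ g → Group._≈_ H (val b g) (Group.ε H)) → InSC G
        finite-order : (H : Group (lsuc 0ℓ) 0ℓ) → ∀ val → Linked ℓ H val → ∀ u →
          (∀ γ → GraphHomotopy.Path G source γ source → Σ ℕ λ i → Σ ℕ λ i' → i < i' × GraphHomotopy._≃_ G (source ∷ power i γ) (source ∷ power i' γ)) →
          Σ ℕ λ i → Σ ℕ λ i' → i < i' × Group._≈_ H (Eval.ev H (val 0) (powW i u)) (Eval.ev H (val 0) (powW i' u))

  -- The number ℓ of the last block encodes the labels of all types of vertices, so that a program with input ℓ knows
  -- the graph. There is no circularity, since by locality the labels are those of the graph with five blocks.
  module Coded (𝒫 : Blueprint) where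
    open Blueprint 𝒫
    open Shape 𝒫 using (K; Ty; Ty↔; module Tower; cell; star)
    open Locality 𝒫
    private module T₄ = Tower 4

    private
      entry : Fin (5 * K) → ℕ
      entry i = Label.label T₄.G T₄.PG (T₄.enc (Inverse.from Ty↔ (proj₂ (remQuot {5} K i)) , proj₁ (remQuot {5} K i)))

    abstract
      table : ℕ
      table = encList (K ∷ tabulate entry)

    -- At least 4, so that the kinds of blocks are distinct and `tab` recovers the table by
    -- subtraction.
    ℓ : ℕ
    ℓ = table + 4

    4≤ℓ : 4 ≤ ℓ
    4≤ℓ = m≤n+m 4 table

    module T = Tower ℓ

    abstract
      tab-size : tab ℓ 0 ≡ K
      tab-size = trans (cong (λ z → nth z 0) (m+n∸n≡m table 4)) (nth-zero K (tabulate entry))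

      -- The table is indexed by the kind of block and the type; locality transfers its entry from
      -- the tower of five blocks to the actual one.
      lab-correct : ∀ c (b : T.Block) → lab ℓ (T.tyℕ c) (toℕ b) ≡ Label.label T.G T.PG (T.enc (c , b))
      lab-correct c b = trans (cong₂ nth (m+n∸n≡m table 4) (cong (λ z → suc (k * z + T.tyℕ c)) tab-size))
        (trans (nth-suc K (tabulate entry) (k * K + T.tyℕ c))
        (trans (cong (nth (encList (tabulate entry))) index)
        (trans (nth-tabulate entry (combine κ (Inverse.to Ty↔ c)))
        (trans (cong (λ p → Label.label T₄.G T₄.PG (T₄.enc (Inverse.from Ty↔ (proj₂ p) , proj₁ p))) (remQuot-combine {5} κ (Inverse.to Ty↔ c)))
        (trans (cong (λ c → Label.label T₄.G T₄.PG (T₄.enc (c , κ))) (Inverse.strictlyInverseʳ Ty↔ c)) (sym (label-local 4≤ℓ c b)))))))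
        where
        k : ℕ
        k = kap ℓ (toℕ b)
        κ : T₄.Block
        κ = T₄.blk k
        index : k * K + T.tyℕ c ≡ toℕ (combine {5} κ (Inverse.to Ty↔ c))
        index = sym (trans (toℕ-combine {5} κ (Inverse.to Ty↔ c)) (cong (_+ T.tyℕ c)
          (trans (*-comm K (toℕ κ)) (cong (_* K) (T₄.toℕ-blk (kap≤4 (≤-pred (toℕ<n b))))))))

    source : Fin T.n
    source = T.enc (cell star , T.blk 0)

    module Simulation (A : Agent) (f : ℕ → ℕ) (f-computable : Computable f) where
      open Simulator A f f-computable
      open Run A T.G T.PG source

      private
        stateOf : Fin T.n → List ℕ → ℕ → ℕ
        stateOf v h g = state (T.tyℕ (proj₁ (T.dec v))) (toℕ (proj₂ (T.dec v))) (encList h) g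

        label≡ : ∀ v → lab ℓ (T.tyℕ (proj₁ (T.dec v))) (toℕ (proj₂ (T.dec v))) ≡ Label.label T.G T.PG v
        label≡ v = trans (lab-correct (proj₁ (T.dec v)) (proj₂ (T.dec v))) (cong (Label.label T.G T.PG) (T.enc-dec v))

        arrive≡ : ∀ v e h → arrive ℓ (T.tyℕ (proj₁ (T.dec v))) (toℕ (proj₂ (T.dec v))) e (encList h) ≡ stateOf v (obs v e ∷ h) 0
        arrive≡ v e h = cong (λ l → state (T.tyℕ (proj₁ (T.dec v))) (toℕ (proj₂ (T.dec v))) (suc (pair (pair l e) (encList h))) 0) (label≡ v)

        source-dec : (T.tyℕ (proj₁ (T.dec source)) ≡ 0) × (toℕ (proj₂ (T.dec source)) ≡ 0)
        source-dec = trans (cong (λ u → T.tyℕ (proj₁ u)) (T.dec-enc (cell star , T.blk 0))) refl ,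
          trans (cong (λ u → toℕ (proj₂ u)) (T.dec-enc (cell star , T.blk 0))) (T.toℕ-blk z≤n)

        init≡ : stateOf source (obs source 0 ∷ []) 0 ≡ init ℓ
        init≡ = trans (sym (arrive≡ source 0 [])) (cong₂ (λ c b → arrive ℓ c b 0 0) (proj₁ source-dec) (proj₂ source-dec))

        hist≡ : ∀ v h g → hist (stateOf v h g) ≡ encList h
        hist≡ v h g = hist-state (T.tyℕ (proj₁ (T.dec v))) (toℕ (proj₂ (T.dec v))) (encList h) g

        flag≡ : ∀ v h g → flag (stateOf v h g) ≡ g
        flag≡ v h g = flag-state (T.tyℕ (proj₁ (T.dec v))) (toℕ (proj₂ (T.dec v))) (encList h) g

        halt≡ : ∀ v h g → stateOf v h 1 ≡ step ℓ (stateOf v h g) 0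
        halt≡ v h g = sym (cong₃ (λ c b e → state c b e 1) (typ-state (T.tyℕ (proj₁ (T.dec v))) (toℕ (proj₂ (T.dec v))) (encList h) g) (blk-state (T.tyℕ (proj₁ (T.dec v))) (toℕ (proj₂ (T.dec v))) (encList h) g) (hist≡ v h g))
          where
          cong₃ : ∀ {A B C D : Set} (f : A → B → C → D) {a a' b b' c c'} → a ≡ a' → b ≡ b' → c ≡ c' → f a b c ≡ f a' b' c'
          cong₃ f refl refl refl = refl

        -- Seen from the other end, an edge has the opposite displacement; after adding 1 to both,
        -- they sum to 2.
        opposite : ∀ {s b b'} → s ≤ 2 → suc b' ≡ b + s → 2 ∸ s ≡ suc b ∸ b'
        opposite {b = b} {b'} z≤n e rewrite trans (sym (+-identityʳ b)) (sym e) = sym (m+n∸n≡m 2 b')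
        opposite {b = b} {b'} (s≤s z≤n) e rewrite suc-injective (trans e (+-comm b 1)) = sym (m+n∸n≡m 1 b)
        opposite {b = b} {b'} (s≤s (s≤s z≤n)) e rewrite suc-injective (trans e (+-comm b 2)) = sym (n∸n≡0 (suc b))

        move≡ : ∀ v u h → Adj T.G v u → stateOf u (obs u (suc (Ports.δ T.PG u v)) ∷ h) 0 ≡ step ℓ (stateOf v h 0) (suc (Ports.δ T.PG v u))
        move≡ v u h a = sym (trans (cong₂ (λ p x → arrive ℓ (quot3 p) ((blk (stateOf v h 0) + rem3 p) ∸ 1) (suc (3 * typ (stateOf v h 0) + (2 ∸ rem3 p))) x) port≡ (hist≡ v h 0))
            (trans (cong₃ (λ c b e → arrive ℓ c b e (encList h)) (proj₂ dm) block≡ entry≡) (arrive≡ u (suc (Ports.δ T.PG u v)) h)))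
          where
          spanned = T.span {T.dec v} {T.dec u} (T.adjᵇ-sound a)
          s = proj₁ spanned
          s≤2 = proj₁ (proj₂ spanned)
          q = proj₁ (proj₂ (proj₂ spanned))
          q' = proj₂ (proj₂ (proj₂ spanned))
          c = proj₁ (T.dec v)
          b = proj₂ (T.dec v)
          c' = proj₁ (T.dec u)
          b' = proj₂ (T.dec u)
          cong₃ : ∀ {A B C D : Set} (f : A → B → C → D) {a a' b b' c c'} → a ≡ a' → b ≡ b' → c ≡ c' → f a b c ≡ f a' b' c'
          cong₃ f refl refl refl = refl
          port≡ : Ports.δ T.PG v u ≡ 3 * T.tyℕ c' + s
          port≡ = cong (3 * T.tyℕ c' +_) q
          dm : rem3 (3 * T.tyℕ c' + s) ≡ s × quot3 (3 * T.tyℕ c' + s) ≡ T.tyℕ c'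
          dm = divmod3 (T.tyℕ c') s≤2
          block≡ : (blk (stateOf v h 0) + rem3 (3 * T.tyℕ c' + s)) ∸ 1 ≡ toℕ b'
          block≡ = trans (cong₂ (λ x y → (x + y) ∸ 1) (blk-state (T.tyℕ c) (toℕ b) (encList h) 0) (proj₁ dm)) (cong (_∸ 1) (sym q'))
          entry≡ : suc (3 * typ (stateOf v h 0) + (2 ∸ rem3 (3 * T.tyℕ c' + s))) ≡ suc (Ports.δ T.PG u v)
          entry≡ = cong suc (cong₂ (λ x y → 3 * x + y) (typ-state (T.tyℕ c) (toℕ b) (encList h) 0)
            (trans (cong (2 ∸_) (proj₁ dm)) (opposite s≤2 q')))

        N : ℕ
        N = rounds ℓ

        rounds≡ : suc (f T.n) ≡ N
        rounds≡ = cong (λ z → suc (f (z * suc ℓ))) (sym tab-size)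

        module Trace {k v h} (R : Reach k v h) where
          at : ∀ i → Σ (Fin T.n) λ u → Σ (List ℕ) λ g → Reach (i ⊓ k) u g
          at i = Reach-prefix A T.G T.PG source R (m⊓n≤n i k)

          s : ℕ → ℕ
          s i = stateOf (proj₁ (at i)) (proj₁ (proj₂ (at i))) 0

          reach : ∀ i → i ≤ k → Reach i (proj₁ (at i)) (proj₁ (proj₂ (at i)))
          reach i i≤k = subst (λ j → Reach j (proj₁ (at i)) (proj₁ (proj₂ (at i)))) (m≤n⇒m⊓n≡m i≤k) (proj₂ (proj₂ (at i)))

          s-source : s 0 ≡ init ℓ
          s-source = trans (agree (Reach-det A T.G T.PG source (reach 0 z≤n) start)) init≡
            where
            agree : ∀ {u g u' g'} → u ≡ u' × g ≡ g' → stateOf u g 0 ≡ stateOf u' g' 0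
            agree (refl , refl) = refl

          private
            advance : ∀ {i u g u' g'} → Reach i u g → Reach (suc i) u' g' →
              Σ ℕ λ a → PR-Eval A (hist (stateOf u g 0) ∷ᵥ []ᵥ) a × stateOf u' g' 0 ≡ step ℓ (stateOf u g 0) a
            advance S (move {v = x} {h = g'} {u = y} S' d a refl) = go (Reach-det A T.G T.PG source S S')
              where
              go : ∀ {u g} → u ≡ x × g ≡ g' → Σ ℕ λ a → PR-Eval A (hist (stateOf u g 0) ∷ᵥ []ᵥ) a × stateOf y (obs y (suc (Ports.δ T.PG y x)) ∷ g') 0 ≡ step ℓ (stateOf u g 0) a
              go (refl , refl) = _ , subst (λ z → PR-Eval A (z ∷ᵥ []ᵥ) _) (sym (hist≡ x g' 0)) d , move≡ x y g' a

          s-step : ∀ i → i < k → Σ ℕ λ a → PR-Eval A (hist (s i) ∷ᵥ []ᵥ) a × s (suc i) ≡ step ℓ (s i) a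
          s-step i i<k = advance (reach i (<⇒≤ i<k)) (reach (suc i) i<k)

      long-run : ∀ {v h} → Reach (suc (f T.n)) v h → PR-Eval program (ℓ ∷ᵥ []ᵥ) 0
      long-run {v} {h} R = subst (PR-Eval program (ℓ ∷ᵥ []ᵥ)) (flag≡ (proj₁ (Tr.at N)) (proj₁ (proj₂ (Tr.at N))) 0)
        (program-eval ℓ Tr.s Tr.s-source (λ i i<N → Tr.s-step i i<N))
        where
        module Tr = Trace (subst (λ k → Reach k v h) rounds≡ R)

      short-run : ∀ {k v h} → k ≤ f T.n → Reach k v h → PR-Eval A (encList h ∷ᵥ []ᵥ) 0 → PR-Eval program (ℓ ∷ᵥ []ᵥ) 1
      short-run {k} {v} {h} k≤f R d = subst (PR-Eval program (ℓ ∷ᵥ []ᵥ)) final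
        (program-eval ℓ s (trans (s-low z≤n) Tr.s-source) (λ i _ → s-step i))
        where
        module Tr = Trace R
        s : ℕ → ℕ
        s i = pick (i ≤? k) (Tr.s i) (stateOf v h 1)
        s-low : ∀ {i} → i ≤ k → s i ≡ Tr.s i
        s-low {i} h' = pick-yes (i ≤? k) h'
        s-high : ∀ {i} → k < i → s i ≡ stateOf v h 1
        s-high {i} h' = pick-no (i ≤? k) (<⇒≱ h')
        s-k : Tr.s k ≡ stateOf v h 0
        s-k = agree (Reach-det A T.G T.PG source (Tr.reach k ≤-refl) R)
          where
          agree : ∀ {u g u' g'} → u ≡ u' × g ≡ g' → stateOf u g 0 ≡ stateOf u' g' 0
          agree (refl , refl) = refl
        Step : ℕ → ℕ → Set
        Step x y = Σ ℕ λ a → PR-Eval A (hist x ∷ᵥ []ᵥ) a × y ≡ step ℓ x a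
        stay : ∀ g → Step (stateOf v h g) (stateOf v h 1)
        stay g = 0 , subst (λ z → PR-Eval A (z ∷ᵥ []ᵥ) 0) (sym (hist≡ v h g)) d , halt≡ v h g
        s-step : ∀ i → Step (s i) (s (suc i))
        s-step i = go (<-cmp i k)
          where
          go : Tri (i < k) (i ≡ k) (k < i) → Step (s i) (s (suc i))
          go (tri< i<k _ _) = subst₂ Step (sym (s-low (<⇒≤ i<k))) (sym (s-low i<k)) (Tr.s-step i i<k)
          go (tri≈ _ refl _) = subst₂ Step (sym (trans (s-low ≤-refl) s-k)) (sym (s-high ≤-refl)) (stay 0)
          go (tri> _ _ k<i) = subst₂ Step (sym (s-high k<i)) (sym (s-high (m≤n⇒m≤1+n k<i))) (stay 1)
        final : flag (s N) ≡ 1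
        final = trans (cong flag (s-high (subst (k <_) rounds≡ (s≤s k≤f)))) (flag≡ v h 1)

      private
        open Words Letter

        loops-trivial : (∀ (H : Group 0ℓ 0ℓ) val → Linked relator cross ℓ H val → ∀ {b} → b ≤ ℓ → ∀ g → Group._≈_ H (val b g) (Group.ε H)) → InSC T.G
        loops-trivial collapse = T.Simple.simply-connected λ b g → value-trivial {b} {g}
            (subst (λ z → value z g π.≈ π.ε) (T.blk-toℕ b) (collapse T.Group-of-loops.π (λ b → value (T.blk b)) linked (≤-pred (toℕ<n b)) g))
          where
          module π = Group T.Group-of-loops.π
          open T.Group-of-loops using (value; value-trivial; value-relator; value-cross; module Val)
          linked : Linked relator cross ℓ T.Group-of-loops.π (λ b → value (T.blk b))
          linked = record
            { relators = λ {b} h r → subst (λ n → Val.ev (T.blk b) (relator (n ≡ᵇ 0) (n ≡ᵇ ℓ) r) π.≈ π.ε) (T.toℕ-blk h) (value-relator (T.blk b) r)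
            ; crosses = λ {b} h g → value-cross (T.blk b) (T.blk (suc b)) g (trans (T.toℕ-blk h) (cong suc (sym (T.toℕ-blk (<⇒≤ h))))) }

        b₀ : T.Block
        b₀ = T.blk 0

        loops-power : ∀ u i → T.loopsAt b₀ (powW i u) ≡ power i (T.loopsAt b₀ u)
        loops-power u zero = refl
        loops-power u (suc i) = trans (loops-++ u (powW i u)) (cong (T.loopsAt b₀ u ++_) (loops-power u i))
          where
          open import Data.List.Properties using (++-assoc)
          open Shape 𝒫 using (loops; loop)
          spots-++ : ∀ u v → loops false (u ++ v) ≡ loops false u ++ loops false v
          spots-++ [] v = refl
          spots-++ (x ∷ u) v = trans (cong (loop false x ++_) (spots-++ u v)) (sym (++-assoc (loop false x) _ _))
          loops-++ : ∀ u v → T.loopsAt b₀ (u ++ v) ≡ T.loopsAt b₀ u ++ T.loopsAt b₀ v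
          loops-++ u v = trans (cong (T.cellsAt b₀) (spots-++ u v)) (map-++ _ (loops false u) (loops false v))

        map-power : ∀ {A B : Set} (g : A → B) i γ → map g (power i γ) ≡ power i (map g γ)
        map-power g zero γ = refl
        map-power g (suc i) γ = trans (map-++ g γ (power i γ)) (cong (map g γ ++_) (map-power g i γ))

        -- The closed walk that spells the word in block 0 has powers spelling its powers. A
        -- homotopy between two of these is carried back to the tower and evaluated by monodromy.
        finite : (H : Group (lsuc 0ℓ) 0ℓ) → ∀ val → Linked relator cross ℓ H val → ∀ u →
          (∀ γ → GraphHomotopy.Path T.G source γ source → Σ ℕ λ i → Σ ℕ λ i' → i < i' × GraphHomotopy._≃_ T.G (source ∷ power i γ) (source ∷ power i' γ)) →
          Σ ℕ λ i → Σ ℕ λ i' → i < i' × Group._≈_ H (Eval.ev H (val 0) (powW i u)) (Eval.ev H (val 0) (powW i' u))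
        finite H val lk u fin = conclude (fin γ (map-path T.idx T.idx-hom (T.loopsAt-path b₀ u)))
          where
          open T.Representation H val (Linked.relators lk) (Linked.crosses lk)
          γ : List (Fin T.n)
          γ = map T.idx (T.loopsAt b₀ u)
          returns : ∀ i → map T.vtx (source ∷ power i γ) ≡ T.pt (star , b₀) ∷ T.loopsAt b₀ (powW i u)
          returns i = cong₂ _∷_ (T.vtx-idx (T.pt (star , b₀))) (trans (map-power T.vtx i γ)
            (trans (cong (power i) (trans (sym (map-∘ (T.loopsAt b₀ u))) (trans (map-cong T.vtx-idx (T.loopsAt b₀ u)) (map-id (T.loopsAt b₀ u))))) (sym (loops-power u i))))
          conclude : (Σ ℕ λ i → Σ ℕ λ i' → i < i' × GraphHomotopy._≃_ T.G (source ∷ power i γ) (source ∷ power i' γ)) →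
            Σ ℕ λ i → Σ ℕ λ i' → i < i' × Group._≈_ H (Eval.ev H (val 0) (powW i u)) (Eval.ev H (val 0) (powW i' u))
          conclude (i , i' , i<i' , e) = i , i' , i<i' , homotopic⇒≈ b₀ (powW i u) (powW i' u)
            (subst₂ T._≃_ (returns i) (returns i') (map-≃ T.vtx (λ {u} {v} → T.vtx-hom {u} {v}) e))

      abstract
        surface : Surface relator cross A f f-computable
        surface = record
          { ℓ = ℓ ; n = T.n ; G = T.G ; P = T.PG ; source = source
          ; long-run = long-run ; short-run = short-run
          ; simply-connected = loops-trivial ; finite-order = finite }

-- Relators for the simulating program, and the conclusion

module Construction where

  open import Defs hiding (Eval; back)
  open import Level using (0ℓ) renaming (suc to lsuc)
  open import Algebra.Bundles using (Group)
  open import Data.Bool using (Bool; true; false) renaming (T to 𝕋)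
  open import Data.Empty using (⊥; ⊥-elim)
  open import Data.Fin using (Fin; zero; suc)
  open import Data.Fin.Properties using (+↔⊎; *↔×)
  open import Data.Integer as ℤ using (ℤ; +_) renaming (-[1+_] to neg)
  import Data.Integer.Properties as ℤₚ
  open import Data.Integer.Solver using () renaming (module +-*-Solver to ℤSolver)
  open import Data.List using (List; []; _++_; length)
  open import Data.Nat using (ℕ; zero; suc; _+_; _*_; _^_; _≤_; _<_; _∸_; z≤n; s≤s; _≡ᵇ_)
  open import Data.Nat.Properties
  open import Data.Nat.Solver using (module +-*-Solver)
  open import Data.Product using (Σ; _×_; _,_; proj₁; proj₂)
  open import Data.Sum using (_⊎_; inj₁; inj₂; [_,_]′)
  open import Data.Sum.Function.Propositional using (_⊎-↔_)
  open import Data.Unit using (tt)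
  open import Function.Bundles using (_↔_)
  open import Function.Construct.Composition using () renaming (inverse to _⊙_)
  open import Function.Construct.Identity using () renaming (inverse to id↔)
  open import Function.Construct.Symmetry using () renaming (inverse to sym↔)
  open import Relation.Binary.Construct.Closure.ReflexiveTransitive using (ε; _◅_)
  open import Relation.Binary.PropositionalEquality using (_≡_; _≢_; refl; cong; subst; sym; trans)
  open import Relation.Nullary using (¬_)
  open Determinism
  open Developments
  open AgentSimulation
  open CounterMachines using (_⊢_⟶*_)
  open MachineRules
  open Presentations
  open RelationalPermutations
  open ResidueClasses
  open PermutationModel using (module Action; S)
  open Blocks using (Blueprint)
  open SelfReference

  module Encoding (F : PR 1) where
    open Machine F

    ρ : ℕ
    ρ = suc (suc (length rules))

    rule : Fin ρ → Rule Q
    rule zero = double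
    rule (suc zero) = undouble
    rule (suc (suc i)) = MRule.rule (ruleAt i)

    machine : Fin ρ → Bool
    machine zero = false
    machine (suc zero) = false
    machine (suc (suc i)) = true

    -- The numbers of the accepting configuration and of the input 2^0, from which the letter `𝐞`
    -- starts.
    h β : ℕ
    h = pos qₕ 1
    β = pos 0 1

    open Presentation Q ρ rule machine zero (suc zero) h β public

    Letter↔ : Letter ↔ Fin (8 + ρ * 3)
    Letter↔ = (id↔ _ ⊎-↔ sym↔ *↔×) ⊙ sym↔ +↔⊎

    Relator↔ : Relator ↔ Fin (15 + ρ * 12)
    Relator↔ = (id↔ _ ⊎-↔ sym↔ *↔×) ⊙ sym↔ +↔⊎

    blueprint : Blueprint
    blueprint = record { Letter = Letter ; Rel = Relator ; λ# = 8 + ρ * 3 ; ρ# = 15 + ρ * 12 ; Letter↔ = Letter↔ ; Rel↔ = Relator↔ ; relator = relator ; cross = cross }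

    private
      pattern START = inj₁ (suc (suc (suc (suc (suc (suc (suc (suc (suc (suc (suc (suc (suc zero)))))))))))))
      pattern END = inj₁ (suc (suc (suc (suc (suc (suc (suc (suc (suc (suc (suc (suc (suc (suc zero))))))))))))))

      -- Only the two relators on `𝐞` depend on the flags, and they are empty inside the tower. So
      -- the unflagged relators hold in every block, and the two ends are treated separately.
      unflag : ∀ first last i → (relator false false i ≡ relator first last i) ⊎ (relator false false i ≡ [] × (i ≡ START ⊎ i ≡ END))
      unflag first last (inj₂ _) = inj₁ refl
      unflag first last (inj₁ zero) = inj₁ refl
      unflag first last (inj₁ (suc zero)) = inj₁ refl
      unflag first last (inj₁ (suc (suc zero))) = inj₁ refl
      unflag first last (inj₁ (suc (suc (suc zero)))) = inj₁ refl
      unflag first last (inj₁ (suc (suc (suc (suc zero))))) = inj₁ refl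
      unflag first last (inj₁ (suc (suc (suc (suc (suc zero)))))) = inj₁ refl
      unflag first last (inj₁ (suc (suc (suc (suc (suc (suc zero))))))) = inj₁ refl
      unflag first last (inj₁ (suc (suc (suc (suc (suc (suc (suc zero)))))))) = inj₁ refl
      unflag first last (inj₁ (suc (suc (suc (suc (suc (suc (suc (suc zero))))))))) = inj₁ refl
      unflag first last (inj₁ (suc (suc (suc (suc (suc (suc (suc (suc (suc zero)))))))))) = inj₁ refl
      unflag first last (inj₁ (suc (suc (suc (suc (suc (suc (suc (suc (suc (suc zero))))))))))) = inj₁ refl
      unflag first last (inj₁ (suc (suc (suc (suc (suc (suc (suc (suc (suc (suc (suc zero)))))))))))) = inj₁ refl
      unflag first last (inj₁ (suc (suc (suc (suc (suc (suc (suc (suc (suc (suc (suc (suc zero))))))))))))) = inj₁ refl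
      unflag first last START = inj₂ (refl , inj₁ refl)
      unflag first last END = inj₂ (refl , inj₂ refl)

      is-e : (g : Letter) → g ≡ 𝐞 ⊎ g ≢ 𝐞
      is-e 𝐚 = inj₂ λ ()
      is-e 𝐛 = inj₂ λ ()
      is-e 𝐭 = inj₂ λ ()
      is-e 𝐮 = inj₂ λ ()
      is-e 𝐤 = inj₂ λ ()
      is-e 𝛉 = inj₂ λ ()
      is-e 𝛈 = inj₂ λ ()
      is-e 𝐞 = inj₁ refl
      is-e (inj₂ _) = inj₂ λ ()

      cross-gen : ∀ g → g ≢ 𝐞 → cross g ≡ gen g
      cross-gen 𝐚 _ = refl
      cross-gen 𝐛 _ = refl
      cross-gen 𝐭 _ = refl
      cross-gen 𝐮 _ = refl
      cross-gen 𝐤 _ = refl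
      cross-gen 𝛉 _ = refl
      cross-gen 𝛈 _ = refl
      cross-gen 𝐞 p = ⊥-elim (p refl)
      cross-gen (inj₂ _) _ = refl

      slot : ∀ q a m j → q + a * Q + m * Q * j ≡ pos q (a + m * j)
      slot q a m j = solve 5 (λ q a m j Q → q :+ a :* Q :+ m :* Q :* j := q :+ (a :+ m :* j) :* Q) refl q a m j Q
        where open +-*-Solver

    module Doubling {c ℓ'} (G : Group c ℓ') (val : Letter → Group.Carrier G)
      (rel : ∀ i → Group._≈_ G (Words.Eval.ev Letter G val (relator false false i)) (Group.ε G)) where
      open GroupKit G renaming (sym to ≈-sym; trans to ≈-trans)
      open Eval G val
      open Consequences G val rel

      double-T : ∀ N → ev 𝐝 ◁ T (pos 0 N) ≈ T (pos 0 (2 * N))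
      double-T N = begin
        ev 𝐝 ◁ T (pos 0 N)                                ≈⟨ ◁-cong (∙-congˡ (ev-gen (𝐫 zero))) ≈-refl ⟩
        (val (𝐫 (suc zero)) ∙ val (𝐫 zero)) ◁ T (pos 0 N) ≈⟨ ◁-∙ _ _ _ ⟩
        val (𝐫 (suc zero)) ◁ val (𝐫 zero) ◁ T (pos 0 N)   ≡⟨ cong (λ n → val (𝐫 (suc zero)) ◁ val (𝐫 zero) ◁ T n) (sym (trans (slot 0 0 1 N) (cong (pos 0) (+-identityʳ N)))) ⟩
        val (𝐫 (suc zero)) ◁ val (𝐫 zero) ◁ T (Rule.α double + Rule.M double * N)
          ≈⟨ ◁-congʳ (rule-conj zero N) ⟩
        val (𝐫 (suc zero)) ◁ T (Rule.α' double + Rule.M' double * N)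
          ≡⟨ cong (λ n → val (𝐫 (suc zero)) ◁ T n) (trans (slot (suc qₕ) 0 2 N) (sym (trans (slot (suc qₕ) 0 1 (2 * N)) (cong (pos (suc qₕ)) (+-identityʳ (2 * N)))))) ⟩
        val (𝐫 (suc zero)) ◁ T (Rule.α undouble + Rule.M undouble * (2 * N))
          ≈⟨ rule-conj (suc zero) (2 * N) ⟩
        T (Rule.α' undouble + Rule.M' undouble * (2 * N)) ≡⟨ cong T (trans (slot 0 0 1 (2 * N)) (cong (pos 0) (+-identityʳ (2 * N)))) ⟩
        T (pos 0 (2 * N))                                 ∎
        where open ≈-Reasoning

    module Collapsing {c ℓ'} (G : Group c ℓ') (val : ℕ → Letter → Group.Carrier G) {ℓ : ℕ}
      (linked : Linked relator cross ℓ G val) (accepted : Accepts ℓ) where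
      open Linked linked renaming (relators to val-relator; crosses to val-cross)
      open GroupKit G renaming (sym to ≈-sym; trans to ≈-trans; ε to 1#)
      private
        module Ev (b : ℕ) = Eval G (val b)

        rel : ∀ i → Ev.ev 0 (relator false false i) ≈ 1#
        rel i with unflag true (0 ≡ᵇ ℓ) i
        ... | inj₁ e = ≈-trans (reflexive (cong (Ev.ev 0) e)) (val-relator z≤n i)
        ... | inj₂ (e , _) = reflexive (cong (Ev.ev 0) e)

        open Consequences G (val 0) rel
        open Doubling G (val 0) rel

        constant : ∀ {b} → b ≤ ℓ → ∀ g → g ≢ 𝐞 → val b g ≈ val 0 g
        constant {zero} _ g _ = ≈-refl
        constant {suc b} b<ℓ g ne = ≈-trans (≈-sym (val-cross b<ℓ g)) (≈-trans (reflexive (cong (Ev.ev b) (cross-gen g ne)))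
          (≈-trans (Ev.ev-gen b g) (constant (<⇒≤ b<ℓ) g ne)))

        -- The first block sets `𝐞` to the involution of the input 2^0, and each passage to the next
        -- block conjugates by `𝐝`, which doubles the number.
        e-value : ∀ {b} → b ≤ ℓ → val b 𝐞 ≈ T (pos 0 (2 ^ b))
        e-value {zero} _ = ≈-trans (≈-sym (Ev.ev-gen 0 𝐞)) (≈-trans (Ev.ev-eq 0 (gen 𝐞) (𝐓 β) (val-relator z≤n START)) (ev-T β))
        e-value {suc b} b<ℓ = begin
          val (suc b) 𝐞                       ≈⟨ ≈-sym (val-cross b<ℓ 𝐞) ⟩
          Ev.ev b (conjW 𝐝 (gen 𝐞))           ≈⟨ Ev.ev-conj b 𝐝 (gen 𝐞) ⟩
          Ev.ev b 𝐝 ◁ Ev.ev b (gen 𝐞)         ≈⟨ ◁-cong (∙-cong (constant b≤ℓ (𝐫 (suc zero)) λ ()) (∙-congʳ (constant b≤ℓ (𝐫 zero) λ ())))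
                                                   (≈-trans (Ev.ev-gen b 𝐞) (e-value b≤ℓ)) ⟩
          Ev.ev 0 𝐝 ◁ T (pos 0 (2 ^ b))       ≈⟨ double-T (2 ^ b) ⟩
          T (pos 0 (2 ^ suc b))               ∎
          where
          open ≈-Reasoning
          b≤ℓ = <⇒≤ b<ℓ

        cube : pow 3 (k ∙ T (pos 0 (2 ^ ℓ))) ≈ 1#
        cube = ≈-trans (pow-cong 3 (∙-cong (≈-sym (constant ≤-refl 𝐤 λ ())) (≈-trans (≈-sym (e-value ≤-refl)) (≈-sym (Ev.ev-gen ℓ 𝐞)))))
          (≈-trans (≈-sym (Ev.ev-pow ℓ 3 (gen 𝐤 ++ gen 𝐞))) (final (ℓ ≡ᵇ ℓ) (≡ᵇ-refl ℓ) (val-relator ≤-refl END)))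
          where
          ≡ᵇ-refl : ∀ n → (n ≡ᵇ n) ≡ true
          ≡ᵇ-refl zero = refl
          ≡ᵇ-refl (suc n) = ≡ᵇ-refl n
          final : ∀ last → last ≡ true → Ev.ev ℓ (when last (powW 3 (gen 𝐤 ++ gen 𝐞))) ≈ 1# → Ev.ev ℓ (powW 3 (gen 𝐤 ++ gen 𝐞)) ≈ 1#
          final _ refl p = p

        -- Commutation with `𝐤` starts at the accepting configuration and is propagated backwards
        -- along the run.
        central : ∀ {q N} → C ⊢ (q , N) ⟶* (qₕ , 1) → Centralised (pos q N)
        central ε = centralised-h
        central (s ◅ ss) with fires s
        ... | i , j , refl , refl , refl , refl =
          subst Centralised (slot q a m j) (centralised-rule (suc (suc i)) j refl (subst Centralised (sym (slot q' a' m' j)) (central ss)))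
          where open MRule (ruleAt i)

        open Collapse {pos 0 (2 ^ ℓ)} (central accepted) cube

      all-trivial : ∀ {b} → b ≤ ℓ → ∀ g → val b g ≈ 1#
      all-trivial {b} b≤ℓ g = go (is-e g)
        where
        go : g ≡ 𝐞 ⊎ g ≢ 𝐞 → val b g ≈ 1#
        go (inj₁ refl) = ≈-trans (e-value b≤ℓ) (≈-trans (◁-congʳ t≈ε) (◁ε _))
        go (inj₂ ne) = ≈-trans (constant b≤ℓ g ne) (trivial g ne)

    -- Conversely, suppose that one action satisfies the unflagged relators in all blocks and only
    -- `𝐞` changes, standing for 2^b in block b. Then the passages hold because `𝐝` doubles, and the
    -- flagged relators hold by the initial value of `𝐞` and by the cube relation.
    module Linking {c ℓ'} (G : Group c ℓ') (val : ℕ → Letter → Group.Carrier G) (τ : ℕ → Group.Carrier G)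
      (rel : ∀ b i → Group._≈_ G (Words.Eval.ev Letter G (val b) (relator false false i)) (Group.ε G))
      (constant : ∀ b g → g ≢ 𝐞 → val (suc b) g ≡ val b g)
      (T≈τ : ∀ b n → Group._≈_ G (Words.Eval.ev Letter G (val b) (𝐓 n)) (τ n))
      (e≈τ : ∀ b → Group._≈_ G (val b 𝐞) (τ (pos 0 (2 ^ b))))
      {ℓ : ℕ} (cube : Group._≈_ G (GroupKit.pow G 3 (Group._∙_ G (val ℓ 𝐤) (Words.Eval.ev Letter G (val ℓ) (𝐓 (pos 0 (2 ^ ℓ)))))) (Group.ε G)) where
      open GroupKit G renaming (sym to ≈-sym; trans to ≈-trans; ε to 1#)
      private
        module Ev (b : ℕ) = Eval G (val b)

        at-start : ∀ b → Ev.ev b (when (b ≡ᵇ 0) (eqW (gen 𝐞) (𝐓 β))) ≈ 1#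
        at-start zero = Ev.eq-ev 0 (gen 𝐞) (𝐓 β) (≈-trans (Ev.ev-gen 0 𝐞) (≈-trans (e≈τ 0) (≈-sym (T≈τ 0 β))))
        at-start (suc b) = ≈-refl

        at-end : ∀ b last → (b ≡ᵇ ℓ) ≡ last → Ev.ev b (when last (powW 3 (gen 𝐤 ++ gen 𝐞))) ≈ 1#
        at-end b false _ = ≈-refl
        at-end b true p = last-block (≡ᵇ⇒≡ b ℓ (subst 𝕋 (sym p) tt))
          where
          last-block : b ≡ ℓ → Ev.ev b (powW 3 (gen 𝐤 ++ gen 𝐞)) ≈ 1#
          last-block refl = ≈-trans (Ev.ev-pow b 3 (gen 𝐤 ++ gen 𝐞))
            (≈-trans (pow-cong 3 (∙-congˡ (≈-trans (Ev.ev-gen b 𝐞) (≈-trans (e≈τ b) (≈-sym (T≈τ b (pos 0 (2 ^ ℓ)))))))) cube)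

        doubled : ∀ b → Ev.ev b (conjW 𝐝 (gen 𝐞)) ≈ val (suc b) 𝐞
        doubled b = begin
          Ev.ev b (conjW 𝐝 (gen 𝐞))           ≈⟨ Ev.ev-conj b 𝐝 (gen 𝐞) ⟩
          Ev.ev b 𝐝 ◁ Ev.ev b (gen 𝐞)         ≈⟨ ◁-congʳ (≈-trans (Ev.ev-gen b 𝐞) (≈-trans (e≈τ b) (≈-trans (≈-sym (T≈τ b n)) (ev-T n)))) ⟩
          Ev.ev b 𝐝 ◁ T (pos 0 (2 ^ b))       ≈⟨ double-T (2 ^ b) ⟩
          T (pos 0 (2 ^ suc b))               ≈⟨ ≈-trans (≈-sym (ev-T (pos 0 (2 ^ suc b)))) (≈-trans (T≈τ b (pos 0 (2 ^ suc b))) (≈-sym (e≈τ (suc b)))) ⟩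
          val (suc b) 𝐞                       ∎
          where
          open ≈-Reasoning
          n = pos 0 (2 ^ b)
          open Consequences G (val b) (rel b)
          open Doubling G (val b) (rel b)

      linked : Linked relator cross ℓ G val
      linked = record { relators = λ {b} _ r → holds b r (unflag (b ≡ᵇ 0) (b ≡ᵇ ℓ) r) ; crosses = λ {b} _ g → crosses b g (is-e g) }
        where
        holds : ∀ b r → (relator false false r ≡ relator (b ≡ᵇ 0) (b ≡ᵇ ℓ) r) ⊎ (relator false false r ≡ [] × (r ≡ START ⊎ r ≡ END)) →
          Ev.ev b (relator (b ≡ᵇ 0) (b ≡ᵇ ℓ) r) ≈ 1#
        holds b r (inj₁ e) = ≈-trans (reflexive (cong (Ev.ev b) (sym e))) (rel b r)
        holds b _ (inj₂ (_ , inj₁ refl)) = at-start b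
        holds b _ (inj₂ (_ , inj₂ refl)) = at-end b (b ≡ᵇ ℓ) refl
        crosses : ∀ b g → g ≡ 𝐞 ⊎ g ≢ 𝐞 → Ev.ev b (cross g) ≈ val (suc b) g
        crosses b g (inj₁ refl) = doubled b
        crosses b g (inj₂ ne) = ≈-trans (reflexive (cong (Ev.ev b) (cross-gen g ne))) (≈-trans (Ev.ev-gen b g) (reflexive (sym (constant b g ne))))

    -- The configuration (q , N) stands for the position q + N Q; positions with N < 0 never halt.
    module Acting (R : Set) {ℓ : ℕ} (accepted⇒R : Accepts ℓ → R) where
      private
        Runs : ℕ → ℤ → Set
        Runs q (+ N) = C ⊢ (q , N) ⟶* (qₕ , 1)
        Runs q (neg N) = ⊥

        Halts : ℤ → Set
        Halts n = Σ ℕ λ q → Σ ℤ λ N → q < Q × n ≡ + q ℤ.+ N ℤ.* + Q × Runs q N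

        runs : ∀ {q N} → q < Q → Halts (+ q ℤ.+ N ℤ.* + Q) → Runs q N
        runs {q} {N} q<Q (q' , N' , q'<Q , e , r) = go (unique-remainder N N' q<Q q'<Q e) e r
          where
          go : q ≡ q' → + q ℤ.+ N ℤ.* + Q ≡ + q' ℤ.+ N' ℤ.* + Q → Runs q' N' → Runs q N
          go refl e r = subst (Runs q) (sym (Class.pt-injective q Q q<Q {N} {N'} e)) r

        +pos : ∀ q N → + pos q N ≡ + q ℤ.+ + N ℤ.* + Q
        +pos q N = cong (λ z → + q ℤ.+ z) (ℤₚ.pos-* N Q)

        halts-h : Halts (+ h)
        halts-h = qₕ , + 1 , n≤1+n _ , +pos qₕ 1 , ε

        -- The point at which R enters the model: acceptance of the input is allowed, at the price
        -- of the desired conclusion.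
        halts-c₀ : Halts (+ pos 0 (2 ^ ℓ)) → R
        halts-c₀ x = accepted⇒R (runs {0} {+ (2 ^ ℓ)} (s≤s z≤n) (subst Halts (+pos 0 (2 ^ ℓ)) x))

        module Act = Action R Q ρ rule machine zero (suc zero) h β (pos 0 (2 ^ ℓ)) Halts halts-h halts-c₀

        slot-pos : ∀ a m k → + a ℤ.+ + k ℤ.* + m ≡ + (a + m * k)
        slot-pos a m k = trans (cong (λ z → + a ℤ.+ z) (sym (ℤₚ.pos-* k m))) (cong (λ z → + (a + z)) (*-comm k m))

        slot-neg : ∀ a d k → + a ℤ.+ neg k ℤ.* + suc (a + d) ≡ neg (d + k * suc (a + d))
        slot-neg a d k = trans (solve 3 (λ a d k → a :+ (:- (con (+ 1) :+ k)) :* (con (+ 1) :+ (a :+ d)) := :- (con (+ 1) :+ (d :+ k :* (con (+ 1) :+ (a :+ d))))) refl (+ a) (+ d) (+ k))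
            (cong (λ z → ℤ.- (+ 1 ℤ.+ (+ d ℤ.+ z))) (sym (ℤₚ.pos-* k (suc (a + d)))))
          where open ℤSolver

        dead : ∀ {q a m k} → a < m → ¬ Runs q (+ a ℤ.+ neg k ℤ.* + m)
        dead {q} {a} {m} {k} a<m r = go (m ∸ suc a) (m+[n∸m]≡n a<m) r
          where
          go : ∀ d → suc a + d ≡ m → ¬ Runs q (+ a ℤ.+ neg k ℤ.* + m)
          go d refl r = subst (Runs q) (slot-neg a d k) r

        -- One direction prepends a step to the run, the other removes it by determinism. For
        -- negative indices both positions belong to negative numbers, which never halt.
        halts-machine : ∀ i j → (Halts (Act.Src.pt (suc (suc i)) j) → Halts (Act.Tgt.pt (suc (suc i)) j))
          × (Halts (Act.Tgt.pt (suc (suc i)) j) → Halts (Act.Src.pt (suc (suc i)) j))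
        halts-machine i j = (λ x → q' , N' j , q'<Q , Act.regroup q' a' m' j , forth j (runs q<Q (subst Halts (Act.regroup q a m j) x)))
                          , (λ x → q , N j , q<Q , Act.regroup q a m j , back j (runs q'<Q (subst Halts (Act.regroup q' a' m' j) x)))
          where
          open MRule (ruleAt i)
          N N' : ℤ → ℤ
          N j = + a ℤ.+ j ℤ.* + m
          N' j = + a' ℤ.+ j ℤ.* + m'
          forth : ∀ j → Runs q (N j) → Runs q' (N' j)
          forth (+ k) r = subst (Runs q') (sym (slot-pos a' m' k)) (⟶*-step (n≤1+n _) (subst (Runs q) (slot-pos a m k) r) (sound k))
          forth (neg k) r = ⊥-elim (dead {q} {a} {m} {k} a<m r)
          back : ∀ j → Runs q' (N' j) → Runs q (N j)
          back (+ k) r = subst (Runs q) (sym (slot-pos a m k)) (sound k ◅ subst (Runs q') (slot-pos a' m' k) r)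
          back (neg k) r = ⊥-elim (dead {q'} {a'} {m'} {k} a'<m' r)

        halts-rule : ∀ i → machine i ≡ true → ∀ j → (Halts (Act.Src.pt i j) → Halts (Act.Tgt.pt i j)) × (Halts (Act.Tgt.pt i j) → Halts (Act.Src.pt i j))
        halts-rule (suc (suc i)) _ = halts-machine i

        open Act.Verify halts-rule using (tauP; module Valued)
        open Permutations R S using (RPerm; group)
        module Val (b : ℕ) = Valued (tauP (pos 0 (2 ^ b)))

        constant : ∀ b g → g ≢ 𝐞 → Val.val (suc b) g ≡ Val.val b g
        constant b 𝐚 _ = refl
        constant b 𝐛 _ = refl
        constant b 𝐭 _ = refl
        constant b 𝐮 _ = refl
        constant b 𝐤 _ = refl
        constant b 𝛉 _ = refl
        constant b 𝛈 _ = refl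
        constant b 𝐞 ne = ⊥-elim (ne refl)
        constant b (𝐫 _) _ = refl
        constant b (𝐲₁ _) _ = refl
        constant b (𝐲₂ _) _ = refl

      permutations : Group (lsuc 0ℓ) 0ℓ
      permutations = group

      val : ℕ → Letter → Group.Carrier permutations
      val = Val.val

      val-linked : Linked relator cross ℓ permutations val
      val-linked = Linking.linked group val tauP Val.relations constant Val.T≈tauP (λ b → Group.refl group {tauP (pos 0 (2 ^ b))}) (Val.cube ℓ)

      infinite-order : ∀ i j → i < j → Group._≈_ permutations (Eval.ev permutations (val 0) (powW i 𝐱)) (Eval.ev permutations (val 0) (powW j 𝐱)) → R
      infinite-order i j i<j = Val.shift-infinite 0 i j (<⇒≢ i<j)

  module Conclusion (A : Agent) (E : ExploresSC A) (f : ℕ → ℕ) (f-computable : Computable f) where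
    open Simulator A f f-computable using (program)
    open Encoding program
    open Machine program using (Accepts; accepts; rejects; not-both)

    module Exploring (Σ' : Surface relator cross A f f-computable) where
      open Surface Σ'
      open Run A G P source

      -- This conclusion takes the place of falsity, so no decision whether the computation accepts
      -- is ever made.
      R : Set
      R = InSC G × MoreThan (f n)

      private
        -- Acceptance makes the graph simply connected, so the agent halts on it. A halt within the
        -- bound would make the same computation reject as well, so the run is longer.
        accepted⇒R : Accepts ℓ → R
        accepted⇒R accepted = inSC , long (E n G inSC P source)
          where
          inSC : InSC G
          inSC = simply-connected (λ H val linked → Collapsing.all-trivial H val linked accepted)
          long : (Σ ℕ λ k → HaltsAt k × (∀ w → VisitedBy k w)) → MoreThan (f n)
          long (k , (_ , _ , reached , halted) , _) = [ (λ k≤ → ⊥-elim (not-both {ℓ} accepted (rejects {ℓ} (short-run k≤ reached halted))))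
            , (λ <k → Reach-prefix A G P source reached <k) ]′ (≤-<-connex k (f n))

        module Cont = Continue A E G P source
        module Perm = Acting R {ℓ} accepted⇒R

        finite⇒R : Cont.FiniteOrder → R
        finite⇒R fin = go (finite-order Perm.permutations Perm.val Perm.val-linked 𝐱 fin)
          where
          go : (Σ ℕ λ i → Σ ℕ λ i' → i < i' × Group._≈_ Perm.permutations (Eval.ev Perm.permutations (Perm.val 0) (powW i 𝐱)) (Eval.ev Perm.permutations (Perm.val 0) (powW i' 𝐱))) → R
          go (i , i' , i<i' , e) = Perm.infinite-order i i' i<i' e

        Reached : ℕ → Set
        Reached j = Σ (Fin n) λ u → Σ (List ℕ) λ h → Reach j u h

        -- Each further step of the agent on `G` is obtained from its halting on the development;
        -- the alternative, finite order of all loops, contradicts the infinite order of the shift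
        -- and so yields R.
        walk : ∀ j → R ⊎ Reached j
        walk zero = inj₂ (_ , _ , start)
        walk (suc j) = [ inj₁ , (λ (_ , _ , r) → [ inj₂ , (λ fin → inj₁ (finite⇒R fin)) ]′ (Cont.continue r)) ]′ (walk j)

      conclusion : R
      conclusion = [ (λ r → r) , (λ (_ , _ , r) → accepted⇒R (accepts {ℓ} (long-run r))) ]′ (walk (suc (f n)))

open import Defs
open import Data.Nat using (ℕ)
open import Data.Fin using (Fin)
open import Data.Product using (Σ; _×_; _,_; proj₁; proj₂)

theorem1 : (A : Agent) → IsExploration A → ExploresSC A →
    (f : ℕ → ℕ) → Computable f →
    Σ ℕ λ n → Σ (Graph n) λ G → InSC G × Σ (Ports G) λ P → Σ (Fin n) λ s →
      Run.MoreThan A G P s (f n)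
theorem1 A _ E f f-computable = n , G , proj₁ conclusion , P , source , proj₂ conclusion
  where
  open AgentSimulation.Simulator A f f-computable using (program)
  open Construction using (module Encoding; module Conclusion)
  open SelfReference using (Surface; module Surface; module Coded)
  open Encoding program
  surface : Surface relator cross A f f-computable
  surface = Coded.Simulation.surface blueprint A f f-computable
  open Surface surface
  open Conclusion.Exploring A E f f-computable surface
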